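{- The Dominating Triangle problem (Dominating $K_3$-Pattern) can be solved in time $\left(m^{1+\frac{2\omega}{\omega+1}}/n\right)^{1+o(1)}$ on host graphs with $n$ vertices and $m$ edges.
   Context: All graphs are finite, simple and undirected; $m=\Theta(n^{\alpha})$ for some $1\le\alpha\le 2$. The Dominating Triangle problem asks, given a graph $G$, whether there are three pairwise adjacent vertices $u,v,w$ of $G$ such that every vertex of $G$ is in $\{u,v,w\}$ or adjacent to one of them. $\omega$ denotes the matrix multiplication exponent. -}

module Defs where

open import Algebra.Properties.CommutativeMonoid.Sum using ()
open import Data.Bool.Base using (if_then_else_)
open import Data.Fin.Base as Fin using (Fin; toℕ)
open import Data.Fin.Properties as Fin using ()
open import Data.Integer.Base as ℤ using (ℤ; 0ℤ; ∣_∣)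
open import Data.Integer.DivMod using (_%ℕ_)
open import Data.Integer.Properties as ℤ using ()
open import Data.List.Base as List
  using (List; []; _∷_; _++_; length; filter; cartesianProduct; allFin; concatMap)
open import Data.List.Relation.Binary.Permutation.Propositional using (_↭_)
open import Data.Nat.Base as ℕ using (ℕ; zero; suc; _+_; _*_; _∸_; _^_; _≤_)
open import Data.Nat.DivMod using (_/_; _%_)
open import Data.Nat.Properties as ℕ using ()
open import Data.Product.Base using (Σ-syntax; ∃; ∃-syntax; ∃₂; _×_; _,_)
open import Data.Rational.Unnormalised.Base as ℚᵘ
  using (ℚᵘ; 0ℚᵘ; 1ℚᵘ; ↥_; ↧_; ↧ₙ_; Positive)
open import Data.Rational.Unnormalised.Properties as ℚᵘ using ()
open import Data.Sum.Base using (_⊎_; inj₁; inj₂)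
open import Function.Bundles using (_⇔_; mk⇔)
open import Level using (0ℓ)
open import Relation.Binary.Core using (Rel)
open import Relation.Binary.Definitions
  using (Decidable; Symmetric; Irreflexive; tri<; tri≈; tri>)
open import Relation.Binary.PropositionalEquality.Core using (_≡_; _≢_)
open import Relation.Nullary.Decidable.Core using (does; _×-dec_)
open import Relation.Nullary.Negation.Core using (¬_)

------------------------------------------------------------------------
-- Real numbers, as two-sided Dedekind cuts

record ℝ : Set₁ where
  field
    Lower Upper   : ℚᵘ → Set
    lower-inhab   : ∃ Lower
    upper-inhab   : ∃ Upper
    lower-rounded : ∀ q → Lower q ⇔ (∃[ r ] q ℚᵘ.< r × Lower r)
    upper-rounded : ∀ q → Upper q ⇔ (∃[ r ] r ℚᵘ.< q × Upper r)
    disjoint      : ∀ q → ¬ (Lower q × Upper q)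
    located       : ∀ {q r} → q ℚᵘ.< r → Lower q ⊎ Upper r

open ℝ public using (Lower; Upper)

infix 4 _≤ʳ_

_≤ʳ_ : ℝ → ℝ → Set
x ≤ʳ y = ∀ q → Lower x q → Lower y q

fromℚᵘ : ℚᵘ → ℝ
fromℚᵘ p = record
  { Lower         = ℚᵘ._< p
  ; Upper         = p ℚᵘ.<_
  ; lower-inhab   = p ℚᵘ.- 1ℚᵘ , p-1<p
  ; upper-inhab   = p ℚᵘ.+ 1ℚᵘ , p<p+1
  ; lower-rounded = λ q → mk⇔ ℚᵘ.<-dense (λ (_ , q<r , r<p) → ℚᵘ.<-trans q<r r<p)
  ; upper-rounded = λ q → mk⇔
      (λ p<q → let r , p<r , r<q = ℚᵘ.<-dense p<q in r , r<q , p<r)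
      (λ (_ , r<q , p<r) → ℚᵘ.<-trans p<r r<q)
  ; disjoint      = λ _ (q<p , p<q) → ℚᵘ.<-asym q<p p<q
  ; located       = locate
  }
  where
  p<p+1 : p ℚᵘ.< p ℚᵘ.+ 1ℚᵘ
  p<p+1 = ℚᵘ.<-respˡ-≃ (ℚᵘ.+-identityʳ p) (ℚᵘ.+-monoʳ-< p (ℚᵘ.positive⁻¹ 1ℚᵘ))

  p-1<p : p ℚᵘ.- 1ℚᵘ ℚᵘ.< p
  p-1<p = ℚᵘ.<-respʳ-≃ (ℚᵘ.+-identityʳ p)
            (ℚᵘ.+-monoʳ-< p (ℚᵘ.negative⁻¹ (ℚᵘ.- 1ℚᵘ)))

  locate : ∀ {q r} → q ℚᵘ.< r → q ℚᵘ.< p ⊎ p ℚᵘ.< r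
  locate {q} q<r with ℚᵘ.<-cmp q p
  ... | tri< q<p _ _ = inj₁ q<p
  ... | tri≈ _ q≃p _ = inj₂ (ℚᵘ.<-respˡ-≃ q≃p q<r)
  ... | tri> _ _ p<q = inj₂ (ℚᵘ.<-trans p<q q<r)

------------------------------------------------------------------------
-- Comparing natural numbers with real powers

posPart negPart : ℤ → ℕ
posPart z = ∣ z ℤ.⊔ 0ℤ ∣
negPart z = posPart (ℤ.- z)

infix 4 _≤ᵖ_↑_·_↑_ _≤ᵖ_↑_ _≤ᵖ_·_↑ʳ_ _↑ʳ_≤ᵖ_

-- t ≤ xᵖ yᑫ for positive x and y.  Both sides are raised to the product of
-- the denominators of p and q, and negative powers are moved to the left.
_≤ᵖ_↑_·_↑_ : ℕ → ℕ → ℚᵘ → ℕ → ℚᵘ → Set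
t ≤ᵖ x ↑ p · y ↑ q =
  t ^ (↧ₙ p * ↧ₙ q) * (x ^ negPart a * y ^ negPart b) ≤ x ^ posPart a * y ^ posPart b
  where
  a b : ℤ
  a = ↥ p ℤ.* ↧ q
  b = ↥ q ℤ.* ↧ p

_≤ᵖ_↑_ : ℕ → ℕ → ℚᵘ → Set
t ≤ᵖ x ↑ p = t ≤ᵖ x ↑ p · 1 ↑ 0ℚᵘ

-- For x ≥ 1 the power x^α is the infimum of the x^q over rational q > α,
-- and the supremum of the x^q over rational q < α.
_≤ᵖ_·_↑ʳ_ : ℕ → ℕ → ℕ → ℝ → Set
t ≤ᵖ b · x ↑ʳ α = ∀ q → Upper α q → t ≤ᵖ b ↑ 1ℚᵘ · x ↑ q

_↑ʳ_≤ᵖ_ : ℕ → ℝ → ℕ → Set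
x ↑ʳ α ≤ᵖ t = ∀ q → Lower α q → 1 ≤ᵖ t ↑ 1ℚᵘ · x ↑ (ℚᵘ.- q)

------------------------------------------------------------------------
-- The word RAM with w-bit words

word : (w : ℕ) → ℕ → ℕ
word w x = (x % 2 ^ w) {{ℕ.m^n≢0 2 w}}

-- Two's complement.
wordℤ : (w : ℕ) → ℤ → ℕ
wordℤ w z = (z %ℕ 2 ^ w) {{ℕ.m^n≢0 2 w}}

data Op : Set where
  add sub mul quo rem lt : Op

-- Division by zero yields zero.
⟦_⟧ : Op → (w : ℕ) → ℕ → ℕ → ℕ
⟦ add ⟧ w x y       = word w (x + y)
⟦ sub ⟧ w x y       = word w (x + (2 ^ w ∸ y))
⟦ mul ⟧ w x y       = word w (x * y)
⟦ quo ⟧ w x zero    = 0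
⟦ quo ⟧ w x (suc y) = word w (x / suc y)
⟦ rem ⟧ w x zero    = 0
⟦ rem ⟧ w x (suc y) = word w (x % suc y)
⟦ lt  ⟧ w x y       = word w (if does (x ℕ.<? y) then 1 else 0)

Reg : Set
Reg = ℕ

infixr 5 _⨾_

data Cmd : Set where
  skip   : Cmd
  const  : Reg → ℕ → Cmd
  op     : Op → Reg → Reg → Reg → Cmd
  load   : Reg → Reg → Cmd
  store  : Reg → Reg → Cmd
  _⨾_    : Cmd → Cmd → Cmd
  ifnz   : Reg → Cmd → Cmd → Cmd
  while  : Reg → Cmd → Cmd

record State : Set where
  constructor ⟨_∣_⟩
  field
    reg : Reg → ℕ
    mem : ℕ → ℕ

open State public

_[_↦_] : (ℕ → ℕ) → ℕ → ℕ → (ℕ → ℕ)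
(f [ i ↦ v ]) j = if does (j ℕ.≟ i) then v else f j

infix 4 _⊢_,_⇓_,_

-- w ⊢ c , s ⇓ s′ , t : with w-bit words, c started in s halts in s′ after t steps.
data _⊢_,_⇓_,_ (w : ℕ) : Cmd → State → State → ℕ → Set where
  skip  : ∀ {s} →
          w ⊢ skip , s ⇓ s , 1
  const : ∀ {r k s} →
          w ⊢ const r k , s ⇓ ⟨ reg s [ r ↦ word w k ] ∣ mem s ⟩ , 1
  op    : ∀ {o r x y s} →
          w ⊢ op o r x y , s ⇓ ⟨ reg s [ r ↦ ⟦ o ⟧ w (reg s x) (reg s y) ] ∣ mem s ⟩ , 1
  load  : ∀ {r x s} →
          w ⊢ load r x , s ⇓ ⟨ reg s [ r ↦ mem s (reg s x) ] ∣ mem s ⟩ , 1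
  store : ∀ {x y s} →
          w ⊢ store x y , s ⇓ ⟨ reg s ∣ mem s [ reg s x ↦ reg s y ] ⟩ , 1
  seq   : ∀ {c d s s′ s″ t u} →
          w ⊢ c , s ⇓ s′ , t → w ⊢ d , s′ ⇓ s″ , u →
          w ⊢ c ⨾ d , s ⇓ s″ , t + u
  then′ : ∀ {r c d s s′ t} → reg s r ≢ 0 →
          w ⊢ c , s ⇓ s′ , t →
          w ⊢ ifnz r c d , s ⇓ s′ , suc t
  else′ : ∀ {r c d s s′ t} → reg s r ≡ 0 →
          w ⊢ d , s ⇓ s′ , t →
          w ⊢ ifnz r c d , s ⇓ s′ , suc t
  done  : ∀ {r c s} → reg s r ≡ 0 →
          w ⊢ while r c , s ⇓ s , 1
  loop  : ∀ {r c s s′ s″ t u} → reg s r ≢ 0 →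
          w ⊢ c , s ⇓ s′ , t → w ⊢ while r c , s′ ⇓ s″ , u →
          w ⊢ while r c , s ⇓ s″ , suc (t + u)

-- An algorithm has to work for every word size w ≥ c · log₂ (2 + n), where n
-- is the size parameter of the input and the constant c is its word factor.
record Algorithm : Set where
  field
    code       : Cmd
    wordFactor : ℕ

open Algorithm public

FitsWords : Algorithm → ℕ → ℕ → Set
FitsWords P n w = (2 + n) ^ wordFactor P ≤ 2 ^ w

nth : List ℕ → ℕ → ℕ
nth []       _       = 0
nth (x ∷ xs) zero    = x
nth (x ∷ xs) (suc i) = nth xs i

-- The registers and the memory hold the two given lists, followed by zeros.
initial : ℕ → List ℕ → List ℕ → State
initial w rs xs = ⟨ (λ i → word w (nth rs i)) ∣ (λ i → word w (nth xs i)) ⟩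

------------------------------------------------------------------------
-- Matrix multiplication

Matrix : ℕ → Set
Matrix n = Fin n → Fin n → ℤ

open Algebra.Properties.CommutativeMonoid.Sum ℤ.+-0-commutativeMonoid
  using (sum)

_⊗_ : ∀ {n} → Matrix n → Matrix n → Matrix n
(A ⊗ B) i j = sum (λ k → A i k ℤ.* B k j)

EntriesBounded : ∀ {n} → Matrix n → Set
EntriesBounded {n} A = ∀ i j → ∣ A i j ∣ ≤ n

rowMajor : ∀ {n} → ℕ → Matrix n → List ℕ
rowMajor {n} w A =
  concatMap (λ i → List.map (λ j → wordℤ w (A i j)) (allFin n)) (allFin n)

matMulInput : ∀ {n} → ℕ → Matrix n → Matrix n → State
matMulInput {n} w A B = initial w (n ∷ []) (rowMajor w A ++ rowMajor w B)

-- The product is left in row-major order from address 0 on.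
MultipliesMatrices : Algorithm → Set
MultipliesMatrices P =
  ∀ {n} w → FitsWords P n w →
  (A B : Matrix n) → EntriesBounded A → EntriesBounded B →
  ∃₂ λ s t → (w ⊢ code P , matMulInput w A B ⇓ s , t) ×
             (∀ i j → mem s (toℕ i * n + toℕ j) ≡ wordℤ w ((A ⊗ B) i j))

-- Multiplication of n × n matrices in time n^(ρ + o(1)).
MatMulTime : Algorithm → ℝ → Set
MatMulTime P ρ =
  ∀ ε → Positive ε → ∃[ N ] ∀ {n} → N ≤ n →
  ∀ w → FitsWords P n w →
  (A B : Matrix n) → EntriesBounded A → EntriesBounded B →
  ∀ {s t} → w ⊢ code P , matMulInput w A B ⇓ s , t →
  ∀ q → Upper ρ q → t ≤ᵖ n ↑ (q ℚᵘ.+ ε)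

-- ω is the least real such that n × n matrices can be multiplied in time
-- n^(ω + o(1)).
record IsMatMulExponent (ω : ℝ) : Set₁ where
  field
    attained : Σ[ P ∈ Algorithm ] MultipliesMatrices P × MatMulTime P ω
    least    : ∀ ρ → (Σ[ P ∈ Algorithm ] MultipliesMatrices P × MatMulTime P ρ) →
               ω ≤ʳ ρ

------------------------------------------------------------------------
-- Graphs and dominating triangles

record Graph (n : ℕ) : Set₁ where
  field
    Adj    : Rel (Fin n) 0ℓ
    adj?   : Decidable Adj
    sym    : Symmetric Adj
    irrefl : Irreflexive _≡_ Adj

open Graph public using (Adj)

edges : ∀ {n} → Graph n → List (Fin n × Fin n)
edges {n} G = filter (λ (u , v) → (u Fin.<? v) ×-dec Graph.adj? G u v)
                     (cartesianProduct (allFin n) (allFin n))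

#edges : ∀ {n} → Graph n → ℕ
#edges G = length (edges G)

HasDominatingTriangle : ∀ {n} → Graph n → Set
HasDominatingTriangle {n} G =
  ∃[ u ] ∃[ v ] ∃[ w ]
    (Adj G u v × Adj G v w × Adj G u w) ×
    (∀ x → (x ≡ u ⊎ x ≡ v ⊎ x ≡ w) ⊎ (Adj G x u ⊎ Adj G x v ⊎ Adj G x w))

-- Registers 0 and 1 hold the numbers of vertices and edges; the memory holds
-- the edges, each as two consecutive words.
graphInput : ℕ → (n : ℕ) → List (Fin n × Fin n) → State
graphInput w n es =
  initial w (n ∷ length es ∷ []) (concatMap (λ (u , v) → toℕ u ∷ toℕ v ∷ []) es)

-- The edges may be listed in any order; the answer is left in register 0.
SolvesDominatingTriangle : Algorithm → Set₁
SolvesDominatingTriangle D =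
  ∀ {n} (G : Graph n) es → es ↭ edges G →
  ∀ w → FitsWords D n w →
  ∃₂ λ s t → (w ⊢ code D , graphInput w n es ⇓ s , t) ×
             (HasDominatingTriangle G → reg s 0 ≡ 1) ×
             (¬ HasDominatingTriangle G → reg s 0 ≡ 0)

-- 1 + 2τ / (τ + 1)
exponent : (τ : ℚᵘ) → .{{Positive τ}} → ℚᵘ
exponent τ = 1ℚᵘ ℚᵘ.+ (2ℚᵘ ℚᵘ.* τ) ℚᵘ.÷ (τ ℚᵘ.+ 1ℚᵘ)
  where
  2ℚᵘ = 1ℚᵘ ℚᵘ.+ 1ℚᵘ
  instance _ = ℚᵘ.pos⇒nonZero (τ ℚᵘ.+ 1ℚᵘ) {{ℚᵘ.pos+pos⇒pos τ 1ℚᵘ}}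

-- t ≤ (m^(1 + 2ω/(ω+1)) / n)^r for m, n ≥ 1 and ω ≥ 0.  As 1 + 2τ/(τ+1) is
-- continuous and increasing in τ ≥ 0, the right-hand side is the infimum of
-- its values at rational τ > ω.
TriangleBound : ℝ → (r : ℚᵘ) (t m n : ℕ) → Set
TriangleBound ω r t m n =
  ∀ τ → .{{_ : Positive τ}} → Upper ω τ →
  t ≤ᵖ m ↑ (exponent τ ℚᵘ.* r) · n ↑ (ℚᵘ.- r)

-- Time (m^(1 + 2ω/(ω+1)) / n)^(1 + o(1)) on graphs with m = Θ(n^α), for every
-- choice a, b of the constants implicit in Θ.
DominatingTriangleTime : Algorithm → (ω α : ℝ) → Set₁
DominatingTriangleTime D ω α =
  ∀ a b ε → Positive ε → ∃[ N ] ∀ {n} → N ≤ n →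
  (G : Graph n) → n ↑ʳ α ≤ᵖ a * #edges G → #edges G ≤ᵖ b · n ↑ʳ α →
  ∀ es → es ↭ edges G →
  ∀ w → FitsWords D n w →
  ∀ {s t} → w ⊢ code D , graphInput w n es ⇓ s , t →
  TriangleBound ω (1ℚᵘ ℚᵘ.+ ε) t (#edges G) n

{-# OPTIONS --safe #-}
module Submission where

-- One vertex v of a dominating triangle dominates a third of the vertices, which leaves O(m / n)
-- candidates for v.  An edge uw inside the neighbourhood N(v) completes a dominating triangle
-- iff N(u) and N(w) cover the complement of N[v], and by inclusion and exclusion it suffices
-- to count the common neighbours of u and w there.  Call a vertex high if its degree exceeds
-- a threshold Δ.  If u or w is low, counting is done by brute force in time O(Δm); otherwise the
-- low common neighbours are counted likewise, and the high ones by multiplying matrices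
-- indexed by the at most 2m / Δ high vertices.  For Δ = m^((ω − 1)/(ω + 1)) both parts take time
-- m^(2ω/(ω + 1)), up to m^o(1).
--
-- Since ω is an arbitrary real, Δ cannot be computed from it.  Instead Δ is doubled, starting
-- from 1, and the multiplication algorithm is run by a simulator that gives up after Δ(m + n)
-- steps, until all multiplications finish in time.

open import Defs
open import Algebra.Properties.CommutativeMonoid.Sum using ()
open import Data.Bool.Base using (Bool; true; false; if_then_else_; _∧_; T)
open import Data.Bool.Properties using (T-∧)
open import Data.Empty using (⊥-elim; ⊥-elim-irr)
open import Data.Fin.Base using (Fin; zero; suc; toℕ; fromℕ<)
open import Data.Fin.Properties using (toℕ<n; toℕ-fromℕ<; fromℕ<-toℕ; toℕ-injective)
import Data.Fin.Properties as Fin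
open import Data.Integer.Base as ℤ using (ℤ)
import Data.Integer.Properties as ℤ
open import Data.List.Base as List
  using (List; []; _∷_; _++_; length; tabulate; concatMap; allFin; filter; cartesianProduct)
open import Data.List.Properties using (map-tabulate; length-++; length-tabulate)
open import Data.List.Relation.Binary.Permutation.Propositional as ↭ using (_↭_)
open import Data.List.Relation.Binary.Permutation.Propositional.Properties using (↭-length)
open import Data.Nat.Base renaming (_/_ to _÷_)
open import Data.Nat.Divisibility using (divides)
open import Data.Nat.DivMod hiding (_/_)
open import Data.Nat.Properties
open import Data.Nat.Solver using (module +-*-Solver)
open import Data.Product.Base
open import Data.Sum.Base using (_⊎_; inj₁; inj₂; [_,_]′)
open import Data.Unit.Base using (⊤; tt)
open import Function.Base using (_∘_)
open import Function.Bundles using (Equivalence)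
open import Data.Rational.Unnormalised.Base as ℚᵘ using (ℚᵘ; mkℚᵘ; Positive; 1ℚᵘ)
open import Relation.Binary.Definitions using (tri<; tri≈; tri>)
open import Relation.Binary.PropositionalEquality hiding ([_]; J)
open import Relation.Nullary
open import Relation.Nullary.Decidable.Core using (_×-dec_)

open +-*-Solver using (solve; _:+_; _:*_; _:=_; con)
open Algebra.Properties.CommutativeMonoid.Sum ℤ.+-0-commutativeMonoid using (sum; sum-cong-≗)

-- The given multiplication algorithm is a black box: nothing is known about the memory it touches
-- or about its time on small matrices. It is therefore simulated on words of `w′` bits, where
-- `2 ^ w′` is polynomial in n, which confines its memory to a region of that many cells. A failed
-- threshold leaves a certificate: the limit on the steps is below the number of entries of a
-- matrix, or some run of the algorithm reaches it. The analysis turns these certificates, for each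
-- rational above ω separately, into inequalities between powers of natural numbers. It needs the
-- exponent to be at least 2, which is derived from the cells that a multiplication has to write.
-- Neighbourhoods are treated as sums of bits over all vertices, so that counting arguments become
-- rearrangements of sums.

-- Finite sums over initial segments of the natural numbers

∑ : ℕ → (ℕ → ℕ) → ℕ
∑ zero    f = 0
∑ (suc n) f = ∑ n f + f n

∑-cong : ∀ n {f g} → (∀ {i} → i < n → f i ≡ g i) → ∑ n f ≡ ∑ n g
∑-cong zero    e = refl
∑-cong (suc n) e = cong₂ _+_ (∑-cong n (e ∘ m<n⇒m<1+n)) (e ≤-refl)

∑-mono : ∀ n {f g} → (∀ {i} → i < n → f i ≤ g i) → ∑ n f ≤ ∑ n g
∑-mono zero    e = z≤n
∑-mono (suc n) e = +-mono-≤ (∑-mono n (e ∘ m<n⇒m<1+n)) (e ≤-refl)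

∑-zero : ∀ n {f} → (∀ {i} → i < n → f i ≡ 0) → ∑ n f ≡ 0
∑-zero zero    e = refl
∑-zero (suc n) e = cong₂ _+_ (∑-zero n (e ∘ m<n⇒m<1+n)) (e ≤-refl)

∑-+ : ∀ n f g → ∑ n (λ i → f i + g i) ≡ ∑ n f + ∑ n g
∑-+ zero    f g = refl
∑-+ (suc n) f g rewrite ∑-+ n f g =
  solve 4 (λ a b c d → (a :+ b) :+ (c :+ d) := (a :+ c) :+ (b :+ d)) refl (∑ n f) (∑ n g) (f n) (g n)

∑-*ˡ : ∀ n c f → ∑ n (λ i → c * f i) ≡ c * ∑ n f
∑-*ˡ zero    c f = sym (*-zeroʳ c)
∑-*ˡ (suc n) c f rewrite ∑-*ˡ n c f = sym (*-distribˡ-+ c (∑ n f) (f n))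

∑-*ʳ : ∀ n f c → ∑ n (λ i → f i * c) ≡ ∑ n f * c
∑-*ʳ n f c = trans (∑-cong n λ {i} _ → *-comm (f i) c) (trans (∑-*ˡ n c f) (*-comm c _))

∑-const : ∀ n c → ∑ n (λ _ → c) ≡ n * c
∑-const zero    c = refl
∑-const (suc n) c = trans (cong (_+ c) (∑-const n c)) (+-comm (n * c) c)

∑-≤ : ∀ n {f c} → (∀ {i} → i < n → f i ≤ c) → ∑ n f ≤ n * c
∑-≤ n {f} {c} e = ≤-trans (∑-mono n e) (≤-reflexive (∑-const n c))

∑-prefix : ∀ f {m n} → m ≤ n → ∑ m f ≤ ∑ n f
∑-prefix f {m} {n} m≤n with m≤n⇒m<n∨m≡n m≤n
... | inj₂ refl = ≤-refl
... | inj₁ (s≤s {n = k} m≤k) = ≤-trans (∑-prefix f m≤k) (m≤m+n (∑ k f) (f k))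

∑-swap : ∀ m n (f : ℕ → ℕ → ℕ) → ∑ m (λ i → ∑ n (f i)) ≡ ∑ n (λ j → ∑ m (λ i → f i j))
∑-swap zero    n f = sym (∑-zero n λ _ → refl)
∑-swap (suc m) n f = trans (cong (_+ ∑ n (f m)) (∑-swap m n f)) (sym (∑-+ n _ _))

∑-left : ∀ n f → ∑ (suc n) f ≡ f 0 + ∑ n (f ∘ suc)
∑-left zero    f = sym (+-identityʳ (f 0))
∑-left (suc n) f = trans (cong (_+ f (suc n)) (∑-left n f)) (+-assoc (f 0) _ _)

∑-term : ∀ n f {i} → i < n → f i ≤ ∑ n f
∑-term (suc n) f {i} i<1+n with m≤n⇒m<n∨m≡n (≤-pred i<1+n)
... | inj₁ i<n  = ≤-trans (∑-term n f i<n) (m≤m+n _ _)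
... | inj₂ refl = m≤n+m (f n) (∑ n f)

∑-positive : ∀ n f → ∑ n f ≢ 0 → ∃ λ i → i < n × f i ≢ 0
∑-positive zero    f s≢0 = contradiction refl s≢0
∑-positive (suc n) f s≢0 with f n ≟ 0
... | no fn≢0 = n , ≤-refl , fn≢0
... | yes fn≡0 with ∑-positive n f (λ e → s≢0 (cong₂ _+_ e fn≡0))
... | i , i<n , fi≢0 = i , m<n⇒m<1+n i<n , fi≢0

-- The sums of the earlier terms are ordered as well, so the last terms must agree, and cancelling
-- them leaves the shorter sums. This turns an equality of two counts into domination of every
-- single vertex.
∑-tight : ∀ n {f g} → (∀ {i} → i < n → f i ≤ g i) → ∑ n f ≡ ∑ n g →
          ∀ {i} → i < n → f i ≡ g i
∑-tight (suc n) {f} {g} f≤g e {i} i<1+n with m≤n⇒m<n∨m≡n (≤-pred i<1+n)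
  | ≤-antisym (f≤g ≤-refl) (+-cancelˡ-≤ (∑ n f) (g n) (f n) (≤-trans (+-monoˡ-≤ (g n) (∑-mono n (f≤g ∘ m<n⇒m<1+n))) (≤-reflexive (sym e))))
... | inj₂ refl | fn≡gn = fn≡gn
... | inj₁ i<n | fn≡gn =
  ∑-tight n (f≤g ∘ m<n⇒m<1+n) (+-cancelʳ-≡ (g n) _ _ (trans (cong (∑ n f +_) (sym fn≡gn)) e)) i<n

δ : ℕ → ℕ → ℕ
δ x y = if x ≡ᵇ y then 1 else 0

δ-same : ∀ {x y} → x ≡ y → δ x y ≡ 1
δ-same {x} {y} x≡y with x ≡ᵇ y | ≡⇒≡ᵇ x y x≡y
... | true | _ = refl

δ-other : ∀ {x y} → x ≢ y → δ x y ≡ 0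
δ-other {x} {y} x≢y with x ≡ᵇ y | ≡ᵇ⇒≡ x y
... | true  | x≡y = contradiction (x≡y tt) x≢y
... | false | _   = refl

δ-comm : ∀ x y → δ x y ≡ δ y x
δ-comm x y with x ≟ y
... | yes refl = refl
... | no x≢y = trans (δ-other x≢y) (sym (δ-other (x≢y ∘ sym)))

∑-δ : ∀ n (g : ℕ → ℕ) {y} → y < n → ∑ n (λ x → δ x y * g x) ≡ g y
∑-δ (suc n) g {y} y<1+n with m≤n⇒m<n∨m≡n (≤-pred y<1+n)
... | inj₁ y<n rewrite ∑-δ n g y<n | δ-other (<⇒≢ y<n ∘ sym) = +-identityʳ (g y)
... | inj₂ refl
  rewrite ∑-zero n {λ x → δ x n * g x} (λ {i} i<n → cong (_* g i) (δ-other (<⇒≢ i<n)))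
        | δ-same {n} refl = +-identityʳ (g n)

≤1 : ∀ {x} → x ≤ 1 → x ≡ 0 ⊎ x ≡ 1
≤1 {zero} _ = inj₁ refl
≤1 {suc zero} _ = inj₂ refl
≤1 {suc (suc _)} (s≤s ())

-- Memory, words and program variables

Mem : Set
Mem = ℕ → ℕ

update-same : ∀ (f : ℕ → ℕ) i {v j} → j ≡ i → (f [ i ↦ v ]) j ≡ v
update-same f i {j = j} j≡i with j ≡ᵇ i | ≡⇒≡ᵇ j i j≡i
... | true | _ = refl

update-other : ∀ (f : ℕ → ℕ) i {v j} → j ≢ i → (f [ i ↦ v ]) j ≡ f j
update-other f i {j = j} j≢i with j ≡ᵇ i | ≡ᵇ⇒≡ j i
... | true  | j≡i = contradiction (j≡i tt) j≢i
... | false | _   = refl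

update-agree : ∀ (f g : ℕ → ℕ) {i v j} → f j ≡ g j → (f [ i ↦ v ]) j ≡ (g [ i ↦ v ]) j
update-agree f g {i} {v} {j} eq with j ≡ᵇ i
... | true  = refl
... | false = eq

update-all : ∀ (P : ℕ → Set) (f : ℕ → ℕ) i {v} j → P v → P (f j) → P ((f [ i ↦ v ]) j)
update-all P f i j pv pf with j ≡ᵇ i
... | true  = pv
... | false = pf

-- Time bounds quantify over all runs, while the proof constructs one. Determinism identifies the
-- two, and likewise the constructed run of the simulator with the one under analysis.
deterministic : ∀ {w c s s₁ s₂ t₁ t₂} → w ⊢ c , s ⇓ s₁ , t₁ → w ⊢ c , s ⇓ s₂ , t₂ →
                s₁ ≡ s₂ × t₁ ≡ t₂
deterministic skip skip = refl , refl
deterministic const const = refl , refl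
deterministic op op = refl , refl
deterministic load load = refl , refl
deterministic store store = refl , refl
deterministic (seq a b) (seq a′ b′) with deterministic a a′
... | refl , refl with deterministic b b′
... | refl , refl = refl , refl
deterministic (then′ _ a) (then′ _ a′) with deterministic a a′
... | refl , refl = refl , refl
deterministic (then′ r≢0 _) (else′ r≡0 _) = contradiction r≡0 r≢0
deterministic (else′ r≡0 _) (then′ r≢0 _) = contradiction r≡0 r≢0
deterministic (else′ _ a) (else′ _ a′) with deterministic a a′
... | refl , refl = refl , refl
deterministic (done _) (done _) = refl , refl
deterministic (done r≡0) (loop r≢0 _ _) = contradiction r≡0 r≢0
deterministic (loop r≢0 _ _) (done r≡0) = contradiction r≡0 r≢0
deterministic (loop _ a b) (loop _ a′ b′) with deterministic a a′
... | refl , refl with deterministic b b′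
... | refl , refl = refl , refl

word-small : ∀ w {x} → x < 2 ^ w → word w x ≡ x
word-small w = m<n⇒m%n≡m {{m^n≢0 2 w}}

word-< : ∀ w x → word w x < 2 ^ w
word-< w x = m%n<n x (2 ^ w) {{m^n≢0 2 w}}

-- `rb` is the side of a table, `rM` the modulus of the simulated words, and `rS` is m + n. For the
-- threshold `rΔ`, `rN` is the dimension of the matrices and `rF` the limit on the steps of a
-- multiplication. `rh` counts the high vertices, `rid` numbers the scratch table in use, and
-- `rbase` is the start of the matrix region. `rans` adds up the successful tests, and `rfail` marks
-- a threshold as too small. From `temp` on, registers hold intermediate values and the registers of
-- the simulated program.
pattern rn    = 0
pattern rm    = 1
pattern rb    = 2
pattern rM    = 3
pattern rS    = 4
pattern rΔ    = 5
pattern rN    = 6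
pattern rF    = 7
pattern rh    = 8
pattern rid   = 9
pattern rbase = 10
pattern rfuel = 11
pattern rv    = 12
pattern ru    = 13
pattern ri    = 14
pattern rk    = 15
pattern rp    = 16
pattern rq    = 17
pattern racc  = 18
pattern rans  = 19
pattern rfail = 20
pattern re    = 21
pattern temp  = 22

Vars : Set
Vars = Reg → ℕ

infixl 8 _[_≔_]

_[_≔_] : Vars → Reg → ℕ → Vars
vs [ r ≔ x ] = vs [ r ↦ x ]

infix 4 _≈_

-- Written out as a product, so that for concrete updates it holds by computation.
record _≈_ (vs vs′ : Vars) : Set where
  constructor same
  field
    values : vs 0 ≡ vs′ 0 × vs 1 ≡ vs′ 1 × vs 2 ≡ vs′ 2 × vs 3 ≡ vs′ 3 × vs 4 ≡ vs′ 4 × vs 5 ≡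
           vs′ 5 × vs 6 ≡ vs′ 6 × vs 7 ≡ vs′ 7 × vs 8 ≡ vs′ 8 × vs 9 ≡ vs′ 9 × vs 10 ≡ vs′ 10 ×
           vs 11 ≡ vs′ 11 × vs 12 ≡ vs′ 12 × vs 13 ≡ vs′ 13 × vs 14 ≡ vs′ 14 × vs 15 ≡ vs′ 15 ×
           vs 16 ≡ vs′ 16 × vs 17 ≡ vs′ 17 × vs 18 ≡ vs′ 18 × vs 19 ≡ vs′ 19 × vs 20 ≡ vs′ 20 ×
           vs 21 ≡ vs′ 21

pattern ✓ = same (refl , refl , refl , refl , refl , refl , refl , refl , refl , refl , refl , refl ,
            refl , refl , refl , refl , refl , refl , refl , refl , refl , refl)

-- The variants leave the registers that computation does not settle to a proof: `rh` here, then
-- `rans` together with `rfail`, then each of these two alone.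
pattern ✓h p = same (
            refl , refl , refl , refl , refl , refl , refl , refl , p , refl , refl , refl ,
            refl , refl , refl , refl , refl , refl , refl , refl , refl , refl)

pattern ✓init p q = same (
            refl , refl , refl , refl , refl , refl , refl , refl , refl , refl , refl , refl ,
            refl , refl , refl , refl , refl , refl , refl , p , q , refl)

pattern ✓fail p = same (
            refl , refl , refl , refl , refl , refl , refl , refl , refl , refl , refl , refl ,
            refl , refl , refl , refl , refl , refl , refl , refl , p , refl)

pattern ✓ans p = same (
            refl , refl , refl , refl , refl , refl , refl , refl , refl , refl , refl , refl ,
            refl , refl , refl , refl , refl , refl , refl , p , refl , refl)

reg-cases : (P : Reg → Set) → P 0 → P 1 → P 2 → P 3 → P 4 → P 5 → P 6 → P 7 → P 8 → P 9 →
            P 10 → P 11 → P 12 → P 13 → P 14 → P 15 → P 16 → P 17 → P 18 → P 19 → P 20 →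
            P 21 → ∀ {r} → r < temp → P r
reg-cases P p0 p1 p2 p3 p4 p5 p6 p7 p8 p9 p10 p11 p12 p13 p14 p15 p16 p17 p18 p19 p20 p21 {r} r<
  = go r r<
  where
  go : ∀ r → r < temp → P r
  go 0 _ = p0
  go 1 _ = p1
  go 2 _ = p2
  go 3 _ = p3
  go 4 _ = p4
  go 5 _ = p5
  go 6 _ = p6
  go 7 _ = p7
  go 8 _ = p8
  go 9 _ = p9
  go 10 _ = p10
  go 11 _ = p11
  go 12 _ = p12
  go 13 _ = p13
  go 14 _ = p14
  go 15 _ = p15
  go 16 _ = p16
  go 17 _ = p17
  go 18 _ = p18
  go 19 _ = p19
  go 20 _ = p20
  go (suc 20) _ = p21
  go (suc (suc (suc (suc (suc (suc (suc (suc (suc (suc (suc (suc (suc (suc (suc (suc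
     (suc (suc (suc (suc (suc (suc r)))))))))))))))))))))) r<22 =
     ⊥-elim (≤⇒≯ (m≤m+n 22 r) r<22)

≈-at : ∀ {vs vs′} → vs ≈ vs′ → ∀ {r} → r < temp → vs r ≡ vs′ r
≈-at {vs} {vs′} (same (e0 , e1 , e2 , e3 , e4 , e5 , e6 , e7 , e8 , e9 , e10 , e11 , e12 , e13 , e14 , e15
  , e16 , e17 , e18 , e19 , e20 , e21)) =
  reg-cases (λ r → vs r ≡ vs′ r) e0 e1 e2 e3 e4 e5 e6 e7 e8 e9 e10 e11 e12 e13 e14 e15 e16 e17 e18 e19 e20 e21

-- A small language of expressions and statements

infix  20 #_
infix  20 `_
infix  19 !_
infixl 17 _⊛_ _⊘_
infixl 16 _⊕_
infix  15 _≺_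

data Exp : Set where
  #_  : ℕ → Exp
  `_  : Reg → Exp
  bin : Op → Exp → Exp → Exp
  !_  : Exp → Exp

pattern _⊕_ a b = bin add a b
pattern _⊛_ a b = bin mul a b
pattern _⊘_ a b = bin quo a b
pattern _≺_ a b = bin lt a b

[_<_] : ℕ → ℕ → ℕ
[ x < y ] = if does (x <? y) then 1 else 0

quotient : ℕ → ℕ → ℕ
quotient x zero = 0
quotient x (suc y) = x ÷ suc y

-- The operations without reduction modulo 2 ^ w. The two that `exactOp` excludes get the junk value
-- 0.
exact : Op → ℕ → ℕ → ℕ
exact add x y = x + y
exact mul x y = x * y
exact quo x y = quotient x y
exact lt  x y = [ x < y ]
exact sub x y = 0
exact rem x y = 0

eval : Vars → Mem → Exp → ℕ
eval vs μ (# k) = k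
eval vs μ (` r) = vs r
eval vs μ (bin o a b) = exact o (eval vs μ a) (eval vs μ b)
eval vs μ (! a) = μ (eval vs μ a)

-- `leaves` is the exponent in `eval-<`. A memory access is a single leaf however large its address
-- is, because every cell is below β. `steps` is the exact running time of `comp`.
leaves steps : Exp → ℕ
leaves (# _) = 1
leaves (` _) = 1
leaves (bin _ a b) = leaves a + leaves b
leaves (! _) = 1

steps (# _) = 1
steps (` _) = 2
steps (bin _ a b) = steps a + (steps b + 1)
steps (! a) = steps a + 1

exactOp : Op → Bool
exactOp sub = false
exactOp rem = false
exactOp _   = true

-- The constants 8 and 17 match `8≤β` and `β¹⁶≤2ʷ` in `Machine`.
wellFormed : Exp → Bool
wellFormed (# k) = k <ᵇ 8
wellFormed (` r) = r <ᵇ temp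
wellFormed e@(bin o a b) = exactOp o ∧ wellFormed a ∧ wellFormed b ∧ (leaves e <ᵇ 17)
wellFormed (! a) = wellFormed a

simple : Exp → Bool
simple e = wellFormed e ∧ (steps e <ᵇ 80)

∧-T : ∀ {x y} → T (x ∧ y) → T x × T y
∧-T = Equivalence.to T-∧

-- The registers from `d` on serve as a stack, so that everything below `d` survives the evaluation.
comp : Reg → Exp → Cmd
comp d (# k) = const d k
comp d (` r) = const d 0 ⨾ op add d r d
comp d (bin o a b) = comp d a ⨾ comp (suc d) b ⨾ op o d d (suc d)
comp d (! a) = comp d a ⨾ load d d

infix 6 _≔_ ⟨_⟩≔_
infixr 5 _⨟_

data Stm : Set where
  _≔_   : Reg → Exp → Stm
  ⟨_⟩≔_ : Exp → Exp → Stm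
  _⨟_   : Stm → Stm → Stm
  when  : Exp → Stm → Stm → Stm
  for   : Reg → Exp → Stm → Stm
  none  : Stm
  call  : Cmd → Stm

compile : Stm → Cmd
compile (r ≔ e) = comp temp e ⨾ const (suc temp) 0 ⨾ op add r temp (suc temp)
compile (⟨ a ⟩≔ e) = comp temp a ⨾ comp (suc temp) e ⨾ store temp (suc temp)
compile (c ⨟ d) = compile c ⨾ compile d
compile (when e c d) = comp temp e ⨾ ifnz temp (compile c) (compile d)
compile (for r l c) =
  compile (r ≔ # 0) ⨾ comp temp (` r ≺ l) ⨾
  while temp (compile c ⨾ compile (r ≔ ` r ⊕ # 1) ⨾ comp temp (` r ≺ l))
compile none = skip
compile (call c) = c

[<]-yes : ∀ {x y} → x < y → [ x < y ] ≡ 1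
[<]-yes {x} {y} x<y with x <ᵇ y | <⇒<ᵇ x<y
... | true | _ = refl

[<]-no : ∀ {x y} → y ≤ x → [ x < y ] ≡ 0
[<]-no {x} {y} y≤x with x <ᵇ y | <ᵇ⇒< x y
... | true  | x<y = contradiction (x<y tt) (≤⇒≯ y≤x)
... | false | _   = refl

[<]≤1 : ∀ x y → [ x < y ] ≤ 1
[<]≤1 x y with x <ᵇ y
... | true  = ≤-refl
... | false = z≤n

m+n<m*n′ : ∀ m n → m + n < suc m * suc n
m+n<m*n′ m n = s≤s (begin
  m + n            ≡⟨ +-comm m n ⟩
  n + m            ≡⟨ cong (n +_) (*-identityʳ m) ⟨
  n + m * 1        ≤⟨ +-monoʳ-≤ n (*-monoʳ-≤ m (s≤s z≤n)) ⟩
  n + m * suc n    ∎)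
  where open ≤-Reasoning

quotient≤ : ∀ x y → quotient x y ≤ x
quotient≤ x zero = z≤n
quotient≤ x (suc y) = m/n≤m x (suc y)

-- In terms of successors the bound is multiplicative: x < β ^ i and y < β ^ j give a result below β
-- ^ (i + j), for every operation alike.
exact-bound : ∀ o x y → exact o x y < suc x * suc y
exact-bound add x y = m+n<m*n′ x y
exact-bound sub x y = s≤s z≤n
exact-bound mul x y = *-mono-< (n<1+n x) (n<1+n y)
exact-bound quo x y = ≤-<-trans (≤-trans (quotient≤ x y) (m≤m+n x y)) (m+n<m*n′ x y)
exact-bound rem x y = s≤s z≤n
exact-bound lt x y with x <ᵇ y | <ᵇ⇒< x y
... | true  | x<y = ≤-<-trans (≤-trans (≤-trans (s≤s z≤n) (x<y tt)) (m≤n+m y x)) (m+n<m*n′ x y)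
... | false | _   = s≤s z≤n

exact-word : ∀ w o x y → T (exactOp o) → exact o x y < 2 ^ w → ⟦ o ⟧ w x y ≡ exact o x y
exact-word w add x y _ = word-small w
exact-word w mul x y _ = word-small w
exact-word w quo x zero _ _ = refl
exact-word w quo x (suc y) _ = word-small w
exact-word w lt x y _ = word-small w

-- A program logic with running times

-- β bounds the variables and memory cells; an expression with at most 16 leaves then
-- stays below β¹⁶ and cannot overflow.  Time is counted in units of κ machine steps.

record Machine : Set where
  constructor machine
  field
    w β κ : ℕ
    8≤β : 8 ≤ β
    β¹⁶≤2ʷ : β ^ 16 ≤ 2 ^ w
    200≤κ : 200 ≤ κ

module Logic (mc : Machine) where

  open Machine mc

  record Bnd (s : State) : Set where
    constructor bnd
    field
      regs : ∀ {r} → r < temp → reg s r < β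
      cells : ∀ a → mem s a < β
  open Bnd

  instance
    β-nonZero : NonZero β
    β-nonZero = >-nonZero (≤-trans (s≤s z≤n) 8≤β)

  leaves≤16 : ∀ e → T (wellFormed e) → leaves e ≤ 16
  leaves≤16 (# x) _ = s≤s z≤n
  leaves≤16 (` x) _ = s≤s z≤n
  leaves≤16 (bin o a b) wf =
    ≤-pred (<ᵇ⇒< _ _ (proj₂ (∧-T {wellFormed b} (proj₂ (∧-T {wellFormed a} (proj₂ (∧-T {exactOp o} wf)))))))
  leaves≤16 (! e) _ = s≤s z≤n

  <β⇒<W : ∀ {x k} → x < β ^ k → k ≤ 16 → x < 2 ^ w
  <β⇒<W x< k≤ = <-≤-trans x< (≤-trans (^-monoʳ-≤ β k≤) β¹⁶≤2ʷ)

  eval-< : ∀ s e → Bnd s → T (wellFormed e) → eval (reg s) (mem s) e < β ^ leaves e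
  eval-< s (# k) B wf = ≤-trans (<ᵇ⇒< k 8 wf) (≤-trans 8≤β (≤-reflexive (sym (^-identityʳ β))))
  eval-< s (` r) B wf = subst (reg s r <_) (sym (^-identityʳ β)) (regs B (<ᵇ⇒< r temp wf))
  eval-< s (bin o a b) B wf with ∧-T {exactOp o} wf
  ... | _ , wf′ with ∧-T {wellFormed a} wf′
  ... | wfa , wf″ with ∧-T {wellFormed b} wf″
  ... | wfb , _ =
    ≤-trans (exact-bound o (eval (reg s) (mem s) a) (eval (reg s) (mem s) b))
      (≤-trans (*-mono-≤ (eval-< s a B wfa) (eval-< s b B wfb))
        (≤-reflexive (sym (^-distribˡ-+-* β (leaves a) (leaves b)))))
  eval-< s (! a) B wf = subst (mem s (eval (reg s) (mem s) a) <_) (sym (^-identityʳ β)) (cells B _)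

  eval-agree : ∀ e {vs vs′ : Vars} {μ μ′} → T (wellFormed e) → (∀ {r} → r < temp → vs r ≡ vs′ r) →
               μ ≡ μ′ → eval vs μ e ≡ eval vs′ μ′ e
  eval-agree (# _) _ _ _ = refl
  eval-agree (` r) wf e _ = e (<ᵇ⇒< r temp wf)
  eval-agree (bin o a b) wf e m with ∧-T {exactOp o} wf
  ... | _ , wf′ with ∧-T {wellFormed a} wf′
  ... | wfa , wf″ with ∧-T {wellFormed b} wf″
  ... | wfb , _ = cong₂ (exact o) (eval-agree a wfa e m) (eval-agree b wfb e m)
  eval-agree (! a) wf e m = cong₂ (λ μ x → μ x) m (eval-agree a wf e m)

  record Computed (d : Reg) (e : Exp) (s : State) : Set where
    field
      end    : State
      runs   : w ⊢ comp d e , s ⇓ end , steps e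
      value  : reg end d ≡ eval (reg s) (mem s) e
      others : ∀ {r} → r < d → reg end r ≡ reg s r
      memory : mem end ≡ mem s
  open Computed

  computed-bnd : ∀ {d e s} (k : Computed d e s) → temp ≤ d → Bnd s → Bnd (end k)
  computed-bnd k t≤d B = bnd
    (λ r< → subst (_< β) (sym (others k (<-≤-trans r< t≤d))) (regs B r<))
    (λ a → subst (λ μ → μ a < β) (sym (memory k)) (cells B a))

  comp-ok : ∀ d e s → temp ≤ d → Bnd s → T (wellFormed e) → Computed d e s
  comp-ok d (# k) s t≤d B wf = record
    { runs = const
    ; value = trans (update-same (reg s) d refl) (word-small w (<β⇒<W {k = 1} (eval-< s (# k) B wf) (s≤s z≤n)))
    ; others = λ r<d → update-other (reg s) d (<⇒≢ r<d)
    ; memory = refl }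
  comp-ok d (` r) s t≤d B wf = record
    { runs = seq const op
    ; value = trans (update-same (reg s [ d ↦ word w 0 ]) d refl)
        (trans (cong₂ (λ x y → word w (x + y)) (update-other (reg s) d (<⇒≢ (<-≤-trans r<t t≤d)))
                  (trans (update-same (reg s) d refl) (word-small w (m^n>0 2 w))))
          (trans (cong (word w) (+-identityʳ _))
            (trans (word-small w (<β⇒<W {k = 1} (subst (_ <_) (sym (^-identityʳ β)) (regs B r<t)) (s≤s z≤n)))
              refl)))
    ; others = λ r<d → trans (update-other (reg s [ d ↦ word w 0 ]) d (<⇒≢ r<d)) (update-other (reg s) d (<⇒≢ r<d))
    ; memory = refl }
    where r<t = <ᵇ⇒< r temp wf
  comp-ok d e@(bin o a b) s t≤d B wf with ∧-T {exactOp o} wf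
  ... | wfo , wf′ with ∧-T {wellFormed a} wf′
  ... | wfa , wf″ with ∧-T {wellFormed b} wf″
  ... | wfb , _ = record
    { runs = seq (runs A) (seq (runs B′) op)
    ; value = trans (update-same (reg (end B′)) d refl)
        (trans (cong₂ (⟦ o ⟧ w) ra rb′)
          (exact-word w o _ _ wfo (<β⇒<W (eval-< s e B wf) (leaves≤16 e wf))))
    ; others = λ r<d → trans (update-other (reg (end B′)) d (<⇒≢ r<d)) (trans (others B′ (m<n⇒m<1+n r<d)) (others A r<d))
    ; memory = trans (memory B′) (memory A) }
    where
    A = comp-ok d a s t≤d B wfa
    B′ = comp-ok (suc d) b (end A) (m≤n⇒m≤1+n t≤d) (computed-bnd A t≤d B) wfb
    ra : reg (end B′) d ≡ eval (reg s) (mem s) a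
    ra = trans (others B′ (n<1+n d)) (value A)
    rb′ : reg (end B′) (suc d) ≡ eval (reg s) (mem s) b
    rb′ = trans (value B′) (eval-agree b wfb (λ r< → others A (<-≤-trans r< t≤d)) (memory A))
  comp-ok d (! a) s t≤d B wf = record
    { runs = seq (runs A) load
    ; value = trans (update-same (reg (end A)) d refl) (cong₂ (λ μ x → μ x) (memory A) (value A))
    ; others = λ r<d → trans (update-other (reg (end A)) d (<⇒≢ r<d)) (others A r<d)
    ; memory = memory A }
    where A = comp-ok d a s t≤d B wf

  Post : Set₁
  Post = Vars → Mem → ℕ → Set

  Agrees : State → Vars → Set
  Agrees s vs = ∀ {r} → r < temp → reg s r ≡ vs r

  record Ends (c : Stm) (s : State) (Q : Post) : Set where
    constructor ends
    field
      {final} : State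
      {time} {units} : ℕ
      {vars} : Vars
      exec : w ⊢ compile c , s ⇓ final , time
      cost : time ≤ κ * units
      bounded : Bnd final
      agrees : Agrees final vars
      post : Q vars (mem final) units

  record Run (c : Stm) (vs : Vars) (μ : Mem) (Q : Post) : Set where
    constructor mkRun
    field
      from : ∀ s → Bnd s → Agrees s vs → mem s ≡ μ → Ends c s Q
  open Run public

  sequence : ∀ {c d vs μ Q} →
             Run c vs μ (λ vs′ μ′ t → Run d vs′ μ′ (λ vs″ μ″ u → Q vs″ μ″ (t + u))) →
             Run (c ⨟ d) vs μ Q
  from (sequence C) s B e m with from C s B e m
  ... | ends {s′} {t₁} {u₁} x k B′ e′ R with from R s′ B′ e′ refl
  ... | ends {_} {t₂} {u₂} y k′ B″ e″ q =
    ends (seq x y) (≤-trans (+-mono-≤ k k′) (≤-reflexive (sym (*-distribˡ-+ κ u₁ u₂)))) B″ e″ q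

  weaken : ∀ {c vs μ} {P Q : Post} → Run c vs μ P → (∀ {vs′ μ′ t} → P vs′ μ′ t → Q vs′ μ′ t) →
           Run c vs μ Q
  from (weaken C f) s B e m with from C s B e m
  ... | ends x k B′ e′ p = ends x k B′ e′ (f p)

  -- Updates made in a different order give stores that agree at every variable without being equal
  -- as functions. The postcondition may therefore be established for a normal form of the final
  -- store; `restart` is the analogue for the initial store.
  settle : ∀ {c vs μ} {Q : Post} → Run c vs μ (λ vs′ μ′ t → ∃ λ vs″ → Q vs″ μ′ t × vs″ ≈ vs′) →
           Run c vs μ Q
  from (settle C) s B e m with from C s B e m
  ... | ends x k B′ e′ (_ , q , e″) = ends x k B′ (λ r< → trans (e′ r<) (sym (≈-at e″ r<))) q

  restart : ∀ {c vs μ} vs′ {Q : Post} → vs ≈ vs′ → Run c vs′ μ Q → Run c vs μ Q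
  from (restart vs′ e C) s B e′ m = from C s B (λ r< → trans (e′ r<) (≈-at e r<)) m

  private
    assigned-time : ∀ e → T (steps e <ᵇ 80) → ∀ {k} → k ≤ 20 → steps e + k ≤ 100
    assigned-time e se k≤ = +-mono-≤ (<⇒≤ (<ᵇ⇒< (steps e) 80 se)) k≤

    units-1 : ∀ {t} → t ≤ 200 → t ≤ κ * 1
    units-1 t≤ = ≤-trans t≤ (≤-trans 200≤κ (≤-reflexive (sym (*-identityʳ κ))))

    few : ∀ {x y} → T (x ≤ᵇ y) → x ≤ y
    few {x} {y} = ≤ᵇ⇒≤ x y

  -- The value passes through an addition of zero, which is how registers are copied.
  assign-ends : ∀ r e {vs μ x} s → Bnd s → Agrees s vs → mem s ≡ μ → T (simple e) →
    eval vs μ e ≡ x → x < β →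
    ∃ λ s′ → (w ⊢ compile (r ≔ e) , s ⇓ s′ , (steps e + 2)) × Bnd s′ ×
             Agrees s′ (vs [ r ≔ x ]) × mem s′ ≡ μ
  assign-ends r e {vs} {μ} {v} s B ag refl se ev v< with ∧-T {wellFormed e} se
  ... | wf , _ =
    _ , seq (runs A) (seq const op)
      , bnd (λ {x} x< → update-all (_< β) ρ r x (subst (_< β) (sym v≡) v<)
                (subst (_< β) (sym (old x<)) (regs B x<)))
            (λ a → subst (λ μ → μ a < β) (sym (memory A)) (cells B a))
      , (λ {x} x< → pointwise x< (x ≟ r))
      , memory A
    where
    A = comp-ok temp e s ≤-refl B wf
    ρ = reg (end A) [ suc temp ↦ word w 0 ]
    old : ∀ {x} → x < temp → ρ x ≡ reg s x
    old x< = trans (update-other (reg (end A)) (suc temp) (<⇒≢ (m<n⇒m<1+n x<))) (others A x<)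
    v≡ : word w (ρ temp + ρ (suc temp)) ≡ v
    v≡ = trans (cong₂ (λ x y → word w (x + y)) (trans (value A) (trans (eval-agree e wf ag refl) ev)) (word-small w (m^n>0 2 w)))
           (trans (cong (word w) (+-identityʳ v)) (word-small w (<β⇒<W {k = 1} (subst (v <_) (sym (^-identityʳ β)) v<) (s≤s z≤n))))
    pointwise : ∀ {x} → x < temp → Dec (x ≡ r) →
                (ρ [ r ↦ word w (ρ temp + ρ (suc temp)) ]) x ≡ (vs [ r ↦ v ]) x
    pointwise x< (yes x≡r) = trans (update-same ρ r x≡r) (trans v≡ (sym (update-same vs r x≡r)))
    pointwise x< (no x≢r) = trans (update-other ρ r x≢r) (trans (old x<) (trans (ag x<) (sym (update-other vs r x≢r))))

  assign : ∀ {r e vs μ} {Q : Post} → {se : T (simple e)} → ∀ x → eval vs μ e ≡ x → x < β →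
           Q (vs [ r ≔ x ]) μ 1 → Run (r ≔ e) vs μ Q
  from (assign {r} {e} {Q = Q} {se} v ev v< q) s B ag refl with assign-ends r e s B ag refl se ev v<
  ... | s′ , x , B′ , ag′ , m≡ =
    ends x (units-1 (≤-trans (assigned-time e (proj₂ (∧-T {wellFormed e} se)) (few _)) (few _))) B′ ag′
      (subst (λ μ → Q (_ [ r ≔ v ]) μ 1) (sym m≡) q)

  set : ∀ {a e vs μ} {Q : Post} → {sa : T (simple a)} → {se : T (simple e)} → ∀ x y →
        eval vs μ a ≡ x → eval vs μ e ≡ y → y < β → Q vs (μ [ x ↦ y ]) 1 → Run (⟨ a ⟩≔ e) vs μ Q
  from (set {a} {e} {vs} {Q = Q} {sa} {se} x y ea ev v< q) s B ag refl
    with ∧-T {wellFormed a} sa | ∧-T {wellFormed e} se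
  ... | wfa , ta | wfe , te =
    ends (seq (runs A) (seq (runs E) store))
      (units-1 (≤-trans (+-monoʳ-≤ (steps a) (assigned-time e te (few _))) (≤-trans (+-monoˡ-≤ 100 (<⇒≤ (<ᵇ⇒< (steps a) 80 ta))) (few _))))
      (bnd (λ x< → subst (_< β) (sym (old x<)) (regs B x<))
           (λ i → subst (λ f → f i < β) (sym mem≡) (update-all (_< β) (mem s) x i v< (cells B i))))
      (λ x< → trans (old x<) (ag x<))
      (subst (λ μ → Q vs μ 1) (sym mem≡) q)
    where
    A = comp-ok temp a s ≤-refl B wfa
    E = comp-ok (suc temp) e (end A) (n≤1+n temp) (computed-bnd A ≤-refl B) wfe
    old : ∀ {x} → x < temp → reg (end E) x ≡ reg s x
    old x< = trans (others E (m<n⇒m<1+n x<)) (others A x<)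
    mem≡ : mem (end E) [ reg (end E) temp ↦ reg (end E) (suc temp) ] ≡ mem s [ x ↦ y ]
    mem≡ = trans (cong₂ (λ x y → mem (end E) [ x ↦ y ])
                    (trans (others E (n<1+n temp)) (trans (value A) (trans (eval-agree a wfa ag refl) ea)))
                    (trans (value E) (trans (eval-agree e wfe (λ x< → trans (others A x<) (ag x<)) (memory A)) ev)))
             (cong (λ μ → μ [ x ↦ y ]) (trans (memory E) (memory A)))

  branch : ∀ {e c d vs μ} {Q : Post} → {se : T (simple e)} →
           (eval vs μ e ≢ 0 → Run c vs μ (λ vs μ t → Q vs μ (suc t))) →
           (eval vs μ e ≡ 0 → Run d vs μ (λ vs μ t → Q vs μ (suc t))) →
           Run (when e c d) vs μ Q
  from (branch {e} {c} {d} {vs} {Q = Q} {se} C D) s B ag refl with ∧-T {wellFormed e} se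
  ... | wf , te = go (eval vs (mem s) e ≟ 0)
    where
    A = comp-ok temp e s ≤-refl B wf
    val : reg (end A) temp ≡ eval vs (mem s) e
    val = trans (value A) (eval-agree e wf ag refl)
    enough : ∀ {t u} → t ≤ κ * u → steps e + suc t ≤ κ * suc u
    enough {t} {u} t≤ = ≤-trans (≤-reflexive (trans (+-suc (steps e) t) (cong (_+ t) (+-comm 1 (steps e)))))
      (≤-trans (+-mono-≤ (units-1 (≤-trans (assigned-time e te (few _)) (few _))) t≤)
               (≤-reflexive (trans (sym (*-distribˡ-+ κ 1 u)) refl)))
    ag′ : Agrees (end A) vs
    ag′ x< = trans (others A x<) (ag x<)
    go : Dec (eval vs (mem s) e ≡ 0) → Ends (when e c d) s Q
    go (yes z) with from (D z) (end A) (computed-bnd A ≤-refl B) ag′ (memory A)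
    ... | ends x k B′ e′ q = ends (seq (runs A) (else′ (trans val z) x)) (enough k) B′ e′ q
    go (no ¬z) with from (C ¬z) (end A) (computed-bnd A ≤-refl B) ag′ (memory A)
    ... | ends x k B′ e′ q = ends (seq (runs A) (then′ (λ z → ¬z (trans (sym val) z)) x)) (enough k) B′ e′ q

  nothing : ∀ {vs μ} {Q : Post} → Q vs μ 1 → Run none vs μ Q
  from (nothing {Q = Q} q) s B ag refl = ends skip (units-1 (few _)) B ag q

  private
    Rest : Reg → Exp → Stm → Cmd
    Rest r l c = comp temp (` r ≺ l) ⨾
      while temp (compile c ⨾ compile (r ≔ ` r ⊕ # 1) ⨾ comp temp (` r ≺ l))

  -- The invariant sees the units spent so far, which lets it distinguish histories of different
  -- cost, as the search for the threshold requires. The limit `l` is evaluated anew before each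
  -- round, hence it has to keep the value N under the invariant.
  loop-rule : ∀ {r l c} (Inv : ℕ → Post) N {vs μ} {Q : Post} →
    {sl : T (simple (` r ≺ l))} → {sr : T (simple (` r ⊕ # 1))} → N < β →
    (∀ {i vs μ t} → i ≤ N → Inv i vs μ t → vs r ≡ i × eval vs μ l ≡ N) →
    (∀ {i vs μ t} → i < N → Inv i vs μ t →
      Run c vs μ (λ vs′ μ′ t′ → vs′ r ≡ i ×
        ∃ λ vs″ → Inv (suc i) vs″ μ′ (suc (t + t′)) × vs″ ≈ vs′ [ r ≔ suc i ])) →
    (∃ λ vs″ → Inv 0 vs″ μ 1 × vs″ ≈ vs [ r ≔ 0 ]) →
    (∀ {vs′ μ′ t} → Inv N vs′ μ′ t → Q vs′ μ′ (suc t)) →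
    Run (for r l c) vs μ Q
  from (loop-rule {r} {l} {c} Inv N {vs₀} {Q = Q} {sl} {sr} N<β limit step (vs₁ , start₀ , start≈) finish) s₀ B₀ ag₀ refl =
    whole
    where
    σ = steps (` r ≺ l)
    wf = proj₁ (∧-T {wellFormed (` r ≺ l)} sl)
    te = proj₂ (∧-T {wellFormed (` r ≺ l)} sl)
    open ≤-Reasoning
    module Test s (B : Bnd s) {vs} (ag : Agrees s vs) where
      A = comp-ok temp (` r ≺ l) s ≤-refl B wf
      B′ : Bnd (end A)
      B′ = computed-bnd A ≤-refl B
      ag′ : Agrees (end A) vs
      ag′ x< = trans (others A x<) (ag x<)
      val : reg (end A) temp ≡ eval vs (mem s) (` r ≺ l)
      val = trans (value A) (eval-agree (` r ≺ l) wf ag refl)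
    -- The 6 is the time of incrementing the loop variable.
    iteration-time : ∀ t₁ u₁ u₃ a b → t₁ ≤ κ * u₁ → a + b ≤ κ * u₃ + σ + 1 →
                     σ + suc (t₁ + (6 + a) + b) ≤ κ * suc (u₁ + u₃) + σ + 1
    iteration-time t₁ u₁ u₃ a b k₁ k = begin
      σ + suc (t₁ + (6 + a) + b)
        ≡⟨ solve 4 (λ σ t a b → σ :+ (con 1 :+ (t :+ (con 6 :+ a) :+ b)) := (σ :+ con 7) :+ t :+ (a :+ b)) refl σ t₁ a b ⟩
      (σ + 7) + t₁ + (a + b)
        ≤⟨ +-mono-≤ (+-mono-≤ (≤-trans (assigned-time (` r ≺ l) te {7} (few _)) (≤-trans (few _) 200≤κ)) k₁) k ⟩
      κ + κ * u₁ + (κ * u₃ + σ + 1)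
        ≡⟨ solve 4 (λ κ u v σ → κ :+ κ :* u :+ (κ :* v :+ σ :+ con 1) := κ :* (con 1 :+ (u :+ v)) :+ σ :+ con 1) refl κ u₁ u₃ σ ⟩
      κ * suc (u₁ + u₃) + σ + 1 ∎
    -- A comparison and the test of the loop condition use up one unit.
    rest : ∀ fuel i {t₀ vs} s → fuel + i ≡ N → Bnd s → Agrees s vs → Inv i vs (mem s) t₀ →
           ∃ λ s′ → ∃ λ t → ∃ λ u → ∃ λ vs′ → (w ⊢ Rest r l c , s ⇓ s′ , t) × t ≤ κ * u + σ + 1 ×
             Bnd s′ × Agrees s′ vs′ × Inv N vs′ (mem s′) (t₀ + u)
    rest zero i {t₀} {vs} s refl B ag inv =
      _ , _ , 0 , vs , seq (runs A) (done (trans val ([<]-no (≤-reflexive (trans (proj₂ lim) (sym (proj₁ lim)))))))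
      , +-monoˡ-≤ 1 (m≤n+m σ (κ * 0)) , B′ , ag′
      , subst (λ μ → Inv i vs μ (t₀ + 0)) (sym (memory A)) (subst (Inv i vs (mem s)) (sym (+-identityʳ t₀)) inv)
      where
      open Test s B ag
      lim = limit ≤-refl inv
    rest (suc fuel) i {t₀} {vs} s eq B ag inv =
      let ends {s₁} {t₁} {u₁} {vs₁} x₁ k₁ B₁ ag₁ (r≡i , vs₂ , inv₁ , ≈₂) = from (step i<N inv) (end A) B′ ag′ (memory A)
          s₂ , x₂ , B₂ , ag₂ , m₂ = assign-ends r (` r ⊕ # 1) {vs₁} {mem s₁} {suc i} s₁ B₁ ag₁ refl sr
                                (trans (cong (_+ 1) r≡i) (+-comm i 1)) (≤-<-trans i<N N<β)
      in again x₁ k₁ x₂ (rest fuel (suc i) s₂ (trans (+-suc fuel i) eq) B₂ (λ x< → trans (ag₂ x<) (sym (≈-at ≈₂ x<)))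
           (subst (λ μ → Inv (suc i) vs₂ μ (suc (t₀ + u₁))) (sym m₂) inv₁))
      where
      open Test s B ag
      i<N : i < N
      i<N = subst (i <_) eq (s≤s (m≤n+m i fuel))
      lim = limit (<⇒≤ i<N) inv
      again : ∀ {s₁ t₁ u₁ s₂} → w ⊢ compile c , end A ⇓ s₁ , t₁ → t₁ ≤ κ * u₁ →
              w ⊢ compile (r ≔ ` r ⊕ # 1) , s₁ ⇓ s₂ , 6 →
              (∃ λ s′ → ∃ λ t → ∃ λ u → ∃ λ vs′ → (w ⊢ Rest r l c , s₂ ⇓ s′ , t) × t ≤ κ * u + σ + 1 ×
                Bnd s′ × Agrees s′ vs′ × Inv N vs′ (mem s′) (suc (t₀ + u₁) + u)) →
              ∃ λ s′ → ∃ λ t → ∃ λ u → ∃ λ vs′ → (w ⊢ Rest r l c , s ⇓ s′ , t) × t ≤ κ * u + σ + 1 ×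
                Bnd s′ × Agrees s′ vs′ × Inv N vs′ (mem s′) (t₀ + u)
      again {s₁} {t₁} {u₁} x₁ k₁ x₂ (s₃ , t₃ , u₃ , vs₃ , seq {t = ty} {u = tz} y z , k₃ , B₃ , ag₃ , inv₃) =
        s₃ , _ , suc (u₁ + u₃) , vs₃
        , seq (runs A) (loop (λ z → contradiction (trans (sym (trans val ([<]-yes (subst₂ _<_ (sym (proj₁ lim)) (sym (proj₂ lim)) i<N)))) z) λ ()) (seq x₁ (seq x₂ y)) z)
        , iteration-time t₁ u₁ u₃ ty tz k₁ k₃ , B₃ , ag₃
        , subst (Inv N vs₃ (mem s₃)) (trans (cong suc (+-assoc t₀ u₁ u₃)) (sym (+-suc t₀ (u₁ + u₃)))) inv₃
    whole : Ends (for r l c) s₀ Q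
    whole with assign-ends r (# 0) {vs₀} s₀ B₀ ag₀ refl _ refl (≤-trans (s≤s z≤n) 8≤β)
    ... | s₁ , x , B₁ , ag₁ , m₁
      with rest N 0 s₁ (+-identityʳ N) B₁ (λ x< → trans (ag₁ x<) (sym (≈-at start≈ x<))) (subst (λ μ → Inv 0 vs₁ μ 1) (sym m₁) start₀)
    ... | s₂ , t , u , vs₂ , y , k , B₂ , ag₂ , inv = ends (seq x y) total B₂ ag₂ (finish inv)
      where
      total : 3 + t ≤ κ * (2 + u)
      total = begin
        3 + t                    ≤⟨ +-monoʳ-≤ 3 k ⟩
        3 + (κ * u + σ + 1)      ≡⟨ solve 2 (λ a σ → con 3 :+ (a :+ σ :+ con 1) := σ :+ con 4 :+ a) refl (κ * u) σ ⟩
        σ + 4 + κ * u            ≤⟨ +-monoˡ-≤ (κ * u) (≤-trans (assigned-time (` r ≺ l) te {4} (few _)) (≤-trans (few _) 200≤κ)) ⟩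
        κ + κ * u                ≤⟨ +-monoʳ-≤ κ (m≤n+m (κ * u) κ) ⟩
        κ + (κ + κ * u)          ≡⟨ solve 2 (λ κ u → κ :+ (κ :+ κ :* u) := κ :* (con 2 :+ u)) refl κ u ⟩
        κ * (2 + u)              ∎

  iterate : ∀ {r l c} (Inv : ℕ → Vars → Mem → Set) N (time : ℕ → ℕ) {vs μ} {Q : Post} →
    {sl : T (simple (` r ≺ l))} → {sr : T (simple (` r ⊕ # 1))} → N < β →
    (∀ {i vs μ} → Inv i vs μ → vs r ≡ i × eval vs μ l ≡ N) →
    (∀ {i vs μ} → i < N → Inv i vs μ →
      Run c vs μ (λ vs′ μ′ t → t ≤ time i × vs′ r ≡ i ×
        ∃ λ vs″ → Inv (suc i) vs″ μ′ × vs″ ≈ vs′ [ r ≔ suc i ])) →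
    (∃ λ vs″ → Inv 0 vs″ μ × vs″ ≈ vs [ r ≔ 0 ]) →
    (∀ {vs′ μ′ t} → Inv N vs′ μ′ → t ≤ 2 + ∑ N (suc ∘ time) → Q vs′ μ′ t) →
    Run (for r l c) vs μ Q
  iterate {r} Inv N time {sl = sl} {sr} N<β limit step (vs₁ , start₀ , start≈) finish =
    loop-rule (λ i vs μ t → Inv i vs μ × t ≤ 1 + ∑ i (suc ∘ time)) N {sl = sl} {sr} N<β
      (λ _ → limit ∘ proj₁)
      (λ {i} i<N (inv , t≤) → weaken (step i<N inv) λ (t′≤ , r≡ , vs″ , inv′ , ≈″) →
        r≡ , vs″ , (inv′ , s≤s (≤-trans (+-mono-≤ t≤ t′≤) (≤-reflexive (sym (+-suc (∑ i (suc ∘ time)) (time i)))))) , ≈″)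
      (vs₁ , (start₀ , ≤-refl) , start≈)
      (λ (inv , t≤) → finish inv (s≤s t≤))

-- The code of the phases

-- Memory is cut into tables of b × b cells: table 0 is the input, 1 the degrees, 2 the
-- adjacency lists, 3 the adjacency matrix, 4 the list of vertices of high degree, 5 the
-- numbers of private neighbours; the tables from 6 on are scratch space.

cell : Exp → Exp → Exp → Exp
cell k x y = (k ⊛ ` rb ⊕ x) ⊛ ` rb ⊕ y

degree : Exp → Exp
degree u = ! cell (# 1) (# 0) u

neighbour : Exp → Exp → Exp
neighbour u i = ! cell (# 2) u i

adjacent : Exp → Exp → Exp
adjacent u x = ! cell (# 3) u x

high : Exp → Exp
high r = ! cell (# 4) (# 0) r

outer : Exp → Exp
outer u = ! cell (# 5) (# 0) u

-- The table of the current candidate v. For two vertices it counts their low common neighbours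
-- outside N[v].
common : Exp → Exp → Exp
common u x = ! cell (` rid) u x

outside : Exp → Exp
outside x = ((` rv ≺ x) ⊕ (x ≺ ` rv)) ⊛ (adjacent (` rv) x ≺ # 1)

-- Inclusion and exclusion: v, x and y dominate `outer` x + `outer` y + deg v + 1 - c vertices,
-- where c is in `racc`, and this number is compared with n. Two comparisons replace a test for
-- equality, and `rfuel`, which is idle outside of a call, holds the terms other than n and c.
test : Reg → Reg → Stm
test x y = when (adjacent (` rv) (` x) ⊛ adjacent (` rv) (` y) ⊛ adjacent (` x) (` y))
  ((rfuel ≔ outer (` x) ⊕ outer (` y) ⊕ degree (` rv) ⊕ # 1) ⨟
   (rans ≔ ` rans ⊕ (((` rfuel ≺ ` rn ⊕ ` racc) ⊕ (` rn ⊕ ` racc ≺ ` rfuel)) ≺ # 1)))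
  none

outerPhase : Stm
outerPhase =
  for ru (` rn)
    ((racc ≔ # 0) ⨟
     for ri (degree (` ru))
       ((rp ≔ neighbour (` ru) (` ri)) ⨟
        (racc ≔ ` racc ⊕ outside (` rp))) ⨟
     (⟨ cell (# 5) (# 0) (` ru) ⟩≔ ` racc))

-- One pass over the pairs p, q of neighbours of a low vertex u serves two purposes: u is recorded
-- as a common neighbour of p and q, and q is counted as a common neighbour of u and p, in both
-- cases only outside N[v].
pairBody : Stm
pairBody =
  (rq ≔ neighbour (` ru) (` rk)) ⨟
  (⟨ cell (` rid) (` rp) (` rq) ⟩≔ common (` rp) (` rq) ⊕ outside (` ru)) ⨟
  (racc ≔ ` racc ⊕ adjacent (` rp) (` rq) ⊛ outside (` rq))

lowBody : Stm
lowBody =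
  (rp ≔ neighbour (` ru) (` ri)) ⨟
  (racc ≔ # 0) ⨟
  for rk (degree (` ru)) pairBody ⨟
  test ru rp

lowPhase : Stm
lowPhase = for ru (` rn) (when (` rΔ ≺ degree (` ru)) none (for ri (degree (` ru)) lowBody))

-- The format that the multiplication expects and leaves behind: after a call, `left` addresses the
-- entries of the product.
left right : Exp → Exp → Exp
left r s = ` rbase ⊕ r ⊛ ` rN ⊕ s
right r s = ` rbase ⊕ ` rN ⊛ ` rN ⊕ r ⊛ ` rN ⊕ s

-- `outside` is applied to the column of the left factor, the middle index of the product, so that
-- only common neighbours outside N[v] are counted. The remaining entries of the N × N matrices stay
-- zero.
fillPhase : Stm
fillPhase =
  for ru (` rh) (for rk (` rh)
    ((rp ≔ high (` ru)) ⨟ (rq ≔ high (` rk)) ⨟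
     (⟨ left (` ru) (` rk) ⟩≔ adjacent (` rp) (` rq) ⊛ outside (` rq)) ⨟
     (⟨ right (` ru) (` rk) ⟩≔ adjacent (` rp) (` rq))))

highPhase : Stm
highPhase =
  for ru (` rh) (for rk (` rh)
    ((rp ≔ high (` ru)) ⨟ (rq ≔ high (` rk)) ⨟
     (racc ≔ common (` rp) (` rq) ⊕ ! left (` ru) (` rk)) ⨟
     test rp rq))

-- Addresses, frames and the graph as arrays

cellℕ : ℕ → ℕ → ℕ → ℕ → ℕ
cellℕ b k x y = (k * b + x) * b + y

cell-< : ∀ {b k x y} → x < b → y < b → cellℕ b k x y < suc k * b * b
cell-< {b} {k} {x} {y} x<b y<b = begin-strict
  (k * b + x) * b + y    <⟨ +-monoʳ-< _ y<b ⟩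
  (k * b + x) * b + b    ≡⟨ +-comm _ b ⟩
  suc (k * b + x) * b    ≤⟨ *-monoˡ-≤ b (≤-trans (≤-reflexive (sym (+-suc (k * b) x))) (≤-trans (+-monoʳ-≤ (k * b) x<b) (≤-reflexive (+-comm (k * b) b)))) ⟩
  suc k * b * b          ∎
  where open ≤-Reasoning

cell-≥ : ∀ b k x y → k * b * b ≤ cellℕ b k x y
cell-≥ b k x y = ≤-trans (*-monoˡ-≤ b (m≤m+n (k * b) x)) (m≤m+n _ y)

digits-injective : ∀ b {x y u v} → y < b → v < b → x * b + y ≡ u * b + v → x ≡ u × y ≡ v
digits-injective b {x} {y} {u} {v} y<b v<b e = x≡u , +-cancelˡ-≡ (u * b) y v (trans (cong (λ z → z * b + y) (sym x≡u)) e)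
  where
  instance b≢0 = >-nonZero (≤-trans (s≤s z≤n) y<b)
  div : ∀ x {y} → y < b → (x * b + y) ÷ b ≡ x
  div x {y} y<b = trans (cong (_÷ b) (+-comm (x * b) y)) (trans (+-distrib-/ y (x * b) small)
     (trans (cong₂ _+_ (m<n⇒m/n≡0 y<b) (m*n/n≡m x b)) refl))
    where
    small : y % b + (x * b) % b < b
    small = subst (_< b) (sym (trans (cong₂ _+_ (m<n⇒m%n≡m y<b) (m*n%n≡0 x b)) (+-identityʳ y))) y<b
  x≡u : x ≡ u
  x≡u = trans (sym (div x y<b)) (trans (cong (_÷ b) e) (div u v<b))

cell-injective : ∀ b {k x y k′ x′ y′} → x < b → y < b → x′ < b → y′ < b →
                 cellℕ b k x y ≡ cellℕ b k′ x′ y′ → x ≡ x′ × y ≡ y′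
cell-injective b {k} {x} {y} {k′} {x′} {y′} x< y< x′< y′< e with digits-injective b {k * b + x} {y} {k′ * b + x′} y< y′< e
... | e′ , y≡ with digits-injective b {k} {x} {k′} x< x′< e′
... | _ , x≡ = x≡ , y≡

record Consts : Set where
  constructor consts
  field cn cm cb cM cS : ℕ

infixl 9 _▹_

-- Overwriting makes the five constants available by computation, from a store in which everything
-- else is arbitrary.
_▹_ : Consts → Vars → Vars
gl ▹ l = l [ rn ≔ Consts.cn gl ] [ rm ≔ Consts.cm gl ] [ rb ≔ Consts.cb gl ] [ rM ≔ Consts.cM gl ] [ rS ≔ Consts.cS gl ]

record Below (K : ℕ) (μ μ′ : Mem) : Set where
  constructor below
  field at : ∀ {a} → a < K → μ′ a ≡ μ a

record Above (K : ℕ) (μ μ′ : Mem) : Set where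
  constructor above
  field at : ∀ {a} → K ≤ a → μ′ a ≡ μ a

below-refl : ∀ {K μ} → Below K μ μ
below-refl = below λ _ → refl

above-refl : ∀ {K μ} → Above K μ μ
above-refl = above λ _ → refl

below-≤ : ∀ {K L μ μ′} → K ≤ L → Below L μ μ′ → Below K μ μ′
below-≤ K≤L f = below λ a<K → Below.at f (<-≤-trans a<K K≤L)

above-≥ : ∀ {K L μ μ′} → L ≤ K → Above L μ μ′ → Above K μ μ′
above-≥ L≤K f = above λ K≤a → Above.at f (≤-trans L≤K K≤a)

below-trans : ∀ {K μ μ₁ μ₂} → Below K μ μ₁ → Below K μ₁ μ₂ → Below K μ μ₂
below-trans f g = below λ a<K → trans (Below.at g a<K) (Below.at f a<K)

above-trans : ∀ {K μ μ₁ μ₂} → Above K μ μ₁ → Above K μ₁ μ₂ → Above K μ μ₂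
above-trans f g = above λ K≤a → trans (Above.at g K≤a) (Above.at f K≤a)

below-set : ∀ {K μ μ′ a v} → K ≤ a → Below K μ μ′ → Below K μ (μ′ [ a ↦ v ])
below-set {K} {μ′ = μ′} {a} K≤a f =
  below λ x<K → trans (update-other μ′ a (<⇒≢ (<-≤-trans x<K K≤a))) (Below.at f x<K)

above-set : ∀ {K μ μ′ a v} → a < K → Above K μ μ′ → Above K μ (μ′ [ a ↦ v ])
above-set {K} {μ′ = μ′} {a} a<K f =
  above λ K≤x → trans (update-other μ′ a (<⇒≢ (<-≤-trans a<K K≤x) ∘ sym)) (Above.at f K≤x)

-- `enumerates` expresses that the list of u contains each neighbour exactly once, in the form in
-- which it is used: a loop along the list computes a sum over all vertices.
record Tables (n : ℕ) : Set where
  field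
    a nb : ℕ → ℕ → ℕ
    deg : ℕ → ℕ
    a≤1 : ∀ u x → a u x ≤ 1
    symmetric : ∀ u x → a u x ≡ a x u
    irreflexive : ∀ u → a u u ≡ 0
    nb< : ∀ {u i} → u < n → i < deg u → nb u i < n
    enumerates : ∀ {u} → u < n → ∀ (g : ℕ → ℕ) → ∑ (deg u) (λ i → g (nb u i)) ≡ ∑ n (λ x → a u x * g x)

  deg≡ : ∀ {u} → u < n → deg u ≡ ∑ n (a u)
  deg≡ {u} u<n = trans (trans (sym (*-identityʳ (deg u))) (sym (∑-const (deg u) 1)))
    (trans (enumerates u<n (λ _ → 1)) (∑-cong n λ {x} _ → *-identityʳ (a u x)))

  deg≤ : ∀ {u} → u < n → deg u ≤ n
  deg≤ {u} u<n = ≤-trans (≤-reflexive (deg≡ u<n)) (≤-trans (∑-≤ n λ {x} _ → a≤1 u x) (≤-reflexive (*-identityʳ n)))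

  -- x ∉ N[v]; the sum of the two comparisons encodes x ≠ v.
  out : ℕ → ℕ → ℕ
  out v x = ([ v < x ] + [ x < v ]) * [ a v x < 1 ]

  private
    apart : ∀ v x → [ v < x ] + [ x < v ] ≤ 1
    apart v x with <-cmp v x
    ... | tri< l _ m rewrite [<]-yes l | [<]-no (≮⇒≥ m) = ≤-refl
    ... | tri≈ m _ m′ rewrite [<]-no (≮⇒≥ m) | [<]-no (≮⇒≥ m′) = z≤n
    ... | tri> m _ l rewrite [<]-yes l | [<]-no (≮⇒≥ m) = ≤-refl

  out≤1 : ∀ v x → out v x ≤ 1
  out≤1 v x = *-mono-≤ {[ v < x ] + [ x < v ]} (apart v x) ([<]≤1 (a v x) 1)

  dOut : ℕ → ℕ → ℕ
  dOut v u = ∑ n (λ x → a u x * out v x)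

  dOut≤ : ∀ v u → dOut v u ≤ n
  dOut≤ v u = ≤-trans (∑-≤ n λ {x} _ → *-mono-≤ {a u x} (a≤1 u x) (out≤1 v x)) (≤-reflexive (*-identityʳ n))

  record Stored (b : ℕ) (μ : Mem) : Set where
    field
      degrees : ∀ {u} → u < n → μ (cellℕ b 1 0 u) ≡ deg u
      lists : ∀ {u i} → u < n → i < deg u → μ (cellℕ b 2 u i) ≡ nb u i
      matrix : ∀ {u x} → u < n → x < n → μ (cellℕ b 3 u x) ≡ a u x

  stored-below : ∀ {b μ μ′} → n < b → Below (4 * b * b) μ μ′ → Stored b μ → Stored b μ′
  stored-below {b} {μ} {μ′} n<b lo st = record
    { degrees = λ u<n → trans (Below.at lo (<-≤-trans (cell-< {k = 1} 0<b (<-trans u<n n<b)) (few 2 (s≤s (s≤s z≤n))))) (degrees u<n)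
    ; lists = λ {u} {i} u<n i<d → trans (Below.at lo (<-≤-trans (cell-< {k = 2} (<-trans u<n n<b) (<-trans (<-≤-trans i<d (deg≤ u<n)) n<b)) (few 3 (s≤s (s≤s (s≤s z≤n)))))) (lists u<n i<d)
    ; matrix = λ u<n x<n → trans (Below.at lo (cell-< {k = 3} (<-trans u<n n<b) (<-trans x<n n<b))) (matrix u<n x<n) }
    where
    open Stored st
    0<b = ≤-trans (s≤s z≤n) n<b
    few : ∀ k → k ≤ 4 → k * b * b ≤ 4 * b * b
    few k k≤ = *-monoˡ-≤ b (*-monoˡ-≤ b k≤)

[<]-≢0 : ∀ {x y} → [ x < y ] ≢ 0 → x < y
[<]-≢0 {x} {y} nz with x <ᵇ y | <ᵇ⇒< x y
... | true  | x<y = x<y tt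
... | false | _   = contradiction refl nz

[<]-≡0 : ∀ {x y} → [ x < y ] ≡ 0 → y ≤ x
[<]-≡0 {x} {y} z = ≮⇒≥ λ x<y → contradiction (trans (sym ([<]-yes x<y)) z) λ ()

-- The simulator

-- A program for w′-bit words is run on a machine with longer words, in the memory region
-- [base, base + 2^w′), on registers from 40 on.  Each test of a loop condition uses up one
-- unit of fuel, and without fuel all loops exit.

guard : Reg
guard = 23

-- A loop tests `guard`, a copy of its own variable as long as fuel remains. Exhaustion thus ends
-- the loop without changing a simulated register.
check : Reg → Cmd
check r = ifnz rfuel
  (const temp 1 ⨾ op sub rfuel rfuel temp ⨾ const temp 0 ⨾ op add guard (40 + r) temp)
  (const guard 0)

reduced : Op → Reg → Reg → Reg → Cmd
reduced o r x y = op o (40 + r) (40 + x) (40 + y) ⨾ op rem (40 + r) (40 + r) rM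

simulate : Cmd → Cmd
simulate skip = skip
simulate (const r k) = const (40 + r) k ⨾ op rem (40 + r) (40 + r) rM
simulate (op sub r x y) =
  op sub temp rM (40 + y) ⨾ op add (40 + r) (40 + x) temp ⨾ op rem (40 + r) (40 + r) rM
simulate (op add r x y) = reduced add r x y
simulate (op mul r x y) = reduced mul r x y
simulate (op quo r x y) = reduced quo r x y
simulate (op rem r x y) = reduced rem r x y
simulate (op lt r x y) = reduced lt r x y
simulate (load r x) = op add temp rbase (40 + x) ⨾ load (40 + r) temp
simulate (store x y) = op add temp rbase (40 + x) ⨾ store temp (40 + y)
simulate (c ⨾ d) = simulate c ⨾ simulate d
simulate (ifnz r c d) = ifnz (40 + r) (simulate c) (simulate d)
simulate (while r c) = check r ⨾ while guard (simulate c ⨾ check r)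

-- The price of a unit of fuel in `Halts`. The 14 of a loop covers `check`, of at most 5 steps, on
-- entry and in each round, and the exit from the loop.
factor : Cmd → ℕ
factor (c ⨾ d) = factor c + factor d
factor (ifnz r c d) = 1 + (factor c + factor d)
factor (while r c) = factor c + 14
factor _ = 3

Within : ℕ → Cmd → Set
Within R skip = ⊤
Within R (const r k) = r < R
Within R (op o r x y) = r < R × x < R × y < R
Within R (load r x) = r < R × x < R
Within R (store x y) = x < R × y < R
Within R (c ⨾ d) = Within R c × Within R d
Within R (ifnz r c d) = r < R × Within R c × Within R d
Within R (while r c) = r < R × Within R c

registers : Cmd → ℕ
registers skip = 0
registers (const r k) = suc r
registers (op o r x y) = suc (r + x + y)
registers (load r x) = suc (r + x)
registers (store x y) = suc (x + y)
registers (c ⨾ d) = registers c + registers d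
registers (ifnz r c d) = suc (r + registers c + registers d)
registers (while r c) = suc (r + registers c)

within-mono : ∀ {R S} → R ≤ S → ∀ c → Within R c → Within S c
within-mono R≤S skip _ = tt
within-mono R≤S (const _ _) h = <-≤-trans h R≤S
within-mono R≤S (op _ _ _ _) (h , i , j) = <-≤-trans h R≤S , <-≤-trans i R≤S , <-≤-trans j R≤S
within-mono R≤S (load _ _) (h , i) = <-≤-trans h R≤S , <-≤-trans i R≤S
within-mono R≤S (store _ _) (h , i) = <-≤-trans h R≤S , <-≤-trans i R≤S
within-mono R≤S (c ⨾ d) (h , i) = within-mono R≤S c h , within-mono R≤S d i
within-mono R≤S (ifnz _ c d) (h , i , j) = <-≤-trans h R≤S , within-mono R≤S c i , within-mono R≤S d j
within-mono R≤S (while _ c) (h , i) = <-≤-trans h R≤S , within-mono R≤S c i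

within-registers : ∀ c → Within (registers c) c
within-registers skip = tt
within-registers (const _ _) = ≤-refl
within-registers (op _ r x y) = s≤s (≤-trans (m≤m+n r x) (m≤m+n (r + x) y)) , s≤s (≤-trans (m≤n+m x r) (m≤m+n (r + x) y)) , s≤s (m≤n+m y (r + x))
within-registers (load r x) = s≤s (m≤m+n r x) , s≤s (m≤n+m x r)
within-registers (store x y) = s≤s (m≤m+n x y) , s≤s (m≤n+m y x)
within-registers (c ⨾ d) = within-mono (m≤m+n _ _) c (within-registers c) , within-mono (m≤n+m _ _) d (within-registers d)
within-registers (ifnz r c d) =
  s≤s (≤-trans (m≤m+n r (registers c)) (m≤m+n _ _))
  , within-mono (≤-trans (≤-trans (m≤n+m (registers c) r) (m≤m+n _ (registers d))) (n≤1+n _)) c (within-registers c)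
  , within-mono (≤-trans (m≤n+m (registers d) (r + registers c)) (n≤1+n _)) d (within-registers d)
within-registers (while r c) = s≤s (m≤m+n r _) , within-mono (≤-trans (m≤n+m _ r) (n≤1+n _)) c (within-registers c)

module Simulation (w w′ R base : ℕ) (w′≤w : w′ ≤ w)
  (M*M≤W : 2 ^ w′ * 2 ^ w′ ≤ 2 ^ w) (M+M≤W : 2 ^ w′ + 2 ^ w′ ≤ 2 ^ w) (base+M≤W : base + 2 ^ w′ ≤ 2 ^ w) where

  private
    M W : ℕ
    M = 2 ^ w′
    W = 2 ^ w

    instance
      M≢0 : NonZero M
      M≢0 = m^n≢0 2 w′

    M≤W : M ≤ W
    M≤W = ≤-trans (m≤m+n M M) M+M≤W

    M>0 : 0 < M
    M>0 = m^n>0 2 w′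

    1<W : 1 < W
    1<W = ≤-trans (+-mono-≤ M>0 M>0) M+M≤W

    rem-ok : ∀ x y .{{_ : NonZero y}} → y ≤ W → ⟦ rem ⟧ w x y ≡ x % y
    rem-ok x (suc y) y≤W = word-small w (<-≤-trans (m%n<n x (suc y)) y≤W)

    rem-M : ∀ x → ⟦ rem ⟧ w x M ≡ word w′ x
    rem-M x = rem-ok x M M≤W

    -- The preceding reduction modulo 2 ^ w does no harm, because 2 ^ w′ divides 2 ^ w.
    const-ok : ∀ k → ⟦ rem ⟧ w (word w k) M ≡ word w′ k
    const-ok k = trans (rem-M (word w k)) (m∣n⇒o%n%m≡o%m M W k {{M≢0}} {{m^n≢0 2 w}}
      (divides (2 ^ (w ∸ w′)) (trans (cong (2 ^_) (sym (m∸n+n≡m w′≤w))) (^-distribˡ-+-* 2 (w ∸ w′) w′))))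

    Reduces : Op → Set
    Reduces o = ∀ {x y} → x < M → y < M → ⟦ rem ⟧ w (⟦ o ⟧ w x y) M ≡ ⟦ o ⟧ w′ x y

    add-ok : Reduces add
    add-ok x< y< = trans (cong (λ z → ⟦ rem ⟧ w z M) (word-small w (<-≤-trans (+-mono-< x< y<) M+M≤W))) (rem-M _)

    mul-ok : Reduces mul
    mul-ok x< y< = trans (cong (λ z → ⟦ rem ⟧ w z M) (word-small w (<-≤-trans (*-mono-< x< y<) M*M≤W))) (rem-M _)

    quo-ok : Reduces quo
    quo-ok {x} {zero} x< y< = trans (rem-M 0) (m<n⇒m%n≡m M>0)
    quo-ok {x} {suc y} x< y< = trans (cong (λ z → ⟦ rem ⟧ w z M) (word-small w (≤-<-trans (m/n≤m x (suc y)) (<-≤-trans x< M≤W)))) (rem-M _)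

    rem-ok′ : Reduces rem
    rem-ok′ {x} {zero} x< y< = trans (rem-M 0) (m<n⇒m%n≡m M>0)
    rem-ok′ {x} {suc y} x< y< = trans (cong (λ z → ⟦ rem ⟧ w z M) (word-small w (<-≤-trans (m%n<n x (suc y)) (≤-trans (<⇒≤ y<) M≤W)))) (rem-M _)

    lt-ok : Reduces lt
    lt-ok {x} {y} _ _ = trans (cong (λ z → ⟦ rem ⟧ w z M) (word-small w (≤-<-trans ([<]≤1 x y) 1<W))) (rem-M _)

    minus-ok : ∀ {X y} → y ≤ X → X < W → word w (X + (W ∸ y)) ≡ X ∸ y
    minus-ok {X} {y} y≤X X<W = trans (cong (word w) eq)
      (trans ([m+n]%n≡m%n (X ∸ y) W {{m^n≢0 2 w}}) (word-small w (≤-<-trans (m∸n≤m X y) X<W)))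
      where
      eq : X + (W ∸ y) ≡ X ∸ y + W
      eq = trans (sym (+-∸-assoc X (≤-trans y≤X (<⇒≤ X<W)))) (trans (cong (_∸ y) (+-comm X W)) (trans (+-∸-assoc W y≤X) (+-comm W (X ∸ y))))

    M<W : M < W
    M<W = <-≤-trans (m<m+n M M>0) M+M≤W

    sub-ok : ∀ {x y} → x < M → y < M → ⟦ rem ⟧ w (⟦ add ⟧ w x (⟦ sub ⟧ w M y)) M ≡ ⟦ sub ⟧ w′ x y
    sub-ok {x} {y} x< y< = trans (cong (λ z → ⟦ rem ⟧ w (word w (x + z)) M) (minus-ok (<⇒≤ y<) M<W))
      (trans (cong (λ z → ⟦ rem ⟧ w z M) (word-small w (<-≤-trans (+-mono-<-≤ x< (m∸n≤m M y)) M+M≤W))) (rem-M _))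

    op-< : ∀ o x y → ⟦ o ⟧ w′ x y < M
    op-< add x y = word-< w′ (x + y)
    op-< sub x y = word-< w′ (x + (M ∸ y))
    op-< mul x y = word-< w′ (x * y)
    op-< quo x zero = M>0
    op-< quo x (suc y) = word-< w′ (x ÷ suc y)
    op-< rem x zero = M>0
    op-< rem x (suc y) = word-< w′ (x % suc y)
    op-< lt x y = word-< w′ [ x < y ]

    small : ∀ {x} → x < M → word w x ≡ x
    small x< = word-small w (<-≤-trans x< M≤W)

  fuel : State → ℕ
  fuel s = reg s rfuel

  -- What survives exhaustion: the simulated words stay below M whether or not they still follow the
  -- original run.
  record Safe (s : State) : Set where
    constructor safe
    field
      M≡ : reg s rM ≡ M
      base≡ : reg s rbase ≡ base
      fuel< : fuel s < W
      reg-M : ∀ {r} → r < R → reg s (40 + r) < M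
      mem-M : ∀ {a} → a < M → mem s (base + a) < M
  open Safe

  record Frame (s s′ : State) : Set where
    constructor frame
    field
      kept : ∀ {r} → r < temp → r ≢ rfuel → reg s′ r ≡ reg s r
      away : ∀ {a} → a < base ⊎ base + M ≤ a → mem s′ a ≡ mem s a
      burnt : fuel s′ ≤ fuel s
  open Frame

  frame-trans : ∀ {s s₁ s₂} → Frame s s₁ → Frame s₁ s₂ → Frame s s₂
  frame-trans f g = frame (λ r< r≢ → trans (kept g r< r≢) (kept f r< r≢)) (λ a → trans (away g a) (away f a)) (≤-trans (burnt g) (burnt f))

  -- An amortised bound, with a potential of K per unit of fuel. It presupposes nothing about the
  -- simulated program, which might not halt by itself.
  record Halts (c : Cmd) (K : ℕ) (s : State) : Set where
    constructor halts
    field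
      {end} : State
      {time} : ℕ
      exec : w ⊢ c , s ⇓ end , time
      ok : Safe end
      fr : Frame s end
      cost : time + K * fuel end ≤ K * suc (fuel s)

  record Related (σ s : State) : Set where
    constructor related
    field
      regs≡ : ∀ {r} → r < R → reg s (40 + r) ≡ reg σ r
      mem≡ : ∀ {a} → a < M → mem s (base + a) ≡ mem σ a
  open Related

  record Atomic (c : Cmd) (s : State) (effect : State → State) : Set where
    field
      {end} : State
      {time} : ℕ
      exec : w ⊢ simulate c , s ⇓ end , time
      time≤ : time ≤ 3
      ok : Safe end
      fr : Frame s end
      fuel≡ : fuel end ≡ fuel s
      rel : ∀ {σ} → Related σ s → Related (effect σ) end

  write-register : ∀ {s s′ r v} → Safe s → r < R → v < M →
    (∀ {x} → x ≢ temp → reg s′ x ≡ (reg s [ 40 + r ↦ v ]) x) → mem s′ ≡ mem s →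
    Safe s′ × Frame s s′ × fuel s′ ≡ fuel s ×
    (∀ {σ v′} → Related σ s → v ≡ v′ → Related ⟨ reg σ [ r ↦ v′ ] ∣ mem σ ⟩ s′)
  write-register {s} {s′} {r} {v} S r<R v<M e refl =
    safe (trans (e λ ()) (M≡ S)) (trans (e λ ()) (base≡ S)) (subst (_< W) (sym (e λ ())) (fuel< S))
      (λ {x} x<R → subst (_< M) (sym (e λ ())) (update-all (_< M) (reg s ∘ (40 +_)) r x v<M (reg-M S x<R)))
      (mem-M S)
    , frame (λ {x} x<t _ → trans (e (<⇒≢ x<t)) (update-other (reg s) (40 + r) (<⇒≢ (<-≤-trans x<t (≤-trans (m≤m+n 22 18) (m≤m+n 40 r))))))
        (λ _ → refl) (≤-reflexive (e λ ()))
    , e (λ ())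
    , λ { {σ} Rel refl → related (λ {x} x<R → trans (e λ ()) (update-agree (reg s ∘ (40 +_)) (reg σ) (regs≡ Rel x<R))) (mem≡ Rel) }

  effect : Cmd → State → State
  effect (const r k) σ = ⟨ reg σ [ r ↦ word w′ k ] ∣ mem σ ⟩
  effect (op o r x y) σ = ⟨ reg σ [ r ↦ ⟦ o ⟧ w′ (reg σ x) (reg σ y) ] ∣ mem σ ⟩
  effect (load r x) σ = ⟨ reg σ [ r ↦ mem σ (reg σ x) ] ∣ mem σ ⟩
  effect (store x y) σ = ⟨ reg σ ∣ mem σ [ reg σ x ↦ reg σ y ] ⟩
  effect _ σ = σ

  same-update : ∀ (f : ℕ → ℕ) i j {u v} → (((f [ i ↦ u ]) [ i ↦ v ]) j) ≡ (f [ i ↦ v ]) j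
  same-update f i j with j ≡ᵇ i
  ... | true = refl
  ... | false = refl

  const-atomic : ∀ r k s → r < R → Safe s → Atomic (const r k) s (effect (const r k))
  const-atomic r k s r<R S with write-register {s} {⟨ f [ 40 + r ↦ ⟦ rem ⟧ w (f (40 + r)) (f rM) ] ∣ mem s ⟩} {r} {word w′ k} S r<R (word-< w′ k)
      (λ {x} _ → trans (same-update (reg s) (40 + r) x) (cong (λ z → (reg s [ 40 + r ↦ z ]) x) v≡)) refl
    where
    f = reg s [ 40 + r ↦ word w k ]
    v≡ : ⟦ rem ⟧ w (f (40 + r)) (f rM) ≡ word w′ k
    v≡ = trans (cong₂ (⟦ rem ⟧ w) (update-same (reg s) (40 + r) refl) (M≡ S)) (const-ok k)
  ... | S′ , F , f≡ , rl = record { exec = seq const op ; time≤ = s≤s (s≤s z≤n) ; ok = S′ ; fr = F ; fuel≡ = f≡ ; rel = λ Rel → rl Rel refl }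

  reducedState : Op → Reg → Reg → Reg → State → State
  reducedState o r x y s = ⟨ f [ 40 + r ↦ ⟦ rem ⟧ w (f (40 + r)) (f rM) ] ∣ mem s ⟩
    where f = reg s [ 40 + r ↦ ⟦ o ⟧ w (reg s (40 + x)) (reg s (40 + y)) ]

  reduced-atomic : ∀ o r x y s → r < R → x < R → y < R → Safe s → Reduces o →
                   simulate (op o r x y) ≡ reduced o r x y → Atomic (op o r x y) s (effect (op o r x y))
  reduced-atomic o r x y s r<R x<R y<R S red eq with write-register {s} {reducedState o r x y s} {r} {⟦ o ⟧ w′ X Y} S r<R (op-< o X Y)
      (λ {x} _ → trans (same-update (reg s) (40 + r) x) (cong (λ z → (reg s [ 40 + r ↦ z ]) x) v≡)) refl
    where
    X = reg s (40 + x)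
    Y = reg s (40 + y)
    f = reg s [ 40 + r ↦ ⟦ o ⟧ w X Y ]
    v≡ : ⟦ rem ⟧ w (f (40 + r)) (f rM) ≡ ⟦ o ⟧ w′ X Y
    v≡ = trans (cong₂ (⟦ rem ⟧ w) (update-same (reg s) (40 + r) refl) (M≡ S)) (red (reg-M S x<R) (reg-M S y<R))
  ... | S′ , F , f≡ , rl = record { exec = subst (λ c → w ⊢ c , s ⇓ reducedState o r x y s , 2) (sym eq) (seq op op) ; time≤ = s≤s (s≤s z≤n) ; ok = S′ ; fr = F ; fuel≡ = f≡
      ; rel = λ Rel → rl Rel (cong₂ (⟦ o ⟧ w′) (regs≡ Rel x<R) (regs≡ Rel y<R)) }

  sub-atomic : ∀ r x y s → r < R → x < R → y < R → Safe s → Atomic (op sub r x y) s (effect (op sub r x y))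
  sub-atomic r x y s r<R x<R y<R S with write-register {s} {⟨ g [ 40 + r ↦ ⟦ rem ⟧ w (g (40 + r)) (g rM) ] ∣ mem s ⟩} {r} {⟦ sub ⟧ w′ X Y} S r<R (op-< sub X Y)
      (λ {z} z≢ → trans (same-update f (40 + r) z) (trans (update-agree f (reg s) {40 + r} {⟦ rem ⟧ w (g (40 + r)) (g rM)} {z} (update-other (reg s) temp z≢)) (cong (λ v → (reg s [ 40 + r ↦ v ]) z) v≡))) refl
    where
    X = reg s (40 + x)
    Y = reg s (40 + y)
    f = reg s [ temp ↦ ⟦ sub ⟧ w (reg s rM) Y ]
    g = f [ 40 + r ↦ ⟦ add ⟧ w (f (40 + x)) (f temp) ]
    v≡ : ⟦ rem ⟧ w (g (40 + r)) (g rM) ≡ ⟦ sub ⟧ w′ X Y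
    v≡ = trans (cong₂ (⟦ rem ⟧ w) (update-same f (40 + r) refl) (M≡ S))
      (trans (cong (λ z → ⟦ rem ⟧ w (⟦ add ⟧ w X (⟦ sub ⟧ w z Y)) M) (M≡ S)) (sub-ok (reg-M S x<R) (reg-M S y<R)))
  ... | S′ , F , f≡ , rl = record { exec = seq op (seq op op) ; time≤ = ≤-refl ; ok = S′ ; fr = F ; fuel≡ = f≡
      ; rel = λ Rel → rl Rel (cong₂ (⟦ sub ⟧ w′) (regs≡ Rel x<R) (regs≡ Rel y<R)) }

  address : ∀ {s x} → Safe s → x < R → ⟦ add ⟧ w (reg s rbase) (reg s (40 + x)) ≡ base + reg s (40 + x)
  address {s} {x} S x<R = trans (cong (λ z → word w (z + reg s (40 + x))) (base≡ S))
    (word-small w (<-≤-trans (+-monoʳ-< base (reg-M S x<R)) base+M≤W))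

  load-atomic : ∀ r x s → r < R → x < R → Safe s → Atomic (load r x) s (effect (load r x))
  load-atomic r x s r<R x<R S with write-register {s} {⟨ f [ 40 + r ↦ mem s (f temp) ] ∣ mem s ⟩} {r} {mem s (base + reg s (40 + x))} S r<R (mem-M S (reg-M S x<R))
      (λ {z} z≢ → trans (update-agree f (reg s) {40 + r} {_} {z} (update-other (reg s) temp z≢)) (cong (λ a → (reg s [ 40 + r ↦ mem s a ]) z) (address {s} S x<R))) refl
    where
    f = reg s [ temp ↦ ⟦ add ⟧ w (reg s rbase) (reg s (40 + x)) ]
  ... | S′ , F , f≡ , rl = record { exec = seq op load ; time≤ = s≤s (s≤s z≤n) ; ok = S′ ; fr = F ; fuel≡ = f≡
      ; rel = λ {σ} Rel → rl Rel (trans (mem≡ Rel (reg-M S x<R)) (cong (mem σ) (regs≡ Rel x<R))) }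

  store-atomic : ∀ x y s → x < R → y < R → Safe s → Atomic (store x y) s (effect (store x y))
  store-atomic x y s x<R y<R S = record
    { exec = seq op store ; time≤ = s≤s (s≤s z≤n)
    ; ok = safe (M≡ S) (base≡ S) (fuel< S) (reg-M S) λ {a} a<M →
        update-all (_< M) (mem s) A {Y} (base + a) (reg-M S y<R) (mem-M S a<M)
    ; fr = frame (λ x< _ → update-other (reg s) temp (<⇒≢ x<)) elsewhere ≤-refl
    ; fuel≡ = refl
    ; rel = λ {σ} Rel → related (regs≡ Rel) (λ {a} a<M → moved Rel a<M (a ≟ X)) }
    where
    X = reg s (40 + x)
    Y = reg s (40 + y)
    A = ⟦ add ⟧ w (reg s rbase) X
    A≡ : A ≡ base + X
    A≡ = address {s} S x<R
    elsewhere : ∀ {a} → a < base ⊎ base + M ≤ a → (mem s [ A ↦ Y ]) a ≡ mem s a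
    elsewhere (inj₁ a<) = update-other (mem s) A (λ e → <⇒≱ a< (≤-trans (m≤m+n base X) (≤-reflexive (trans (sym A≡) (sym e)))))
    elsewhere (inj₂ a≥) = update-other (mem s) A (λ e → ≤⇒≯ a≥ (subst (_< base + M) (trans (sym A≡) (sym e)) (+-monoʳ-< base (reg-M S x<R))))
    moved : ∀ {σ a} → Related σ s → a < M → Dec (a ≡ X) → (mem s [ A ↦ Y ]) (base + a) ≡ (mem σ [ reg σ x ↦ reg σ y ]) a
    moved {σ} Rel a<M (yes refl) = trans (update-same (mem s) A (sym A≡))
      (trans (regs≡ Rel y<R) (sym (update-same (mem σ) (reg σ x) (regs≡ Rel x<R))))
    moved {σ} Rel a<M (no a≢) = trans (update-other (mem s) A (λ e → a≢ (+-cancelˡ-≡ base _ _ (trans e A≡))))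
      (trans (mem≡ Rel a<M) (sym (update-other (mem σ) (reg σ x) (λ e → a≢ (trans e (sym (regs≡ Rel x<R)))))))

  op-atomic : ∀ o r x y s → r < R → x < R → y < R → Safe s → Atomic (op o r x y) s (effect (op o r x y))
  op-atomic add r x y s r< x< y< S = reduced-atomic add r x y s r< x< y< S add-ok refl
  op-atomic sub r x y s r< x< y< S = sub-atomic r x y s r< x< y< S
  op-atomic mul r x y s r< x< y< S = reduced-atomic mul r x y s r< x< y< S mul-ok refl
  op-atomic quo r x y s r< x< y< S = reduced-atomic quo r x y s r< x< y< S quo-ok refl
  op-atomic rem r x y s r< x< y< S = reduced-atomic rem r x y s r< x< y< S rem-ok′ refl
  op-atomic lt r x y s r< x< y< S = reduced-atomic lt r x y s r< x< y< S lt-ok refl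

  record Checked (r : Reg) (s : State) : Set where
    field
      {end} : State
      {time} : ℕ
      exec : w ⊢ check r , s ⇓ end , time
      time≤ : time ≤ 5
      ok : Safe end
      fr : Frame s end
      outcome : (fuel s ≡ 0 × fuel end ≡ 0 × reg end guard ≡ 0) ⊎
                (fuel s ≡ suc (fuel end) × reg end guard ≡ reg s (40 + r))
      rel : ∀ {σ} → Related σ s → Related σ end

  check-ok : ∀ r s → r < R → Safe s → Checked r s
  check-ok r s r<R S = go (fuel s) refl
    where
    go : ∀ f → fuel s ≡ f → Checked r s
    go zero f≡ = record
      { exec = else′ f≡ const ; time≤ = s≤s (s≤s z≤n)
      ; ok = safe (M≡ S) (base≡ S) (fuel< S) (reg-M S) (mem-M S)
      ; fr = frame (λ x< _ → update-other (reg s) guard (<⇒≢ (m<n⇒m<1+n x<))) (λ _ → refl) ≤-refl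
      ; outcome = inj₁ (f≡ , f≡ , word-small w (m^n>0 2 w))
      ; rel = λ Rel → related (regs≡ Rel) (mem≡ Rel) }
    go (suc f) f≡ = record
      { exec = then′ (λ z → contradiction (trans (sym f≡) z) λ ()) (seq const (seq op (seq const op))) ; time≤ = ≤-refl
      ; ok = safe (M≡ S) (base≡ S) (subst (_< W) (sym dec) (<-trans (n<1+n f) (subst (_< W) f≡ (fuel< S)))) (reg-M S) (mem-M S)
      ; fr = frame (λ {x} x< x≢ → trans (update-other f₃ guard (<⇒≢ (m<n⇒m<1+n x<)))
                      (trans (update-other f₂ temp (<⇒≢ x<)) (trans (update-other f₁ rfuel x≢) (update-other (reg s) temp (<⇒≢ x<)))))
               (λ _ → refl) (≤-trans (≤-reflexive dec) (≤-trans (n≤1+n f) (≤-reflexive (sym f≡))))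
      ; outcome = inj₂ (trans f≡ (cong suc (sym dec)) , trans (cong (λ z → word w (reg s (40 + r) + z)) (word-small w (m^n>0 2 w)))
                                                       (trans (cong (word w) (+-identityʳ _)) (small (reg-M S r<R))))
      ; rel = λ Rel → related (regs≡ Rel) (mem≡ Rel) }
      where
      f₁ = reg s [ temp ↦ word w 1 ]
      f₂ = f₁ [ rfuel ↦ ⟦ sub ⟧ w (fuel s) (word w 1) ]
      f₃ = f₂ [ temp ↦ word w 0 ]
      dec : ⟦ sub ⟧ w (fuel s) (word w 1) ≡ f
      dec = trans (cong₂ (λ a b → word w (a + (W ∸ b))) f≡ (word-small w 1<W)) (minus-ok {suc f} {1} (s≤s z≤n) (subst (_< W) f≡ (fuel< S)))

  Halting : Cmd → Set
  Halting c = ∀ s → Safe s → Halts (simulate c) (factor c) s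

  atomic-halts : ∀ {c s e} → 3 ≤ factor c → Atomic c s e → Halts (simulate c) (factor c) s
  atomic-halts {c} {s} 3≤ A = halts exec ok fr
    (≤-trans (+-mono-≤ (≤-trans time≤ 3≤) (≤-reflexive (cong (factor c *_) fuel≡))) (≤-reflexive (sym (*-suc (factor c) (fuel s)))))
    where open Atomic A

  open ≤-Reasoning

  -- Each round passes `check`, so the bound k on the fuel decreases. In the estimate the potential
  -- after the body is added to both sides in order to avoid subtraction.
  while-halts : ∀ r c → r < R → Halting c → ∀ k s → fuel s ≤ k → Safe s →
    ∃ λ s′ → ∃ λ u → (w ⊢ while guard (simulate c ⨾ check r) , s ⇓ s′ , u) × Safe s′ × Frame s s′ ×
      u + (factor c + 14) * fuel s′ ≤ factor c + 8 + (factor c + 14) * fuel s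
  while-halts r c r<R H k s f≤k S with reg s guard ≟ 0
  ... | yes z = s , 1 , done z , S , frame (λ _ _ → refl) (λ _ → refl) ≤-refl , +-monoˡ-≤ _ (≤-trans (s≤s z≤n) (m≤n+m 8 (factor c)))
  ... | no nz with H s S
  ... | halts {s₁} {u₁} x₁ S₁ F₁ k₁ with check-ok r s₁ r<R S₁
  ... | record { end = s₂ ; time = u₂ ; exec = x₂ ; time≤ = t₂ ; ok = S₂ ; fr = F₂ ; outcome = inj₁ (f₁≡0 , f₂≡0 , g≡0) } =
    s₂ , _ , loop nz (seq x₁ x₂) (done g≡0) , S₂ , frame-trans F₁ F₂ , bound
    where
    K = factor c
    bound : suc (u₁ + u₂ + 1) + (K + 14) * fuel s₂ ≤ K + 8 + (K + 14) * fuel s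
    bound = begin
      suc (u₁ + u₂ + 1) + (K + 14) * fuel s₂ ≡⟨ cong (λ z → suc (u₁ + u₂ + 1) + (K + 14) * z) f₂≡0 ⟩
      suc (u₁ + u₂ + 1) + (K + 14) * 0       ≤⟨ +-monoˡ-≤ _ (s≤s (+-monoˡ-≤ 1 (+-mono-≤ (≤-trans (m≤m+n u₁ _) k₁) t₂))) ⟩
      suc (K * suc (fuel s) + 5 + 1) + (K + 14) * 0 ≡⟨ solve 2 (λ K f → con 1 :+ (K :* (con 1 :+ f) :+ con 5 :+ con 1) :+ (K :+ con 14) :* con 0 := K :+ con 7 :+ K :* f) refl K (fuel s) ⟩
      K + 7 + K * fuel s                     ≤⟨ +-mono-≤ (+-monoʳ-≤ K (n≤1+n 7)) (*-monoˡ-≤ (fuel s) (m≤m+n K 14)) ⟩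
      K + 8 + (K + 14) * fuel s              ∎
  ... | record { end = s₂ ; time = u₂ ; exec = x₂ ; time≤ = t₂ ; ok = S₂ ; fr = F₂ ; outcome = inj₂ (f₁≡ , _) } with k
  ... | zero = contradiction (≤-trans (≤-trans (≤-reflexive (sym f₁≡)) (burnt F₁)) f≤k) λ ()
  ... | suc k′ with while-halts r c r<R H k′ s₂ (≤-pred (≤-trans (≤-trans (≤-reflexive (sym f₁≡)) (burnt F₁)) f≤k)) S₂
  ... | s₃ , u₃ , x₃ , S₃ , F₃ , k₃ =
    s₃ , _ , loop nz (seq x₁ x₂) x₃ , S₃ , frame-trans (frame-trans F₁ F₂) F₃ , bound
    where
    K = factor c
    f₀ = fuel s
    f₁ = fuel s₁
    f₂ = fuel s₂
    bound : suc (u₁ + u₂ + u₃) + (K + 14) * fuel s₃ ≤ K + 8 + (K + 14) * f₀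
    bound = +-cancelʳ-≤ (K * f₁) _ _ (begin
      suc (u₁ + u₂ + u₃) + (K + 14) * fuel s₃ + K * f₁
        ≡⟨ solve 5 (λ a b c d e → con 1 :+ (a :+ b :+ c) :+ d :+ e := (a :+ e) :+ (con 1 :+ b) :+ (c :+ d)) refl u₁ u₂ u₃ ((K + 14) * fuel s₃) (K * f₁) ⟩
      (u₁ + K * f₁) + suc u₂ + (u₃ + (K + 14) * fuel s₃)
        ≤⟨ +-mono-≤ (+-mono-≤ k₁ (s≤s t₂)) k₃ ⟩
      K * suc f₀ + 6 + (K + 8 + (K + 14) * f₂)
        ≡⟨ solve 3 (λ K f g → K :* (con 1 :+ f) :+ con 6 :+ (K :+ con 8 :+ (K :+ con 14) :* g) := K :+ K :* f :+ (K :+ con 14) :* (con 1 :+ g)) refl K f₀ f₂ ⟩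
      K + K * f₀ + (K + 14) * suc f₂
        ≡⟨ cong (λ z → K + K * f₀ + (K + 14) * z) (sym f₁≡) ⟩
      K + K * f₀ + (K + 14) * f₁
        ≡⟨ solve 3 (λ K f g → K :+ K :* f :+ (K :+ con 14) :* g := K :+ (K :* f :+ con 14 :* g) :+ K :* g) refl K f₀ f₁ ⟩
      K + (K * f₀ + 14 * f₁) + K * f₁
        ≤⟨ +-monoˡ-≤ (K * f₁) (+-mono-≤ (m≤m+n K 8) (+-monoʳ-≤ (K * f₀) (*-monoʳ-≤ 14 (burnt F₁)))) ⟩
      K + 8 + (K * f₀ + 14 * f₀) + K * f₁
        ≡⟨ cong (λ z → K + 8 + z + K * f₁) (*-distribʳ-+ f₀ K 14) ⟨
      K + 8 + (K + 14) * f₀ + K * f₁ ∎)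

  simulate-halts : ∀ c → Within R c → Halting c
  simulate-halts skip _ s S = halts skip S (frame (λ _ _ → refl) (λ _ → refl) ≤-refl) (≤-trans (+-monoˡ-≤ (3 * fuel s) (s≤s (z≤n {2}))) (≤-reflexive (sym (*-suc 3 (fuel s)))))
  simulate-halts (const r k) r< s S = atomic-halts {const r k} ≤-refl (const-atomic r k s r< S)
  simulate-halts (op o r x y) (r< , x< , y<) s S = atomic-halts {op o r x y} ≤-refl (op-atomic o r x y s r< x< y< S)
  simulate-halts (load r x) (r< , x<) s S = atomic-halts {load r x} ≤-refl (load-atomic r x s r< x< S)
  simulate-halts (store x y) (x< , y<) s S = atomic-halts {store x y} ≤-refl (store-atomic x y s x< y< S)
  simulate-halts (c ⨾ d) (wc , wd) s S with simulate-halts c wc s S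
  ... | halts {s₁} {u₁} x₁ S₁ F₁ k₁ with simulate-halts d wd s₁ S₁
  ... | halts {s₂} {u₂} x₂ S₂ F₂ k₂ = halts (seq x₁ x₂) S₂ (frame-trans F₁ F₂)
    (+-cancelʳ-≤ (K * fuel s₁) _ _ (begin
      u₁ + u₂ + (K + L) * fuel s₂ + K * fuel s₁
        ≡⟨ solve 6 (λ u v K L f g → u :+ v :+ (K :+ L) :* g :+ K :* f := (u :+ K :* f) :+ (v :+ L :* g) :+ K :* g) refl u₁ u₂ K L (fuel s₁) (fuel s₂) ⟩
      (u₁ + K * fuel s₁) + (u₂ + L * fuel s₂) + K * fuel s₂
        ≤⟨ +-mono-≤ (+-mono-≤ k₁ (≤-trans k₂ (*-monoʳ-≤ L (s≤s (burnt F₁))))) (*-monoʳ-≤ K (burnt F₂)) ⟩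
      K * suc (fuel s) + L * suc (fuel s) + K * fuel s₁
        ≡⟨ cong (_+ K * fuel s₁) (*-distribʳ-+ (suc (fuel s)) K L) ⟨
      (K + L) * suc (fuel s) + K * fuel s₁ ∎))
    where
    K = factor c
    L = factor d
  simulate-halts (ifnz r c d) (r< , wc , wd) s S with reg s (40 + r) ≟ 0
  ... | no nz with simulate-halts c wc s S
  ... | halts {s₁} {u₁} x S₁ F k = halts (then′ nz x) S₁ F (begin
      suc u₁ + (1 + (K + L)) * fuel s₁
        ≡⟨ solve 4 (λ u K L f → con 1 :+ u :+ (con 1 :+ (K :+ L)) :* f := (u :+ K :* f) :+ (con 1 :+ (con 1 :+ L) :* f)) refl u₁ K L (fuel s₁) ⟩
      (u₁ + K * fuel s₁) + (1 + (1 + L) * fuel s₁)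
        ≤⟨ +-mono-≤ k (≤-trans (+-mono-≤ (s≤s (z≤n {L})) (*-monoʳ-≤ (1 + L) (burnt F))) (≤-reflexive (sym (*-suc (1 + L) (fuel s))))) ⟩
      K * suc (fuel s) + (1 + L) * suc (fuel s)
        ≡⟨ solve 3 (λ K L f → K :* f :+ (con 1 :+ L) :* f := (con 1 :+ (K :+ L)) :* f) refl K L (suc (fuel s)) ⟩
      (1 + (K + L)) * suc (fuel s) ∎)
    where
    K = factor c
    L = factor d
  simulate-halts (ifnz r c d) (r< , wc , wd) s S | yes z with simulate-halts d wd s S
  ... | halts {s₁} {u₁} x S₁ F k = halts (else′ z x) S₁ F (begin
      suc u₁ + (1 + (K + L)) * fuel s₁
        ≡⟨ solve 4 (λ u K L f → con 1 :+ u :+ (con 1 :+ (K :+ L)) :* f := (u :+ L :* f) :+ (con 1 :+ (con 1 :+ K) :* f)) refl u₁ K L (fuel s₁) ⟩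
      (u₁ + L * fuel s₁) + (1 + (1 + K) * fuel s₁)
        ≤⟨ +-mono-≤ k (≤-trans (+-mono-≤ (s≤s (z≤n {K})) (*-monoʳ-≤ (1 + K) (burnt F))) (≤-reflexive (sym (*-suc (1 + K) (fuel s))))) ⟩
      L * suc (fuel s) + (1 + K) * suc (fuel s)
        ≡⟨ solve 3 (λ K L f → L :* f :+ (con 1 :+ K) :* f := (con 1 :+ (K :+ L)) :* f) refl K L (suc (fuel s)) ⟩
      (1 + (K + L)) * suc (fuel s) ∎)
    where
    K = factor c
    L = factor d
  simulate-halts (while r c) (r< , wc) s S with check-ok r s r< S
  ... | record { end = s₁ ; time = u₁ ; exec = x₁ ; time≤ = t₁ ; ok = S₁ ; fr = F₁ ; outcome = out }
    with while-halts r c r< (simulate-halts c wc) (fuel s₁) s₁ ≤-refl S₁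
  ... | s₂ , u₂ , x₂ , S₂ , F₂ , k₂ = halts (seq x₁ x₂) S₂ (frame-trans F₁ F₂) (begin
      u₁ + u₂ + K * fuel s₂      ≡⟨ +-assoc u₁ u₂ _ ⟩
      u₁ + (u₂ + K * fuel s₂)    ≤⟨ +-mono-≤ t₁ k₂ ⟩
      5 + (factor c + 8 + K * fuel s₁) ≡⟨ solve 2 (λ F x → con 5 :+ (F :+ con 8 :+ x) := F :+ con 13 :+ x) refl (factor c) (K * fuel s₁) ⟩
      factor c + 13 + K * fuel s₁ ≤⟨ +-mono-≤ (+-monoʳ-≤ (factor c) (n≤1+n 13)) (*-monoʳ-≤ K (burnt F₁)) ⟩
      K + K * fuel s             ≡⟨ *-suc K (fuel s) ⟨
      K * suc (fuel s)           ∎)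
    where K = factor c + 14

  -- Every burnt unit of fuel is charged to a step of the original run. An exhausted simulation
  -- therefore proves that this run takes at least as many steps as there was fuel.
  data Outcome (σ′ : State) (t : ℕ) (s s′ : State) : Set where
    aborted : fuel s′ ≡ 0 → fuel s ≤ t → Outcome σ′ t s s′
    finished : Related σ′ s′ → fuel s ≤ fuel s′ + t → Outcome σ′ t s s′

  private
    safe-after : ∀ c {s s′ u} → Within R c → Safe s → w ⊢ simulate c , s ⇓ s′ , u → Safe s′ × Frame s s′
    safe-after c {s} W S x with simulate-halts c W s S
    ... | halts y S′ F _ with deterministic x y
    ... | refl , refl = S′ , F

    exhausted : ∀ c {s s′ u t} → Within R c → Safe s → w ⊢ simulate c , s ⇓ s′ , u → fuel s ≡ 0 → ∀ {σ′} →
                Outcome σ′ t s s′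
    exhausted c W S x f≡ = aborted (n≤0⇒n≡0 (≤-trans (burnt (proj₂ (safe-after c W S x))) (≤-reflexive f≡))) (≤-trans (≤-reflexive f≡) z≤n)

    atomic-outcome : ∀ {c s s′ u e σ t} → Atomic c s e → Related σ s → w ⊢ simulate c , s ⇓ s′ , u →
                     Outcome (e σ) t s s′
    atomic-outcome A Rel x with deterministic x (Atomic.exec A)
    ... | refl , refl = finished (Atomic.rel A Rel) (≤-trans (≤-reflexive (sym (Atomic.fuel≡ A))) (m≤m+n _ _))

    after : ∀ {σ₁ σ₂ t₁ t₂ s₀ s₁ s₂} → fuel s₂ ≤ fuel s₁ → Outcome σ₁ t₁ s₀ s₁ → (Related σ₁ s₁ → Outcome σ₂ t₂ s₁ s₂) →
            Outcome σ₂ (t₁ + t₂) s₀ s₂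
    after f≤ (aborted f≡ t≤) _ = aborted (n≤0⇒n≡0 (≤-trans f≤ (≤-reflexive f≡))) (≤-trans t≤ (m≤m+n _ _))
    after {t₁ = t₁} {t₂} {s₁ = s₁} {s₂} f≤ (finished Rel t≤) k with k Rel
    ... | aborted f≡ t≤′ = aborted f≡ (≤-trans t≤ (≤-trans (+-monoˡ-≤ t₁ t≤′) (≤-reflexive (+-comm t₂ t₁))))
    ... | finished Rel′ t≤′ = finished Rel′ (≤-trans t≤ (≤-trans (+-monoˡ-≤ t₁ t≤′) (≤-reflexive (trans (+-assoc (fuel s₂) t₂ t₁) (cong (fuel s₂ +_) (+-comm t₂ t₁))))))

    later : ∀ {σ t s s′} → Outcome σ t s s′ → Outcome σ (suc t) s s′
    later (aborted f≡ t≤) = aborted f≡ (m≤n⇒m≤1+n t≤)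
    later {t = t} {s′ = s′} (finished Rel t≤) = finished Rel (≤-trans t≤ (+-monoʳ-≤ (fuel s′) (n≤1+n t)))

  simulate-ok : ∀ {c σ σ′ t s s′ u} → Within R c → Safe s → Related σ s →
    w′ ⊢ c , σ ⇓ σ′ , t → w ⊢ simulate c , s ⇓ s′ , u → Outcome σ′ t s s′
  simulate-ok W S Rel skip skip = finished Rel (m≤m+n _ _)
  simulate-ok W S Rel (const {r} {k}) x = atomic-outcome (const-atomic r k _ W S) Rel x
  simulate-ok (r< , x< , y<) S Rel (op {o} {r} {x} {y}) d = atomic-outcome (op-atomic o r x y _ r< x< y< S) Rel d
  simulate-ok (r< , x<) S Rel (load {r} {x}) d = atomic-outcome (load-atomic r x _ r< x< S) Rel d
  simulate-ok (x< , y<) S Rel (store {x} {y}) d = atomic-outcome (store-atomic x y _ x< y< S) Rel d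
  simulate-ok {c ⨾ d} (wc , wd) S Rel (seq x y) (seq x′ y′) with safe-after c wc S x′
  ... | S₁ , _ = after (burnt (proj₂ (safe-after d wd S₁ y′))) (simulate-ok wc S Rel x x′) (λ Rel₁ → simulate-ok wd S₁ Rel₁ y y′)
  simulate-ok {ifnz r c d} (r< , wc , wd) S Rel (then′ nz x) (then′ _ x′) = later (simulate-ok wc S Rel x x′)
  simulate-ok {ifnz r c d} (r< , wc , wd) S Rel (then′ nz x) (else′ z _) = contradiction (trans (sym (regs≡ Rel r<)) z) nz
  simulate-ok {ifnz r c d} (r< , wc , wd) S Rel (else′ z x) (then′ nz _) = contradiction (trans (regs≡ Rel r<) z) nz
  simulate-ok {ifnz r c d} (r< , wc , wd) S Rel (else′ z x) (else′ _ x′) = later (simulate-ok wd S Rel x x′)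
  simulate-ok {while r c} {s = s} W@(r< , wc) S Rel d (seq x′ y′) with check-ok r s r< S
  ... | C with deterministic x′ (Checked.exec C)
  ... | refl , refl with Checked.outcome C
  ... | inj₁ (f≡ , _) = exhausted (while r c) W S (seq x′ y′) f≡
  simulate-ok {while r c} W@(r< , wc) S Rel (done z) (seq x′ (done _)) | C | refl , refl | inj₂ (f≡ , g≡) =
    finished (Checked.rel C Rel) (≤-reflexive (trans f≡ (+-comm 1 _)))
  simulate-ok {while r c} W@(r< , wc) S Rel (done z) (seq x′ (loop nz _ _)) | C | refl , refl | inj₂ (f≡ , g≡) =
    contradiction (trans g≡ (trans (regs≡ Rel r<) z)) nz
  simulate-ok {while r c} W@(r< , wc) S Rel (loop nz x y) (seq x′ (done z)) | C | refl , refl | inj₂ (f≡ , g≡) =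
    contradiction (trans (sym (trans g≡ (regs≡ Rel r<))) z) nz
  -- The closing `check` and the remaining rounds again form the simulation of the same loop, so the
  -- induction applies to the rest `y` of the original run.
  simulate-ok {while r c} W@(r< , wc) S Rel (loop nz x y) (seq x′ (loop _ (seq y′ z′) q′)) | C | refl , refl | inj₂ (f≡ , g≡)
    with safe-after c wc (Checked.ok C) y′
  ... | S₁ , F₁ with after (burnt (proj₂ (safe-after (while r c) W S₁ (seq z′ q′)))) (simulate-ok wc (Checked.ok C) (Checked.rel C Rel) x y′)
                     (λ Rel₁ → simulate-ok {while r c} W S₁ Rel₁ y (seq z′ q′))
  ... | aborted f₀ t≤ = aborted f₀ (≤-trans (≤-reflexive f≡) (s≤s t≤))
  ... | finished Rel′ t≤ = finished Rel′ (≤-trans (≤-reflexive f≡) (≤-trans (s≤s t≤) (≤-reflexive (sym (+-suc _ _)))))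

-- Calling the multiplication algorithm

zeros : ℕ → Cmd
zeros zero = skip
zeros (suc r) = zeros r ⨾ const (40 + r) 0

-- The registers may hold remains of an earlier call, whereas the memory region is fresh and needs
-- no clearing. Register 40 is register 0 of the simulated program, where the dimension is expected.
callCode : Cmd → Cmd
callCode c = zeros (suc (registers c)) ⨾ const temp 0 ⨾ op add 40 rN temp ⨾ simulate c

zeros-ok : ∀ w R s → ∃ λ s′ → (w ⊢ zeros R , s ⇓ s′ , suc R) × (∀ {r} → r < R → reg s′ (40 + r) ≡ 0) ×
           (∀ {x} → x < 40 → reg s′ x ≡ reg s x) × mem s′ ≡ mem s
zeros-ok w zero s = s , skip , (λ ()) , (λ _ → refl) , refl
zeros-ok w (suc R) s with zeros-ok w R s
... | s′ , x , z , k , m = ⟨ reg s′ [ 40 + R ↦ word w 0 ] ∣ mem s′ ⟩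
  , subst (λ t → w ⊢ zeros (suc R) , s ⇓ ⟨ reg s′ [ 40 + R ↦ word w 0 ] ∣ mem s′ ⟩ , t) (+-comm (suc R) 1) (seq x const)
  , (λ {r} r< → update-last r<)
  , (λ {y} y< → trans (update-other (reg s′) (40 + R) {word w 0} (<⇒≢ (<-≤-trans y< (m≤m+n 40 R)))) (k y<)) , m
  where
  update-last : ∀ {r} → r < suc R → (reg s′ [ 40 + R ↦ word w 0 ]) (40 + r) ≡ 0
  update-last {r} r< with r ≟ R
  ... | yes refl = trans (update-same (reg s′) (40 + R) refl) (word-small w (m^n>0 2 w))
  ... | no r≢R = trans (update-other (reg s′) (40 + R) (λ e → r≢R (+-cancelˡ-≡ 40 r R e))) (z (≤∧≢⇒< (≤-pred r<) r≢R))

module Calling (mc : Machine) (code′ : Cmd) (w′ : ℕ) (w′≤w : w′ ≤ Machine.w mc)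
  (M*M≤W : 2 ^ w′ * 2 ^ w′ ≤ 2 ^ Machine.w mc) (M+M≤W : 2 ^ w′ + 2 ^ w′ ≤ 2 ^ Machine.w mc)
  (M≤β : 2 ^ w′ ≤ Machine.β mc) (κ≥ : registers code′ + factor code′ + 10 ≤ Machine.κ mc) where

  open Machine mc
  open Logic mc

  private
    M W : ℕ
    M = 2 ^ w′
    W = 2 ^ w

  -- That the call halts, and its cost, follow from the fuel alone. The run of the algorithm on its
  -- own machine only serves to interpret the outcome: without fuel left, that run is at least as
  -- long as the limit; otherwise the region holds its final memory.
  call-ok : ∀ (vs : Vars) {μ} {n} (A B : Matrix n) → vs rM ≡ M → vs rN ≡ n → n < M → vs rbase + M ≤ W →
    (∀ {a} → a < M → μ (vs rbase + a) ≡ mem (matMulInput w′ A B) a) →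
    ∀ {σ t} → w′ ⊢ code′ , matMulInput w′ A B ⇓ σ , t →
    Run (call (callCode code′)) vs μ (λ vs′ μ′ T → T ≤ suc (vs rfuel) × Below (vs rbase) μ μ′ × Above (vs rbase + M) μ μ′ ×
      ∃ λ f → vs′ ≡ vs [ rfuel ≔ f ] × (f ≡ 0 → vs rfuel ≤ t) ×
        (f ≢ 0 → ∀ a → a < M → μ′ (vs rbase + a) ≡ mem σ a))
  from (call-ok vs {_} {n} A B M≡ n≡ n<M fits input {σ} {t} deriv) s Bd ag refl with zeros-ok w (suc (registers code′)) s
  ... | s₁ , x₁ , z₁ , k₁ , refl = final (simulate-halts code′ wc s₂ safe₂)
    where
    base = vs rbase
    R = suc (registers code′)
    open Simulation w w′ R base w′≤w M*M≤W M+M≤W fits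
    open Bnd
    wc : Within R code′
    wc = within-mono (n≤1+n _) code′ (within-registers code′)
    s₂ : State
    s₂ = ⟨ (reg s₁ [ temp ↦ word w 0 ]) [ 40 ↦ ⟦ add ⟧ w (reg s₁ rN) (word w 0) ] ∣ mem s₁ ⟩
    old : ∀ {x} → x < temp → reg s₂ x ≡ vs x
    old {x} x< = trans (update-other (reg s₁ [ temp ↦ word w 0 ]) 40 (<⇒≢ (<-trans x< (≤ᵇ⇒≤ 23 40 tt))))
      (trans (update-other (reg s₁) temp (<⇒≢ x<)) (trans (k₁ (<-trans x< (≤ᵇ⇒≤ 23 40 tt))) (ag x<)))
    M≤W : M ≤ W
    M≤W = ≤-trans (m≤m+n M M) M+M≤W
    first : ⟦ add ⟧ w (reg s₁ rN) (word w 0) ≡ word w′ n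
    first = trans (cong₂ (λ x y → word w (x + y)) (trans (k₁ (≤ᵇ⇒≤ 7 40 tt)) (trans (ag (≤ᵇ⇒≤ 7 22 tt)) n≡)) (word-small w (m^n>0 2 w)))
      (trans (cong (word w) (+-identityʳ n)) (trans (word-small w (<-≤-trans n<M M≤W)) (sym (word-small w′ n<M))))
    regs₂ : ∀ {r} → r < R → reg s₂ (40 + r) ≡ reg (matMulInput w′ A B) r
    regs₂ {zero} r<R = first
    regs₂ {suc r} r<R = trans (z₁ r<R) (sym (word-small w′ (m^n>0 2 w′)))
    safe₂ : Safe s₂
    safe₂ = safe (trans (old (≤ᵇ⇒≤ 4 22 tt)) M≡) (old (≤ᵇ⇒≤ 11 22 tt))
      (subst (_< W) (sym (trans (old (≤ᵇ⇒≤ 12 22 tt)) (sym (ag (≤ᵇ⇒≤ 12 22 tt))))) (<β⇒<W {k = 1} (subst (reg s rfuel <_) (sym (^-identityʳ β)) (regs Bd (≤ᵇ⇒≤ 12 22 tt))) (s≤s z≤n)))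
      (λ {r} r<R → subst (_< M) (sym (regs₂ r<R)) (word-< w′ (nth (n ∷ []) r)))
      (λ {a} a<M → subst (_< M) (sym (input a<M)) (word-< w′ _))
    rel₂ : Related (matMulInput w′ A B) s₂
    rel₂ = related regs₂ input
    fuel₂ : fuel s₂ ≡ vs rfuel
    fuel₂ = old (≤ᵇ⇒≤ 12 22 tt)
    final : Halts (simulate code′) (factor code′) s₂ → Ends (call (callCode code′)) s _
    final (halts {s₃} {u} x₃ S₃ F₃ cost₃) =
      ends {units = suc (vs rfuel)} (seq x₁ (seq const (seq op x₃))) bound
        (bnd (λ {r} r< → reg-bound r< (r ≟ rfuel)) (λ a → cell-bound a))
        (λ {r} r< → agree r< (r ≟ rfuel))
        (≤-refl , below (λ a< → away (inj₁ a<)) , above (λ a≥ → away (inj₂ a≥)) , fuel s₃ , refl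
         , (λ f≡ → aborted-case f≡ outcome′) , (λ f≢ → finished-case f≢ outcome′))
      where
      open Frame F₃
      outcome′ = simulate-ok wc safe₂ rel₂ deriv x₃
      aborted-case : fuel s₃ ≡ 0 → Outcome σ t s₂ s₃ → vs rfuel ≤ t
      aborted-case f≡ (aborted _ t≤) = subst (_≤ t) fuel₂ t≤
      -- A simulation that finishes on its last unit of fuel counts as aborted, too.
      aborted-case f≡ (finished _ t≤) = subst (_≤ t) fuel₂ (≤-trans t≤ (≤-reflexive (cong (_+ t) f≡)))
      finished-case : fuel s₃ ≢ 0 → Outcome σ t s₂ s₃ → ∀ a → a < M → mem s₃ (base + a) ≡ mem σ a
      finished-case f≢ (aborted f≡ _) = contradiction f≡ f≢
      finished-case f≢ (finished Rel _) a a<M = Related.mem≡ Rel a<M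
      agree : ∀ {r} → r < temp → Dec (r ≡ rfuel) → reg s₃ r ≡ (vs [ rfuel ≔ fuel s₃ ]) r
      agree r< (yes refl) = refl
      agree {r} r< (no r≢) = trans (kept r< r≢) (trans (old r<) (sym (update-other vs rfuel r≢)))
      reg-bound : ∀ {r} → r < temp → Dec (r ≡ rfuel) → reg s₃ r < β
      reg-bound r< (yes refl) = ≤-<-trans burnt (subst (_< β) (sym (trans fuel₂ (sym (ag r<)))) (regs Bd r<))
      reg-bound r< (no r≢) = subst (_< β) (sym (trans (kept r< r≢) (trans (old r<) (sym (ag r<))))) (regs Bd r<)
      cell-bound : ∀ a → mem s₃ a < β
      cell-bound a with a <? base
      ... | yes a< = subst (_< β) (sym (away (inj₁ a<))) (cells Bd a)
      ... | no a≮ with base + M ≤? a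
      ... | yes a≥ = subst (_< β) (sym (away (inj₂ a≥))) (cells Bd a)
      ... | no a≱ = subst (λ x → mem s₃ x < β) (m+[n∸m]≡n (≮⇒≥ a≮))
          (<-≤-trans (Safe.mem-M S₃ (+-cancelˡ-< base _ _ (subst (_< base + M) (sym (m+[n∸m]≡n (≮⇒≥ a≮))) (≰⇒> a≱)))) M≤β)
      open ≤-Reasoning
      u≤ : u ≤ factor code′ * suc (vs rfuel)
      u≤ = ≤-trans (m≤m+n u _) (subst (λ z → u + factor code′ * fuel s₃ ≤ factor code′ * suc z) fuel₂ cost₃)
      bound : suc R + (1 + (1 + u)) ≤ κ * suc (vs rfuel)
      bound = begin
        suc R + (1 + (1 + u))  ≡⟨ solve 2 (λ R u → con 1 :+ (con 1 :+ R) :+ (con 1 :+ (con 1 :+ u)) := (R :+ con 4) :+ u) refl (registers code′) u ⟩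
        (registers code′ + 4) + u ≤⟨ +-mono-≤ (≤-trans (+-monoʳ-≤ (registers code′) (≤ᵇ⇒≤ 4 10 tt)) (m≤m*n (registers code′ + 10) (suc (vs rfuel)))) u≤ ⟩
        (registers code′ + 10) * suc (vs rfuel) + factor code′ * suc (vs rfuel)
          ≡⟨ solve 3 (λ r f x → (r :+ con 10) :* x :+ f :* x := (r :+ f :+ con 10) :* x) refl (registers code′) (factor code′) (suc (vs rfuel)) ⟩
        (registers code′ + factor code′ + 10) * suc (vs rfuel) ≤⟨ *-monoˡ-≤ (suc (vs rfuel)) κ≥ ⟩
        κ * suc (vs rfuel)     ∎

-- Matrices in memory

nth-++ˡ : ∀ xs ys {i} → i < length xs → nth (xs ++ ys) i ≡ nth xs i
nth-++ˡ (x ∷ xs) ys {zero} _ = refl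
nth-++ˡ (x ∷ xs) ys {suc i} (s≤s i<) = nth-++ˡ xs ys i<

nth-++ʳ : ∀ xs ys i → nth (xs ++ ys) (length xs + i) ≡ nth ys i
nth-++ʳ [] ys i = refl
nth-++ʳ (x ∷ xs) ys i = nth-++ʳ xs ys i

nth-beyond : ∀ xs {i} → length xs ≤ i → nth xs i ≡ 0
nth-beyond [] _ = refl
nth-beyond (x ∷ xs) {suc i} (s≤s i≥) = nth-beyond xs i≥

nth-tabulate : ∀ {n} (f : Fin n → ℕ) i → nth (tabulate f) (toℕ i) ≡ f i
nth-tabulate f zero = refl
nth-tabulate f (suc i) = nth-tabulate (f ∘ suc) i

rows : ∀ k n → (Fin k → Fin n → ℕ) → List ℕ
rows k n f = concatMap (λ i → List.map (f i) (allFin n)) (allFin k)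

rows-suc : ∀ k n (f : Fin (suc k) → Fin n → ℕ) → rows (suc k) n f ≡ tabulate (f zero) ++ rows k n (f ∘ suc)
rows-suc k n f = cong₂ _++_ (map-tabulate (λ z → z) (f zero))
  (cong List.concat (trans (map-tabulate suc (λ i → List.map (f i) (allFin n)))
    (sym (map-tabulate (λ z → z) (λ i → List.map (f (suc i)) (allFin n))))))

length-rows : ∀ k n f → length (rows k n f) ≡ k * n
length-rows zero n f = refl
length-rows (suc k) n f = trans (cong length (rows-suc k n f))
  (trans (length-++ (tabulate (f zero))) (cong₂ _+_ (length-tabulate (f zero)) (length-rows k n (f ∘ suc))))

nth-rows : ∀ k n f i (j : Fin n) → nth (rows k n f) (toℕ i * n + toℕ j) ≡ f i j
nth-rows (suc k) n f zero j = trans (cong (λ xs → nth xs (toℕ j)) (rows-suc k n f))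
  (trans (nth-++ˡ (tabulate (f zero)) (rows k n (f ∘ suc)) (subst (toℕ j <_) (sym (length-tabulate (f zero))) (toℕ<n j)))
    (nth-tabulate (f zero) j))
nth-rows (suc k) n f (suc i) j = trans (cong₂ nth (rows-suc k n f) (+-assoc n (toℕ i * n) (toℕ j)))
  (trans (cong (λ z → nth (tabulate (f zero) ++ rows k n (f ∘ suc)) (z + (toℕ i * n + toℕ j))) (sym (length-tabulate (f zero))))
    (trans (nth-++ʳ (tabulate (f zero)) (rows k n (f ∘ suc)) (toℕ i * n + toℕ j)) (nth-rows k n (f ∘ suc) i j)))

wordℤ-+ : ∀ w {x} → x < 2 ^ w → wordℤ w (ℤ.+ x) ≡ x
wordℤ-+ w = word-small w

matrix-of : ∀ n → (ℕ → ℕ → ℕ) → Matrix n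
matrix-of n f i j = ℤ.+ f (toℕ i) (toℕ j)

module _ (w n : ℕ) (f g : ℕ → ℕ → ℕ) (f< : ∀ i j → f i j < 2 ^ w) (g< : ∀ i j → g i j < 2 ^ w) (μ : ℕ → ℕ) (base M : ℕ)
  (left≡ : ∀ r s → r < n → s < n → μ (base + r * n + s) ≡ f r s)
  (right≡ : ∀ r s → r < n → s < n → μ (base + n * n + r * n + s) ≡ g r s)
  (rest≡ : ∀ a → n * n + n * n ≤ a → a < M → μ (base + a) ≡ 0) where

  private
    F G : List ℕ
    F = rowMajor w (matrix-of n f)
    G = rowMajor w (matrix-of n g)
    |F| : length F ≡ n * n
    |F| = length-rows n n (λ i j → wordℤ w (matrix-of n f i j))
    |G| : length G ≡ n * n
    |G| = length-rows n n (λ i j → wordℤ w (matrix-of n g i j))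

    entry : ∀ h → (∀ i j → h i j < 2 ^ w) → ∀ a → a < n * n → ∃ λ r → ∃ λ s → r < n × s < n × r * n + s ≡ a ×
            nth (rowMajor w (matrix-of n h)) a ≡ h r s
    entry h h< a a< = a ÷ n , a % n , r< , s< , a≡ ,
      trans (cong (nth (rowMajor w (matrix-of n h))) (trans (sym a≡) (cong₂ (λ x y → x * n + y) (sym (toℕ-fromℕ< r<)) (sym (toℕ-fromℕ< s<)))))
        (trans (nth-rows n n (λ i j → wordℤ w (matrix-of n h i j)) (fromℕ< r<) (fromℕ< s<))
          (trans (wordℤ-+ w (h< _ _)) (cong₂ h (toℕ-fromℕ< r<) (toℕ-fromℕ< s<))))
      where
      instance n≢0 = >-nonZero {n} (n≢0⇒n>0 λ { refl → contradiction a< λ () })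
      r< : a ÷ n < n
      r< = m<n*o⇒m/o<n a<
      s< : a % n < n
      s< = m%n<n a n
      a≡ : a ÷ n * n + a % n ≡ a
      a≡ = trans (+-comm (a ÷ n * n) (a % n)) (sym (m≡m%n+[m/n]*n a n))

  layout : ∀ {a} → a < M → μ (base + a) ≡ mem (matMulInput w (matrix-of n f) (matrix-of n g)) a
  layout {a} a<M with a <? n * n
  ... | yes a< = begin
    μ (base + a)   ≡⟨ cong μ (trans (cong (base +_) (sym (proj₁ (proj₂ (proj₂ (proj₂ (proj₂ e))))))) (sym (+-assoc base (r * n) s))) ⟩
    μ (base + r * n + s) ≡⟨ left≡ r s (proj₁ (proj₂ (proj₂ e))) (proj₁ (proj₂ (proj₂ (proj₂ e)))) ⟩
    f r s          ≡⟨ word-small w (f< r s) ⟨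
    word w (f r s) ≡⟨ cong (word w) (trans (nth-++ˡ F G (subst (a <_) (sym |F|) a<)) (proj₂ (proj₂ (proj₂ (proj₂ (proj₂ e)))))) ⟨
    word w (nth (F ++ G) a) ∎
    where
    open ≡-Reasoning
    e = entry f f< a a<
    r = proj₁ e
    s = proj₁ (proj₂ e)
  ... | no a≮ with n * n + n * n ≤? a
  ... | yes a≥ = trans (rest≡ a a≥ a<M) (sym (trans (cong (word w) (nth-beyond (F ++ G)
        (subst (_≤ a) (sym (trans (length-++ F) (cong₂ _+_ |F| |G|))) a≥))) (word-small w (m^n>0 2 w))))
  ... | no a≱ = begin
    μ (base + a)   ≡⟨ cong (λ z → μ (base + z)) (sym a′≡) ⟩
    μ (base + (n * n + a′)) ≡⟨ cong μ (trans (cong (λ z → base + (n * n + z)) (sym (proj₁ (proj₂ (proj₂ (proj₂ (proj₂ e))))))) (solve 4 (λ b q x y → b :+ (q :+ (x :+ y)) := b :+ q :+ x :+ y) refl base (n * n) (r * n) s)) ⟩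
    μ (base + n * n + r * n + s) ≡⟨ right≡ r s (proj₁ (proj₂ (proj₂ e))) (proj₁ (proj₂ (proj₂ (proj₂ e)))) ⟩
    g r s          ≡⟨ word-small w (g< r s) ⟨
    word w (g r s) ≡⟨ cong (word w) (trans (cong (nth (F ++ G)) (trans (sym a′≡) (cong (_+ a′) (sym |F|)))) (trans (nth-++ʳ F G a′) (proj₂ (proj₂ (proj₂ (proj₂ (proj₂ e))))))) ⟨
    word w (nth (F ++ G) a) ∎
    where
    open ≡-Reasoning
    a′ = a ∸ n * n
    a′≡ : n * n + a′ ≡ a
    a′≡ = m+[n∸m]≡n (≮⇒≥ a≮)
    e = entry g g< a′ (+-cancelˡ-< (n * n) a′ (n * n) (subst (_< n * n + n * n) (sym a′≡) (≰⇒> a≱)))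
    r = proj₁ e
    s = proj₁ (proj₂ e)

sum-∑ : ∀ n f → sum {n} (λ k → ℤ.+ f (toℕ k)) ≡ ℤ.+ ∑ n f
sum-∑ zero f = refl
sum-∑ (suc n) f = trans (cong (ℤ._+_ (ℤ.+ f 0)) (sum-∑ n (f ∘ suc)))
  (trans (sym (ℤ.pos-+ (f 0) (∑ n (f ∘ suc)))) (cong ℤ.+_ (sym (∑-left n f))))

matrix-product : ∀ n f g i j → (matrix-of n f ⊗ matrix-of n g) i j ≡ ℤ.+ ∑ n (λ k → f (toℕ i) k * g k (toℕ j))
matrix-product n f g i j =
  trans (sum-cong-≗ {n} (λ k → sym (ℤ.pos-* (f (toℕ i) (toℕ k)) (g (toℕ k) (toℕ j)))))
    (sum-∑ n (λ k → f (toℕ i) k * g k (toℕ j)))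

∑-support : ∀ {h n} f → h ≤ n → (∀ {k} → h ≤ k → f k ≡ 0) → ∑ n f ≡ ∑ h f
∑-support {h} {zero} f z≤n z = refl
∑-support {h} {suc n} f h≤ z with m≤n⇒m<n∨m≡n h≤
... | inj₂ refl = refl
... | inj₁ h<1+n = trans (cong₂ _+_ (∑-support f (≤-pred h<1+n) z) (z (≤-pred h<1+n))) (+-identityʳ _)

-- The search for the threshold

-- A new `rid` provides a table and a matrix region that are still zero. If the limit is below N²,
-- handling matrices of this size would already exceed it, and the threshold is rejected without a
-- call. Without high vertices there is nothing to multiply.
process : Cmd → Stm
process code =
  (rid ≔ ` rid ⊕ # 1) ⨟ (rbase ≔ ` rid ⊛ ` rM) ⨟ outerPhase ⨟ lowPhase ⨟
  when (` rh)
    (when (` rF ≺ ` rN ⊛ ` rN) (rfail ≔ # 1)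
      (fillPhase ⨟ (rfuel ≔ ` rF) ⨟ call (callCode code) ⨟ when (` rfuel) highPhase (rfail ≔ # 1)))
    none

-- The values left in the working registers are of no interest; they are taken from an unspecified
-- store `j`.
scratch : Vars → Vars → Vars
scratch vs j = vs [ rbase ≔ j rbase ] [ rfuel ≔ j rfuel ] [ ru ≔ j ru ] [ ri ≔ j ri ] [ rk ≔ j rk ]
                  [ rp ≔ j rp ] [ rq ≔ j rq ] [ racc ≔ j racc ]

-- The only trace that a failure leaves about time. Either case will bound the limit F by a power of
-- the dimension N.
data Slow (P : Algorithm) (w′ N F : ℕ) : Set where
  too-large : F < N * N → Slow P w′ N F
  timeout : ∀ {A B : Matrix N} {σ t} → EntriesBounded A → EntriesBounded B →
            w′ ⊢ code P , matMulInput w′ A B ⇓ σ , t → F ≤ t → Slow P w′ N F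

-- The threshold Δ was too small for a graph with n vertices and m edges.
Stuck : Algorithm → ℕ → ℕ → ℕ → ℕ → Set
Stuck P n m w′ Δ = Δ ≤ m + m × FitsWords P (quotient (m + m) Δ) w′ × Slow P w′ (quotient (m + m) Δ) (Δ * (m + n))

highBodyList : Stm
highBodyList = when (` rΔ ≺ degree (` ru)) ((⟨ cell (# 4) (# 0) (` rh) ⟩≔ ` ru) ⨟ (rh ≔ ` rh ⊕ # 1)) none

-- The comparison says n ≤ 3 (deg v + 1), that is, N[v] contains a third of the vertices. After a
-- failure the remaining candidates are skipped.
vertexBody : Cmd → Stm
vertexBody code = when (` rfail) none (when (` rn ≺ # 3 ⊛ degree (` rv) ⊕ # 4) (process code) none)

-- The dimension is ⌊2m / Δ⌋ and not the number of high vertices: a dimension so small that the time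
-- bound of the multiplication does not yet apply then forces Δ to be of the order of m.
attempt : Cmd → Stm
attempt code =
  (rN ≔ (` rm ⊕ ` rm) ⊘ ` rΔ) ⨟ (rF ≔ ` rΔ ⊛ ` rS) ⨟ (rh ≔ # 0) ⨟ for ru (` rn) highBodyList ⨟
  (rfail ≔ # 0) ⨟ (rans ≔ # 0) ⨟ for rv (` rn) (vertexBody code)

attemptBody : Cmd → Stm
attemptBody code = when (` rfail) (attempt code ⨟ when (` rfail) (rΔ ≔ ` rΔ ⊕ ` rΔ) none) none

-- A failing threshold is at most 2m, so one of these rounds succeeds, and the later ones do
-- nothing. The numbering of scratch tables starts after 5, the last table with a fixed purpose.
attempts : Cmd → Stm
attempts code =
  (rfail ≔ # 1) ⨟ (rΔ ≔ # 1) ⨟ (rid ≔ # 5) ⨟ for re (` rm ⊕ ` rm ⊕ # 2) (attemptBody code)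

n<2^n : ∀ n → n < 2 ^ n
n<2^n zero = s≤s z≤n
n<2^n (suc n) = ≤-trans (+-mono-≤ (≤-trans (s≤s z≤n) (n<2^n n)) (n<2^n n)) (≤-reflexive (cong (2 ^ n +_) (sym (+-identityʳ (2 ^ n)))))

≢0-*ˡ : ∀ {x y} → x * y ≢ 0 → x ≢ 0
≢0-*ˡ nz refl = nz refl

≢0-*ʳ : ∀ {x y} → x * y ≢ 0 → y ≢ 0
≢0-*ʳ {x} nz refl = nz (*-zeroʳ x)

*-≢0 : ∀ {x y} → x ≢ 0 → y ≢ 0 → x * y ≢ 0
*-≢0 {x} x≢ y≢ e = [ x≢ , y≢ ]′ (m*n≡0⇒m≡0∨n≡0 x e)

∑-≢0 : ∀ n f {i} → i < n → f i ≢ 0 → ∑ n f ≢ 0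
∑-≢0 n f i<n fi≢ e = fi≢ (n≤0⇒n≡0 (≤-trans (∑-term n f i<n) (≤-reflexive e)))

-- Counting dominated vertices

module Dominating {n} (tables : Tables n) where

  open Tables tables

  record Triangle (v u w : ℕ) : Set where
    constructor triangle
    field
      v< : v < n
      u< : u < n
      w< : w < n
      vu : a v u ≡ 1
      vw : a v w ≡ 1
      uw : a u w ≡ 1
      dominates : ∀ {x} → x < n → x ≡ v ⊎ a v x ≡ 1 ⊎ a u x ≡ 1 ⊎ a w x ≡ 1

  rotate : ∀ {v u w} → Triangle v u w → Triangle u v w
  rotate {v} {u} {w} (triangle v< u< w< vu vw uw dom) = triangle u< v< w< (trans (symmetric u v) vu) uw vw λ x<n → turn (dom x<n)
    where
    turn : ∀ {x} → x ≡ v ⊎ a v x ≡ 1 ⊎ a u x ≡ 1 ⊎ a w x ≡ 1 → x ≡ u ⊎ a u x ≡ 1 ⊎ a v x ≡ 1 ⊎ a w x ≡ 1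
    turn (inj₁ refl) = inj₂ (inj₁ (trans (symmetric u v) vu))
    turn (inj₂ (inj₁ x)) = inj₂ (inj₂ (inj₁ x))
    turn (inj₂ (inj₂ (inj₁ x))) = inj₂ (inj₁ x)
    turn (inj₂ (inj₂ (inj₂ x))) = inj₂ (inj₂ (inj₂ x))

  swap-triangle : ∀ {v u w} → Triangle v u w → Triangle v w u
  swap-triangle {v} {u} {w} (triangle v< u< w< vu vw uw dom) = triangle v< w< u< vw vu (trans (symmetric w u) uw) λ x<n → turn (dom x<n)
    where
    turn : ∀ {x} → x ≡ v ⊎ a v x ≡ 1 ⊎ a u x ≡ 1 ⊎ a w x ≡ 1 → x ≡ v ⊎ a v x ≡ 1 ⊎ a w x ≡ 1 ⊎ a u x ≡ 1
    turn (inj₁ x) = inj₁ x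
    turn (inj₂ (inj₁ x)) = inj₂ (inj₁ x)
    turn (inj₂ (inj₂ (inj₁ x))) = inj₂ (inj₂ (inj₂ x))
    turn (inj₂ (inj₂ (inj₂ x))) = inj₂ (inj₂ (inj₁ x))

  shared : ℕ → ℕ → ℕ → ℕ
  shared v u w = ∑ n (λ x → a u x * (a w x * out v x))

  -- The number of vertices dominated by v, u and w is deg v + 1 plus the size of the
  -- union of the outer neighbourhoods of u and w.
  private
    dominated weight : ℕ → ℕ → ℕ → ℕ → ℕ
    dominated v u w x = (δ x v * 1 + a v x) + (a u x * out v x + a w x * out v x)
    weight v u w x = 1 + a u x * (a w x * out v x)

    data Position (v x : ℕ) : Set where
      centre : x ≡ v → a v x ≡ 0 → out v x ≡ 0 → δ x v ≡ 1 → Position v x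
      near   : a v x ≡ 1 → out v x ≡ 0 → δ x v ≡ 0 → Position v x
      far    : x ≢ v → a v x ≡ 0 → out v x ≡ 1 → δ x v ≡ 0 → Position v x

    position : ∀ v x → Position v x
    position v x with <-cmp v x
    position v .v | tri≈ _ refl _ = centre refl (irreflexive v) (trans (cong (_* [ a v v < 1 ]) (cong₂ _+_ ([<]-no {v} {v} ≤-refl) ([<]-no {v} {v} ≤-refl))) refl) (δ-same {v} refl)
    position v x | tri< v<x v≢x _ with ≤1 (a≤1 v x)
    ... | inj₁ z = far (v≢x ∘ sym) z (trans (cong (([ v < x ] + [ x < v ]) *_) (trans (cong [_< 1 ] z) refl)) (trans (*-identityʳ _) (cong₂ _+_ ([<]-yes v<x) ([<]-no (<⇒≤ v<x))))) (δ-other (v≢x ∘ sym))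
    ... | inj₂ o = near o (trans (cong (([ v < x ] + [ x < v ]) *_) (trans (cong [_< 1 ] o) refl)) (*-zeroʳ ([ v < x ] + [ x < v ]))) (δ-other (v≢x ∘ sym))
    position v x | tri> _ v≢x x<v with ≤1 (a≤1 v x)
    ... | inj₁ z = far (v≢x ∘ sym) z (trans (cong (([ v < x ] + [ x < v ]) *_) (trans (cong [_< 1 ] z) refl)) (trans (*-identityʳ _) (cong₂ _+_ ([<]-no (<⇒≤ x<v)) ([<]-yes x<v)))) (δ-other (v≢x ∘ sym))
    ... | inj₂ o = near o (trans (cong (([ v < x ] + [ x < v ]) *_) (trans (cong [_< 1 ] o) refl)) (*-zeroʳ ([ v < x ] + [ x < v ]))) (δ-other (v≢x ∘ sym))

    Dominated : ℕ → ℕ → ℕ → ℕ → Set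
    Dominated v u w x = x ≡ v ⊎ a v x ≡ 1 ⊎ a u x ≡ 1 ⊎ a w x ≡ 1

    closed : ∀ v u w x {d q o p r} → δ x v ≡ d → a v x ≡ q → out v x ≡ o → a u x ≡ p → a w x ≡ r →
             dominated v u w x ≡ (d * 1 + q) + (p * o + r * o) × weight v u w x ≡ 1 + p * (r * o)
    closed v u w x refl refl refl refl refl = refl , refl

    -- Inside N[v] both sides are 1. Outside, with bits p and r for adjacency to u and w, the
    -- inequality is p + r ≤ 1 + p r, which is strict only for p = r = 0.
    pointwise : ∀ v u w x → dominated v u w x ≤ weight v u w x ×
                (dominated v u w x ≡ weight v u w x → Dominated v u w x) × (Dominated v u w x → dominated v u w x ≡ weight v u w x)
    pointwise v u w x with position v x | ≤1 (a≤1 u x) | ≤1 (a≤1 w x)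
    ... | centre x≡v q o d | _ | _ with closed v u w x d q o refl refl
    ... | e₁ , e₂ rewrite e₁ | e₂ | *-zeroʳ (a u x) | *-zeroʳ (a w x) | *-zeroʳ (a u x) = ≤-refl , (λ _ → inj₁ x≡v) , λ _ → refl
    pointwise v u w x | near q o d | _ | _ with closed v u w x d q o refl refl
    ... | e₁ , e₂ rewrite e₁ | e₂ | *-zeroʳ (a u x) | *-zeroʳ (a w x) | *-zeroʳ (a u x) = ≤-refl , (λ _ → inj₂ (inj₁ q)) , λ _ → refl
    pointwise v u w x | far x≢ q o d | inj₁ p | inj₁ r with closed v u w x d q o p r
    ... | e₁ , e₂ rewrite e₁ | e₂ = z≤n , (λ ()) , λ
      { (inj₁ e) → contradiction e x≢
      ; (inj₂ (inj₁ e)) → contradiction (trans (sym q) e) λ ()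
      ; (inj₂ (inj₂ (inj₁ e))) → contradiction (trans (sym p) e) λ ()
      ; (inj₂ (inj₂ (inj₂ e))) → contradiction (trans (sym r) e) λ () }
    pointwise v u w x | far x≢ q o d | inj₁ p | inj₂ r with closed v u w x d q o p r
    ... | e₁ , e₂ rewrite e₁ | e₂ = ≤-refl , (λ _ → inj₂ (inj₂ (inj₂ r))) , λ _ → refl
    pointwise v u w x | far x≢ q o d | inj₂ p | inj₁ r with closed v u w x d q o p r
    ... | e₁ , e₂ rewrite e₁ | e₂ = ≤-refl , (λ _ → inj₂ (inj₂ (inj₁ p))) , λ _ → refl
    pointwise v u w x | far x≢ q o d | inj₂ p | inj₂ r with closed v u w x d q o p r
    ... | e₁ , e₂ rewrite e₁ | e₂ = ≤-refl , (λ _ → inj₂ (inj₂ (inj₁ p))) , λ _ → refl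

    ∑-dominated : ∀ v u w → v < n → ∑ n (dominated v u w) ≡ dOut v u + dOut v w + deg v + 1
    ∑-dominated v u w v<n = trans (trans (∑-+ n (λ x → δ x v * 1 + a v x) (λ x → a u x * out v x + a w x * out v x))
      (cong₂ _+_ (trans (∑-+ n (λ x → δ x v * 1) (a v)) (cong₂ _+_ (∑-δ n (λ _ → 1) v<n) (sym (deg≡ v<n))))
                 (∑-+ n (λ x → a u x * out v x) (λ x → a w x * out v x))))
      (solve 3 (λ d p q → con 1 :+ d :+ (p :+ q) := p :+ q :+ d :+ con 1) refl (deg v) (dOut v u) (dOut v w))

    ∑-weight : ∀ v u w → ∑ n (weight v u w) ≡ n + shared v u w
    ∑-weight v u w = trans (∑-+ n (λ _ → 1) (λ x → a u x * (a w x * out v x))) (cong (_+ shared v u w) (trans (∑-const n 1) (*-identityʳ n)))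

  -- The inequality of `pointwise` sums to the given equation, so `∑-tight` makes it an equality at
  -- each vertex.
  counts⇒dominates : ∀ v u w → v < n → dOut v u + dOut v w + deg v + 1 ≡ n + shared v u w →
                     ∀ {x} → x < n → x ≡ v ⊎ a v x ≡ 1 ⊎ a u x ≡ 1 ⊎ a w x ≡ 1
  counts⇒dominates v u w v<n e {x} x<n = proj₁ (proj₂ (pointwise v u w x))
    (∑-tight n (λ {i} _ → proj₁ (pointwise v u w i)) (trans (∑-dominated v u w v<n) (trans e (sym (∑-weight v u w)))) x<n)

  dominates⇒counts : ∀ {v u w} → Triangle v u w → dOut v u + dOut v w + deg v + 1 ≡ n + shared v u w
  dominates⇒counts {v} {u} {w} t = trans (sym (∑-dominated v u w v<)) (trans (∑-cong n (λ {x} x<n → proj₂ (proj₂ (pointwise v u w x)) (dominates x<n))) (∑-weight v u w))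
    where open Triangle t

  cover : ∀ {v u w} → Triangle v u w → n ≤ deg v + deg u + deg w + 3
  cover {v} {u} {w} t = ≤-trans (≤-reflexive (trans (sym (*-identityʳ n)) (sym (∑-const n 1)))) (≤-trans (∑-mono n (λ {x} x<n → each (dominates x<n))) (≤-trans (≤-reflexive sums) below-3))
    where
    open Triangle t
    each : ∀ {x} → x ≡ v ⊎ a v x ≡ 1 ⊎ a u x ≡ 1 ⊎ a w x ≡ 1 → 1 ≤ (δ x v * 1 + a v x) + (a u x + a w x)
    each {x} (inj₁ e) = ≤-trans (≤-reflexive (sym (trans (*-identityʳ (δ x v)) (δ-same e)))) (≤-trans (m≤m+n _ (a v x)) (m≤m+n _ _))
    each {x} (inj₂ (inj₁ e)) = ≤-trans (≤-reflexive (sym e)) (≤-trans (m≤n+m (a v x) (δ x v * 1)) (m≤m+n _ _))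
    each {x} (inj₂ (inj₂ (inj₁ e))) = ≤-trans (≤-reflexive (sym e)) (≤-trans (m≤m+n (a u x) (a w x)) (m≤n+m _ (δ x v * 1 + a v x)))
    each {x} (inj₂ (inj₂ (inj₂ e))) = ≤-trans (≤-reflexive (sym e)) (≤-trans (m≤n+m (a w x) (a u x)) (m≤n+m _ (δ x v * 1 + a v x)))
    sums : ∑ n (λ x → (δ x v * 1 + a v x) + (a u x + a w x)) ≡ (1 + deg v) + (deg u + deg w)
    sums = trans (∑-+ n (λ x → δ x v * 1 + a v x) (λ x → a u x + a w x))
      (cong₂ _+_ (trans (∑-+ n (λ x → δ x v * 1) (a v)) (cong₂ _+_ (∑-δ n (λ _ → 1) v<) (sym (deg≡ v<))))
                 (trans (∑-+ n (a u) (a w)) (cong₂ _+_ (sym (deg≡ u<)) (sym (deg≡ w<)))))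
    below-3 : (1 + deg v) + (deg u + deg w) ≤ deg v + deg u + deg w + 3
    below-3 = ≤-trans (m≤m+n _ 2) (≤-reflexive (solve 3 (λ a b c → con 1 :+ a :+ (b :+ c) :+ con 2 := a :+ b :+ c :+ con 3) refl (deg v) (deg u) (deg w)))

  -- The three closed neighbourhoods cover the graph, so one of them contains a third of it, and the
  -- roles of the three vertices can be exchanged.
  heavy-first : ∀ {v u w} → Triangle v u w → ∃ λ v′ → ∃ λ u′ → ∃ λ w′ → Triangle v′ u′ w′ × n < 3 * deg v′ + 4
  heavy-first {v} {u} {w} t with n <? 3 * deg v + 4 | n <? 3 * deg u + 4 | n <? 3 * deg w + 4
  ... | yes h | _ | _ = v , u , w , t , h
  ... | no _ | yes h | _ = u , v , w , rotate t , h
  ... | no _ | no _ | yes h = w , v , u , rotate (swap-triangle t) , h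
  ... | no p | no q | no r = contradiction (≤-trans (+-mono-≤ (+-mono-≤ (≮⇒≥ p) (≮⇒≥ q)) (≮⇒≥ r)) (≤-trans (≤-reflexive (solve 1 (λ n → n :+ n :+ n := con 3 :* n) refl n)) (*-monoʳ-≤ 3 (cover t))))
     (<⇒≱ (≤-trans (m≤m+n _ 2) (≤-reflexive (solve 3 (λ a b c → con 1 :+ con 3 :* (a :+ b :+ c :+ con 3) :+ con 2 := con 3 :* a :+ con 4 :+ (con 3 :* b :+ con 4) :+ (con 3 :* c :+ con 4)) refl (deg v) (deg u) (deg w)))))

-- Edge lists and the adjacency matrix

Edge : ℕ → Set
Edge n = Fin n × Fin n

source target : ∀ {n} → List (Edge n) → ℕ → ℕ
source [] _ = 0
source ((u , v) ∷ es) zero = toℕ u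
source (_ ∷ es) (suc i) = source es i
target [] _ = 0
target ((u , v) ∷ es) zero = toℕ v
target (_ ∷ es) (suc i) = target es i

listed : ∀ {n} → List (Edge n) → List ℕ
listed = concatMap (λ (u , v) → toℕ u ∷ toℕ v ∷ [])

nth-source : ∀ {n} (es : List (Edge n)) i → nth (listed es) (i + i) ≡ source es i
nth-source [] i = refl
nth-source (_ ∷ es) zero = refl
nth-source (e ∷ es) (suc i) rewrite +-suc i i = nth-source es i

nth-target : ∀ {n} (es : List (Edge n)) i → nth (listed es) (i + i + 1) ≡ target es i
nth-target [] i = refl
nth-target (_ ∷ es) zero = refl
nth-target (e ∷ es) (suc i) rewrite +-suc i i = nth-target es i

length-listed : ∀ {n} (es : List (Edge n)) → length (listed es) ≡ length es + length es
length-listed [] = refl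
length-listed (e ∷ es) = cong suc (trans (cong suc (length-listed es)) (sym (+-suc (length es) (length es))))

source< : ∀ {n} (es : List (Edge n)) {i} → i < length es → source es i < n
source< ((u , v) ∷ es) {zero} _ = toℕ<n u
source< (_ ∷ es) {suc i} (s≤s i<) = source< es i<

target< : ∀ {n} (es : List (Edge n)) {i} → i < length es → target es i < n
target< ((u , v) ∷ es) {zero} _ = toℕ<n v
target< (_ ∷ es) {suc i} (s≤s i<) = target< es i<

nth-listed< : ∀ {n} (es : List (Edge n)) i → nth (listed es) i ≤ n
nth-listed< [] i = z≤n
nth-listed< ((u , v) ∷ es) zero = <⇒≤ (toℕ<n u)
nth-listed< ((u , v) ∷ es) (suc zero) = <⇒≤ (toℕ<n v)
nth-listed< (_ ∷ es) (suc (suc i)) = nth-listed< es i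

sumOver : ∀ {A : Set} → List A → (A → ℕ) → ℕ
sumOver [] f = 0
sumOver (x ∷ xs) f = f x + sumOver xs f

-- The input lists the edges in an unknown order. The adjacency matrix is obtained from sums over
-- the list, so the order drops out here.
sumOver-↭ : ∀ {A : Set} {xs ys : List A} (f : A → ℕ) → xs ↭ ys → sumOver xs f ≡ sumOver ys f
sumOver-↭ f ↭.refl = refl
sumOver-↭ f (↭.prep x p) = cong (f x +_) (sumOver-↭ f p)
sumOver-↭ f (↭.swap x y p) = trans (cong (λ z → f x + (f y + z)) (sumOver-↭ f p))
  (solve 3 (λ a b c → a :+ (b :+ c) := b :+ (a :+ c)) refl (f x) (f y) _)
sumOver-↭ f (↭.trans p q) = trans (sumOver-↭ f p) (sumOver-↭ f q)

sumOver-++ : ∀ {A : Set} (xs ys : List A) f → sumOver (xs ++ ys) f ≡ sumOver xs f + sumOver ys f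
sumOver-++ [] ys f = refl
sumOver-++ (x ∷ xs) ys f = trans (cong (f x +_) (sumOver-++ xs ys f)) (sym (+-assoc (f x) _ _))

sumOver-map : ∀ {A B : Set} (g : A → B) xs (f : B → ℕ) → sumOver (List.map g xs) f ≡ sumOver xs (f ∘ g)
sumOver-map g [] f = refl
sumOver-map g (x ∷ xs) f = cong (f (g x) +_) (sumOver-map g xs f)

sumOver-tabulate : ∀ {A : Set} n (g : Fin n → A) (f : A → ℕ) (h : ℕ → ℕ) → (∀ i → f (g i) ≡ h (toℕ i)) →
                   sumOver (tabulate g) f ≡ ∑ n h
sumOver-tabulate zero g f h e = refl
sumOver-tabulate (suc n) g f h e = trans (cong₂ _+_ (e zero) (sumOver-tabulate n (g ∘ suc) f (h ∘ suc) (e ∘ suc))) (sym (∑-left n h))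

sumOver-filter : ∀ {A : Set} {P : A → Set} (P? : ∀ x → Dec (P x)) xs (f : A → ℕ) →
                 sumOver (filter P? xs) f ≡ sumOver xs (λ x → (if does (P? x) then 1 else 0) * f x)
sumOver-filter P? [] f = refl
sumOver-filter P? (x ∷ xs) f with does (P? x)
... | true = cong₂ _+_ (sym (+-identityʳ (f x))) (sumOver-filter P? xs f)
... | false = sumOver-filter P? xs f

sumOver-product : ∀ {A B : Set} (xs : List A) (ys : List B) f →
                  sumOver (cartesianProduct xs ys) f ≡ sumOver xs (λ x → sumOver ys (λ y → f (x , y)))
sumOver-product [] ys f = refl
sumOver-product (x ∷ xs) ys f = trans (sumOver-++ (List.map (x ,_) ys) _ f)
  (cong₂ _+_ (sumOver-map (x ,_) ys f) (sumOver-product xs ys f))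

∑-edges : ∀ {n} (es : List (Edge n)) (f : ℕ → ℕ → ℕ) →
          ∑ (length es) (λ i → f (source es i) (target es i)) ≡ sumOver es (λ (u , v) → f (toℕ u) (toℕ v))
∑-edges [] f = refl
∑-edges ((u , v) ∷ es) f = trans (∑-left (length es) _) (cong (f (toℕ u) (toℕ v) +_) (∑-edges es f))

-- The amount by which the edge pq raises the entry (u, x) of the adjacency matrix.
incident : ℕ → ℕ → ℕ → ℕ → ℕ
incident p q u x = δ p u * δ q x + δ q u * δ p x

module Counting {n} (G : Graph n) (es : List (Edge n)) (es↭ : es ↭ edges G) where

  adjacency : ℕ → ℕ → ℕ
  adjacency u x with u <? n | x <? n
  ... | yes u< | yes x< = if does (Graph.adj? G (fromℕ< u<) (fromℕ< x<)) then 1 else 0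
  ... | _ | _ = 0

  m : ℕ
  m = length es

  -- The adjacency matrix after k edges have been read, for the invariant of `readGraph`.
  count : ℕ → ℕ → ℕ → ℕ
  count k u x = ∑ k (λ i → incident (source es i) (target es i) u x)

  indicator : Fin n → Fin n → ℕ
  indicator u x = if does (Graph.adj? G u x) then 1 else 0

  adjacency-Fin : ∀ u x → adjacency (toℕ u) (toℕ x) ≡ indicator u x
  adjacency-Fin u x with toℕ u <? n | toℕ x <? n
  ... | yes u< | yes x< = cong₂ indicator (fromℕ<-toℕ u u<) (fromℕ<-toℕ x x<)
  ... | no u≮ | _ = contradiction (toℕ<n u) u≮
  ... | yes _ | no x≮ = contradiction (toℕ<n x) x≮

  adjacency≤1 : ∀ u x → adjacency u x ≤ 1
  adjacency≤1 u x with u <? n | x <? n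
  ... | yes u< | yes x< with does (Graph.adj? G (fromℕ< u<) (fromℕ< x<))
  ... | true = ≤-refl
  ... | false = z≤n
  adjacency≤1 u x | yes _ | no _ = z≤n
  adjacency≤1 u x | no _ | _ = z≤n

  indicator-sym : ∀ u x → indicator u x ≡ indicator x u
  indicator-sym u x with Graph.adj? G u x | Graph.adj? G x u
  ... | yes _ | yes _ = refl
  ... | no _ | no _ = refl
  ... | yes p | no q = contradiction (Graph.sym G p) q
  ... | no p | yes q = contradiction (Graph.sym G q) p

  indicator-irrefl : ∀ u → indicator u u ≡ 0
  indicator-irrefl u with Graph.adj? G u u
  ... | yes p = contradiction p (Graph.irrefl G refl)
  ... | no _ = refl

  adjacency-sym : ∀ u x → adjacency u x ≡ adjacency x u
  adjacency-sym u x with u <? n | x <? n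
  ... | yes u< | yes x< = indicator-sym (fromℕ< u<) (fromℕ< x<)
  ... | yes _ | no _ = refl
  ... | no _ | yes _ = refl
  ... | no _ | no _ = refl

  adjacency-irrefl : ∀ u → adjacency u u ≡ 0
  adjacency-irrefl u with u <? n
  ... | yes u< = indicator-irrefl (fromℕ< u<)
  ... | no _ = refl

  adjacent-yes : ∀ {u x} → Adj G u x → adjacency (toℕ u) (toℕ x) ≡ 1
  adjacent-yes {u} {x} p = trans (adjacency-Fin u x) yes-case
    where
    yes-case : indicator u x ≡ 1
    yes-case with Graph.adj? G u x
    ... | yes _ = refl
    ... | no q = contradiction p q

  adjacent-no : ∀ {u x} → adjacency (toℕ u) (toℕ x) ≡ 1 → Adj G u x
  adjacent-no {u} {x} e = yes-case (trans (sym (adjacency-Fin u x)) e)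
    where
    yes-case : indicator u x ≡ 1 → Adj G u x
    yes-case e with Graph.adj? G u x
    ... | yes p = p
    yes-case () | no q

  private
    both : ∀ {A B : Set} (a? : Dec A) (b? : Dec B) → (if does (a? ×-dec b?) then 1 else 0) ≡ (if does a? then 1 else 0) * (if does b? then 1 else 0)
    both (yes _) (yes _) = refl
    both (yes _) (no _) = refl
    both (no _) _ = refl

    sumOver-edges : ∀ (f : ℕ → ℕ → ℕ) → sumOver es (λ (u , v) → f (toℕ u) (toℕ v)) ≡ ∑ n (λ p → ∑ n (λ q → [ p < q ] * adjacency p q * f p q))
    sumOver-edges f = trans (sumOver-↭ (λ (u , v) → f (toℕ u) (toℕ v)) es↭)
      (trans (sumOver-filter (λ (u , v) → (u Fin.<? v) ×-dec Graph.adj? G u v) (cartesianProduct (allFin n) (allFin n)) (λ (u , v) → f (toℕ u) (toℕ v)))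
      (trans (sumOver-product (allFin n) (allFin n) (λ (u , v) → (if does ((u Fin.<? v) ×-dec Graph.adj? G u v) then 1 else 0) * f (toℕ u) (toℕ v)))
        (sumOver-tabulate n (λ i → i) _ _ λ u → sumOver-tabulate n (λ i → i) _ _ λ v →
          cong (_* f (toℕ u) (toℕ v)) (trans (both (u Fin.<? v) (Graph.adj? G u v)) (cong ([ toℕ u < toℕ v ] *_) (sym (adjacency-Fin u v)))))))

    pick : ∀ (c : ℕ → ℕ → ℕ) {u x} → u < n → x < n → ∑ n (λ p → ∑ n (λ q → c p q * (δ p u * δ q x))) ≡ c u x
    pick c {u} {x} u< x< = trans (∑-cong n λ {p} _ → trans (∑-cong n λ {q} _ →
        solve 3 (λ c d e → c :* (d :* e) := d :* (e :* c)) refl (c p q) (δ p u) (δ q x)) (∑-*ˡ n (δ p u) (λ q → δ q x * c p q)))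
      (trans (∑-cong n λ {p} _ → cong (δ p u *_) (∑-δ n (c p) x<)) (∑-δ n (λ p → c p x) u<))

  -- `edges` contains each edge once, with the smaller end first, so for an adjacent pair exactly
  -- one summand of `incident` contributes, for exactly one edge.
  count-all : ∀ {u x} → u < n → x < n → count m u x ≡ adjacency u x
  count-all {u} {x} u< x< = begin
    count m u x ≡⟨ ∑-edges es (λ p q → incident p q u x) ⟩
    sumOver es (λ (p , q) → incident (toℕ p) (toℕ q) u x) ≡⟨ sumOver-edges (λ p q → incident p q u x) ⟩
    ∑ n (λ p → ∑ n (λ q → c p q * incident p q u x))
      ≡⟨ ∑-cong n (λ {p} _ → trans (∑-cong n λ {q} _ → trans (*-distribˡ-+ (c p q) (δ p u * δ q x) (δ q u * δ p x)) (cong (λ z → c p q * (δ p u * δ q x) + c p q * z) (*-comm (δ q u) (δ p x)))) (∑-+ n _ _)) ⟩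
    ∑ n (λ p → ∑ n (λ q → c p q * (δ p u * δ q x)) + ∑ n (λ q → c p q * (δ p x * δ q u))) ≡⟨ ∑-+ n _ _ ⟩
    ∑ n (λ p → ∑ n (λ q → c p q * (δ p u * δ q x))) + ∑ n (λ p → ∑ n (λ q → c p q * (δ p x * δ q u))) ≡⟨ cong₂ _+_ (pick c u< x<) (pick c x< u<) ⟩
    [ u < x ] * adjacency u x + [ x < u ] * adjacency x u ≡⟨ cong (λ z → [ u < x ] * adjacency u x + [ x < u ] * z) (adjacency-sym x u) ⟩
    [ u < x ] * adjacency u x + [ x < u ] * adjacency u x ≡⟨ one-side (<-cmp u x) ⟩
    adjacency u x ∎
    where
    open ≡-Reasoning
    c : ℕ → ℕ → ℕ
    c p q = [ p < q ] * adjacency p q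
    one-side : _ → [ u < x ] * adjacency u x + [ x < u ] * adjacency u x ≡ adjacency u x
    one-side (tri< l _ _) rewrite [<]-yes l | [<]-no (<⇒≤ l) = trans (+-identityʳ _) (+-identityʳ _)
    one-side (tri> _ _ l) rewrite [<]-yes l | [<]-no (<⇒≤ l) = +-identityʳ _
    one-side (tri≈ _ refl _) rewrite [<]-no {u} {u} ≤-refl = sym (adjacency-irrefl u)

  -- Partial matrices are bounded by the complete one, which keeps entries and degrees in range
  -- during reading.
  count≤1 : ∀ {k u x} → k ≤ m → u < n → x < n → count k u x ≤ 1
  count≤1 {k} {u} {x} k≤ u< x< = ≤-trans (∑-prefix _ k≤) (≤-trans (≤-reflexive (count-all u< x<)) (adjacency≤1 u x))

  handshake : ∑ n (λ u → ∑ n (adjacency u)) ≡ m + m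
  handshake = begin
    ∑ n (λ u → ∑ n (adjacency u)) ≡⟨ ∑-cong n (λ u< → ∑-cong n (λ x< → sym (count-all u< x<))) ⟩
    ∑ n (λ u → ∑ n (λ x → ∑ m (λ i → e i u x))) ≡⟨ ∑-cong n (λ {u} _ → ∑-swap n m (λ x i → e i u x)) ⟩
    ∑ n (λ u → ∑ m (λ i → ∑ n (λ x → e i u x))) ≡⟨ ∑-swap n m (λ u i → ∑ n (λ x → e i u x)) ⟩
    ∑ m (λ i → ∑ n (λ u → ∑ n (λ x → e i u x))) ≡⟨ ∑-cong m (λ i< → each (source< es i<) (target< es i<)) ⟩
    ∑ m (λ _ → 2) ≡⟨ ∑-const m 2 ⟩
    m * 2 ≡⟨ solve 1 (λ m → m :* con 2 := m :+ m) refl m ⟩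
    m + m ∎
    where
    open ≡-Reasoning
    e : ℕ → ℕ → ℕ → ℕ
    e i u x = incident (source es i) (target es i) u x
    unit : ∀ {p q} → p < n → q < n → ∑ n (λ u → ∑ n (λ x → δ p u * δ q x)) ≡ 1
    unit {p} {q} p< q< = trans (∑-cong n λ {u} _ → trans (∑-cong n λ {x} _ → cong₂ _*_ (δ-comm p u) (δ-comm q x))
        (trans (∑-cong n λ {x} _ → *-comm (δ u p) (δ x q)) (∑-δ n (λ _ → δ u p) q<)))
      (trans (∑-cong n λ {u} _ → sym (*-identityʳ (δ u p))) (∑-δ n (λ _ → 1) p<))
    each : ∀ {p q} → p < n → q < n → ∑ n (λ u → ∑ n (λ x → incident p q u x)) ≡ 2
    each {p} {q} p< q< = trans (∑-cong n λ {u} _ → ∑-+ n (λ x → δ p u * δ q x) (λ x → δ q u * δ p x))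
      (trans (∑-+ n _ _) (cong₂ _+_ (unit p< q<) (unit q< p<)))

  2m≤n² : m + m ≤ n * n
  2m≤n² = ≤-trans (≤-reflexive (sym handshake)) (∑-≤ n λ {u} _ → ≤-trans (∑-≤ n λ {x} _ → adjacency≤1 u x) (≤-reflexive (*-identityʳ n)))

-- Reading the graph

arc : Reg → Reg → Stm
arc p q =
  (⟨ cell (# 2) (` p) (degree (` p)) ⟩≔ ` q) ⨟
  (⟨ cell (# 1) (# 0) (` p) ⟩≔ degree (` p) ⊕ # 1) ⨟
  (⟨ cell (# 3) (` p) (` q) ⟩≔ adjacent (` p) (` q) ⊕ # 1)

readEdge : Stm
readEdge = (rp ≔ ! (` re ⊕ ` re)) ⨟ (rq ≔ ! (` re ⊕ ` re ⊕ # 1)) ⨟ arc rp rq ⨟ arc rq rp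

readGraph : Stm
readGraph = for re (` rm) readEdge

powers : ℕ → Stm
powers zero = rM ≔ # 1
powers (suc c) = powers c ⨟ (rM ≔ ` rM ⊛ ` rb)

doubling : Stm
doubling = when (` rb ≺ ` rn ⊕ # 2) (rb ≔ ` rb ⊕ ` rb) none

-- The side of the tables is a power of two, 2 ^ k, so that its c-th power is the modulus of words
-- with k c bits.
choose : ℕ → Stm
choose c = (rb ≔ # 1) ⨟ for re (` rn ⊕ # 2) doubling ⨟ powers c ⨟ (rS ≔ ` rm ⊕ ` rn)

cell-table : ∀ {b k x y k′ x′ y′} → x < b → y < b → x′ < b → y′ < b → k ≢ k′ → cellℕ b k x y ≢ cellℕ b k′ x′ y′
cell-table {b} {k} {x} {y} {k′} {x′} {y′} x< y< x′< y′< k≢ e =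
  k≢ (proj₁ (digits-injective b {k} {x} {k′} {x′} x< x′< (proj₁ (digits-injective b {k * b + x} {y} {k′ * b + x′} y< y′< e))))

module Reading (mc : Machine) (gl : Consts) (n<b : Consts.cn gl < Consts.cb gl) (b<β : Consts.cb gl < Machine.β mc)
  (G : Graph (Consts.cn gl)) (es : List (Edge (Consts.cn gl))) (es↭ : es ↭ edges G)
  (m≡ : Consts.cm gl ≡ length es) (m<β : length es < Machine.β mc) where

  open Machine mc
  open Consts gl using () renaming (cn to n; cb to b)
  open Logic mc
  open Counting G es es↭

  private
    0<b : 0 < b
    0<b = ≤-trans (s≤s z≤n) n<b

    n<β : n < β
    n<β = <-trans n<b b<β

  -- `sums` is the property `enumerates` of `Tables` for the edges read so far.
  record Partial (α : ℕ → ℕ → ℕ) (μ : Mem) : Set where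
    field
      sums : ∀ u → u < n → (g : ℕ → ℕ) → ∑ (μ (cellℕ b 1 0 u)) (λ i → g (μ (cellℕ b 2 u i))) ≡ ∑ n (λ x → α u x * g x)
      inRange : ∀ u i → u < n → i < μ (cellℕ b 1 0 u) → μ (cellℕ b 2 u i) < n
      entries : ∀ u x → u < n → x < n → μ (cellℕ b 3 u x) ≡ α u x

    degree≡ : ∀ u → u < n → μ (cellℕ b 1 0 u) ≡ ∑ n (α u)
    degree≡ u u<n = trans (sym (trans (∑-const (μ (cellℕ b 1 0 u)) 1) (*-identityʳ _))) (trans (sums u u<n (λ _ → 1)) (∑-cong n λ {x} _ → *-identityʳ (α u x)))

  open Partial

  module _ {α : ℕ → ℕ → ℕ} {μ : Mem} (part : Partial α μ) {p q : ℕ} (p<n : p < n) (q<n : q < n)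
    (α′≤1 : ∀ {u x} → u < n → x < n → α u x + δ p u * δ q x ≤ 1) where

    private
      d : ℕ
      d = μ (cellℕ b 1 0 p)
      μ₁ μ₂ μ₃ : Mem
      μ₁ = μ [ cellℕ b 2 p d ↦ q ]
      μ₂ = μ₁ [ cellℕ b 1 0 p ↦ d + 1 ]
      μ₃ = μ₂ [ cellℕ b 3 p q ↦ α p q + 1 ]

      -- After the new arc the row of p sums to d + 1, and its entries are at most 1, so the list of
      -- p still has room at position d.
      d<n : d < n
      d<n = ≤-trans (≤-reflexive (begin
          suc d                ≡⟨ +-comm 1 d ⟩
          d + 1                ≡⟨ cong₂ _+_ (degree≡ part p p<n) (sym (trans (∑-cong n λ {x} _ → trans (δ-comm q x) (sym (*-identityʳ (δ x q)))) (∑-δ n (λ _ → 1) q<n))) ⟩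
          ∑ n (α p) + ∑ n (δ q) ≡⟨ ∑-+ n (α p) (δ q) ⟨
          ∑ n (λ x → α p x + δ q x) ≡⟨ ∑-cong n (λ {x} _ → cong (α p x +_) (sym (trans (cong (_* δ q x) (δ-same {p} refl)) (+-identityʳ (δ q x))))) ⟩
          ∑ n (λ x → α p x + δ p p * δ q x) ∎))
        (≤-trans (∑-≤ n λ x< → α′≤1 p<n x<) (≤-reflexive (*-identityʳ n)))
        where open ≡-Reasoning

      p<b = <-trans p<n n<b
      q<b = <-trans q<n n<b
      d<b = <-trans d<n n<b

      deg-same : ∀ {u} → u ≡ p → μ₃ (cellℕ b 1 0 u) ≡ d + 1
      deg-same refl = trans (update-other μ₂ _ (cell-table {k = 1} {0} {p} {3} {p} {q} 0<b p<b p<b q<b λ ())) (update-same μ₁ (cellℕ b 1 0 p) refl)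

      deg-other : ∀ {u} → u < n → u ≢ p → μ₃ (cellℕ b 1 0 u) ≡ μ (cellℕ b 1 0 u)
      deg-other {u} u<n u≢p = trans (update-other μ₂ _ (cell-table {k = 1} {0} {u} {3} {p} {q} 0<b u<b p<b q<b λ ()))
        (trans (update-other μ₁ _ (u≢p ∘ proj₂ ∘ cell-injective b {1} {0} {u} {1} {0} {p} 0<b u<b 0<b p<b))
          (update-other μ _ (cell-table {k = 1} {0} {u} {2} {p} {d} 0<b u<b p<b d<b λ ())))
        where u<b = <-trans u<n n<b

      list-other : ∀ {u i} → u < n → i < b → u ≢ p ⊎ i ≢ d → μ₃ (cellℕ b 2 u i) ≡ μ (cellℕ b 2 u i)
      list-other {u} {i} u<n i<b apart = trans (update-other μ₂ _ (cell-table {k = 2} {u} {i} {3} {p} {q} u<b i<b p<b q<b λ ()))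
        (trans (update-other μ₁ _ (cell-table {k = 2} {u} {i} {1} {0} {p} u<b i<b 0<b p<b λ ()))
          (update-other μ _ λ e → differ apart (cell-injective b {2} {u} {i} {2} {p} {d} u<b i<b p<b d<b e)))
        where
        u<b = <-trans u<n n<b
        differ : u ≢ p ⊎ i ≢ d → u ≡ p × i ≡ d → _
        differ (inj₁ u≢) (u≡ , _) = u≢ u≡
        differ (inj₂ i≢) (_ , i≡) = i≢ i≡

      list-new : μ₃ (cellℕ b 2 p d) ≡ q
      list-new = trans (update-other μ₂ _ (cell-table {k = 2} {p} {d} {3} {p} {q} p<b d<b p<b q<b λ ()))
        (trans (update-other μ₁ _ (cell-table {k = 2} {p} {d} {1} {0} {p} p<b d<b 0<b p<b λ ())) (update-same μ (cellℕ b 2 p d) refl))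

      deg≤n : ∀ u → u < n → u ≢ p ⊎ u ≡ p → μ (cellℕ b 1 0 u) ≤ n
      deg≤n u u<n _ = ≤-trans (≤-reflexive (degree≡ part u u<n)) (≤-trans (∑-≤ n λ {x} x< → ≤-trans (m≤m+n (α u x) (δ p u * δ q x)) (α′≤1 u<n x<)) (≤-reflexive (*-identityʳ n)))

      sums′ : ∀ u → u < n → (g : ℕ → ℕ) → Dec (u ≡ p) →
              ∑ (μ₃ (cellℕ b 1 0 u)) (λ i → g (μ₃ (cellℕ b 2 u i))) ≡ ∑ n (λ x → (α u x + δ p u * δ q x) * g x)
      sums′ u u<n g (yes refl) = begin
        ∑ (μ₃ (cellℕ b 1 0 p)) (λ i → g (μ₃ (cellℕ b 2 p i))) ≡⟨ cong (λ k → ∑ k (λ i → g (μ₃ (cellℕ b 2 p i)))) (trans (deg-same refl) (+-comm d 1)) ⟩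
        ∑ d (λ i → g (μ₃ (cellℕ b 2 p i))) + g (μ₃ (cellℕ b 2 p d))
          ≡⟨ cong₂ _+_ (trans (∑-cong d λ {i} i<d → cong g (list-other p<n (<-trans i<d d<b) (inj₂ (<⇒≢ i<d)))) (sums part p p<n g)) (cong g list-new) ⟩
        ∑ n (λ x → α p x * g x) + g q ≡⟨ cong (∑ n (λ x → α p x * g x) +_) (sym (∑-δ n g q<n)) ⟩
        ∑ n (λ x → α p x * g x) + ∑ n (λ x → δ x q * g x) ≡⟨ ∑-+ n _ _ ⟨
        ∑ n (λ x → α p x * g x + δ x q * g x)
          ≡⟨ ∑-cong n (λ {x} _ → trans (sym (*-distribʳ-+ (g x) (α p x) (δ x q))) (cong (λ z → (α p x + z) * g x) (trans (δ-comm x q) (sym (trans (cong (_* δ q x) (δ-same {p} refl)) (+-identityʳ _)))))) ⟩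
        ∑ n (λ x → (α p x + δ p p * δ q x) * g x) ∎
        where open ≡-Reasoning
      sums′ u u<n g (no u≢p) = begin
        ∑ (μ₃ (cellℕ b 1 0 u)) (λ i → g (μ₃ (cellℕ b 2 u i))) ≡⟨ cong (λ k → ∑ k (λ i → g (μ₃ (cellℕ b 2 u i)))) (deg-other u<n u≢p) ⟩
        ∑ (μ (cellℕ b 1 0 u)) (λ i → g (μ₃ (cellℕ b 2 u i)))
          ≡⟨ ∑-cong (μ (cellℕ b 1 0 u)) (λ {i} i< → cong g (list-other u<n (≤-<-trans (≤-trans (<⇒≤ i<) (deg≤n u u<n (inj₁ u≢p))) n<b) (inj₁ u≢p))) ⟩
        ∑ (μ (cellℕ b 1 0 u)) (λ i → g (μ (cellℕ b 2 u i))) ≡⟨ sums part u u<n g ⟩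
        ∑ n (λ x → α u x * g x) ≡⟨ ∑-cong n (λ {x} _ → cong (_* g x) (sym (trans (cong (λ z → α u x + z * δ q x) (δ-other (u≢p ∘ sym))) (+-identityʳ _)))) ⟩
        ∑ n (λ x → (α u x + δ p u * δ q x) * g x) ∎
        where open ≡-Reasoning

      range′ : ∀ u i → u < n → i < μ₃ (cellℕ b 1 0 u) → Dec (u ≡ p) → μ₃ (cellℕ b 2 u i) < n
      range′ u i u<n i< (no u≢p) = subst (_< n) (sym (list-other u<n (≤-<-trans (≤-trans (<⇒≤ i<′) (deg≤n u u<n (inj₁ u≢p))) n<b) (inj₁ u≢p))) (inRange part u i u<n i<′)
        where i<′ = subst (i <_) (deg-other u<n u≢p) i<
      range′ u i u<n i< (yes refl) with i ≟ d
      ... | yes refl = subst (_< n) (sym list-new) q<n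
      ... | no i≢d = subst (_< n) (sym (list-other p<n (<-trans i<d d<b) (inj₂ i≢d))) (inRange part p i p<n i<d)
        where i<d = ≤∧≢⇒< (≤-pred (subst (i <_) (trans (deg-same refl) (+-comm d 1)) i<)) i≢d

      entries′ : ∀ u x → u < n → x < n → μ₃ (cellℕ b 3 u x) ≡ α u x + δ p u * δ q x
      entries′ u x u<n x<n with u ≟ p | x ≟ q
      ... | yes refl | yes refl = trans (update-same μ₂ (cellℕ b 3 p q) refl) (cong (α p q +_) (sym (cong₂ _*_ (δ-same {p} refl) (δ-same {q} refl))))
      ... | no u≢ | _ = trans (older (u≢ ∘ proj₁)) (sym (trans (cong (λ z → α u x + z * δ q x) (δ-other (u≢ ∘ sym))) (+-identityʳ _)))
        where
        older : ¬ (u ≡ p × x ≡ q) → μ₃ (cellℕ b 3 u x) ≡ α u x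
        older ne = trans (update-other μ₂ _ (ne ∘ cell-injective b {3} {u} {x} {3} {p} {q} (<-trans u<n n<b) (<-trans x<n n<b) p<b q<b))
          (trans (update-other μ₁ _ (cell-table {k = 3} {u} {x} {1} {0} {p} (<-trans u<n n<b) (<-trans x<n n<b) 0<b p<b λ ()))
            (trans (update-other μ _ (cell-table {k = 3} {u} {x} {2} {p} {d} (<-trans u<n n<b) (<-trans x<n n<b) p<b d<b λ ())) (entries part u x u<n x<n)))
      ... | yes refl | no x≢ = trans older (sym (trans (cong (λ z → α p x + δ p p * z) (δ-other (x≢ ∘ sym))) (trans (cong (α p x +_) (*-zeroʳ (δ p p))) (+-identityʳ _))))
        where
        older : μ₃ (cellℕ b 3 p x) ≡ α p x
        older = trans (update-other μ₂ _ (x≢ ∘ proj₂ ∘ cell-injective b {3} {p} {x} {3} {p} {q} p<b (<-trans x<n n<b) p<b q<b))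
          (trans (update-other μ₁ _ (cell-table {k = 3} {p} {x} {1} {0} {p} p<b (<-trans x<n n<b) 0<b p<b λ ()))
            (trans (update-other μ _ (cell-table {k = 3} {p} {x} {2} {p} {d} p<b (<-trans x<n n<b) p<b d<b λ ())) (entries part p x p<n x<n)))

      part₃ : Partial (λ u x → α u x + δ p u * δ q x) μ₃
      part₃ = record { sums = λ u u<n g → sums′ u u<n g (u ≟ p) ; inRange = λ u i u<n i< → range′ u i u<n i< (u ≟ p) ; entries = entries′ }

    arc-ok : ∀ {P Q} l (let vs = gl ▹ l) →
      {s₁ : T (simple (cell (# 2) (` P) (degree (` P))))} {s₂ : T (simple (` Q))} {s₃ : T (simple (cell (# 1) (# 0) (` P)))}
      {s₄ : T (simple (degree (` P) ⊕ # 1))} {s₅ : T (simple (cell (# 3) (` P) (` Q)))} {s₆ : T (simple (adjacent (` P) (` Q) ⊕ # 1))} →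
      vs P ≡ p → vs Q ≡ q →
      Run (arc P Q) vs μ (λ vs′ μ′ t → t ≤ 3 × vs′ ≡ vs × Partial (λ u x → α u x + δ p u * δ q x) μ′ × Below (1 * b * b) μ μ′ × Above (4 * b * b) μ μ′)
    arc-ok l {s₁} {s₂} {s₃} {s₄} {s₅} {s₆} refl refl =
      sequence (set {sa = s₁} {se = s₂} (cellℕ b 2 p d) q refl refl (<-trans q<n n<β)
      (sequence (set {sa = s₃} {se = s₄} (cellℕ b 1 0 p) (d + 1) refl (cong (_+ 1) (update-other μ _ (cell-table {k = 1} {0} {p} {2} {p} {d} 0<b p<b p<b d<b λ ())))
          (≤-<-trans (≤-trans (≤-reflexive (+-comm d 1)) d<n) n<β)
      (set {sa = s₅} {se = s₆} (cellℕ b 3 p q) (α p q + 1) refl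
        (cong (_+ 1) (trans (update-other μ₁ _ (cell-table {k = 3} {p} {q} {1} {0} {p} p<b q<b 0<b p<b λ ()))
            (trans (update-other μ _ (cell-table {k = 3} {p} {q} {2} {p} {d} p<b q<b p<b d<b λ ())) (entries part p q p<n q<n))))
        (≤-<-trans (≤-trans (≤-reflexive (cong (α p q +_) (sym (cong₂ _*_ (δ-same {p} refl) (δ-same {q} refl))))) (α′≤1 p<n q<n)) (≤-trans (s≤s (s≤s z≤n)) 8≤β))
        (≤-refl , refl , part₃
        , below-set {μ′ = μ₂} (≤-trans (up 1 3) (cell-≥ b 3 p q)) (below-set {μ′ = μ₁} (cell-≥ b 1 0 p) (below-set {μ′ = μ} (≤-trans (up 1 2) (cell-≥ b 2 p d)) below-refl))
        , above-set {μ′ = μ₂} (cell-< {k = 3} p<b q<b) (above-set {μ′ = μ₁} (<-≤-trans (cell-< {k = 1} 0<b p<b) (up 2 4)) (above-set {μ′ = μ} (<-≤-trans (cell-< {k = 2} p<b d<b) (up 3 4)) above-refl)))))))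
      where
      up : ∀ j k → {T (j ≤ᵇ k)} → j * b * b ≤ k * b * b
      up j k {t} = *-monoˡ-≤ b (*-monoˡ-≤ b (≤ᵇ⇒≤ j k t))

  readGraph-ok : ∀ l {μ} (let vs = gl ▹ l) → (∀ a → μ a ≡ nth (listed es) a) →
    Run readGraph vs μ (λ vs′ μ′ t → t ≤ 2 + m * 9 × Partial (count m) μ′ × Above (4 * b * b) μ μ′ ×
      ∃ λ e → ∃ λ p → ∃ λ q → vs′ ≡ vs [ re ≔ e ] [ rp ≔ p ] [ rq ≔ q ])
  readGraph-ok l {μ} input =
    iterate
      (λ k vs′ μ′ → Partial (count k) μ′ × Below (1 * b * b) μ μ′ × Above (4 * b * b) μ μ′ × ∃ λ p → ∃ λ q → vs′ ≡ vs [ re ≔ k ] [ rp ≔ p ] [ rq ≔ q ])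
      m (λ _ → 8) m<β
      (λ { (_ , _ , _ , _ , _ , refl) → refl , m≡ })
      (λ { {k} {μ = μ₁} k< (part , lo , hi , p , q , refl) →
        let p′ = source es k
            q′ = target es k
            l₁ = vs [ re ≔ k ] [ rp ≔ p′ ] [ rq ≔ q′ ]
        in
        sequence (assign p′ (trans (Below.at lo (<-trans (m<m+n (k + k) (s≤s z≤n)) (cells< k<))) (trans (input (k + k)) (nth-source es k))) (<-trans (source< es k<) n<β)
        (sequence (assign q′ (trans (Below.at lo (cells< k<)) (trans (input (k + k + 1)) (nth-target es k))) (<-trans (target< es k<) n<β)
        (sequence (restart (gl ▹ l₁) ✓ (weaken (arc-ok {count k} {μ₁} part (source< es k<) (target< es k<) (λ u< x< → ≤-trans (+-monoʳ-≤ (count k _ _) (m≤m+n (δ p′ _ * δ q′ _) _)) (count≤1 k< u< x<)) {rp} {rq} l₁ refl refl)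
          λ { {μ′ = μ₂} {t₂} (t₂≤ , refl , part₂ , lo₂ , hi₂) →
          weaken (arc-ok {λ u x → count k u x + δ p′ u * δ q′ x} {μ₂} part₂ (target< es k<) (source< es k<) (λ {u} {x} u< x< → ≤-trans (≤-reflexive (+-assoc (count k u x) _ _)) (count≤1 k< u< x<)) {rq} {rp} l₁ refl refl)
          λ { {μ′ = μ₃} {t₃} (t₃≤ , refl , part₃ , lo₃ , hi₃) →
            +-monoʳ-≤ 2 (+-mono-≤ t₂≤ t₃≤) , refl , _ , (reassoc {k} {μ₃} part₃ , below-trans lo (below-trans lo₂ lo₃) , above-trans hi (above-trans hi₂ hi₃) , p′ , q′ , refl) , ✓ } })))))) })
      (_ , (start , below-refl , above-refl , vs rp , vs rq , refl) , ✓)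
      (λ { (part , lo , hi , p , q , refl) t≤ → ≤-trans t≤ (+-monoʳ-≤ 2 (≤-reflexive (∑-const m 9))) , part , hi , m , p , q , refl })
    where
    vs = gl ▹ l
    -- The input has 2m words and thus fits into table 0, which `arc` never writes.
    2m≤b² : m + m ≤ 1 * b * b
    2m≤b² = ≤-trans 2m≤n² (≤-trans (*-mono-≤ (<⇒≤ n<b) (<⇒≤ n<b)) (≤-reflexive (cong (_* b) (sym (+-identityʳ b)))))
    cells< : ∀ {k} → k < m → k + k + 1 < 1 * b * b
    cells< {k} k< = <-≤-trans (≤-trans (≤-reflexive (solve 1 (λ k → con 1 :+ (k :+ k :+ con 1) := (con 1 :+ k) :+ (con 1 :+ k)) refl k)) (+-mono-≤ k< k<)) 2m≤b²
    zero-cells : ∀ {a} → 1 * b * b ≤ a → μ a ≡ 0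
    zero-cells {a} a≥ = trans (input a) (nth-beyond (listed es) (≤-trans (≤-reflexive (length-listed es)) (≤-trans 2m≤b² a≥)))
    start : Partial (count 0) μ
    start = record
      { sums = λ u u<n g → trans (cong (λ k → ∑ k (λ i → g (μ (cellℕ b 2 u i)))) (zero-cells (cell-≥ b 1 0 u))) (sym (∑-zero n λ _ → refl))
      ; inRange = λ u i u<n i< → contradiction (subst (i <_) (zero-cells (cell-≥ b 1 0 u)) i<) λ ()
      ; entries = λ u x u<n x<n → zero-cells (≤-trans (*-monoˡ-≤ b (*-monoˡ-≤ b (≤ᵇ⇒≤ 1 3 tt))) (cell-≥ b 3 u x)) }
    reassoc : ∀ {k μ′} → Partial (λ u x → count k u x + δ (source es k) u * δ (target es k) x + δ (target es k) u * δ (source es k) x) μ′ → Partial (count (suc k)) μ′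
    reassoc {k} part = record
      { sums = λ u u<n g → trans (sums part u u<n g) (∑-cong n λ {x} _ → cong (_* g x) (+-assoc (count k u x) _ _))
      ; inRange = inRange part
      ; entries = λ u x u<n x<n → trans (entries part u x u<n x<n) (+-assoc (count k u x) _ _) }

  tables-of : ∀ {μ} → Partial (count m) μ → Tables n
  tables-of {μ} part = record
    { a = adjacency ; nb = λ u i → μ (cellℕ b 2 u i) ; deg = λ u → μ (cellℕ b 1 0 u)
    ; a≤1 = adjacency≤1 ; symmetric = adjacency-sym ; irreflexive = adjacency-irrefl
    ; nb< = λ {u} {i} u<n i< → inRange part u i u<n i<
    ; enumerates = λ {u} u<n g → trans (sums part u u<n g) (∑-cong n λ {x} x< → cong (_* g x) (count-all u<n x<)) }

  tables-stored : ∀ {μ} (part : Partial (count m) μ) → Tables.Stored (tables-of part) b μ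
  tables-stored part = record
    { degrees = λ _ → refl ; lists = λ _ _ → refl
    ; matrix = λ {u} {x} u<n x<n → trans (entries part u x u<n x<n) (count-all u<n x<n) }

  tables-degrees : ∀ {μ} (part : Partial (count m) μ) → ∑ n (Tables.deg (tables-of part)) ≡ m + m
  tables-degrees part = trans (∑-cong n λ u<n → Tables.deg≡ (tables-of part) u<n) handshake

module Choosing (mc : Machine) where

  open Machine mc
  open Logic mc

  powers-ok : ∀ c vs {μ} b → vs rb ≡ b → 1 ≤ b → b ^ c < β →
    Run (powers c) vs μ (λ vs′ μ′ t → t ≡ suc c × vs′ ≈ vs [ rM ≔ b ^ c ] × μ′ ≡ μ)
  powers-ok zero vs b _ _ _ = assign 1 refl (≤-trans (≤ᵇ⇒≤ 2 8 tt) 8≤β) (refl , ✓ , refl)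
  powers-ok (suc c) vs b b≡ 1≤b p< =
    sequence (weaken (powers-ok c vs b b≡ 1≤b (≤-<-trans (m≤n*m (b ^ c) b {{>-nonZero 1≤b}}) p<))
      λ { {vs₁} (refl , same-vs , refl) → restart (vs [ rM ≔ b ^ c ]) same-vs
        (assign (b ^ suc c) (trans (cong (b ^ c *_) b≡) (*-comm (b ^ c) b)) p<
          (+-comm (suc c) 1 , ✓ , refl)) })

-- Word size and memory bounds

module Sizes (n m c wf b : ℕ) (x≤b : 2 + n ≤ b) (b≤2x : b ≤ 2 * (2 + n)) (2m≤ : m + m ≤ n * n) (c≡ : c ≡ 2 * wf + 8) where

  -- Since b ≤ 2 x ≤ x², the modulus b ^ c is at most x ^ (2 c), and the exponent 2 c + 8 of β
  -- leaves room for multiplying it by b³. The part 2 `wf` of c makes the simulated words long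
  -- enough for dimensions up to 2m; the 8 makes the modulus at least b⁵, which covers all tables
  -- and a pair of matrices.
  x β : ℕ
  x = 2 + n
  β = x ^ (2 * c + 8)

  private
    2≤x : 2 ≤ x
    2≤x = m≤m+n 2 n

    instance
      x≢0 : NonZero x
      x≢0 = _
      b≢0 : NonZero b
      b≢0 = >-nonZero (≤-trans (s≤s z≤n) x≤b)

    n≤x : n ≤ x
    n≤x = m≤n+m n 2

    n²≤ : n * n ≤ x * x
    n²≤ = *-mono-≤ n≤x n≤x

    x²≡ : x * x ≡ x ^ 2
    x²≡ = cong (x *_) (sym (*-identityʳ x))

    b≤x² : b ≤ x ^ 2
    b≤x² = ≤-trans b≤2x (≤-trans (*-monoˡ-≤ x 2≤x) (≤-reflexive x²≡))

    b^≤ : ∀ i → b ^ i ≤ x ^ (2 * i)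
    b^≤ i = ≤-trans (^-monoˡ-≤ i b≤x²) (≤-reflexive (^-*-assoc x 2 i))

    scale : ∀ i j → 2 ^ i * x ^ j ≤ x ^ (i + j)
    scale i j = ≤-trans (*-monoˡ-≤ (x ^ j) (^-monoˡ-≤ i 2≤x)) (≤-reflexive (sym (^-distribˡ-+-* x i j)))

    8≤E : 8 ≤ 2 * c + 8
    8≤E = m≤n+m 8 (2 * c)

    ≤β : ∀ {k y} → y ≤ x ^ k → k ≤ 7 → y < β
    ≤β {k} y≤ k≤ = ≤-<-trans y≤ (^-monoʳ-< x (s≤s (s≤s z≤n)) (<-≤-trans (s≤s k≤) 8≤E))

    8≤c : 8 ≤ c
    8≤c = ≤-trans (m≤n+m 8 (2 * wf)) (≤-reflexive (sym c≡))

    b≤M : ∀ {i} → i ≤ 8 → b ^ i ≤ b ^ c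
    b≤M i≤ = ^-monoʳ-≤ b (≤-trans i≤ 8≤c)

    m≤x² : m ≤ x * x
    m≤x² = ≤-trans (m≤m+n m m) (≤-trans 2m≤ n²≤)

    2≤b : 2 ≤ b
    2≤b = ≤-trans 2≤x x≤b

    b²≡ : b * b ≡ b ^ 2
    b²≡ = cong (b *_) (sym (*-identityʳ b))

    2m≤b² : m + m ≤ b ^ 2
    2m≤b² = ≤-trans 2m≤ (≤-trans n²≤ (≤-trans (*-mono-≤ x≤b x≤b) (≤-reflexive b²≡)))

  open ≤-Reasoning

  n<b : n < b
  n<b = ≤-trans (n≤1+n (suc n)) x≤b

  8≤β : 8 ≤ β
  8≤β = <⇒≤ (≤β {4} (≤-trans (≤ᵇ⇒≤ 8 16 tt) (≤-trans (≤-reflexive (sym (*-identityʳ 16))) (≤-trans (scale 4 0) ≤-refl))) (≤ᵇ⇒≤ 4 7 tt))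

  b<β : b < β
  b<β = ≤β {2} b≤x² (≤ᵇ⇒≤ 2 7 tt)

  b³≤β : b * b * b ≤ β
  b³≤β = <⇒≤ (≤β {6} (≤-trans (≤-reflexive (solve 1 (λ b → b :* b :* b := b :* (b :* (b :* con 1))) refl b)) (b^≤ 3)) (≤ᵇ⇒≤ 6 7 tt))

  n+2<β : n + 2 < β
  n+2<β = ≤β {1} (≤-reflexive (trans (+-comm n 2) (sym (*-identityʳ x)))) (s≤s z≤n)

  n<β : n < β
  n<β = ≤-<-trans (m≤m+n n 2) n+2<β

  3n<β : 3 * n + 1 < β
  3n<β = ≤β {3} (≤-trans (≤-trans (m≤m+n _ (n + 7)) (≤-reflexive (solve 1 (λ n → con 3 :* n :+ con 1 :+ (n :+ con 7) := con 4 :* ((con 2 :+ n) :* con 1)) refl n))) (scale 2 1)) (≤ᵇ⇒≤ 3 7 tt)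

  ans<β : n * (n * n + n * n) + (n * n + n * n) < β
  ans<β = ≤β {5} (begin
    n * (n * n + n * n) + (n * n + n * n) ≤⟨ +-mono-≤ (*-mono-≤ n≤x (+-mono-≤ n²≤ n²≤)) (≤-trans (+-mono-≤ n²≤ n²≤) (m≤n*m (x * x + x * x) x)) ⟩
    x * (x * x + x * x) + x * (x * x + x * x) ≡⟨ solve 1 (λ x → x :* (x :* x :+ x :* x) :+ x :* (x :* x :+ x :* x) := con 4 :* (x :* (x :* (x :* con 1)))) refl x ⟩
    2 ^ 2 * x ^ 3 ≤⟨ scale 2 3 ⟩
    x ^ 5 ∎) (≤ᵇ⇒≤ 5 7 tt)

  private
    4m≤ : ∀ {k} → k ≤ 4 → 4 * m + k ≤ 4 * (x * x)
    4m≤ {k} k≤ = begin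
      4 * m + k ≡⟨ cong (_+ k) (solve 1 (λ m → con 4 :* m := con 2 :* (m :+ m)) refl m) ⟩
      2 * (m + m) + k ≤⟨ +-mono-≤ (*-monoʳ-≤ 2 (≤-trans 2m≤ n²≤)) (≤-trans k≤ (*-mono-≤ 2≤x 2≤x)) ⟩
      2 * (x * x) + x * x ≤⟨ m≤m+n _ (x * x) ⟩
      2 * (x * x) + x * x + x * x ≡⟨ solve 1 (λ y → con 2 :* y :+ y :+ y := con 4 :* y) refl (x * x) ⟩
      4 * (x * x) ∎

  F<β : (4 * m + 1) * (m + n) < β
  F<β = ≤β {7} (begin
    (4 * m + 1) * (m + n) ≤⟨ *-mono-≤ (4m≤ (s≤s z≤n)) (+-mono-≤ m≤x² (≤-trans n≤x (m≤m*n x x))) ⟩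
    4 * (x * x) * (x * x + x * x) ≡⟨ solve 1 (λ x → con 4 :* (x :* x) :* (x :* x :+ x :* x) := con 8 :* (x :* (x :* (x :* (x :* con 1))))) refl x ⟩
    2 ^ 3 * x ^ 4 ≤⟨ scale 3 4 ⟩
    x ^ 7 ∎) ≤-refl

  4m<β : 4 * m + 3 < β
  4m<β = ≤β {4} (begin
    4 * m + 3 ≤⟨ 4m≤ (≤ᵇ⇒≤ 3 4 tt) ⟩
    4 * (x * x) ≡⟨ cong (4 *_) x²≡ ⟩
    2 ^ 2 * x ^ 2 ≤⟨ scale 2 2 ⟩
    x ^ 4 ∎) (≤ᵇ⇒≤ 4 7 tt)

  m<β : m < β
  m<β = ≤-<-trans (≤-trans (m≤n*m m 4) (m≤m+n _ 3)) 4m<β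

  m+n<β : m + n < β
  m+n<β = ≤-<-trans (m≤n*m (m + n) (4 * m + 1) {{>-nonZero (m≤n+m 1 (4 * m))}}) F<β

  M<β : b ^ c < β
  M<β = ≤-<-trans (b^≤ c) (^-monoʳ-< x (s≤s (s≤s z≤n)) (m<m+n (2 * c) (s≤s z≤n)))

  n<M : n < b ^ c
  n<M = <-≤-trans n<b (≤-trans (≤-reflexive (sym (*-identityʳ b))) (b≤M {1} (s≤s z≤n)))

  2m<M : m + m < b ^ c
  2m<M = ≤-<-trans 2m≤b² (<-≤-trans (^-monoʳ-< b 2≤b (n<1+n 2)) (b≤M {3} (≤ᵇ⇒≤ 3 8 tt)))

  N²≤M : (m + m) * (m + m) + (m + m) * (m + m) ≤ b ^ c
  N²≤M = begin
    (m + m) * (m + m) + (m + m) * (m + m) ≤⟨ +-mono-≤ (*-mono-≤ 2m≤b² 2m≤b²) (*-mono-≤ 2m≤b² 2m≤b²) ⟩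
    b ^ 2 * b ^ 2 + b ^ 2 * b ^ 2 ≡⟨ solve 1 (λ b → b :* (b :* con 1) :* (b :* (b :* con 1)) :+ b :* (b :* con 1) :* (b :* (b :* con 1)) := con 2 :* (b :* (b :* (b :* (b :* con 1))))) refl b ⟩
    2 * b ^ 4 ≤⟨ *-monoˡ-≤ (b ^ 4) 2≤b ⟩
    b ^ 5 ≤⟨ b≤M (≤ᵇ⇒≤ 5 8 tt) ⟩
    b ^ c ∎

  fits : ∀ {N} → N ≤ m + m → (2 + N) ^ wf ≤ b ^ c
  fits {N} N≤ = begin
    (2 + N) ^ wf ≤⟨ ^-monoˡ-≤ wf (≤-trans (+-monoʳ-≤ 2 (≤-trans N≤ 2m≤)) (≤-trans (m≤m+n _ (4 * n + 2)) (≤-trans (≤-reflexive (solve 1 (λ n → con 2 :+ n :* n :+ (con 4 :* n :+ con 2) := (con 2 :+ n) :* (con 2 :+ n)) refl n)) (≤-trans (*-mono-≤ x≤b x≤b) (≤-reflexive b²≡))))) ⟩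
    (b ^ 2) ^ wf ≡⟨ ^-*-assoc b 2 wf ⟩
    b ^ (2 * wf) ≤⟨ ^-monoʳ-≤ b (≤-trans (m≤m+n (2 * wf) 8) (≤-reflexive (sym c≡))) ⟩
    b ^ c ∎

  -- A bound for the numbers of scratch tables: the 2m + 2 rounds use at most n each, and 2m ≤ n².
  ids : ℕ
  ids = b ^ 3

  ids≥ : 7 + (m + m + 2) * n + n ≤ ids
  ids≥ = begin
    7 + (m + m + 2) * n + n ≤⟨ +-monoˡ-≤ n (+-monoʳ-≤ 7 (*-monoˡ-≤ n (+-monoˡ-≤ 2 2m≤))) ⟩
    7 + (n * n + 2) * n + n ≤⟨ m≤m+n _ (6 * (n * n) + 9 * n + 1) ⟩
    7 + (n * n + 2) * n + n + (6 * (n * n) + 9 * n + 1) ≡⟨ solve 1 (λ n → con 7 :+ (n :* n :+ con 2) :* n :+ n :+ (con 6 :* (n :* n) :+ con 9 :* n :+ con 1) := (con 2 :+ n) :* ((con 2 :+ n) :* ((con 2 :+ n) :* con 1))) refl n ⟩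
    x ^ 3 ≤⟨ ^-monoˡ-≤ 3 x≤b ⟩
    b ^ 3 ∎

  idb : ids * b * b ≤ b ^ c
  idb = ≤-trans (≤-reflexive (solve 1 (λ b → b :* (b :* (b :* con 1)) :* b :* b := b :* (b :* (b :* (b :* (b :* con 1))))) refl b)) (b≤M {5} (≤ᵇ⇒≤ 5 8 tt))

  idM : ids * b ^ c < β
  idM = ≤-<-trans (≤-trans (≤-reflexive (sym (^-distribˡ-+-* b 3 c))) (b^≤ (3 + c)))
    (^-monoʳ-< x (s≤s (s≤s z≤n)) (≤-trans (≤-reflexive (cong suc (*-distribˡ-+ 2 3 c))) (≤-trans (≤-reflexive (solve 1 (λ c → con 7 :+ con 2 :* c := con 2 :* c :+ con 7) refl c)) (+-monoʳ-≤ (2 * c) (n≤1+n 7)))))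

record Multiplier (mc : Machine) (gl : Consts) (P : Algorithm) : Set where
  open Machine mc
  field
    mult : MultipliesMatrices P
    w′ : ℕ
    w′≤w : w′ ≤ w
    M≡ : Consts.cM gl ≡ 2 ^ w′
  M : ℕ
  M = 2 ^ w′
  field
    M≤β : M ≤ β
    κ≥ : registers (code P) + factor (code P) + 10 ≤ κ
    n<M : Consts.cn gl < M

-- `J` bounds the numbers of scratch tables. By `idb` the tables end below M, while the matrix
-- region with number i ≥ 1 starts at i M; hence tables and regions are disjoint. By `idM` the
-- starts of the regions stay below β.
record Bounds (mc : Machine) (gl : Consts) {P : Algorithm} (multiplier : Multiplier mc gl P) : Set where
  open Machine mc
  open Multiplier multiplier
  private
    n = Consts.cn gl
    m = Consts.cm gl
    b = Consts.cb gl
  field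
    S≡ : Consts.cS gl ≡ m + n
    fits : ∀ {N} → N ≤ m + m → FitsWords P N w′
    2m<M : m + m < M
    N²≤M : (m + m) * (m + m) + (m + m) * (m + m) ≤ M
    J : ℕ
    J< : 7 + (m + m + 2) * n + n ≤ J
    idb : J * b * b ≤ M
    idM : J * M < β
    3n< : 3 * n + 1 < β
    n+2< : n + 2 < β
    ans< : n * (n * n + n * n) + (n * n + n * n) < β
    F< : (4 * m + 1) * (m + n) < β
    4m< : 4 * m + 3 < β

-- Correctness of the phases

module Phases (mc : Machine) (gl : Consts) (tables : Tables (Consts.cn gl)) (n<b : Consts.cn gl < Consts.cb gl)
  (b³≤β : Consts.cb gl * Consts.cb gl * Consts.cb gl ≤ Machine.β mc) where

  open Machine mc
  open Consts gl using () renaming (cn to n; cb to b)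
  open Logic mc
  open Tables tables
  open Stored

  0<b : 0 < b
  0<b = ≤-trans (s≤s z≤n) n<b

  n<β : n < β
  n<β = <-≤-trans n<b (≤-trans (≤-trans (m≤m*n b b {{>-nonZero 0<b}}) (m≤m*n (b * b) b {{>-nonZero 0<b}})) b³≤β)

  outside≡ : ∀ {μ v x} → Stored b μ → v < n → x < n →
    ([ v < x ] + [ x < v ]) * [ μ (cellℕ b 3 v x) < 1 ] ≡ out v x
  outside≡ {v = v} {x} st v<n x<n = cong (λ z → ([ v < x ] + [ x < v ]) * [ z < 1 ]) (matrix st v<n x<n)

  -- c counts the common neighbours of x and y outside N[v], so the two numbers are equal iff
  -- the triangle {v, x, y} dominates.
  balanced : ℕ → ℕ → ℕ
  balanced x y = [ [ x < y ] + [ y < x ] < 1 ]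

  tested : ℕ → ℕ → ℕ → ℕ → ℕ
  tested v x y c = a v x * a v y * a x y * balanced (dOut v x + dOut v y + deg v + 1) (n + c)

  balanced≤1 : ∀ x y → balanced x y ≤ 1
  balanced≤1 x y = [<]≤1 ([ x < y ] + [ y < x ]) 1

  tested≤1 : ∀ v x y c → tested v x y c ≤ 1
  tested≤1 v x y c = *-mono-≤ {a v x * a v y * a x y} (*-mono-≤ {a v x * a v y} (*-mono-≤ {a v x} (a≤1 v x) (a≤1 v y)) (a≤1 x y)) (balanced≤1 (dOut v x + dOut v y + deg v + 1) (n + c))

  OuterTable : ℕ → Mem → Set
  OuterTable v μ = ∀ x → x < n → μ (cellℕ b 5 0 x) ≡ dOut v x

  test-ok : ∀ {x y} l {μ} (let vs = gl ▹ l; v = vs rv; X = vs x; Y = vs y) →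
    {sx : T (simple (adjacent (` rv) (` x) ⊛ adjacent (` rv) (` y) ⊛ adjacent (` x) (` y)))} →
    {sy : T (simple (outer (` x) ⊕ outer (` y) ⊕ degree (` rv) ⊕ # 1))} →
    v < n → X < n → Y < n → Stored b μ → OuterTable v μ → vs rans + 1 < β → 3 * n + 1 < β →
    Run (test x y) vs μ (λ vs′ μ′ t → μ′ ≡ μ × t ≤ 3 × ∃ λ j →
      vs′ ≡ vs [ rfuel ≔ j ] [ rans ≔ tested v X Y (vs racc) + vs rans ])
  test-ok {x} {y} l {μ} {sx} {sy} v<n X<n Y<n st ot ans< 3n< =
    settle (branch {se = sx}
      (λ nz → sequence (assign {se = sy} (dOut v X + dOut v Y + deg v + 1)
        (cong₂ (λ p q → p + q + 1) (cong₂ _+_ (ot X X<n) (ot Y Y<n)) (degrees st v<n))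
        (≤-<-trans (+-monoˡ-≤ 1 (≤-trans (+-mono-≤ (+-mono-≤ (dOut≤ v X) (dOut≤ v Y)) (deg≤ v<n)) (≤-reflexive (solve 1 (λ n → n :+ n :+ n := con 3 :* n) refl n)))) 3n<)
        (assign (tested v X Y c + vs rans)
          (trans (cong (vs rans +_) (sym (trans (cong (_* bal) (one nz)) (+-identityʳ bal)))) (+-comm (vs rans) (tested v X Y c)))
          (≤-<-trans (≤-trans (≤-reflexive (+-comm (tested v X Y c) (vs rans))) (+-monoʳ-≤ (vs rans) (tested≤1 v X Y c))) ans<)
          (_ , (refl , ≤-refl , _ , refl) , ✓))))
      (λ z → nothing (_ , (refl , s≤s (s≤s z≤n) , vs rfuel , refl)
        , ✓ans (cong (λ r → r * bal + vs rans) (trans (sym weight) z)))))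
    where
    vs = gl ▹ l
    v = vs rv
    X = vs x
    Y = vs y
    c = vs racc
    bal = balanced (dOut v X + dOut v Y + deg v + 1) (n + c)
    weight : eval vs μ (adjacent (` rv) (` x) ⊛ adjacent (` rv) (` y) ⊛ adjacent (` x) (` y)) ≡ a v X * a v Y * a X Y
    weight = cong₂ _*_ (cong₂ _*_ (matrix st v<n X<n) (matrix st v<n Y<n)) (matrix st X<n Y<n)
    one : eval vs μ (adjacent (` rv) (` x) ⊛ adjacent (` rv) (` y) ⊛ adjacent (` x) (` y)) ≢ 0 → a v X * a v Y * a X Y ≡ 1
    one nz with ≤1 (*-mono-≤ {a v X * a v Y} (*-mono-≤ {a v X} (a≤1 v X) (a≤1 v Y)) (a≤1 X Y))
    ... | inj₁ e = contradiction (trans weight e) nz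
    ... | inj₂ e = e

  -- The sum along the list becomes a sum over all vertices by `enumerates`.
  outer-row : ∀ l {μ} (let vs = gl ▹ l; v = vs rv; u = vs ru) → v < n → u < n → Stored b μ →
    Run (for ri (degree (` ru)) ((rp ≔ neighbour (` ru) (` ri)) ⨟ (racc ≔ ` racc ⊕ outside (` rp))))
      (vs [ racc ≔ 0 ]) μ
      (λ vs′ μ′ t → μ′ ≡ μ × t ≤ 2 + deg u * 3 ×
        ∃ λ i → ∃ λ p → vs′ ≡ vs [ ri ≔ i ] [ rp ≔ p ] [ racc ≔ dOut v u ])
  outer-row l {μ} v<n u<n st =
    iterate
      (λ i vs′ μ′ → μ′ ≡ μ × ∃ λ p → vs′ ≡ vs [ ri ≔ i ] [ rp ≔ p ] [ racc ≔ ∑ i (λ j → out v (nb u j)) ])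
      (deg u) (λ _ → 2) (≤-<-trans (deg≤ u<n) n<β)
      (λ { (refl , p , refl) → refl , degrees st u<n })
      (λ { {i} i< (refl , p , refl) →
        sequence (assign (nb u i) (lists st u<n i<) (<-trans (nb< u<n i<) n<β)
          (assign (∑ i (λ j → out v (nb u j)) + out v (nb u i))
            (cong (∑ i (λ j → out v (nb u j)) +_) (outside≡ {μ} {v} {nb u i} st v<n (nb< u<n i<)))
            (≤-<-trans (≤-trans (∑-≤ (suc i) (λ {j} _ → out≤1 v (nb u j))) (≤-reflexive (*-identityʳ (suc i)))) (≤-<-trans (≤-trans i< (deg≤ u<n)) n<β))
            (≤-refl , refl , _ , (refl , nb u i , refl) , ✓))) })
      (_ , (refl , vs rp , refl) , ✓)
      (λ { (refl , p , refl) t≤ → refl , ≤-trans t≤ (+-monoʳ-≤ 2 (≤-reflexive (∑-const (deg u) 3))) , deg u , p ,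
             cong (λ z → vs [ ri ≔ deg u ] [ rp ≔ p ] [ racc ≔ z ]) (enumerates u<n (out v)) })
    where
    vs = gl ▹ l
    v = vs rv
    u = vs ru

  outerPhase-ok : ∀ l {μ} (let vs = gl ▹ l; v = vs rv) → v < n → Stored b μ →
    Run outerPhase vs μ (λ vs′ μ′ t → t ≤ 2 + ∑ n (λ u → 5 + deg u * 3) ×
      Below (5 * b * b) μ μ′ × Above (6 * b * b) μ μ′ × OuterTable v μ′ ×
      ∃ λ u → ∃ λ i → ∃ λ p → ∃ λ c → vs′ ≡ vs [ ru ≔ u ] [ ri ≔ i ] [ rp ≔ p ] [ racc ≔ c ])
  outerPhase-ok l {μ} v<n st =
    iterate
      (λ u vs′ μ′ → Below (5 * b * b) μ μ′ × Above (6 * b * b) μ μ′ × (∀ x → x < u → μ′ (cellℕ b 5 0 x) ≡ dOut v x) ×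
        ∃ λ i → ∃ λ p → ∃ λ c → vs′ ≡ vs [ ru ≔ u ] [ ri ≔ i ] [ rp ≔ p ] [ racc ≔ c ])
      n (λ u → 4 + deg u * 3) n<β
      (λ { (_ , _ , _ , _ , _ , _ , refl) → refl , refl })
      (λ { {u} {μ = μ₁} u<n (lo , hi , ot , i , p , c , refl) →
        let l₁ = vs [ ru ≔ u ] [ ri ≔ i ] [ rp ≔ p ] [ racc ≔ c ] in
        sequence (assign 0 refl (≤-<-trans z≤n n<β)
        (sequence (restart ((gl ▹ l₁) [ racc ≔ 0 ]) ✓ (weaken (outer-row l₁ v<n u<n (stored-below n<b (below-≤ 4≤5 lo) st))
          λ { (refl , t≤ , i′ , p′ , refl) →
            set (cellℕ b 5 0 u) (dOut v u) refl refl (≤-<-trans (dOut≤ v u) n<β)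
              (s≤s (≤-trans (≤-reflexive (+-comm _ 1)) (s≤s t≤)) , refl
              , _ , (below-set {a = cellℕ b 5 0 u} {dOut v u} (cell-≥ b 5 0 u) lo
                    , above-set {μ′ = μ₁} {cellℕ b 5 0 u} {dOut v u} (cell-< {k = 5} 0<b (<-trans u<n n<b)) hi
                    , (λ x x<1+u → entry μ₁ ot x<1+u (x ≟ u)) , i′ , p′ , dOut v u , refl)
              , ✓) })))) })
      (_ , (below-refl , above-refl , (λ _ ()) , vs ri , vs rp , vs racc , refl) , ✓)
      (λ { (lo , hi , ot , i , p , c , refl) t≤ → t≤ , lo , hi , ot , n , i , p , c , refl })
    where
    vs = gl ▹ l
    v = vs rv
    4≤5 : 4 * b * b ≤ 5 * b * b
    4≤5 = *-monoˡ-≤ b (*-monoˡ-≤ b (n≤1+n 4))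
    entry : ∀ μ₁ {u x} → (∀ x → x < u → μ₁ (cellℕ b 5 0 x) ≡ dOut v x) → x < suc u → Dec (x ≡ u) →
            (μ₁ [ cellℕ b 5 0 u ↦ dOut v u ]) (cellℕ b 5 0 x) ≡ dOut v x
    entry μ₁ ot x< (yes refl) = update-same μ₁ _ refl
    entry μ₁ {u} ot x< (no x≢u) =
      trans (update-other μ₁ _ (x≢u ∘ +-cancelˡ-≡ ((5 * b + 0) * b) _ _)) (ot _ (≤∧≢⇒< (≤-pred x<) x≢u))


  Tab : ℕ → Mem → (ℕ → ℕ → ℕ) → Set
  Tab k μ f = ∀ x y → x < n → y < n → μ (cellℕ b k x y) ≡ f x y

  -- By definition this is `shared` of `Dominating`, so the counting criterion proved there applies
  -- to `tested` directly.
  com : ℕ → ℕ → ℕ → ℕ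
  com v u p = ∑ n (λ x → a u x * (a p x * out v x))

  lowTests : ℕ → ℕ → ℕ
  lowTests v u = ∑ n (λ x → a u x * tested v u x (com v u x))

  -- The part of the row of u that the first k entries of its list account for; by `occurs-all` it
  -- is complete at k = deg u.
  occurs : ℕ → ℕ → ℕ → ℕ
  occurs u k y = ∑ k (λ j → δ (nb u j) y)

  occurs-all : ∀ {u y} → u < n → y < n → occurs u (deg u) y ≡ a u y
  occurs-all {u} {y} u<n y<n = trans (enumerates u<n (λ x → δ x y))
    (trans (∑-cong n λ {x} _ → *-comm (a u x) (δ x y)) (∑-δ n (a u) y<n))

  occurs≤1 : ∀ {u y k} → u < n → y < n → k ≤ deg u → occurs u k y ≤ 1
  occurs≤1 {u} {y} u<n y<n k≤ =
    ≤-trans (∑-prefix (λ j → δ (nb u j) y) k≤) (≤-trans (≤-reflexive (occurs-all u<n y<n)) (a≤1 u y))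

  δ≤1 : ∀ x y → δ x y ≤ 1
  δ≤1 x y with x ≡ᵇ y
  ... | true  = ≤-refl
  ... | false = z≤n

  -- Only row p of the table changes: each neighbour y of u gains u as a common neighbour with p,
  -- provided that u is outside N[v].
  pairs-ok : ∀ l {μ} f (let vs = gl ▹ l; v = vs rv; u = vs ru; p = vs rp; id = vs rid) →
    v < n → u < n → p < n → 4 ≤ id → Stored b μ → Tab id μ f → (∀ {x y} → x < n → y < n → f x y + 1 < β) →
    Run (for rk (degree (` ru)) pairBody) (vs [ racc ≔ 0 ]) μ (λ vs′ μ′ t → t ≤ 2 + deg u * 4 ×
      Below (id * b * b) μ μ′ × Above (suc id * b * b) μ μ′ ×
      Tab id μ′ (λ x y → f x y + δ x p * (a u y * out v u)) ×
      ∃ λ k → ∃ λ q → vs′ ≡ vs [ rk ≔ k ] [ rq ≔ q ] [ racc ≔ com v u p ])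
  pairs-ok l {μ} f v<n u<n p<n 4≤id st tab f< =
    iterate
      (λ k vs′ μ′ → Below (id * b * b) μ μ′ × Above (suc id * b * b) μ μ′ × Tab id μ′ (g k) ×
        ∃ λ q → vs′ ≡ vs [ rk ≔ k ] [ rq ≔ q ] [ racc ≔ ac k ])
      (deg u) (λ _ → 3) (≤-<-trans (deg≤ u<n) n<β)
      (λ { (lo , _ , _ , q , refl) → refl , degrees (kept lo) u<n })
      (λ { {k} {μ = μ₁} k< (lo , hi , tb , q , refl) →
        sequence (assign (nb u k) (lists (kept lo) u<n k<) (<-trans (nb< u<n k<) n<β)
        (sequence (set (cellℕ b id p (nb u k)) (g (suc k) p (nb u k)) refl
            (value {μ₁} {k} {([ v < u ] + [ u < v ]) * [ μ₁ (cellℕ b 3 v u) < 1 ]} k< tb (outside≡ {μ₁} {v} {u} (kept lo) v<n u<n))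
            (g< k< p<n (nb< u<n k<))
        (assign (ac (suc k))
            (cong (ac k +_) (cong₂ _*_ (matrix (kept (lo₁ μ₁ k lo)) p<n (nb< u<n k<)) (outside≡ {v = v} {nb u k} (kept (lo₁ μ₁ k lo)) v<n (nb< u<n k<))))
            (ac< k<)
            (≤-refl , refl
            , _ , (lo₁ μ₁ k lo
                  , above-set {μ′ = μ₁} {cellℕ b id p (nb u k)} {g (suc k) p (nb u k)} (cell-< {k = id} (<-trans p<n n<b) (<-trans (nb< u<n k<) n<b)) hi
                  , (λ x y x< y< → entry {μ₁} k< tb x< y<) , nb u k , refl)
            , ✓))))) })
      (_ , (below-refl , above-refl , (λ x y x< y< → trans (tab x y x< y<) (sym (trans (cong (f x y +_) (*-zeroʳ (δ x p))) (+-identityʳ _)))) , vs rq , refl) , ✓)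
      (λ { (lo , hi , tb , q , refl) t≤ → ≤-trans t≤ (+-monoʳ-≤ 2 (≤-reflexive (∑-const (deg u) 4))) , lo , hi ,
           (λ x y x< y< → trans (tb x y x< y<) (cong (λ z → f x y + δ x p * (z * out v u)) (occurs-all u<n y<))) , deg u , q ,
           cong (λ z → vs [ rk ≔ deg u ] [ rq ≔ q ] [ racc ≔ z ]) (enumerates u<n (λ x → a p x * out v x)) })
    where
    vs = gl ▹ l
    v = vs rv
    u = vs ru
    p = vs rp
    id = vs rid
    g : ℕ → ℕ → ℕ → ℕ
    g k x y = f x y + δ x p * (occurs u k y * out v u)
    ac : ℕ → ℕ
    ac k = ∑ k (λ j → a p (nb u j) * out v (nb u j))
    kept : ∀ {μ′} → Below (id * b * b) μ μ′ → Stored b μ′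
    kept lo = stored-below n<b (below-≤ (*-monoˡ-≤ b (*-monoˡ-≤ b 4≤id)) lo) st
    lo₁ : ∀ μ₁ k → Below (id * b * b) μ μ₁ →
          Below (id * b * b) μ (μ₁ [ cellℕ b id p (nb u k) ↦ g (suc k) p (nb u k) ])
    lo₁ μ₁ k lo = below-set (cell-≥ b id p (nb u k)) lo
    value : ∀ {μ₁ k o} → k < deg u → Tab id μ₁ (g k) → o ≡ out v u →
            μ₁ (cellℕ b id p (nb u k)) + o ≡ g (suc k) p (nb u k)
    value {μ₁} {k} k< tb refl = trans (cong (_+ out v u) (tb p (nb u k) p<n (nb< u<n k<)))
      (trans (cong (λ z → f p q + z * (occurs u k q * out v u) + out v u) (δ-same {p} refl))
      (trans (solve 3 (λ f s o → f :+ con 1 :* (s :* o) :+ o := f :+ con 1 :* ((s :+ con 1) :* o)) refl (f p q) (occurs u k q) (out v u))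
        (cong₂ (λ z z′ → f p q + z * ((occurs u k q + z′) * out v u)) (sym (δ-same {p} refl)) (sym (δ-same {q} refl)))))
      where q = nb u k
    g< : ∀ {k x y} → k < deg u → x < n → y < n → g (suc k) x y < β
    g< {k} {x} {y} k< x< y< = ≤-<-trans (+-monoʳ-≤ (f x y)
      (*-mono-≤ {δ x p} (δ≤1 x p) (*-mono-≤ {occurs u (suc k) y} (occurs≤1 u<n y< k<) (out≤1 v u)))) (f< x< y<)
    ac< : ∀ {k} → k < deg u → ac (suc k) < β
    ac< {k} k< = ≤-<-trans (∑-≤ (suc k) λ {j} _ → *-mono-≤ {a p (nb u j)} (a≤1 p (nb u j)) (out≤1 v (nb u j)))
      (≤-<-trans (≤-reflexive (*-identityʳ (suc k))) (≤-<-trans (≤-trans k< (deg≤ u<n)) n<β))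
    entry : ∀ {μ₁ k x y} → k < deg u → Tab id μ₁ (g k) → x < n → y < n →
            (μ₁ [ cellℕ b id p (nb u k) ↦ g (suc k) p (nb u k) ]) (cellℕ b id x y) ≡ g (suc k) x y
    entry {μ₁} {k} {x} {y} k< tb x< y< with x ≟ p | y ≟ nb u k
    ... | yes refl | yes refl = update-same μ₁ (cellℕ b id p (nb u k)) refl
    ... | yes refl | no y≢ =
      trans (update-other μ₁ (cellℕ b id p (nb u k)) (y≢ ∘ proj₂ ∘ cell-injective b {id} {x} {y} {id} {p} (<-trans x< n<b) (<-trans y< n<b) (<-trans p<n n<b) (<-trans (nb< u<n k<) n<b)))
        (trans (tb x y x< y<) (cong (λ z → f x y + δ x p * (z * out v u)) (sym (trans (cong (occurs u k y +_) (δ-other (y≢ ∘ sym))) (+-identityʳ _)))))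
    ... | no x≢ | _ =
      trans (update-other μ₁ (cellℕ b id p (nb u k)) (x≢ ∘ proj₁ ∘ cell-injective b {id} {x} {y} {id} {p} (<-trans x< n<b) (<-trans y< n<b) (<-trans p<n n<b) (<-trans (nb< u<n k<) n<b)))
        (trans (tb x y x< y<) (cong (f x y +_) (trans (cong (_* (occurs u k y * out v u)) (δ-other x≢)) (sym (cong (_* (occurs u (suc k) y * out v u)) (δ-other x≢))))))

  below-outer : ∀ {v μ μ′} → Below (6 * b * b) μ μ′ → OuterTable v μ → OuterTable v μ′
  below-outer lo ot x x<n = trans (Below.at lo (cell-< {k = 5} 0<b (<-trans x<n n<b))) (ot x x<n)

  tables≤ : ∀ {j k} → j ≤ k → j * b * b ≤ k * b * b
  tables≤ j≤k = *-monoˡ-≤ b (*-monoˡ-≤ b j≤k)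

  lowRow-ok : ∀ l {μ} f (let vs = gl ▹ l; v = vs rv; u = vs ru; id = vs rid) →
    v < n → u < n → 6 ≤ id → Stored b μ → OuterTable v μ → Tab id μ f →
    (∀ {x y} → x < n → y < n → f x y + 2 < β) → vs rans + n < β → 3 * n + 1 < β →
    Run (for ri (degree (` ru)) lowBody) vs μ (λ vs′ μ′ t → t ≤ 2 + deg u * (8 + deg u * 4) ×
      Below (id * b * b) μ μ′ × Above (suc id * b * b) μ μ′ ×
      Tab id μ′ (λ x y → f x y + a u x * (a u y * out v u)) ×
      ∃ λ i → ∃ λ p → ∃ λ k → ∃ λ q → ∃ λ c → ∃ λ j →
        vs′ ≡ vs [ ri ≔ i ] [ rp ≔ p ] [ rk ≔ k ] [ rq ≔ q ] [ racc ≔ c ] [ rfuel ≔ j ]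
                 [ rans ≔ lowTests v u + vs rans ])
  lowRow-ok l {μ} f v<n u<n 6≤id st ot tab f< ans< 3n< =
    iterate
      (λ i vs′ μ′ → Below (id * b * b) μ μ′ × Above (suc id * b * b) μ μ′ × Tab id μ′ (g i) ×
        ∃ λ p → ∃ λ k → ∃ λ q → ∃ λ c → ∃ λ j →
        vs′ ≡ vs [ ri ≔ i ] [ rp ≔ p ] [ rk ≔ k ] [ rq ≔ q ] [ racc ≔ c ] [ rfuel ≔ j ] [ rans ≔ total i + vs rans ])
      (deg u) (λ _ → 7 + deg u * 4) (≤-<-trans (deg≤ u<n) n<β)
      (λ { (lo , _ , _ , p , k , q , c , j , refl) → refl , degrees (kept lo) u<n })
      (λ { {i} {μ = μ₁} i< (lo , hi , tb , p , k , q , c , j , refl) →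
        let l₁ = vs [ ri ≔ i ] [ rp ≔ nb u i ] [ rk ≔ k ] [ rq ≔ q ] [ racc ≔ c ] [ rfuel ≔ j ] [ rans ≔ total i + vs rans ] in
        sequence (assign (nb u i) (lists (kept lo) u<n i<) (<-trans (nb< u<n i<) n<β)
        (sequence (assign 0 refl (≤-<-trans z≤n n<β)
        (sequence (restart ((gl ▹ l₁) [ racc ≔ 0 ]) ✓
            (weaken (pairs-ok l₁ (g i) v<n u<n (nb< u<n i<) (≤-trans (few {4} {6} _) 6≤id) (kept lo) tb (λ x< y< → g< i< x< y<))
          λ { {μ′ = μ₂} (t≤ , lo′ , hi′ , tb′ , k′ , q′ , refl) →
            let l₂ = l₁ [ rk ≔ k′ ] [ rq ≔ q′ ] [ racc ≔ com v u (nb u i) ] in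
            restart (gl ▹ l₂) ✓
            (weaken (test-ok {ru} {rp} l₂ v<n u<n (nb< u<n i<) (kept {μ₂} (below-trans lo lo′)) (kept′ {μ₂} (below-trans lo lo′)) (total< i<) 3n<)
            λ { (refl , t₂≤ , j′ , refl) →
              time t≤ t₂≤ , refl
              , _ , (below-trans lo lo′ , above-trans hi hi′
                    , (λ x y x< y< → trans (tb′ x y x< y<) (step i x y))
                    , nb u i , k′ , q′ , com v u (nb u i) , j′ , refl)
              , ✓ans (total-suc i) }) })))))) })
      (_ , (below-refl , above-refl , (λ x y x< y< → trans (tab x y x< y<) (sym (+-identityʳ _))) , vs rp , vs rk , vs rq , vs racc , vs rfuel , refl) , ✓)
      (λ { (lo , hi , tb , p , k , q , c , j , refl) t≤ →
        ≤-trans t≤ (+-monoʳ-≤ 2 (≤-reflexive (∑-const (deg u) _))) , lo , hi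
        , (λ x y x< y< → trans (tb x y x< y<) (cong (λ z → f x y + z * (a u y * out v u)) (occurs-all u<n x<)))
        , _ , p , k , q , c , j
        , cong (λ z → vs [ ri ≔ deg u ] [ rp ≔ p ] [ rk ≔ k ] [ rq ≔ q ] [ racc ≔ c ] [ rfuel ≔ j ] [ rans ≔ z + vs rans ])
            (enumerates u<n (λ x → tested v u x (com v u x))) })
    where
    vs = gl ▹ l
    v = vs rv
    u = vs ru
    id = vs rid
    few : ∀ {x y} → T (x ≤ᵇ y) → x ≤ y
    few {x} {y} = ≤ᵇ⇒≤ x y
    g : ℕ → ℕ → ℕ → ℕ
    g i x y = f x y + occurs u i x * (a u y * out v u)
    total : ℕ → ℕ
    total i = ∑ i (λ j → tested v u (nb u j) (com v u (nb u j)))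
    kept : ∀ {μ′} → Below (id * b * b) μ μ′ → Stored b μ′
    kept lo = stored-below n<b (below-≤ (tables≤ (≤-trans (few {4} {6} _) 6≤id)) lo) st
    kept′ : ∀ {μ′} → Below (id * b * b) μ μ′ → OuterTable v μ′
    kept′ lo = below-outer (below-≤ (tables≤ 6≤id) lo) ot
    g< : ∀ {i x y} → i < deg u → x < n → y < n → g i x y + 1 < β
    g< {i} {x} {y} i< x< y< = ≤-<-trans (+-monoˡ-≤ 1 (+-monoʳ-≤ (f x y)
      (*-mono-≤ {occurs u i x} (occurs≤1 u<n x< (<⇒≤ i<)) (*-mono-≤ {a u y} (a≤1 u y) (out≤1 v u)))))
      (≤-<-trans (≤-reflexive (+-assoc (f x y) 1 1)) (f< x< y<))
    total≤ : ∀ i → total i ≤ i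
    total≤ i = ≤-trans (∑-≤ i λ {j} _ → tested≤1 v u (nb u j) (com v u (nb u j))) (≤-reflexive (*-identityʳ i))
    total< : ∀ {i} → i < deg u → total i + vs rans + 1 < β
    total< {i} i< = ≤-<-trans (≤-reflexive (trans (cong (_+ 1) (+-comm (total i) (vs rans))) (+-assoc (vs rans) (total i) 1)))
      (≤-<-trans (+-monoʳ-≤ (vs rans) (≤-trans (+-monoˡ-≤ 1 (total≤ i)) (≤-trans (≤-reflexive (+-comm i 1)) (≤-trans i< (deg≤ u<n))))) ans<)
    step : ∀ i x y → g i x y + δ x (nb u i) * (a u y * out v u) ≡ g (suc i) x y
    step i x y = trans (cong (λ z → g i x y + z * (a u y * out v u)) (δ-comm x (nb u i)))
      (solve 4 (λ f s d o → f :+ s :* o :+ d :* o := f :+ (s :+ d) :* o) refl (f x y) (occurs u i x) (δ (nb u i) x) (a u y * out v u))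
    total-suc : ∀ i → total (suc i) + vs rans ≡ tested v u (nb u i) (com v u (nb u i)) + (total i + vs rans)
    total-suc i = trans (cong (_+ vs rans) (+-comm (total i) _)) (+-assoc _ (total i) (vs rans))
    time : ∀ {t₁ t₂} → t₁ ≤ 2 + deg u * 4 → t₂ ≤ 3 → 1 + (1 + (t₁ + t₂)) ≤ 7 + deg u * 4
    time {t₁} {t₂} t₁≤ t₂≤ = s≤s (s≤s (≤-trans (+-mono-≤ t₁≤ t₂≤) (≤-reflexive (+-comm (2 + deg u * 4) 3))))

  -- A vertex u costs a multiple of (deg u)². Skipping the high vertices replaces one factor by Δ,
  -- so that the sum over all vertices is O(Δ m + n).
  lowPhase-ok : ∀ l {μ} (let vs = gl ▹ l; v = vs rv; Δ = vs rΔ; id = vs rid) →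
    v < n → 6 ≤ id → Stored b μ → OuterTable v μ → Tab id μ (λ _ _ → 0) →
    vs rans + n * n < β → 3 * n + 1 < β → n + 2 < β →
    Run lowPhase vs μ (λ vs′ μ′ t → t ≤ 2 + ∑ n (λ u → 4 + deg u * (8 + Δ * 4)) ×
      Below (id * b * b) μ μ′ × Above (suc id * b * b) μ μ′ ×
      Tab id μ′ (λ x y → ∑ n (λ z → [ deg z < suc Δ ] * (a z x * (a z y * out v z)))) ×
      ∃ λ u → ∃ λ i → ∃ λ p → ∃ λ k → ∃ λ q → ∃ λ c → ∃ λ j →
        vs′ ≡ vs [ ru ≔ u ] [ ri ≔ i ] [ rp ≔ p ] [ rk ≔ k ] [ rq ≔ q ] [ racc ≔ c ] [ rfuel ≔ j ]
                 [ rans ≔ ∑ n (λ z → [ deg z < suc Δ ] * lowTests v z) + vs rans ])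
  lowPhase-ok l {μ} v<n 6≤id st ot zeros ans< 3n< n+2< =
    iterate
      (λ u vs′ μ′ → Below (id * b * b) μ μ′ × Above (suc id * b * b) μ μ′ × Tab id μ′ (g u) ×
        ∃ λ i → ∃ λ p → ∃ λ k → ∃ λ q → ∃ λ c → ∃ λ j →
        vs′ ≡ vs [ ru ≔ u ] [ ri ≔ i ] [ rp ≔ p ] [ rk ≔ k ] [ rq ≔ q ] [ racc ≔ c ] [ rfuel ≔ j ] [ rans ≔ total u + vs rans ])
      n (λ u → 3 + deg u * (8 + Δ * 4)) n<β
      (λ { (lo , _ , _ , i , p , k , q , c , j , refl) → refl , refl })
      (λ { {u} {μ = μ₁} u<n (lo , hi , tb , i , p , k , q , c , j , refl) →
        let l₁ = vs [ ru ≔ u ] [ ri ≔ i ] [ rp ≔ p ] [ rk ≔ k ] [ rq ≔ q ] [ racc ≔ c ] [ rfuel ≔ j ] [ rans ≔ total u + vs rans ] in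
        branch
          (λ nz → nothing (s≤s (s≤s z≤n) , refl
            , _ , (lo , hi
                  , (λ x y x< y< → trans (tb x y x< y<) (sym (trans (cong (λ z → g u x y + z * (a u x * (a u y * out v u))) (high-case {u} {μ₁} lo u<n nz)) (+-identityʳ _))))
                  , i , p , k , q , c , j , refl)
            , ✓ans (cong (_+ vs rans) (trans (cong (λ z → total u + z * lowTests v u) (high-case {u} {μ₁} lo u<n nz)) (+-identityʳ _)))))
          (λ z → restart (gl ▹ l₁) ✓
            (weaken (lowRow-ok l₁ (g u) v<n u<n 6≤id (kept lo) (kept′ lo) tb (λ x< y< → g< u<n) (total< u<n) 3n<)
            λ { (t≤ , lo′ , hi′ , tb′ , i′ , p′ , k′ , q′ , c′ , j′ , refl) →
              time u<n (low-case {u} {μ₁} lo u<n z) t≤ , refl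
              , _ , (below-trans lo lo′ , above-trans hi hi′
                    , (λ x y x< y< → trans (tb′ x y x< y<) (cong (g u x y +_) (sym (trans (cong (_* (a u x * (a u y * out v u))) (low≡1 (low-case {u} {μ₁} lo u<n z))) (+-identityʳ _)))))
                    , i′ , p′ , k′ , q′ , c′ , j′ , refl)
              , ✓ans (trans (cong (λ z → total u + z * lowTests v u + vs rans) (low≡1 (low-case {u} {μ₁} lo u<n z)))
                      (solve 3 (λ t x r → t :+ con 1 :* x :+ r := x :+ (t :+ r)) refl (total u) (lowTests v u) (vs rans))) })) })
      (_ , (below-refl , above-refl , zeros , vs ri , vs rp , vs rk , vs rq , vs racc , vs rfuel , refl) , ✓)
      (λ { (lo , hi , tb , i , p , k , q , c , j , refl) t≤ → t≤ , lo , hi , tb , n , i , p , k , q , c , j , refl })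
    where
    vs = gl ▹ l
    v = vs rv
    Δ = vs rΔ
    id = vs rid
    few : ∀ {x y} → T (x ≤ᵇ y) → x ≤ y
    few {x} {y} = ≤ᵇ⇒≤ x y
    g : ℕ → ℕ → ℕ → ℕ
    g u x y = ∑ u (λ z → [ deg z < suc Δ ] * (a z x * (a z y * out v z)))
    total : ℕ → ℕ
    total u = ∑ u (λ z → [ deg z < suc Δ ] * lowTests v z)
    kept : ∀ {μ′} → Below (id * b * b) μ μ′ → Stored b μ′
    kept lo = stored-below n<b (below-≤ (tables≤ (≤-trans (few {4} {6} _) 6≤id)) lo) st
    kept′ : ∀ {μ′} → Below (id * b * b) μ μ′ → OuterTable v μ′
    kept′ lo = below-outer (below-≤ (tables≤ 6≤id) lo) ot
    high-case : ∀ {u μ′} → Below (id * b * b) μ μ′ → u < n → [ Δ < μ′ (cellℕ b 1 0 u) ] ≢ 0 → [ deg u < suc Δ ] ≡ 0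
    high-case lo u<n nz = [<]-no (subst (suc Δ ≤_) (degrees (kept lo) u<n) ([<]-≢0 nz))
    low-case : ∀ {u μ′} → Below (id * b * b) μ μ′ → u < n → [ Δ < μ′ (cellℕ b 1 0 u) ] ≡ 0 → deg u ≤ Δ
    low-case lo u<n z = subst (_≤ Δ) (degrees (kept lo) u<n) ([<]-≡0 z)
    low≡1 : ∀ {u} → deg u ≤ Δ → [ deg u < suc Δ ] ≡ 1
    low≡1 d≤ = [<]-yes (s≤s d≤)
    g< : ∀ {u x y} → u < n → g u x y + 2 < β
    g< {u} {x} {y} u<n = ≤-<-trans (+-monoˡ-≤ 2 (≤-trans (∑-≤ u λ {z} _ →
        *-mono-≤ {[ deg z < suc Δ ]} ([<]≤1 (deg z) (suc Δ)) (*-mono-≤ {a z x} (a≤1 z x) (*-mono-≤ {a z y} (a≤1 z y) (out≤1 v z))))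
        (≤-trans (≤-reflexive (*-identityʳ u)) (<⇒≤ u<n)))) n+2<
    lowTests≤ : ∀ z → lowTests v z ≤ n
    lowTests≤ z = ≤-trans (∑-≤ n λ {x} _ → *-mono-≤ {a z x} (a≤1 z x) (tested≤1 v z x (com v z x))) (≤-reflexive (*-identityʳ n))
    total< : ∀ {u} → u < n → total u + vs rans + n < β
    total< {u} u<n = ≤-<-trans (≤-reflexive (trans (cong (_+ n) (+-comm (total u) (vs rans))) (+-assoc (vs rans) (total u) n)))
      (≤-<-trans (+-monoʳ-≤ (vs rans) (≤-trans (+-monoˡ-≤ n (∑-≤ u λ {z} _ →
          ≤-trans (*-mono-≤ {[ deg z < suc Δ ]} ([<]≤1 (deg z) (suc Δ)) (lowTests≤ z)) (≤-reflexive (+-identityʳ n))))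
        (≤-trans (≤-reflexive (+-comm (u * n) n)) (*-monoˡ-≤ n u<n)))) ans<)
    time : ∀ {u t} → u < n → deg u ≤ Δ → t ≤ 2 + deg u * (8 + deg u * 4) → suc t ≤ 3 + deg u * (8 + Δ * 4)
    time {u} u<n d≤ t≤ = s≤s (≤-trans t≤ (+-monoʳ-≤ 2 (*-monoʳ-≤ (deg u) (+-monoʳ-≤ 8 (*-monoˡ-≤ 4 d≤)))))

  module Grid (base N h : ℕ) (h≤N : h ≤ N) where

    leftℕ rightℕ : ℕ → ℕ → ℕ
    leftℕ r s = base + r * N + s
    rightℕ r s = base + N * N + r * N + s

    private
      inside : ∀ {r s} → r < h → s < h → r * N + s < N * N
      inside {r} {s} r< s< = <-≤-trans (+-monoʳ-< (r * N) (<-≤-trans s< h≤N))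
        (≤-trans (≤-reflexive (+-comm (r * N) N)) (*-monoˡ-≤ N (<-≤-trans r< h≤N)))

    left< : ∀ {r s} → r < h → s < h → leftℕ r s < base + N * N
    left< {r} {s} r< s< = ≤-trans (≤-reflexive (cong suc (+-assoc base (r * N) s))) (+-monoʳ-< base (inside r< s<))

    right≥ : ∀ r s → base + N * N ≤ rightℕ r s
    right≥ r s = ≤-trans (m≤m+n _ (r * N)) (m≤m+n _ s)

    right< : ∀ {r s} → r < h → s < h → rightℕ r s < base + (N * N + N * N)
    right< {r} {s} r< s< = <-≤-trans (≤-trans (≤-reflexive (cong suc (+-assoc (base + N * N) (r * N) s))) (+-monoʳ-< (base + N * N) (inside r< s<)))
      (≤-reflexive (+-assoc base (N * N) (N * N)))

    left≢right : ∀ {r s} r′ s′ → r < h → s < h → leftℕ r s ≢ rightℕ r′ s′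
    left≢right r′ s′ r< s< = <⇒≢ (<-≤-trans (left< r< s<) (right≥ r′ s′))

    left-injective : ∀ {r s r′ s′} → s < h → s′ < h → leftℕ r s ≡ leftℕ r′ s′ → r ≡ r′ × s ≡ s′
    left-injective {r} {s} {r′} {s′} s< s′< e =
      digits-injective N {r} {s} {r′} {s′} (<-≤-trans s< h≤N) (<-≤-trans s′< h≤N)
      (+-cancelˡ-≡ base _ _ (trans (sym (+-assoc base (r * N) s)) (trans e (+-assoc base (r′ * N) s′))))

    right-injective : ∀ {r s r′ s′} → s < h → s′ < h → rightℕ r s ≡ rightℕ r′ s′ → r ≡ r′ × s ≡ s′
    right-injective {r} {s} {r′} {s′} s< s′< e =
      digits-injective N {r} {s} {r′} {s′} (<-≤-trans s< h≤N) (<-≤-trans s′< h≤N)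
      (+-cancelˡ-≡ (base + N * N) _ _ (trans (sym (+-assoc (base + N * N) (r * N) s)) (trans e (+-assoc (base + N * N) (r′ * N) s′))))

    Untouched : ℕ → ℕ → Set
    Untouched r x = ∀ s → s < h → x ≢ leftℕ r s × x ≢ rightℕ r s

  HighList : ℕ → (ℕ → ℕ) → Mem → Set
  HighList h V μ = ∀ r → r < h → μ (cellℕ b 4 0 r) ≡ V r

  highList-below : ∀ {h V μ μ′} → h ≤ n → Below (5 * b * b) μ μ′ → HighList h V μ → HighList h V μ′
  highList-below h≤n lo hl r r< = trans (Below.at lo (cell-< {k = 4} 0<b (<-trans (<-≤-trans r< h≤n) n<b))) (hl r r<)

  fillRow : Stm
  fillRow = for rk (` rh)
    ((rp ≔ high (` ru)) ⨟ (rq ≔ high (` rk)) ⨟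
     (⟨ left (` ru) (` rk) ⟩≔ adjacent (` rp) (` rq) ⊛ outside (` rq)) ⨟
     (⟨ right (` ru) (` rk) ⟩≔ adjacent (` rp) (` rq)))

  module _ (v base N h : ℕ) (V : ℕ → ℕ) (v<n : v < n) (h≤N : h ≤ N) (h≤n : h ≤ n)
           (V<n : ∀ r → r < h → V r < n) (base≥ : 5 * b * b ≤ base) where

    open Grid base N h h≤N

    leftEntry rightEntry : ℕ → ℕ → ℕ
    leftEntry r s = a (V r) (V s) * out v (V s)
    rightEntry r s = a (V r) (V s)

    RowDone : ℕ → ℕ → Mem → Set
    RowDone r k μ = ∀ s → s < k → μ (leftℕ r s) ≡ leftEntry r s × μ (rightℕ r s) ≡ rightEntry r s

    private
      bounded : ∀ {x} → x ≤ 1 → x < β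
      bounded x≤1 = ≤-trans (s≤s x≤1) (≤-trans (s≤s (s≤s z≤n)) 8≤β)

      left≤1 : ∀ r s → leftEntry r s ≤ 1
      left≤1 r s = *-mono-≤ {a (V r) (V s)} (a≤1 (V r) (V s)) (out≤1 v (V s))

      4≤5 : 4 * b * b ≤ 5 * b * b
      4≤5 = *-monoˡ-≤ b (*-monoˡ-≤ b (n≤1+n 4))

    -- The clause on untouched cells is what keeps the padding of the matrices zero.
    fillRow-ok : ∀ l {μ} (let vs = gl ▹ l; r = vs ru) → vs rv ≡ v → vs rbase ≡ base → vs rN ≡ N → vs rh ≡ h →
      r < h → Stored b μ → HighList h V μ →
      Run fillRow vs μ (λ vs′ μ′ t → t ≤ 2 + h * 5 × Below base μ μ′ × RowDone r h μ′ ×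
        (∀ x → Untouched r x → μ′ x ≡ μ x) ×
        ∃ λ k → ∃ λ p → ∃ λ q → vs′ ≡ vs [ rk ≔ k ] [ rp ≔ p ] [ rq ≔ q ])
    fillRow-ok l {μ} refl refl refl refl r<h st hl =
      iterate
        (λ k vs′ μ′ → Below base μ μ′ × RowDone r k μ′ × (∀ x → Untouched r x → μ′ x ≡ μ x) ×
          ∃ λ p → ∃ λ q → vs′ ≡ vs [ rk ≔ k ] [ rp ≔ p ] [ rq ≔ q ])
        h (λ _ → 4) (≤-<-trans h≤n n<β)
        (λ { (_ , _ , _ , _ , _ , refl) → refl , refl })
        (λ { {k} {μ = μ₁} k<h (lo , dn , unt , p , q , refl) →
          sequence (assign (V r) (kept-high lo r r<h) (<-trans (V<n r r<h) n<β)
          (sequence (assign (V k) (kept-high lo k k<h) (<-trans (V<n k k<h) n<β)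
          (sequence (set (leftℕ r k) (leftEntry r k) refl
            (cong₂ _*_ (matrix (kept lo) (V<n r r<h) (V<n k k<h)) (outside≡ {μ₁} {v} {V k} (kept lo) v<n (V<n k k<h)))
            (bounded (left≤1 r k))
          (set (rightℕ r k) (rightEntry r k) refl
            (matrix (kept (lo₁ μ₁ k lo)) (V<n r r<h) (V<n k k<h))
            (bounded (a≤1 (V r) (V k)))
            (≤-refl , refl
            , _ , (lo₂ μ₁ k lo , row μ₁ k<h dn , (λ x u → trans (skip₂ μ₁ (u k k<h)) (unt x u)) , V r , V k , refl)
            , ✓))))))) })
        (_ , (below-refl , (λ _ ()) , (λ _ _ → refl) , vs rp , vs rq , refl) , ✓)
        (λ { (lo , dn , unt , p , q , refl) t≤ →
          ≤-trans t≤ (+-monoʳ-≤ 2 (≤-reflexive (∑-const h 5))) , lo , dn , unt , h , p , q , refl })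
      where
      vs = gl ▹ l
      r = vs ru
      kept : ∀ {μ′} → Below base μ μ′ → Stored b μ′
      kept lo = stored-below n<b (below-≤ (≤-trans 4≤5 base≥) lo) st
      kept-high : ∀ {μ′} → Below base μ μ′ → HighList h V μ′
      kept-high lo = highList-below h≤n (below-≤ base≥ lo) hl
      write₁ write₂ : Mem → ℕ → Mem
      write₁ μ₁ k = μ₁ [ leftℕ r k ↦ leftEntry r k ]
      write₂ μ₁ k = write₁ μ₁ k [ rightℕ r k ↦ rightEntry r k ]
      lo₁ : ∀ μ₁ k → Below base μ μ₁ → Below base μ (write₁ μ₁ k)
      lo₁ μ₁ k lo = below-set (≤-trans (m≤m+n base (r * N)) (m≤m+n _ k)) lo
      lo₂ : ∀ μ₁ k → Below base μ μ₁ → Below base μ (write₂ μ₁ k)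
      lo₂ μ₁ k lo = below-set (≤-trans (m≤m+n base (N * N)) (right≥ r k)) (lo₁ μ₁ k lo)
      skip₂ : ∀ μ₁ {k x} → x ≢ leftℕ r k × x ≢ rightℕ r k → write₂ μ₁ k x ≡ μ₁ x
      skip₂ μ₁ {k} (≢l , ≢r) = trans (update-other (write₁ μ₁ k) (rightℕ r k) ≢r) (update-other μ₁ (leftℕ r k) ≢l)
      row : ∀ μ₁ {k} → k < h → RowDone r k μ₁ → RowDone r (suc k) (write₂ μ₁ k)
      row μ₁ {k} k<h dn s s<1+k with s ≟ k
      ... | yes refl = trans (update-other (write₁ μ₁ k) (rightℕ r k) (left≢right r k r<h k<h)) (update-same μ₁ (leftℕ r k) refl)
                     , update-same (write₁ μ₁ k) (rightℕ r k) refl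
      ... | no s≢k =
        trans (skip₂ μ₁ ((λ e → s≢k (proj₂ (left-injective {r} {s} {r} {k} s<h k<h e))) , left≢right r k r<h s<h)) (proj₁ (dn s s<k))
        , trans (skip₂ μ₁ ((λ e → left≢right r s r<h k<h (sym e)) , (λ e → s≢k (proj₂ (right-injective {r} {s} {r} {k} s<h k<h e))))) (proj₂ (dn s s<k))
        where
        s<k = ≤∧≢⇒< (≤-pred s<1+k) s≢k
        s<h = <-trans s<k k<h

    fillPhase-ok : ∀ l {μ} (let vs = gl ▹ l) → vs rv ≡ v → vs rbase ≡ base → vs rN ≡ N → vs rh ≡ h →
      Stored b μ → HighList h V μ →
      Run fillPhase vs μ (λ vs′ μ′ t → t ≤ 2 + h * (3 + h * 5) × Below base μ μ′ ×
        (∀ r → r < h → RowDone r h μ′) ×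
        (∀ x → (∀ r → r < h → Untouched r x) → μ′ x ≡ μ x) ×
        ∃ λ u → ∃ λ k → ∃ λ p → ∃ λ q → vs′ ≡ vs [ ru ≔ u ] [ rk ≔ k ] [ rp ≔ p ] [ rq ≔ q ])
    fillPhase-ok l {μ} refl refl refl refl st hl =
      iterate
        (λ u vs′ μ′ → Below base μ μ′ × (∀ r → r < u → RowDone r h μ′) ×
          (∀ x → (∀ r → r < h → Untouched r x) → μ′ x ≡ μ x) ×
          ∃ λ k → ∃ λ p → ∃ λ q → vs′ ≡ vs [ ru ≔ u ] [ rk ≔ k ] [ rp ≔ p ] [ rq ≔ q ])
        h (λ _ → 2 + h * 5) (≤-<-trans h≤n n<β)
        (λ { (_ , _ , _ , _ , _ , _ , refl) → refl , refl })
        (λ { {u} {μ = μ₁} u<h (lo , dn , unt , k , p , q , refl) →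
          let l₁ = vs [ ru ≔ u ] [ rk ≔ k ] [ rp ≔ p ] [ rq ≔ q ] in
          restart (gl ▹ l₁) ✓
          (weaken (fillRow-ok l₁ refl refl refl refl u<h
              (stored-below n<b (below-≤ (≤-trans 4≤5 base≥) lo) st) (highList-below h≤n (below-≤ base≥ lo) hl))
          λ { {μ′ = μ₂} (t≤ , lo′ , row , unt′ , k′ , p′ , q′ , refl) →
            t≤ , refl
            , _ , (below-trans lo lo′ , all-rows μ₁ μ₂ u<h dn row unt′ , (λ x f → trans (unt′ x (f u u<h)) (unt x f)) , k′ , p′ , q′ , refl)
            , ✓ }) })
        (_ , (below-refl , (λ _ ()) , (λ _ _ → refl) , vs rk , vs rp , vs rq , refl) , ✓)
        (λ { (lo , dn , unt , k , p , q , refl) t≤ →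
          ≤-trans t≤ (+-monoʳ-≤ 2 (≤-reflexive (∑-const h (3 + h * 5)))) , lo , dn , unt , h , k , p , q , refl })
      where
      vs = gl ▹ l
      all-rows : ∀ μ₁ μ₂ {u} → u < h → (∀ r → r < u → RowDone r h μ₁) → RowDone u h μ₂ →
             (∀ x → Untouched u x → μ₂ x ≡ μ₁ x) → ∀ r → r < suc u → RowDone r h μ₂
      all-rows μ₁ μ₂ {u} u<h dn row unt r r<1+u s s<h with r ≟ u
      ... | yes refl = row s s<h
      ... | no r≢u =
        trans (unt (leftℕ r s) λ s′ s′<h → (λ e → r≢u (proj₁ (left-injective {r} {s} {u} {s′} s<h s′<h e))) , left≢right u s′ r<h s<h) (proj₁ (dn r r<u s s<h))
        , trans (unt (rightℕ r s) λ s′ s′<h → (λ e → left≢right r s u<h s′<h (sym e)) , (λ e → r≢u (proj₁ (right-injective {r} {s} {u} {s′} s<h s′<h e)))) (proj₂ (dn r r<u s s<h))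
        where
        r<u = ≤∧≢⇒< (≤-pred r<1+u) r≢u
        r<h = <-trans r<u u<h

    highBody : Stm
    highBody = (rp ≔ high (` ru)) ⨟ (rq ≔ high (` rk)) ⨟
      (racc ≔ common (` rp) (` rq) ⊕ ! left (` ru) (` rk)) ⨟ test rp rq

    module _ (c P : ℕ → ℕ → ℕ) (cP< : ∀ r s → r < h → s < h → c (V r) (V s) + P r s < β) where

      highTest : ℕ → ℕ → ℕ
      highTest r s = tested v (V r) (V s) (c (V r) (V s) + P r s)

      highRow : ℕ → ℕ
      highRow r = ∑ h (highTest r)

      highRow-ok : ∀ l {μ} (let vs = gl ▹ l; r = vs ru) → vs rv ≡ v → vs rbase ≡ base → vs rN ≡ N → vs rh ≡ h →
        r < h → Stored b μ → HighList h V μ → OuterTable v μ → Tab (vs rid) μ c →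
        (∀ r s → r < h → s < h → μ (leftℕ r s) ≡ P r s) →
        vs rans + n < β → 3 * n + 1 < β →
        Run (for rk (` rh) highBody) vs μ (λ vs′ μ′ t → t ≤ 2 + h * 7 × μ′ ≡ μ ×
          ∃ λ k → ∃ λ p → ∃ λ q → ∃ λ d → ∃ λ j →
            vs′ ≡ vs [ rk ≔ k ] [ rp ≔ p ] [ rq ≔ q ] [ racc ≔ d ] [ rfuel ≔ j ] [ rans ≔ highRow r + vs rans ])
      highRow-ok l {μ} refl refl refl refl r<h st hl ot tab prod ans< 3n< =
        iterate
          (λ k vs′ μ′ → μ′ ≡ μ × ∃ λ p → ∃ λ q → ∃ λ d → ∃ λ j →
            vs′ ≡ vs [ rk ≔ k ] [ rp ≔ p ] [ rq ≔ q ] [ racc ≔ d ] [ rfuel ≔ j ] [ rans ≔ total k + vs rans ])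
          h (λ _ → 6) (≤-<-trans h≤n n<β)
          (λ { (_ , _ , _ , _ , _ , refl) → refl , refl })
          (λ { {k} k<h (refl , p , q , d , j , refl) →
            let l₁ = vs [ rk ≔ k ] [ rp ≔ V r ] [ rq ≔ V k ] [ racc ≔ c (V r) (V k) + P r k ] [ rfuel ≔ j ] [ rans ≔ total k + vs rans ] in
            sequence (assign (V r) (hl r r<h) (<-trans (V<n r r<h) n<β)
            (sequence (assign (V k) (hl k k<h) (<-trans (V<n k k<h) n<β)
            (sequence (assign (c (V r) (V k) + P r k) (cong₂ _+_ (tab (V r) (V k) (V<n r r<h) (V<n k k<h)) (prod r k r<h k<h)) (cP< r k r<h k<h)
            (restart (gl ▹ l₁) ✓
              (weaken (test-ok {rp} {rq} l₁ {μ} v<n (V<n r r<h) (V<n k k<h) st ot (total< k<h) 3n<)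
              λ { (refl , t≤ , j′ , refl) →
                +-monoʳ-≤ 3 t≤ , refl
                , _ , (refl , V r , V k , c (V r) (V k) + P r k , j′ , refl)
                , ✓ans (trans (cong (_+ vs rans) (+-comm (total k) (highTest r k))) (+-assoc (highTest r k) (total k) (vs rans))) }))))))) })
          (_ , (refl , vs rp , vs rq , vs racc , vs rfuel , refl) , ✓)
          (λ { (refl , p , q , d , j , refl) t≤ →
            ≤-trans t≤ (+-monoʳ-≤ 2 (≤-reflexive (∑-const h 7))) , refl , h , p , q , d , j , refl })
        where
        vs = gl ▹ l
        r = vs ru
        total : ℕ → ℕ
        total k = ∑ k (highTest r)
        total< : ∀ {k} → k < h → total k + vs rans + 1 < β
        total< {k} k<h = ≤-<-trans (≤-reflexive (trans (cong (_+ 1) (+-comm (total k) (vs rans))) (+-assoc (vs rans) (total k) 1)))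
          (≤-<-trans (+-monoʳ-≤ (vs rans) (≤-trans (+-monoˡ-≤ 1 (≤-trans (∑-≤ k λ {s} _ → tested≤1 v (V r) (V s) (c (V r) (V s) + P r s)) (≤-reflexive (*-identityʳ k))))
             (≤-trans (≤-reflexive (+-comm k 1)) (≤-trans k<h h≤n)))) ans<)

      highPhase-ok : ∀ l {μ} (let vs = gl ▹ l) → vs rv ≡ v → vs rbase ≡ base → vs rN ≡ N → vs rh ≡ h →
        Stored b μ → HighList h V μ → OuterTable v μ → Tab (vs rid) μ c →
        (∀ r s → r < h → s < h → μ (leftℕ r s) ≡ P r s) →
        vs rans + n * n < β → 3 * n + 1 < β →
        Run highPhase vs μ (λ vs′ μ′ t → t ≤ 2 + h * (3 + h * 7) × μ′ ≡ μ ×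
          ∃ λ u → ∃ λ k → ∃ λ p → ∃ λ q → ∃ λ d → ∃ λ j →
            vs′ ≡ vs [ ru ≔ u ] [ rk ≔ k ] [ rp ≔ p ] [ rq ≔ q ] [ racc ≔ d ] [ rfuel ≔ j ] [ rans ≔ ∑ h highRow + vs rans ])
      highPhase-ok l {μ} refl refl refl refl st hl ot tab prod ans< 3n< =
        iterate
          (λ u vs′ μ′ → μ′ ≡ μ × ∃ λ k → ∃ λ p → ∃ λ q → ∃ λ d → ∃ λ j →
            vs′ ≡ vs [ ru ≔ u ] [ rk ≔ k ] [ rp ≔ p ] [ rq ≔ q ] [ racc ≔ d ] [ rfuel ≔ j ] [ rans ≔ ∑ u highRow + vs rans ])
          h (λ _ → 2 + h * 7) (≤-<-trans h≤n n<β)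
          (λ { (_ , _ , _ , _ , _ , _ , refl) → refl , refl })
          (λ { {u} u<h (refl , k , p , q , d , j , refl) →
            let l₁ = vs [ ru ≔ u ] [ rk ≔ k ] [ rp ≔ p ] [ rq ≔ q ] [ racc ≔ d ] [ rfuel ≔ j ] [ rans ≔ ∑ u highRow + vs rans ] in
            restart (gl ▹ l₁) ✓
            (weaken (highRow-ok l₁ {μ} refl refl refl refl u<h st hl ot tab prod (total< u<h) 3n<)
            λ { (t≤ , refl , k′ , p′ , q′ , d′ , j′ , refl) →
              t≤ , refl , _ , (refl , k′ , p′ , q′ , d′ , j′ , refl)
              , ✓ans (trans (cong (_+ vs rans) (+-comm (∑ u highRow) (highRow u))) (+-assoc (highRow u) (∑ u highRow) (vs rans))) }) })
          (_ , (refl , vs rk , vs rp , vs rq , vs racc , vs rfuel , refl) , ✓)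
          (λ { (refl , k , p , q , d , j , refl) t≤ →
            ≤-trans t≤ (+-monoʳ-≤ 2 (≤-reflexive (∑-const h (3 + h * 7)))) , refl , h , k , p , q , d , j , refl })
        where
        vs = gl ▹ l
        row≤ : ∀ r → highRow r ≤ n
        row≤ r = ≤-trans (∑-≤ h λ {s} _ → tested≤1 v (V r) (V s) (c (V r) (V s) + P r s)) (≤-trans (≤-reflexive (*-identityʳ h)) h≤n)
        total< : ∀ {u} → u < h → ∑ u highRow + vs rans + n < β
        total< {u} u<h = ≤-<-trans (≤-reflexive (trans (cong (_+ n) (+-comm (∑ u highRow) (vs rans))) (+-assoc (vs rans) (∑ u highRow) n)))
          (≤-<-trans (+-monoʳ-≤ (vs rans) (≤-trans (+-monoˡ-≤ n (∑-≤ u λ {r} _ → row≤ r))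
            (≤-trans (≤-reflexive (+-comm (u * n) n)) (*-monoˡ-≤ n (<-≤-trans u<h h≤n))))) ans<)

  -- One candidate

  module Processing {P : Algorithm} (multiplier : Multiplier mc gl P) where

    open Multiplier multiplier

    private
      β*β≤W : β * β ≤ 2 ^ w
      β*β≤W = ≤-trans (≤-reflexive (cong (β *_) (sym (*-identityʳ β)))) (≤-trans (^-monoʳ-≤ β (≤ᵇ⇒≤ 2 16 tt)) β¹⁶≤2ʷ)

      β+β≤W : β + β ≤ 2 ^ w
      β+β≤W = ≤-trans (≤-trans (≤-reflexive (cong (β +_) (sym (+-identityʳ β)))) (*-monoˡ-≤ β (≤-trans (≤ᵇ⇒≤ 2 8 tt) 8≤β))) β*β≤W

    open Calling mc (code P) w′ w′≤w (≤-trans (*-mono-≤ M≤β M≤β) β*β≤W) (≤-trans (+-mono-≤ M≤β M≤β) β+β≤W) M≤β κ≥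

    -- Tables and regions with numbers up to `id` may have been used, all later ones are still zero;
    -- M separates the tables from the regions.
    Fresh : ℕ → Mem → Set
    Fresh id μ = ∀ a → (suc id * b * b ≤ a × a < M) ⊎ suc id * M ≤ a → μ a ≡ 0

    low : ℕ → ℕ → ℕ
    low Δ z = [ deg z < suc Δ ]

    -- A pair may be counted from both of its ends; only whether the score vanishes matters.
    module Scores (v Δ h : ℕ) (V : ℕ → ℕ) where

      lowCommon : ℕ → ℕ → ℕ
      lowCommon x y = ∑ n (λ z → low Δ z * (a z x * (a z y * out v z)))

      highCommon : ℕ → ℕ → ℕ
      highCommon r j = ∑ h (λ s → (a (V r) (V s) * out v (V s)) * a (V s) (V j))

      score : ℕ
      score = ∑ h (λ r → ∑ h (λ s → tested v (V r) (V s) (lowCommon (V r) (V s) + highCommon r s)))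
              + ∑ n (λ z → low Δ z * lowTests v z)

    module _ (v Δ N F h id : ℕ) (V : ℕ → ℕ) (v<n : v < n) (h≤N : h ≤ N) (h≤n : h ≤ n)
      (V<n : ∀ r → r < h → V r < n) (5≤id : 5 ≤ id) (fits : FitsWords P N w′) (N<M : N < M)
      (2N²≤M : N * N + N * N ≤ M) (idb : suc (suc id) * b * b ≤ M) (idM : suc id * M < β) (F<β : F < β)
      (3n< : 3 * n + 1 < β) (n+2< : n + 2 < β) where

      private
        base : ℕ
        base = suc id * M

        M≤base : M ≤ base
        M≤base = m≤m+n M (id * M)

        5b≤M : 5 * b * b ≤ M
        5b≤M = ≤-trans (tables≤ (≤-trans 5≤id (≤-trans (n≤1+n id) (n≤1+n (suc id))))) idb

        5b≤base : 5 * b * b ≤ base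
        5b≤base = ≤-trans 5b≤M M≤base

        id≤ : ∀ {k} → k ≤ id → k * b * b ≤ M
        id≤ k≤ = ≤-trans (tables≤ (≤-trans k≤ (≤-trans (n≤1+n id) (n≤1+n (suc id))))) idb

        open Grid base N h h≤N
        open Scores v Δ h V

        -- The matrices are padded with zeros to N × N matrices.
        inRange : ℕ → ℕ → ℕ
        inRange r s = [ r < h ] * [ s < h ]

        entA entB : ℕ → ℕ → ℕ
        entA r s = inRange r s * (a (V r) (V s) * out v (V s))
        entB r s = inRange r s * a (V r) (V s)

        inside-range : ∀ {r s} → r < h → s < h → inRange r s ≡ 1
        inside-range r< s< = cong₂ _*_ ([<]-yes r<) ([<]-yes s<)

        outside-range : ∀ {r s} → h ≤ r ⊎ h ≤ s → inRange r s ≡ 0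
        outside-range {r} {s} (inj₁ h≤r) = cong (_* [ s < h ]) ([<]-no h≤r)
        outside-range {r} {s} (inj₂ h≤s) = trans (cong ([ r < h ] *_) ([<]-no h≤s)) (*-zeroʳ [ r < h ])

        inRange≤1 : ∀ r s → inRange r s ≤ 1
        inRange≤1 r s = *-mono-≤ {[ r < h ]} ([<]≤1 r h) ([<]≤1 s h)

        entA≤1 : ∀ r s → entA r s ≤ 1
        entA≤1 r s = *-mono-≤ {inRange r s} (inRange≤1 r s) (*-mono-≤ {a (V r) (V s)} (a≤1 (V r) (V s)) (out≤1 v (V s)))

        entB≤1 : ∀ r s → entB r s ≤ 1
        entB≤1 r s = *-mono-≤ {inRange r s} (inRange≤1 r s) (a≤1 (V r) (V s))

        range : ∀ r s → (r < h × s < h) ⊎ (h ≤ r ⊎ h ≤ s)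
        range r s with r <? h | s <? h
        ... | yes r< | yes s< = inj₁ (r< , s<)
        ... | no r≮ | _ = inj₂ (inj₁ (≮⇒≥ r≮))
        ... | yes _ | no s≮ = inj₂ (inj₂ (≮⇒≥ s≮))

        unaligned : ∀ {r s r′ s′} → s < N → r′ < h → s′ < h → h ≤ r ⊎ h ≤ s → ∀ B → B + r * N + s ≢ B + r′ * N + s′
        unaligned {r} {s} {r′} {s′} s<N r′< s′< out B e
          with digits-injective N {r} {s} {r′} {s′} s<N (<-≤-trans s′< h≤N)
                 (+-cancelˡ-≡ B _ _ (trans (sym (+-assoc B (r * N) s)) (trans e (+-assoc B (r′ * N) s′))))
        ... | refl , refl = [ (λ h≤ → <⇒≱ r′< h≤) , (λ h≤ → <⇒≱ s′< h≤) ]′ out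

        inN² : ∀ {r s} → r < N → s < N → r * N + s < N * N
        inN² {r} {s} r< s< = <-≤-trans (+-monoʳ-< (r * N) s<) (≤-trans (≤-reflexive (+-comm (r * N) N)) (*-monoˡ-≤ N r<))

        untouched-left : ∀ {r s} → r < N → s < N → h ≤ r ⊎ h ≤ s → ∀ r′ → r′ < h → Untouched r′ (leftℕ r s)
        untouched-left {r} {s} r< s< out r′ r′< s′ s′< = unaligned s< r′< s′< out base
          , <⇒≢ (<-≤-trans (≤-trans (≤-reflexive (cong suc (+-assoc base (r * N) s))) (+-monoʳ-< base (inN² r< s<))) (right≥ r′ s′))

        untouched-right : ∀ {r s} → r < N → s < N → h ≤ r ⊎ h ≤ s → ∀ r′ → r′ < h → Untouched r′ (rightℕ r s)
        untouched-right {r} {s} r< s< out r′ r′< s′ s′< =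
          (λ e → <⇒≢ (<-≤-trans (left< r′< s′<) (right≥ r s)) (sym e)) , unaligned s< r′< s′< out (base + N * N)

        untouched-above : ∀ {x} → base + (N * N + N * N) ≤ x → ∀ r → r < h → Untouched r x
        untouched-above x≥ r r< s s< =
          (λ e → <⇒≢ (<-≤-trans (<-≤-trans (left< r< s<) (+-monoʳ-≤ base (m≤m+n (N * N) (N * N)))) x≥) (sym e))
          , (λ e → <⇒≢ (<-≤-trans (right< r< s<) x≥) (sym e))

      product-entry : ∀ {σ} →
        (∀ i j → mem σ (toℕ i * N + toℕ j) ≡ wordℤ w′ ((matrix-of N entA ⊗ matrix-of N entB) i j)) →
        ∀ r j → r < h → j < h → mem σ (r * N + j) ≡ highCommon r j
      product-entry {σ} prod r j r< j< = begin
        mem σ (r * N + j)      ≡⟨ cong₂ (λ x y → mem σ (x * N + y)) (sym (toℕ-fromℕ< r<N)) (sym (toℕ-fromℕ< j<N)) ⟩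
        mem σ (toℕ (fromℕ< r<N) * N + toℕ (fromℕ< j<N)) ≡⟨ prod (fromℕ< r<N) (fromℕ< j<N) ⟩
        wordℤ w′ ((matrix-of N entA ⊗ matrix-of N entB) (fromℕ< r<N) (fromℕ< j<N))
          ≡⟨ cong (wordℤ w′) (trans (matrix-product N entA entB (fromℕ< r<N) (fromℕ< j<N))
               (cong ℤ.+_ (trans (cong₂ (λ x y → ∑ N (λ k → entA x k * entB k y)) (toℕ-fromℕ< r<N) (toℕ-fromℕ< j<N)) shrink))) ⟩
        -- The entry is at most h, and h ≤ n < M, so that its word is the number itself.
        wordℤ w′ (ℤ.+ highCommon r j) ≡⟨ wordℤ-+ w′ (≤-<-trans (≤-trans (∑-≤ h λ {s} _ → *-mono-≤ {a (V r) (V s) * out v (V s)} (*-mono-≤ {a (V r) (V s)} (a≤1 (V r) (V s)) (out≤1 v (V s))) (a≤1 (V s) (V j))) (≤-trans (≤-reflexive (*-identityʳ h)) h≤n)) n<M) ⟩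
        highCommon r j         ∎
        where
        open ≡-Reasoning
        r<N = <-≤-trans r< h≤N
        j<N = <-≤-trans j< h≤N
        shrink : ∑ N (λ k → entA r k * entB k j) ≡ highCommon r j
        -- From index h on the padding makes the left factor zero.
        shrink = trans (∑-support (λ k → entA r k * entB k j) h≤N
            (λ {k} h≤k → cong (λ z → z * (a (V r) (V k) * out v (V k)) * entB k j) (outside-range {r} {k} (inj₂ h≤k))))
          (∑-cong h λ {k} k< → cong₂ _*_ (trans (cong (_* (a (V r) (V k) * out v (V k))) (inside-range r< k<)) (+-identityʳ _))
            (trans (cong (_* a (V k) (V j)) (inside-range k< j<)) (+-identityʳ _)))

      Processed : ℕ → Mem → ℕ → ℕ → Set
      Processed s₀ μ′ f z = Fresh (suc id) μ′ × ((f ≡ 0 × z ≡ score + s₀) ⊎ (f ≡ 1 × h ≢ 0 × Slow P w′ N F))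

      -- The loops over pairs of high vertices take 3 h + 5 h² and 3 h + 7 h² units, up to 2. They
      -- are reached only if N² ≤ F, and h ≤ N, which gives 8 F and 10 F.
      processTime : ℕ
      processTime = 10 + (2 + ∑ n (λ u → 5 + deg u * 3)) + (2 + ∑ n (λ u → 4 + deg u * (8 + Δ * 4)))
        + (2 + 8 * F) + suc F + (2 + 10 * F)

      private
        keep-fresh : ∀ {μ μ₁} → Above (suc (suc id) * b * b) μ μ₁ → Fresh id μ → Fresh (suc id) μ₁
        keep-fresh hi fr a (inj₁ (a≥ , a<)) = trans (Above.at hi a≥) (fr a (inj₁ (≤-trans (tables≤ (n≤1+n (suc id))) a≥ , a<)))
        keep-fresh hi fr a (inj₂ a≥) = trans (Above.at hi (≤-trans idb (≤-trans (m≤m+n M _) a≥))) (fr a (inj₂ (≤-trans (m≤n+m (suc id * M) M) a≥)))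

        region-fresh : ∀ {μ μ₁} → Below base μ μ₁ → (∀ {a} → base + M ≤ a → μ₁ a ≡ μ a) → Fresh (suc id) μ → Fresh (suc id) μ₁
        region-fresh lo hi fr a (inj₁ (a≥ , a<)) = trans (Below.at lo (<-≤-trans a< M≤base)) (fr a (inj₁ (a≥ , a<)))
        region-fresh lo hi fr a (inj₂ a≥) = trans (hi (≤-trans (≤-reflexive (+-comm base M)) a≥)) (fr a (inj₂ a≥))

      process-ok : ∀ l {μ} (let vs = gl ▹ l) → vs rv ≡ v → vs rΔ ≡ Δ → vs rN ≡ N → vs rF ≡ F → vs rh ≡ h → vs rid ≡ id →
        vs rfail ≡ 0 → Stored b μ → HighList h V μ → Fresh id μ → vs rans + n * n + n * n < β →
        Run (process (code P)) vs μ (λ vs′ μ′ t → t ≤ processTime × Below (5 * b * b) μ μ′ ×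
          ∃ λ f → ∃ λ z → Processed (vs rans) μ′ f z ×
          ∃ λ j → vs′ ≡ scratch vs j [ rid ≔ suc id ] [ rans ≔ z ] [ rfail ≔ f ])
      process-ok l {μ} refl refl refl refl refl refl fail≡0 st hl fresh ans< =
        sequence (assign (suc id) (+-comm id 1) id′<
        (sequence (assign base (cong (suc id *_) M≡) idM
        (sequence (restart (gl ▹ l₁) ✓ (weaken (outerPhase-ok l₁ {μ} v<n st)
          λ { {μ′ = μ₁} {t₁} (t₁≤ , lo₁ , hi₁ , ot , u₁ , i₁ , p₁ , c₁ , refl) →
          let l₂ = l₁ [ ru ≔ u₁ ] [ ri ≔ i₁ ] [ rp ≔ p₁ ] [ racc ≔ c₁ ] in
          sequence (restart (gl ▹ l₂) ✓ (weaken
            (lowPhase-ok l₂ {μ₁} v<n (s≤s 5≤id) (stored-below n<b (below-≤ 4≤5 lo₁) st) ot (zero-table hi₁)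
              (≤-<-trans (m≤m+n _ (n * n)) ans<) 3n< n+2<)
          λ { {μ′ = μ₂} {t₂} (t₂≤ , lo₂ , hi₂ , tab , u₂ , i₂ , p₂ , k₂ , q₂ , c₂ , j₂ , refl) →
          let l₃ = l₂ [ ru ≔ u₂ ] [ ri ≔ i₂ ] [ rp ≔ p₂ ] [ rk ≔ k₂ ] [ rq ≔ q₂ ] [ racc ≔ c₂ ] [ rfuel ≔ j₂ ] [ rans ≔ lowScore + vs rans ]
              hi₂′ = above-trans (above-≥ (tables≤ (≤-trans 6≤id′ (n≤1+n (suc id)))) hi₁) hi₂
              fresh₂ = keep-fresh {μ} {μ₂} hi₂′ fresh
              lo₁₂ = below-trans lo₁ (below-≤ (tables≤ (≤-trans 5≤6 6≤id′)) lo₂)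
              st₂ = stored-below n<b (below-≤ 4≤5 lo₁₂) st
              hl₂ = highList-below {μ′ = μ₂} h≤n lo₁₂ hl
              ot₂ = below-outer {μ′ = μ₂} (below-≤ (tables≤ 6≤id′) lo₂) ot
          in settle (branch
            (λ h≢0 → branch
              (λ F< → assign 1 refl 1<β
                (_ , (time-large t₁≤ t₂≤ , lo₁₂ , 1 , lowScore + vs rans , (fresh₂ , inj₂ (refl , h≢0 , too-large ([<]-≢0 F<)))
                 , gl ▹ l₃ , refl) , ✓))
              (λ F≥ → sequence (restart (gl ▹ l₃) ✓ (weaken
                (fillPhase-ok v base N h V v<n h≤N h≤n V<n 5b≤base l₃ {μ₂} refl refl refl refl st₂ hl₂)
              λ { {μ′ = μ₃} {t₃} (t₃≤ , lo₃ , filled , unt , u₃ , k₃ , p₃ , q₃ , refl) →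
              let l₄ = l₃ [ ru ≔ u₃ ] [ rk ≔ k₃ ] [ rp ≔ p₃ ] [ rq ≔ q₃ ]
                  -- `EntriesBounded` asks for entries of at most N, so N must be positive for
                  -- entries equal to 1.
                  0<N = <-≤-trans (n≢0⇒n>0 h≢0) h≤N
                  σ , t , deriv , prod = mult {N} w′ fits (matrix-of N entA) (matrix-of N entB) (entries-bounded {entA} 0<N entA≤1) (entries-bounded {entB} 0<N entB≤1)
              in sequence (assign F refl F<β
              (sequence (restart ((gl ▹ l₄) [ rfuel ≔ F ]) ✓ (weaken (call-ok ((gl ▹ l₄) [ rfuel ≔ F ]) {μ₃} (matrix-of N entA) (matrix-of N entB) M≡ refl N<M region≤
                  (input {μ₂} {μ₃} (zero₂ hi₂′) filled unt h≢0) deriv)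
              λ { {μ′ = μ₄} {t₄} (t₄≤ , lo₄ , hi₄ , f , refl , aborts , finishes) →
              let l₅ = l₄ [ rfuel ≔ f ]
                  lo₃₄ = below-trans lo₃ lo₄
                  -- All writes since `fresh₂` fall into the region of this candidate.
                  fresh₄ = region-fresh {μ₂} {μ₄} lo₃₄ (λ a≥ → trans (Above.at hi₄ a≥) (unt _ (untouched-above (≤-trans (+-monoʳ-≤ base 2N²≤M) a≥)))) fresh₂
                  lo₁₄ = below-trans lo₁₂ (below-≤ 5b≤base lo₃₄)
              in branch
                (λ f≢0 → restart (gl ▹ l₅) ✓ (weaken
                  (highPhase-ok v base N h V v<n h≤N h≤n V<n 5b≤base lowCommon highCommon (λ r s r< s< → common< r s)
                    l₅ {μ₄} refl refl refl refl
                    (stored-below n<b (below-≤ 4≤5 lo₁₄) st) (highList-below {μ′ = μ₄} h≤n lo₁₄ hl)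
                    (below-outer {μ′ = μ₄} (below-≤ (≤-trans (≤-trans (tables≤ (≤-trans 6≤id′ (n≤1+n (suc id)))) idb) M≤base) lo₃₄) ot₂)
                    (λ x y x< y< → trans (Below.at lo₃₄ (<-≤-trans (cell-< {k = suc id} (<-trans x< n<b) (<-trans y< n<b)) (≤-trans idb M≤base))) (tab x y x< y<))
                    (λ r s r< s< → trans (cong μ₄ (+-assoc base (r * N) s))
                       (trans (finishes f≢0 (r * N + s) (in-region r< s<)) (product-entry {σ} prod r s r< s<)))
                    (low-ans< ans<) 3n<)
                  λ { (t₅≤ , refl , u₅ , k₅ , p₅ , q₅ , d₅ , j₅ , refl) →
                    _ , (time-full t₁≤ t₂≤ (grid≤ 5 F≥ t₃≤) t₄≤ (grid≤ 7 F≥ t₅≤) , lo₁₄ , 0 , _ , (fresh₄ , inj₁ (refl , sym (+-assoc (∑ h highScores) lowScore (vs rans))))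
                        , l₅ [ ru ≔ u₅ ] [ rk ≔ k₅ ] [ rp ≔ p₅ ] [ rq ≔ q₅ ] [ racc ≔ d₅ ] [ rfuel ≔ j₅ ] , refl)
                    , ✓fail (sym fail≡0) }))
                (λ f≡0 → assign 1 refl 1<β
                  (_ , (time-abort t₁≤ t₂≤ (grid≤ 5 F≥ t₃≤) t₄≤ , lo₁₄ , 1 , lowScore + vs rans
                   , (fresh₄ , inj₂ (refl , h≢0 , timeout {A = matrix-of N entA} {matrix-of N entB} (entries-bounded {entA} 0<N entA≤1) (entries-bounded {entB} 0<N entB≤1) deriv (aborts f≡0)))
                   , gl ▹ l₅ , refl) , ✓)) })))) }))))
            (λ h≡0 → nothing (_ , (time-none t₁≤ t₂≤ , lo₁₂ , 0 , lowScore + vs rans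
               , (fresh₂ , inj₁ (refl , cong (λ x → x + lowScore + vs rans) (sym (cong (λ k → ∑ k highScores) h≡0)))) , gl ▹ l₃ , refl) , ✓fail (sym fail≡0)))) })) }))))))
        where
        vs = gl ▹ l
        l₁ = l [ rid ≔ suc id ] [ rbase ≔ base ]
        M>0 : 0 < M
        M>0 = m^n>0 2 w′
        1<β : 1 < β
        1<β = ≤-trans (≤ᵇ⇒≤ 2 8 tt) 8≤β
        id′< : suc id < β
        id′< = ≤-<-trans (m≤m*n (suc id) M {{>-nonZero M>0}}) idM
        4≤5 : 4 * b * b ≤ 5 * b * b
        4≤5 = tables≤ (n≤1+n 4)
        5≤6 : 5 ≤ 6
        5≤6 = n≤1+n 5
        6≤id′ : 6 ≤ suc id
        6≤id′ = s≤s 5≤id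
        lowScore : ℕ
        lowScore = ∑ n (λ z → low Δ z * lowTests v z)
        highScores : ℕ → ℕ
        highScores r = ∑ h (λ s → tested v (V r) (V s) (lowCommon (V r) (V s) + highCommon r s))
        zero-table : ∀ {μ₁} → Above (6 * b * b) μ μ₁ → Tab (suc id) μ₁ (λ _ _ → 0)
        zero-table hi x y x< y< = trans (Above.at hi (≤-trans (tables≤ 6≤id′) (cell-≥ b (suc id) x y)))
          (fresh _ (inj₁ (cell-≥ b (suc id) x y , <-≤-trans (cell-< {k = suc id} (<-trans x< n<b) (<-trans y< n<b)) idb)))
        zero₂ : ∀ {μ₂} → Above (suc (suc id) * b * b) μ μ₂ → ∀ {x} → base ≤ x → μ₂ x ≡ 0
        zero₂ hi x≥ = trans (Above.at hi (≤-trans idb (≤-trans M≤base x≥))) (fresh _ (inj₂ x≥))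
        entries-bounded : ∀ {f} → 0 < N → (∀ r s → f r s ≤ 1) → EntriesBounded (matrix-of N f)
        entries-bounded 0<N f≤1 i j = ≤-trans (f≤1 (toℕ i) (toℕ j)) 0<N
        region≤ : base + M ≤ 2 ^ w
        region≤ = ≤-trans (+-mono-≤ (<⇒≤ idM) M≤β) β+β≤W
        small : ∀ {x} → x ≤ 1 → h ≢ 0 → x < M
        small x≤1 h≢0 = ≤-<-trans (≤-trans x≤1 (n≢0⇒n>0 h≢0)) (≤-<-trans h≤n n<M)
        input : ∀ {μ₂ μ₃} → (∀ {x} → base ≤ x → μ₂ x ≡ 0) →
          (∀ r → r < h → RowDone v base N h V v<n h≤N h≤n V<n 5b≤base r h μ₃) →
          (∀ x → (∀ r → r < h → Untouched r x) → μ₃ x ≡ μ₂ x) → h ≢ 0 →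
          ∀ {a} → a < M → μ₃ (base + a) ≡ mem (matMulInput w′ (matrix-of N entA) (matrix-of N entB)) a
        input {μ₂} {μ₃} z filled unt h≢0 = layout w′ N entA entB (λ r s → small (entA≤1 r s) h≢0) (λ r s → small (entB≤1 r s) h≢0) μ₃ base M
          (λ r s r< s< → left≡ r s r< s< (range r s)) (λ r s r< s< → right≡ r s r< s< (range r s))
          (λ a a≥ a< → trans (unt _ (untouched-above (+-monoʳ-≤ base a≥))) (z (m≤m+n base a)))
          where
          left≡ : ∀ r s → r < N → s < N → (r < h × s < h) ⊎ (h ≤ r ⊎ h ≤ s) → μ₃ (base + r * N + s) ≡ entA r s
          left≡ r s r<N s<N (inj₁ (r< , s<)) = trans (proj₁ (filled r r< s s<))
            (sym (trans (cong (_* (a (V r) (V s) * out v (V s))) (inside-range r< s<)) (+-identityʳ _)))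
          left≡ r s r<N s<N (inj₂ outr) = trans (unt _ (untouched-left r<N s<N outr))
            (trans (z (≤-trans (m≤m+n base (r * N)) (m≤m+n _ s))) (sym (cong (_* (a (V r) (V s) * out v (V s))) (outside-range {r} {s} outr))))
          right≡ : ∀ r s → r < N → s < N → (r < h × s < h) ⊎ (h ≤ r ⊎ h ≤ s) → μ₃ (base + N * N + r * N + s) ≡ entB r s
          right≡ r s r<N s<N (inj₁ (r< , s<)) = trans (proj₂ (filled r r< s s<))
            (sym (trans (cong (_* a (V r) (V s)) (inside-range r< s<)) (+-identityʳ _)))
          right≡ r s r<N s<N (inj₂ outr) = trans (unt _ (untouched-right r<N s<N outr))
            (trans (z (≤-trans (m≤m+n base (N * N)) (right≥ r s))) (sym (cong (_* a (V r) (V s)) (outside-range {r} {s} outr))))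
        common< : ∀ r s → lowCommon (V r) (V s) + highCommon r s < β
        common< r s = ≤-<-trans (≤-trans (+-mono-≤
            (≤-trans (∑-≤ n λ {z} _ → *-mono-≤ {low Δ z} ([<]≤1 (deg z) (suc Δ)) (*-mono-≤ {a z (V r)} (a≤1 z (V r)) (*-mono-≤ {a z (V s)} (a≤1 z (V s)) (out≤1 v z)))) (≤-reflexive (*-identityʳ n)))
            (≤-trans (∑-≤ h λ {k} _ → *-mono-≤ {a (V r) (V k) * out v (V k)} (*-mono-≤ {a (V r) (V k)} (a≤1 (V r) (V k)) (out≤1 v (V k))) (a≤1 (V k) (V s))) (≤-trans (≤-reflexive (*-identityʳ h)) h≤n)))
            (≤-trans (m≤m+n (n + n) (n + 1)) (≤-reflexive (solve 1 (λ n → n :+ n :+ (n :+ con 1) := con 3 :* n :+ con 1) refl n)))) 3n<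
        low-ans< : vs rans + n * n + n * n < β → lowScore + vs rans + n * n < β
        low-ans< h< = ≤-<-trans (+-monoˡ-≤ (n * n) (≤-trans (+-monoˡ-≤ (vs rans) (∑-≤ n λ {z} _ →
          ≤-trans (*-mono-≤ {low Δ z} ([<]≤1 (deg z) (suc Δ)) (≤-trans (∑-≤ n λ {x} _ → *-mono-≤ {a z x} (a≤1 z x) (tested≤1 v z x (com v z x))) (≤-reflexive (*-identityʳ n)))) (≤-reflexive (+-identityʳ n))))
          (≤-reflexive (+-comm (n * n) (vs rans))))) h<
        in-region : ∀ {r s} → r < h → s < h → r * N + s < M
        in-region r< s< = <-≤-trans (inN² (<-≤-trans r< h≤N) (<-≤-trans s< h≤N)) (≤-trans (m≤m+n (N * N) (N * N)) 2N²≤M)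
        T₁ T₂ T₃ T₄ T₅ : ℕ
        T₁ = 2 + ∑ n (λ u → 5 + deg u * 3)
        T₂ = 2 + ∑ n (λ u → 4 + deg u * (8 + Δ * 4))
        T₃ = 2 + 8 * F
        T₄ = suc F
        T₅ = 2 + 10 * F
        grid≤ : ∀ k {t} → [ F < N * N ] ≡ 0 → t ≤ 2 + h * (3 + h * k) → t ≤ 2 + (3 + k) * F
        grid≤ k {t} F≥ t≤ = ≤-trans t≤ (+-monoʳ-≤ 2 (begin
          h * (3 + h * k)         ≡⟨ solve 2 (λ h k → h :* (con 3 :+ h :* k) := con 3 :* h :+ k :* (h :* h)) refl h k ⟩
          3 * h + k * (h * h)     ≤⟨ +-monoˡ-≤ (k * (h * h)) (*-monoʳ-≤ 3 (square h)) ⟩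
          3 * (h * h) + k * (h * h) ≡⟨ *-distribʳ-+ (h * h) 3 k ⟨
          (3 + k) * (h * h)       ≤⟨ *-monoʳ-≤ (3 + k) (≤-trans (*-mono-≤ h≤N h≤N) ([<]-≡0 F≥)) ⟩
          (3 + k) * F             ∎))
          where
          open ≤-Reasoning
          square : ∀ x → x ≤ x * x
          square zero = z≤n
          square (suc x) = m≤m*n (suc x) (suc x)
        full : ∀ {t₁ t₂ t₃ t₄ t₅} → t₁ ≤ T₁ → t₂ ≤ T₂ → t₃ ≤ T₃ → t₄ ≤ T₄ → t₅ ≤ T₅ → 10 + t₁ + t₂ + t₃ + t₄ + t₅ ≤ 10 + T₁ + T₂ + T₃ + T₄ + T₅
        full a b c d e = +-mono-≤ (+-mono-≤ (+-mono-≤ (+-mono-≤ (+-monoʳ-≤ 10 a) b) c) d) e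
        time-full : ∀ {t₁ t₂ t₃ t₄ t₅} → t₁ ≤ T₁ → t₂ ≤ T₂ → t₃ ≤ T₃ → t₄ ≤ T₄ → t₅ ≤ T₅ →
          1 + (1 + (t₁ + (t₂ + suc (suc (t₃ + (1 + (t₄ + suc t₅))))))) ≤ processTime
        time-full {t₁} {t₂} {t₃} {t₄} {t₅} a b c d e = ≤-trans (≤-trans (m≤n+m _ 4) (≤-reflexive
          (solve 5 (λ a b c d e → con 4 :+ (con 1 :+ (con 1 :+ (a :+ (b :+ (con 1 :+ (con 1 :+ (c :+ (con 1 :+ (d :+ (con 1 :+ e)))))))))) := con 10 :+ a :+ b :+ c :+ d :+ e) refl t₁ t₂ t₃ t₄ t₅)))
          (full a b c d e)
        time-abort : ∀ {t₁ t₂ t₃ t₄} → t₁ ≤ T₁ → t₂ ≤ T₂ → t₃ ≤ T₃ → t₄ ≤ T₄ →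
          1 + (1 + (t₁ + (t₂ + suc (suc (t₃ + (1 + (t₄ + suc 1))))))) ≤ processTime
        time-abort a b c d = time-full a b c d (s≤s z≤n)
        time-none : ∀ {t₁ t₂} → t₁ ≤ T₁ → t₂ ≤ T₂ → 1 + (1 + (t₁ + (t₂ + suc 1))) ≤ processTime
        time-none {t₁} {t₂} a b = ≤-trans (≤-trans (m≤n+m _ 6) (≤-reflexive
          (solve 2 (λ a b → con 6 :+ (con 1 :+ (con 1 :+ (a :+ (b :+ (con 1 :+ con 1))))) := con 10 :+ a :+ b :+ con 0 :+ con 0 :+ con 0) refl t₁ t₂)))
          (full a b z≤n z≤n z≤n)
        time-large : ∀ {t₁ t₂} → t₁ ≤ T₁ → t₂ ≤ T₂ → 1 + (1 + (t₁ + (t₂ + suc (suc 1)))) ≤ processTime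
        time-large {t₁} {t₂} a b = ≤-trans (≤-trans (m≤n+m _ 5) (≤-reflexive
          (solve 2 (λ a b → con 5 :+ (con 1 :+ (con 1 :+ (a :+ (b :+ (con 1 :+ (con 1 :+ con 1)))))) := con 10 :+ a :+ b :+ con 0 :+ con 0 :+ con 0) refl t₁ t₂)))
          (full a b z≤n z≤n z≤n)

    -- All candidates and all thresholds

    module Attempting (sizes : Bounds mc gl multiplier) (edges≡ : ∑ n (Tables.deg tables) ≡ Consts.cm gl + Consts.cm gl) where

      open Bounds sizes
      open Consts gl using () renaming (cm to m)

      hi : ℕ → ℕ → ℕ
      hi Δ x = [ Δ < deg x ]

      heavy : ℕ → ℕ
      heavy v = [ n < 3 * deg v + 4 ]

      numHigh : ℕ → ℕ
      numHigh Δ = ∑ n (hi Δ)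

      -- As in `Tables`, a list without repetitions is described by the sums along it.
      Enumerates : ℕ → (ℕ → ℕ) → Set
      Enumerates Δ V = (∀ (g : ℕ → ℕ) → ∑ (numHigh Δ) (g ∘ V) ≡ ∑ n (λ x → hi Δ x * g x)) × (∀ r → r < numHigh Δ → V r < n)

      hi≤1 : ∀ Δ x → hi Δ x ≤ 1
      hi≤1 Δ x = [<]≤1 Δ (deg x)

      ∑hi≤ : ∀ Δ u → ∑ u (hi Δ) ≤ u
      ∑hi≤ Δ u = ≤-trans (∑-≤ u λ {x} _ → hi≤1 Δ x) (≤-reflexive (*-identityʳ u))

      -- Every high vertex has more than Δ of the 2m endpoints of edges.
      numHigh*Δ : ∀ Δ → numHigh Δ * Δ ≤ m + m
      numHigh*Δ Δ = ≤-trans (≤-reflexive (sym (∑-*ʳ n (hi Δ) Δ))) (≤-trans (∑-mono n λ {x} _ → each x) (≤-reflexive edges≡))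
        where
        each : ∀ x → hi Δ x * Δ ≤ deg x
        each x with Δ <? deg x
        ... | yes Δ< = ≤-trans (≤-reflexive (trans (cong (_* Δ) ([<]-yes Δ<)) (+-identityʳ Δ))) (<⇒≤ Δ<)
        ... | no Δ≮ = ≤-trans (≤-reflexive (cong (_* Δ) ([<]-no (≮⇒≥ Δ≮)))) z≤n

      size : ℕ → ℕ
      size Δ = quotient (m + m) Δ

      numHigh≤size : ∀ Δ → 1 ≤ Δ → numHigh Δ ≤ size Δ
      numHigh≤size (suc Δ) _ = ≤-trans (≤-reflexive (sym (m*n/n≡m (numHigh (suc Δ)) (suc Δ)))) (/-monoˡ-≤ (suc Δ) (numHigh*Δ (suc Δ)))

      -- A high vertex has degree above Δ, so its existence bounds Δ by 2m; this is what ends the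
      -- doubling.
      Fail : ℕ → Set
      Fail Δ = numHigh Δ ≢ 0 × Slow P w′ (size Δ) (Δ * (m + n))

      score : ℕ → ℕ → (ℕ → ℕ) → ℕ
      score v Δ V = Scores.score v Δ (numHigh Δ) V

      total : ℕ → (ℕ → ℕ) → ℕ → ℕ
      total Δ V k = ∑ k (λ v → heavy v * score v Δ V)

      score≤ : ∀ v Δ V → score v Δ V ≤ n * n + n * n
      score≤ v Δ V = +-mono-≤
        (≤-trans (∑-≤ h λ {r} _ → ≤-trans (∑-≤ h λ {s} _ → tested≤1 v (V r) (V s) (lowCommon (V r) (V s) + highCommon r s)) (≤-trans (≤-reflexive (*-identityʳ h)) (∑hi≤ Δ n)))
          (*-monoˡ-≤ n (∑hi≤ Δ n)))
        (∑-≤ n λ {z} _ → ≤-trans (*-mono-≤ {low Δ z} ([<]≤1 (deg z) (suc Δ))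
          (≤-trans (∑-≤ n λ {x} _ → *-mono-≤ {a z x} (a≤1 z x) (tested≤1 v z x (com v z x))) (≤-reflexive (*-identityʳ n)))) (≤-reflexive (+-identityʳ n)))
        where
        h = numHigh Δ
        open Scores v Δ h V

      vertexTime : ℕ → ℕ
      vertexTime Δ = 10 + (2 + ∑ n (λ u → 5 + deg u * 3)) + (2 + ∑ n (λ u → 4 + deg u * (8 + Δ * 4)))
          + (2 + 8 * (Δ * (m + n))) + suc (Δ * (m + n)) + (2 + 10 * (Δ * (m + n)))

      attemptTime : ℕ → ℕ
      attemptTime Δ = 5 + (2 + ∑ n (λ _ → 4)) + (2 + ∑ n (λ v → suc (3 + heavy v * vertexTime Δ)))

      highList-ok : ∀ l {μ} (let vs = gl ▹ l; Δ = vs rΔ) → Stored b μ →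
        Run (for ru (` rn) highBodyList) (vs [ rh ≔ 0 ]) μ (λ vs′ μ′ t → t ≤ 2 + ∑ n (λ _ → 4) ×
          Below (4 * b * b) μ μ′ × Above (5 * b * b) μ μ′ × Enumerates Δ (λ r → μ′ (cellℕ b 4 0 r)) ×
          ∃ λ u → vs′ ≡ vs [ ru ≔ u ] [ rh ≔ numHigh Δ ])
      highList-ok l {μ} st =
        iterate
          (λ u vs′ μ′ → Below (4 * b * b) μ μ′ × Above (5 * b * b) μ μ′ × Upto u μ′ × vs′ ≡ vs [ ru ≔ u ] [ rh ≔ ∑ u (hi Δ) ])
          n (λ _ → 3) n<β
          (λ { (_ , _ , _ , refl) → refl , refl })
          (λ { {u} {μ = μ₁} u<n (lo , ab , up , refl) →
            branch
              (λ nz → sequence (set (cellℕ b 4 0 (∑ u (hi Δ))) u refl refl (<-trans u<n n<β)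
                (assign (∑ u (hi Δ) + 1) refl (≤-<-trans (+-monoˡ-≤ 1 (∑hi≤ Δ u)) (≤-<-trans (≤-reflexive (+-comm u 1)) (≤-<-trans u<n n<β)))
                  (≤-refl , refl
                  , _ , (below-set {a = cellℕ b 4 0 (∑ u (hi Δ))} {u} (cell-≥ b 4 0 _) lo
                        , above-set {μ′ = μ₁} {cellℕ b 4 0 (∑ u (hi Δ))} {u} (cell-< {k = 4} 0<b (≤-<-trans (∑hi≤ Δ u) (<-trans u<n n<b))) ab
                        , add-high μ₁ u<n (degree-high lo u<n nz) up , refl)
                  , ✓h (cong (∑ u (hi Δ) +_) (degree-high lo u<n nz))))))
              (λ z → nothing (s≤s (s≤s z≤n) , refl
                , _ , (lo , ab , skip-low μ₁ u<n (degree-low lo u<n z) up , refl)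
                , ✓h (trans (cong (∑ u (hi Δ) +_) (degree-low lo u<n z)) (+-identityʳ _)))) })
          (_ , (below-refl , above-refl , ((λ g → refl) , λ r ()) , refl) , ✓)
          (λ { (lo , ab , up , refl) t≤ → t≤ , lo , ab , up , n , refl })
        where
        vs = gl ▹ l
        Δ = vs rΔ
        Upto : ℕ → Mem → Set
        Upto u μ′ = (∀ (g : ℕ → ℕ) → ∑ (∑ u (hi Δ)) (λ r → g (μ′ (cellℕ b 4 0 r))) ≡ ∑ u (λ x → hi Δ x * g x))
                    × (∀ r → r < ∑ u (hi Δ) → μ′ (cellℕ b 4 0 r) < n)
        degree-high : ∀ {μ₁ u} → Below (4 * b * b) μ μ₁ → u < n → [ Δ < μ₁ (cellℕ b 1 0 u) ] ≢ 0 → hi Δ u ≡ 1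
        degree-high lo u<n nz = [<]-yes (subst (Δ <_) (Stored.degrees (stored-below n<b lo st) u<n) ([<]-≢0 nz))
        degree-low : ∀ {μ₁ u} → Below (4 * b * b) μ μ₁ → u < n → [ Δ < μ₁ (cellℕ b 1 0 u) ] ≡ 0 → hi Δ u ≡ 0
        degree-low lo u<n z = [<]-no (subst (_≤ Δ) (Stored.degrees (stored-below n<b lo st) u<n) ([<]-≡0 z))
        skip-low : ∀ μ₁ {u} → u < n → hi Δ u ≡ 0 → Upto u μ₁ → Upto (suc u) μ₁
        skip-low μ₁ {u} u<n z (sums , bound) rewrite z | +-identityʳ (∑ u (hi Δ)) =
          (λ g → trans (sums g) (sym (+-identityʳ _))) , bound
        add-high : ∀ μ₁ {u} → u < n → hi Δ u ≡ 1 → Upto u μ₁ → Upto (suc u) (μ₁ [ cellℕ b 4 0 (∑ u (hi Δ)) ↦ u ])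
        add-high μ₁ {u} u<n one (sums , bound) rewrite one | +-comm (∑ u (hi Δ)) 1 =
          (λ g → cong₂ _+_ (trans (∑-cong H (λ {r} r< → cong g (older r<))) (sums g))
                     (trans (cong g newest) (sym (+-identityʳ (g u)))))
          , λ r r< → entry< r r< (r ≟ H)
          where
          H = ∑ u (hi Δ)
          older : ∀ {r} → r < H → (μ₁ [ cellℕ b 4 0 H ↦ u ]) (cellℕ b 4 0 r) ≡ μ₁ (cellℕ b 4 0 r)
          older r< = update-other μ₁ (cellℕ b 4 0 H) (<⇒≢ r< ∘ +-cancelˡ-≡ ((4 * b + 0) * b) _ _)
          newest : (μ₁ [ cellℕ b 4 0 H ↦ u ]) (cellℕ b 4 0 H) ≡ u
          newest = update-same μ₁ (cellℕ b 4 0 H) refl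
          entry< : ∀ r → r < suc H → Dec (r ≡ H) → (μ₁ [ cellℕ b 4 0 H ↦ u ]) (cellℕ b 4 0 r) < n
          entry< r r< (yes refl) = subst (_< n) (sym newest) u<n
          entry< r r< (no r≢) = subst (_< n) (sym (older r<H)) (bound r r<H)
            where r<H = ≤∧≢⇒< (≤-pred r<) r≢

      Verdict : ℕ → (ℕ → ℕ) → ℕ → ℕ → ℕ → Set
      Verdict Δ V k f z = (f ≡ 0 × z ≡ total Δ V k) ⊎ (f ≡ 1 × Fail Δ)

      vertices-ok : ∀ l {μ} (let vs = gl ▹ l; Δ = vs rΔ; V = λ r → μ (cellℕ b 4 0 r)) → 1 ≤ Δ → Δ ≤ 4 * m + 1 →
        vs rN ≡ size Δ → vs rF ≡ Δ * (m + n) → vs rh ≡ numHigh Δ → vs rfail ≡ 0 → vs rans ≡ 0 →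
        5 ≤ vs rid → vs rid + n + 2 ≤ J → Stored b μ → Enumerates Δ V → Fresh (vs rid) μ →
        Run (for rv (` rn) (vertexBody (code P))) vs μ (λ vs′ μ′ t → t ≤ 2 + ∑ n (λ v → suc (3 + heavy v * vertexTime Δ)) ×
          Below (5 * b * b) μ μ′ × ∃ λ id → ∃ λ f → ∃ λ z → id ≤ vs rid + n × Fresh id μ′ × Verdict Δ V n f z × 5 ≤ id ×
          ∃ λ j → vs′ ≡ scratch vs j [ rv ≔ n ] [ rid ≔ id ] [ rans ≔ z ] [ rfail ≔ f ])
      vertices-ok l {μ} 1≤Δ Δ≤ N≡ F≡ h≡ fail≡ ans≡ 5≤id id≤J st en fresh =
        iterate
          (λ v vs′ μ′ → Below (5 * b * b) μ μ′ × ∃ λ id → ∃ λ f → ∃ λ z → id ≤ vs rid + v × Fresh id μ′ × Verdict Δ V v f z × 5 ≤ id ×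
            ∃ λ j → vs′ ≡ scratch vs j [ rv ≔ v ] [ rid ≔ id ] [ rans ≔ z ] [ rfail ≔ f ])
          n (λ v → 3 + heavy v * vertexTime Δ) n<β
          (λ { (_ , _ , _ , _ , _ , _ , _ , _ , _ , refl) → refl , refl })
          (λ { {v} {μ = μ₁} v<n (lo , id , f , z , id≤ , fr , verdict , 5≤ , j , refl) →
            let l₁ = scratch vs j [ rv ≔ v ] [ rid ≔ id ] [ rans ≔ z ] [ rfail ≔ f ] in
            branch
              (λ f≢0 → nothing (s≤s (s≤s z≤n) , refl
                , _ , (lo , id , f , z , ≤-trans id≤ (+-monoʳ-≤ (vs rid) (n≤1+n v)) , fr , still {v = v} f≢0 verdict , 5≤ , j , refl) , ✓))
              (λ f≡0 → branch
                (λ nz → restart (gl ▹ l₁) ✓ (weaken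
                  (process-ok v Δ (size Δ) (Δ * (m + n)) (numHigh Δ) id V v<n (numHigh≤size Δ 1≤Δ) (∑hi≤ Δ n) (proj₂ en) 5≤
                    (fits (size≤ Δ)) (≤-<-trans (size≤ Δ) 2m<M) (≤-trans (+-mono-≤ (*-mono-≤ (size≤ Δ) (size≤ Δ)) (*-mono-≤ (size≤ Δ) (size≤ Δ))) N²≤M)
                    (≤-trans (*-monoˡ-≤ b (*-monoˡ-≤ b (id+2≤ id≤ v<n))) idb)
                    (≤-<-trans (*-monoˡ-≤ M (≤-trans (n≤1+n (suc id)) (id+2≤ id≤ v<n))) idM)
                    (≤-<-trans (*-monoˡ-≤ (m + n) Δ≤) F<) 3n< n+2<
                    l₁ {μ₁} refl refl N≡ F≡ h≡ refl f≡0
                    (stored-below n<b (below-≤ (tables≤ (n≤1+n 4)) lo) st) (λ r r< → Below.at lo (cell-< {k = 4} 0<b (<-trans (<-≤-trans r< (∑hi≤ Δ n)) n<b)))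
                    fr (z< {v = v} v<n f≡0 verdict))
                  λ { (t≤ , lo′ , f′ , z′ , (fr′ , out) , j′ , refl) →
                    time-heavy (is-heavy lo v<n nz) t≤ , refl
                    , _ , (below-trans lo lo′ , suc id , f′ , z′ , ≤-trans (s≤s id≤) (≤-reflexive (sym (+-suc (vs rid) v))) , fr′
                          , next (is-heavy lo v<n nz) (finished {v = v} f≡0 verdict) out , m≤n⇒m≤1+n 5≤ , j′ , refl)
                    , ✓ }))
                (λ z≡0 → nothing (s≤s (s≤s (s≤s z≤n)) , refl
                  , _ , (lo , id , f , z , ≤-trans id≤ (+-monoʳ-≤ (vs rid) (n≤1+n v)) , fr
                        , inj₁ (f≡0 , trans (finished {v = v} f≡0 verdict) (sym (trans (cong (λ y → total Δ V v + y * score v Δ V) (not-heavy lo v<n z≡0)) (+-identityʳ _)))) , 5≤ , j , refl)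
                  , ✓))) })
          (_ , (below-refl , vs rid , 0 , 0 , m≤m+n (vs rid) 0 , fresh , inj₁ (refl , refl) , 5≤id , vs , refl) , ✓init (sym ans≡) (sym fail≡))
          (λ { (lo , id , f , z , id≤ , fr , verdict , 5≤ , j , refl) t≤ → t≤ , lo , id , f , z , id≤ , fr , verdict , 5≤ , j , refl })
        where
        vs = gl ▹ l
        Δ = vs rΔ
        V : ℕ → ℕ
        V r = μ (cellℕ b 4 0 r)
        size≤ : ∀ Δ → size Δ ≤ m + m
        size≤ = quotient≤ (m + m)
        id+2≤ : ∀ {id v} → id ≤ vs rid + v → v < n → suc (suc id) ≤ J
        id+2≤ {id} {v} id≤ v<n = ≤-trans (≤-trans (s≤s (s≤s id≤)) (≤-trans (≤-reflexive (+-comm 2 (vs rid + v))) (+-monoˡ-≤ 2 (+-monoʳ-≤ (vs rid) (<⇒≤ v<n))))) id≤J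
        still : ∀ {f v z} → f ≢ 0 → Verdict Δ V v f z → Verdict Δ V (suc v) f z
        still f≢0 (inj₁ (f≡ , _)) = contradiction f≡ f≢0
        still f≢0 (inj₂ x) = inj₂ x
        finished : ∀ {f v z} → f ≡ 0 → Verdict Δ V v f z → z ≡ total Δ V v
        finished _ (inj₁ (_ , e)) = e
        finished refl (inj₂ (() , _))
        z< : ∀ {f v z} → v < n → f ≡ 0 → Verdict Δ V v f z → z + n * n + n * n < β
        z< {v = v} {z} v<n f≡0 verdict = ≤-<-trans (≤-trans (≤-reflexive (+-assoc z (n * n) (n * n)))
          (+-monoˡ-≤ (n * n + n * n) (≤-trans (≤-reflexive (finished {v = v} f≡0 verdict))
            (≤-trans (∑-≤ v λ {x} _ → ≤-trans (*-mono-≤ {heavy x} ([<]≤1 n (3 * deg x + 4)) (score≤ x Δ V)) (≤-reflexive (+-identityʳ _)))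
              (*-monoˡ-≤ (n * n + n * n) (<⇒≤ v<n)))))) ans<
        is-heavy : ∀ {μ₁ v} → Below (5 * b * b) μ μ₁ → v < n → [ n < 3 * μ₁ (cellℕ b 1 0 v) + 4 ] ≢ 0 → heavy v ≡ 1
        is-heavy lo v<n nz = [<]-yes (subst (λ d → n < 3 * d + 4) (Stored.degrees (stored-below n<b (below-≤ (tables≤ (n≤1+n 4)) lo) st) v<n) ([<]-≢0 nz))
        not-heavy : ∀ {μ₁ v} → Below (5 * b * b) μ μ₁ → v < n → [ n < 3 * μ₁ (cellℕ b 1 0 v) + 4 ] ≡ 0 → heavy v ≡ 0
        not-heavy lo v<n z = [<]-no (subst (λ d → 3 * d + 4 ≤ n) (Stored.degrees (stored-below n<b (below-≤ (tables≤ (n≤1+n 4)) lo) st) v<n) ([<]-≡0 z))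
        next : ∀ {v z f′ z′} → heavy v ≡ 1 → z ≡ total Δ V v →
          (f′ ≡ 0 × z′ ≡ score v Δ V + z) ⊎ (f′ ≡ 1 × numHigh Δ ≢ 0 × Slow P w′ (size Δ) (Δ * (m + n))) → Verdict Δ V (suc v) f′ z′
        next {v} {z} hv z≡ (inj₁ (f≡ , z′≡)) = inj₁ (f≡ , trans z′≡ (trans (+-comm (score v Δ V) z)
          (cong₂ _+_ z≡ (sym (trans (cong (_* score v Δ V) hv) (+-identityʳ _))))))
        next _ _ (inj₂ (f≡ , fl)) = inj₂ (f≡ , fl)
        time-heavy : ∀ {v t} → heavy v ≡ 1 → t ≤ vertexTime Δ → suc (suc t) ≤ 3 + heavy v * vertexTime Δ
        time-heavy {v} {t} hv t≤ = s≤s (s≤s (≤-trans t≤ (≤-trans (≤-reflexive (sym (trans (cong (_* vertexTime Δ) hv) (+-identityʳ _)))) (n≤1+n _))))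

      scratch₂ : Vars → Vars → Vars
      scratch₂ vs j = scratch (vs [ rN ≔ j rN ] [ rF ≔ j rF ] [ rh ≔ j rh ] [ rv ≔ j rv ]) j

      private
        1<β : 1 < β
        1<β = ≤-trans (≤ᵇ⇒≤ 2 8 tt) 8≤β

        7≤J : 7 ≤ J
        7≤J = ≤-trans (≤-trans (m≤m+n 7 ((m + m + 2) * n)) (m≤m+n _ n)) J<

      -- The order in which the high vertices are listed stays unspecified.
      Answer : ℕ → ℕ → Set
      Answer Δ z = ∃ λ V → Enumerates Δ V × z ≡ total Δ V n

      attempt-ok : ∀ l {μ} (let vs = gl ▹ l; Δ = vs rΔ) → 1 ≤ Δ → Δ ≤ 4 * m + 1 →
        5 ≤ vs rid → vs rid + n + 2 ≤ J → Stored b μ → Fresh (vs rid) μ →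
        Run (attempt (code P)) vs μ (λ vs′ μ′ t → t ≤ attemptTime Δ × Below (4 * b * b) μ μ′ ×
          ∃ λ id → ∃ λ f → ∃ λ z → id ≤ vs rid + n × 5 ≤ id × Fresh id μ′ ×
          ((f ≡ 0 × Answer Δ z) ⊎ (f ≡ 1 × Fail Δ)) ×
          ∃ λ j → vs′ ≡ scratch₂ vs j [ rid ≔ id ] [ rans ≔ z ] [ rfail ≔ f ])
      attempt-ok l {μ} 1≤Δ Δ≤ 5≤id id≤J st fresh =
        sequence (assign (size Δ) refl (≤-<-trans (quotient≤ (m + m) Δ) (<-≤-trans 2m<M M≤β))
        (sequence (assign (Δ * (m + n)) (cong (Δ *_) S≡) (≤-<-trans (*-monoˡ-≤ (m + n) Δ≤) F<)
        (sequence (assign 0 refl (<-trans (s≤s z≤n) 1<β)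
        (sequence (restart ((gl ▹ l₁) [ rh ≔ 0 ]) ✓ (weaken (highList-ok l₁ {μ} st)
          λ { {μ′ = μ₁} {t₁} (t₁≤ , lo₁ , hi₁ , en , u₁ , refl) →
          sequence (assign 0 refl (<-trans (s≤s z≤n) 1<β)
          (sequence (assign 0 refl (<-trans (s≤s z≤n) 1<β)
          (let l₂ = l₁ [ ru ≔ u₁ ] [ rh ≔ numHigh Δ ] [ rfail ≔ 0 ] [ rans ≔ 0 ] in
           restart (gl ▹ l₂) ✓ (settle (weaken
            (vertices-ok l₂ {μ₁} 1≤Δ Δ≤ refl refl refl refl refl 5≤id id≤J (stored-below n<b lo₁ st) en (keep {μ₁} hi₁))
            λ { {μ′ = μ₂} {t₂} (t₂≤ , lo₂ , id , f , z , id≤ , fr , verdict , 5≤ , j , refl) →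
              _ , (time t₁≤ t₂≤ , below-trans lo₁ (below-≤ (tables≤ (n≤1+n 4)) lo₂) , id , f , z , id≤ , 5≤ , fr , judge en verdict
                  , scratch l₂ j [ rv ≔ n ] , refl) , ✓ })))))) }))))))))
        where
        vs = gl ▹ l
        Δ = vs rΔ
        l₁ = l [ rN ≔ size Δ ] [ rF ≔ Δ * (m + n) ]
        keep : ∀ {μ₁} → Above (5 * b * b) μ μ₁ → Fresh (vs rid) μ₁
        keep hi a (inj₁ (a≥ , a<)) = trans (Above.at hi (≤-trans (tables≤ (≤-trans 5≤id (n≤1+n _))) a≥)) (fresh a (inj₁ (a≥ , a<)))
        keep hi a (inj₂ a≥) = trans (Above.at hi (≤-trans (≤-trans (tables≤ (≤-trans (≤ᵇ⇒≤ 5 7 tt) 7≤J)) idb) (≤-trans (m≤m+n M _) a≥))) (fresh a (inj₂ a≥))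
        judge : ∀ {V f z} → Enumerates Δ V → Verdict Δ V n f z → (f ≡ 0 × Answer Δ z) ⊎ (f ≡ 1 × Fail Δ)
        judge {V} en (inj₁ (f≡ , z≡)) = inj₁ (f≡ , V , en , z≡)
        judge en (inj₂ x) = inj₂ x
        time : ∀ {t₁ t₂ T₁ T₂} → t₁ ≤ T₁ → t₂ ≤ T₂ → 1 + (1 + (1 + (t₁ + (1 + (1 + t₂))))) ≤ 5 + T₁ + T₂
        time {t₁} {t₂} a b = ≤-trans (≤-reflexive (solve 2 (λ a b → con 1 :+ (con 1 :+ (con 1 :+ (a :+ (con 1 :+ (con 1 :+ b))))) := con 5 :+ a :+ b) refl t₁ t₂)) (+-mono-≤ (+-monoʳ-≤ 5 a) b)

      stepCost : ℕ → ℕ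
      stepCost i = attemptTime (2 ^ i) + 4

      Failed : ℕ → Set
      Failed k = ∀ i → i < k → Fail (2 ^ i)

      -- Every round is charged 3 units for the loop itself, also after success; only the rounds up
      -- to the successful one pay for an attempt.
      data Progress (e t f z Δ : ℕ) : Set where
        failing : f ≡ 1 → Δ ≡ 2 ^ e → Failed e → t ≤ 1 + 3 * e + ∑ e stepCost → Progress e t f z Δ
        solved : ∀ k → f ≡ 0 → Failed k → Answer (2 ^ k) z → t ≤ 1 + 3 * e + ∑ (suc k) stepCost → Progress e t f z Δ

      fail≤ : ∀ {Δ} → Fail Δ → Δ ≤ m + m
      fail≤ {Δ} (h≢0 , _) = ≤-trans (m≤n*m Δ (numHigh Δ) {{≢-nonZero h≢0}}) (numHigh*Δ Δ)

      failed-suc : ∀ {k} → Failed k → Fail (2 ^ k) → Failed (suc k)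
      failed-suc {k} fs f i i< with i ≟ k
      ... | yes refl = f
      ... | no i≢k = fs i (≤∧≢⇒< (≤-pred i<) i≢k)

      -- Beyond the first threshold, 1, only the double of a failed one is tried, and a failed one
      -- is at most 2m.
      power≤ : ∀ e → Failed e → 2 ^ e ≤ 4 * m + 1
      power≤ zero _ = m≤n+m 1 (4 * m)
      power≤ (suc e) fs = ≤-trans (*-monoʳ-≤ 2 (fail≤ (fs e ≤-refl)))
        (≤-trans (≤-reflexive (solve 1 (λ m → con 2 :* (m :+ m) := con 4 :* m) refl m)) (m≤m+n (4 * m) 1))

      attempts-ok : ∀ l {μ} (let vs = gl ▹ l) → Stored b μ → Fresh 5 μ →
        Run (attempts (code P)) vs μ (λ vs′ μ′ t → ∃ λ k → Failed k × Answer (2 ^ k) (vs′ rans) ×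
          t ≤ 5 + 3 * (m + m + 2) + ∑ (suc k) stepCost)
      attempts-ok l {μ} st fresh =
        sequence (assign 1 refl 1<β
        (sequence (assign 1 refl 1<β
        (sequence (assign 5 refl (≤-trans (≤ᵇ⇒≤ 6 8 tt) 8≤β)
        (loop-rule Inv (m + m + 2) (≤-trans (s≤s (≤-reflexive (solve 1 (λ m → m :+ m :+ con 2 := con 2 :* m :+ con 2) refl m))) (≤-trans (s≤s (+-mono-≤ (*-monoˡ-≤ m (≤ᵇ⇒≤ 2 4 tt)) (≤ᵇ⇒≤ 2 3 tt))) 4m<))
          (λ { _ (_ , _ , _ , _ , _ , _ , _ , _ , _ , _ , refl) → refl , refl })
          (λ { {e} {μ = μ₁} {t} e< (Δ , id , f , z , progress , id≤ , 5≤ , fr , lo , j , refl) →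
            let l₁ = scratch₂ vs j [ re ≔ e ] [ rΔ ≔ Δ ] [ rid ≔ id ] [ rans ≔ z ] [ rfail ≔ f ] in
            branch
              (λ f≢0 → let Δ≡ , fs , t≤ = still-failing {e} {t} {f} {z} {Δ} progress f≢0 in
                sequence (restart (gl ▹ l₁) ✓ (weaken
                  (attempt-ok l₁ {μ₁} (subst (1 ≤_) (sym Δ≡) (m^n>0 2 e)) (subst (_≤ 4 * m + 1) (sym Δ≡) (power≤ e fs)) 5≤
                    (id-fits id≤ e<) (stored-below n<b lo st) fr)
                λ { {μ′ = μ₂} {t₁} (t₁≤ , lo₂ , id₂ , f₂ , z₂ , id₂≤ , 5≤′ , fr₂ , verdict , j₂ , refl) →
                  branch
                    (λ f₂≢0 → let fl = failure verdict f₂≢0 in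
                      assign (Δ + Δ) refl (≤-<-trans (+-mono-≤ (fail≤ fl) (fail≤ fl)) (≤-trans (s≤s (≤-trans (≤-reflexive (solve 1 (λ m → m :+ m :+ (m :+ m) := con 4 :* m) refl m)) (m≤m+n (4 * m) 3))) 4m<))
                      (refl , _ , (Δ + Δ , id₂ , f₂ , z₂
                        , failing (failure-flag verdict f₂≢0) (trans (cong₂ _+_ Δ≡ Δ≡) (cong (2 ^ e +_) (sym (+-identityʳ (2 ^ e)))))
                            (failed-suc fs (subst Fail Δ≡ fl)) (time-step {e} (subst (λ d → t₁ ≤ attemptTime d) Δ≡ t₁≤) t≤)
                        , id-next {e = e} id≤ id₂≤ , 5≤′ , fr₂ , below-trans lo lo₂ , j₂ , refl) , ✓))
                    (λ f₂≡0 → nothing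
                      (refl , _ , (Δ , id₂ , f₂ , z₂
                        , solved e f₂≡0 fs (subst (λ d → Answer d z₂) Δ≡ (success verdict f₂≡0)) (time-step {e} (subst (λ d → t₁ ≤ attemptTime d) Δ≡ t₁≤) t≤)
                        , id-next {e = e} id≤ id₂≤ , 5≤′ , fr₂ , below-trans lo lo₂ , j₂ , refl) , ✓)) })))
              (λ f≡0 → nothing (refl , _ , (Δ , id , f , z , wait progress f≡0 , ≤-trans id≤ (+-monoʳ-≤ 5 (*-monoˡ-≤ n (n≤1+n e))) , 5≤ , fr , lo , j , refl) , ✓)) })
          (_ , (1 , 5 , 1 , vs rans , failing refl refl (λ _ ()) ≤-refl , ≤-refl , ≤-refl , fresh , below-refl , vs , refl) , ✓)
          (λ { {t = t} (Δ , id , f , z , progress , _ , _ , _ , _ , j , refl) → conclude {t} progress })))))))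
        where
        vs = gl ▹ l
        Inv : ℕ → Post
        Inv e vs′ μ′ t = ∃ λ Δ → ∃ λ id → ∃ λ f → ∃ λ z → Progress e t f z Δ × id ≤ 5 + e * n × 5 ≤ id × Fresh id μ′ ×
          Below (4 * b * b) μ μ′ × ∃ λ j → vs′ ≡ scratch₂ vs j [ re ≔ e ] [ rΔ ≔ Δ ] [ rid ≔ id ] [ rans ≔ z ] [ rfail ≔ f ]
        still-failing : ∀ {e t f z Δ} → Progress e t f z Δ → f ≢ 0 → Δ ≡ 2 ^ e × Failed e × t ≤ 1 + 3 * e + ∑ e stepCost
        still-failing (failing _ Δ≡ fs t≤) _ = Δ≡ , fs , t≤
        still-failing (solved _ f≡ _ _ _) f≢ = contradiction f≡ f≢
        failure : ∀ {f z Δ} → (f ≡ 0 × Answer Δ z) ⊎ (f ≡ 1 × Fail Δ) → f ≢ 0 → Fail Δ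
        failure (inj₁ (f≡ , _)) f≢ = contradiction f≡ f≢
        failure (inj₂ (_ , fl)) _ = fl
        failure-flag : ∀ {f z Δ} → (f ≡ 0 × Answer Δ z) ⊎ (f ≡ 1 × Fail Δ) → f ≢ 0 → f ≡ 1
        failure-flag (inj₁ (f≡ , _)) f≢ = contradiction f≡ f≢
        failure-flag (inj₂ (f≡ , _)) _ = f≡
        success : ∀ {f z Δ} → (f ≡ 0 × Answer Δ z) ⊎ (f ≡ 1 × Fail Δ) → f ≡ 0 → Answer Δ z
        success (inj₁ (_ , ans)) _ = ans
        success (inj₂ (refl , _)) ()
        wait : ∀ {e t f z Δ} → Progress e t f z Δ → f ≡ 0 → Progress (suc e) (suc (t + 2)) f z Δ
        wait (failing refl _ _ _) ()
        wait {e} {t} (solved k f≡ fs ans t≤) _ = solved k f≡ fs ans (≤-trans (s≤s (+-monoˡ-≤ 2 t≤))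
          (≤-reflexive (solve 2 (λ e c → con 1 :+ (con 1 :+ con 3 :* e :+ c :+ con 2) := con 1 :+ con 3 :* (con 1 :+ e) :+ c) refl e (∑ (suc k) stepCost))))
        time-step : ∀ {e t t₁} → t₁ ≤ attemptTime (2 ^ e) → t ≤ 1 + 3 * e + ∑ e stepCost →
                    suc (t + suc (t₁ + suc 1)) ≤ 1 + 3 * suc e + ∑ (suc e) stepCost
        time-step {e} {t} {t₁} t₁≤ t≤ = ≤-trans (s≤s (+-mono-≤ t≤ (s≤s (+-monoˡ-≤ 2 t₁≤)))) (≤-trans (m≤n+m _ 3)
          (≤-reflexive (solve 3 (λ e c x → con 3 :+ (con 1 :+ (con 1 :+ con 3 :* e :+ c :+ (con 1 :+ (x :+ con 2)))) := con 1 :+ con 3 :* (con 1 :+ e) :+ (c :+ (x :+ con 4))) refl e (∑ e stepCost) (attemptTime (2 ^ e)))))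
        id-fits : ∀ {id e} → id ≤ 5 + e * n → e < m + m + 2 → id + n + 2 ≤ J
        id-fits {id} {e} id≤ e< = ≤-trans (+-monoˡ-≤ 2 (+-monoˡ-≤ n id≤)) (≤-trans (≤-reflexive (solve 2 (λ x n → con 5 :+ x :+ n :+ con 2 := con 7 :+ x :+ n) refl (e * n) n))
          (≤-trans (+-monoˡ-≤ n (+-monoʳ-≤ 7 (*-monoˡ-≤ n (<⇒≤ e<)))) J<))
        id-next : ∀ {id id₂ e} → id ≤ 5 + e * n → id₂ ≤ id + n → id₂ ≤ 5 + suc e * n
        id-next {e = e} id≤ id₂≤ = ≤-trans id₂≤ (≤-trans (+-monoˡ-≤ n id≤) (≤-reflexive (solve 2 (λ x n → con 5 :+ x :+ n := con 5 :+ (n :+ x)) refl (e * n) n)))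
        conclude : ∀ {t f z Δ} → Progress (m + m + 2) t f z Δ →
          ∃ λ k → Failed k × Answer (2 ^ k) z × 1 + (1 + (1 + suc t)) ≤ 5 + 3 * (m + m + 2) + ∑ (suc k) stepCost
        -- The rounds include the threshold 2 ^ (2m), which exceeds 2m and so cannot fail.
        conclude (failing _ _ fs _) = contradiction (fail≤ (fs (m + m) (m<m+n (m + m) (s≤s z≤n)))) (<⇒≱ (n<2^n (m + m)))
        conclude (solved k _ fs ans t≤) = k , fs , ans , +-monoʳ-≤ 4 t≤

      -- The meaning of the answer

      open Dominating tables

      balanced-yes : ∀ {x y} → x ≡ y → balanced x y ≡ 1
      balanced-yes {x} refl = cong (λ z → [ z + z < 1 ]) ([<]-no {x} {x} ≤-refl)

      balanced-no : ∀ {x y} → balanced x y ≢ 0 → x ≡ y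
      balanced-no {x} {y} nz with <-cmp x y
      ... | tri≈ _ e _ = e
      ... | tri< x<y _ _ = contradiction (cong₂ (λ p q → [ p + q < 1 ]) ([<]-yes x<y) ([<]-no (<⇒≤ x<y))) nz
      ... | tri> _ _ y<x = contradiction (cong₂ (λ p q → [ p + q < 1 ]) ([<]-no (<⇒≤ y<x)) ([<]-yes y<x)) nz

      T₀ : ℕ → ℕ → ℕ → ℕ
      T₀ v u x = tested v u x (com v u x)

      one : ∀ {x} → x ≤ 1 → x ≢ 0 → x ≡ 1
      one x≤ x≢ with ≤1 x≤
      ... | inj₁ z = contradiction z x≢
      ... | inj₂ o = o

      T₀-sound : ∀ {v u x} → v < n → u < n → x < n → T₀ v u x ≢ 0 → Triangle v u x
      T₀-sound {v} {u} {x} v< u< x< nz = triangle v< u< x<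
        (one (a≤1 v u) (≢0-*ˡ (≢0-*ˡ {a v u * a v x} (≢0-*ˡ {a v u * a v x * a u x} nz))))
        (one (a≤1 v x) (≢0-*ʳ {a v u} (≢0-*ˡ {a v u * a v x} (≢0-*ˡ {a v u * a v x * a u x} nz))))
        (one (a≤1 u x) (≢0-*ʳ {a v u * a v x} (≢0-*ˡ {a v u * a v x * a u x} nz)))
        (counts⇒dominates v u x v< (balanced-no {dOut v u + dOut v x + deg v + 1} (≢0-*ʳ {a v u * a v x * a u x} nz)))

      T₀-complete : ∀ {v u x} → Triangle v u x → T₀ v u x ≢ 0
      T₀-complete {v} {u} {x} t e = contradiction (trans (sym e) (cong₂ _*_ (cong₂ _*_ (cong₂ _*_ vu vw) uw) (balanced-yes (dominates⇒counts t)))) λ ()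
        where open Triangle t

      low+hi : ∀ Δ x → low Δ x + hi Δ x ≡ 1
      low+hi Δ x with Δ <? deg x
      ... | yes l = cong₂ _+_ ([<]-no l) ([<]-yes l)
      ... | no l = cong₂ _+_ ([<]-yes (s≤s (≮⇒≥ l))) ([<]-no (≮⇒≥ l))

      module _ (Δ : ℕ) (V : ℕ → ℕ) (en : Enumerates Δ V) (v : ℕ) (v<n : v < n) where

        open Scores v Δ (numHigh Δ) V using (lowCommon; highCommon)

        -- The table holds the low common neighbours and the product the high ones.
        common-split : ∀ r s → r < numHigh Δ → s < numHigh Δ → lowCommon (V r) (V s) + highCommon r s ≡ com v (V r) (V s)
        common-split r s r< s< = trans (cong (lowCommon (V r) (V s) +_) (proj₁ en (λ x → (a (V r) x * out v x) * a x (V s))))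
          (trans (sym (∑-+ n _ _)) (∑-cong n λ {x} _ → begin
            low Δ x * (a x (V r) * (a x (V s) * out v x)) + hi Δ x * (a (V r) x * out v x * a x (V s))
              ≡⟨ cong₂ (λ p q → low Δ x * (p * (q * out v x)) + hi Δ x * (a (V r) x * out v x * q)) (symmetric x (V r)) (symmetric x (V s)) ⟩
            low Δ x * (a (V r) x * (a (V s) x * out v x)) + hi Δ x * (a (V r) x * out v x * a (V s) x)
              ≡⟨ solve 5 (λ l h p q o → l :* (p :* (q :* o)) :+ h :* (p :* o :* q) := (l :+ h) :* (p :* (q :* o))) refl (low Δ x) (hi Δ x) (a (V r) x) (a (V s) x) (out v x) ⟩
            (low Δ x + hi Δ x) * (a (V r) x * (a (V s) x * out v x))
              ≡⟨ trans (cong (_* (a (V r) x * (a (V s) x * out v x))) (low+hi Δ x)) (+-identityʳ _) ⟩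
            a (V r) x * (a (V s) x * out v x) ∎))
          where open ≡-Reasoning

        -- Sums along the list of high vertices become sums over all vertices weighted by `hi`,
        -- which makes the score independent of the list.
        score≡ : score v Δ V ≡ ∑ n (λ x → hi Δ x * ∑ n (λ y → hi Δ y * T₀ v x y)) + ∑ n (λ z → low Δ z * ∑ n (λ x → a z x * T₀ v z x))
        score≡ = cong (_+ ∑ n (λ z → low Δ z * ∑ n (λ x → a z x * T₀ v z x)))
          (trans (∑-cong (numHigh Δ) λ {r} r< → trans (∑-cong (numHigh Δ) λ {s} s< → cong (tested v (V r) (V s)) (common-split r s r< s<))
                   (proj₁ en (λ y → T₀ v (V r) y)))
                 (proj₁ en (λ x → ∑ n (λ y → hi Δ y * T₀ v x y))))

        score-sound : score v Δ V ≢ 0 → ∃ λ u → ∃ λ x → Triangle v u x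
        score-sound nz with ∑ n (λ x → hi Δ x * ∑ n (λ y → hi Δ y * T₀ v x y)) ≟ 0
        ... | no nz₁ with ∑-positive n _ nz₁
        ... | u , u< , nz₂ with ∑-positive n _ (≢0-*ʳ {hi Δ u} nz₂)
        ... | x , x< , nz₃ = u , x , T₀-sound v<n u< x< (≢0-*ʳ {hi Δ x} nz₃)
        score-sound nz | yes z with ∑-positive n (λ z → low Δ z * ∑ n (λ x → a z x * T₀ v z x)) (λ z′ → nz (trans score≡ (cong₂ _+_ z z′)))
        ... | u , u< , nz₂ with ∑-positive n _ (≢0-*ʳ {low Δ u} nz₂)
        ... | x , x< , nz₃ = u , x , T₀-sound v<n u< x< (≢0-*ʳ {a u x} nz₃)

        -- A pair with a low end is found from that end, after swapping if necessary; a pair of two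
        -- high vertices is found by means of the product.
        score-complete : ∀ {u x} → Triangle v u x → score v Δ V ≢ 0
        score-complete {u} {x} t e with m+n≡0⇒m≡0 _ (trans (sym score≡) e) | m+n≡0⇒n≡0 (∑ n (λ x → hi Δ x * ∑ n (λ y → hi Δ y * T₀ v x y))) (trans (sym score≡) e)
        ... | z₁ | z₂ with Δ <? deg u | Δ <? deg x
        ... | no lu | _ = ∑-≢0 n (λ z → low Δ z * ∑ n (λ x → a z x * T₀ v z x)) u<
              (*-≢0 (λ z → contradiction (trans (sym ([<]-yes (s≤s (≮⇒≥ lu)))) z) λ ())
                (∑-≢0 n (λ x → a u x * T₀ v u x) w< (*-≢0 (λ z → contradiction (trans (sym uw) z) λ ()) (T₀-complete t)))) z₂
          where open Triangle t
        ... | yes _ | no lx = ∑-≢0 n (λ z → low Δ z * ∑ n (λ x → a z x * T₀ v z x)) w<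
              (*-≢0 (λ z → contradiction (trans (sym ([<]-yes (s≤s (≮⇒≥ lx)))) z) λ ())
                (∑-≢0 n (λ y → a x y * T₀ v x y) u< (*-≢0 (λ z → contradiction (trans (sym (trans (symmetric x u) uw)) z) λ ()) (T₀-complete (swap-triangle t))))) z₂
          where open Triangle t
        ... | yes hu | yes hx = ∑-≢0 n (λ x → hi Δ x * ∑ n (λ y → hi Δ y * T₀ v x y)) u<
              (*-≢0 (λ z → contradiction (trans (sym ([<]-yes hu)) z) λ ())
                (∑-≢0 n (λ y → hi Δ y * T₀ v u y) w< (*-≢0 (λ z → contradiction (trans (sym ([<]-yes hx)) z) λ ()) (T₀-complete t)))) z₁
          where open Triangle t

      answer-sound : ∀ {Δ z} → Answer Δ z → z ≢ 0 → ∃ λ v → ∃ λ u → ∃ λ x → Triangle v u x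
      answer-sound {Δ} (V , en , refl) nz with ∑-positive n (λ v → heavy v * score v Δ V) nz
      ... | v , v< , nz′ = v , score-sound Δ V en v v< (≢0-*ʳ {heavy v} nz′)

      answer-complete : ∀ {Δ z v u x} → Answer Δ z → Triangle v u x → z ≢ 0
      answer-complete {Δ} (V , en , refl) t with heavy-first t
      ... | v , u , x , t′ , h = ∑-≢0 n (λ v → heavy v * score v Δ V) (Triangle.v< t′)
        (*-≢0 (λ z → contradiction (trans (sym ([<]-yes h)) z) λ ()) (score-complete Δ V en v (Triangle.v< t′) t′))

      -- Adding up the running time

      module _ where
        open ≤-Reasoning

        private
          S = m + n

        vertexTime≤ : ∀ Δ → 1 ≤ Δ → 1 ≤ n → vertexTime Δ ≤ 68 * (Δ * S)
        vertexTime≤ Δ 1≤Δ 1≤n = begin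
          vertexTime Δ
            ≡⟨ cong₂ (λ x y → 10 + (2 + x) + (2 + y) + (2 + 8 * F) + suc F + (2 + 10 * F)) (linear 5 3) (linear 4 (8 + Δ * 4)) ⟩
          10 + (2 + (n * 5 + (m + m) * 3)) + (2 + (n * 4 + (m + m) * (8 + Δ * 4))) + (2 + 8 * F) + suc F + (2 + 10 * F)
            ≡⟨ solve 4 (λ n m d F → con 10 :+ (con 2 :+ (n :* con 5 :+ (m :+ m) :* con 3)) :+ (con 2 :+ (n :* con 4 :+ (m :+ m) :* (con 8 :+ d :* con 4))) :+ (con 2 :+ con 8 :* F) :+ (con 1 :+ F) :+ (con 2 :+ con 10 :* F)
                 := con 19 :* con 1 :+ con 9 :* n :+ con 22 :* m :+ con 8 :* (d :* m) :+ con 19 :* F) refl n m Δ F ⟩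
          19 * 1 + 9 * n + 22 * m + 8 * (Δ * m) + 19 * F
            ≤⟨ +-monoˡ-≤ (19 * F) (+-mono-≤ (+-mono-≤ (+-mono-≤ (*-monoʳ-≤ 19 (≤-trans 1≤n n≤F)) (*-monoˡ-≤ n (≤ᵇ⇒≤ 9 22 tt))) ≤-refl) (*-monoʳ-≤ 8 (*-monoʳ-≤ Δ (m≤m+n m n)))) ⟩
          19 * F + 22 * n + 22 * m + 8 * F + 19 * F
            ≡⟨ solve 3 (λ n m F → con 19 :* F :+ con 22 :* n :+ con 22 :* m :+ con 8 :* F :+ con 19 :* F := con 46 :* F :+ con 22 :* (m :+ n)) refl n m F ⟩
          46 * F + 22 * S ≤⟨ +-monoʳ-≤ (46 * F) (*-monoʳ-≤ 22 S≤F) ⟩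
          46 * F + 22 * F ≡⟨ *-distribʳ-+ F 46 22 ⟨
          68 * F ∎
          where
          F = Δ * S
          S≤F : S ≤ F
          S≤F = m≤n*m S Δ {{>-nonZero 1≤Δ}}
          n≤F : n ≤ F
          n≤F = ≤-trans (m≤n+m n m) S≤F
          linear : ∀ c d → ∑ n (λ u → c + deg u * d) ≡ n * c + (m + m) * d
          linear c d = trans (∑-+ n (λ _ → c) (λ u → deg u * d)) (cong₂ _+_ (∑-const n c) (trans (∑-*ʳ n deg d) (cong (_* d) edges≡)))

        -- The sum of n over the heavy vertices is at most three times that of deg v + 1.
        heavy-count : n * ∑ n heavy ≤ 6 * S
        heavy-count = begin
          n * ∑ n heavy ≡⟨ trans (*-comm n _) (sym (∑-*ʳ n heavy n)) ⟩
          ∑ n (λ v → heavy v * n) ≤⟨ ∑-mono n (λ {v} _ → each v) ⟩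
          ∑ n (λ v → 3 * deg v + 3) ≡⟨ trans (∑-+ n (λ v → 3 * deg v) (λ _ → 3)) (cong₂ _+_ (trans (∑-*ˡ n 3 deg) (cong (3 *_) edges≡)) (∑-const n 3)) ⟩
          3 * (m + m) + n * 3 ≤⟨ m≤m+n _ (3 * n) ⟩
          3 * (m + m) + n * 3 + 3 * n ≡⟨ solve 2 (λ m n → con 3 :* (m :+ m) :+ n :* con 3 :+ con 3 :* n := con 6 :* (m :+ n)) refl m n ⟩
          6 * S ∎
          where
          each : ∀ v → heavy v * n ≤ 3 * deg v + 3
          each v with n <? 3 * deg v + 4
          ... | yes h = ≤-trans (≤-reflexive (trans (cong (_* n) ([<]-yes h)) (+-identityʳ n))) (≤-pred (≤-trans h (≤-reflexive (+-suc (3 * deg v) 3))))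
          ... | no h = ≤-trans (≤-reflexive (cong (_* n) ([<]-no (≮⇒≥ h)))) z≤n

        -- The number of heavy vertices is O(m + n) only after multiplication by n, hence the factor
        -- n on the left. The constant is 6 · 68 for the heavy vertices, from `heavy-count` and
        -- `vertexTime≤`, plus 21 for the loops around them.
        stepCost≤ : ∀ i → 1 ≤ n → n * stepCost i ≤ 429 * (2 ^ i * (S * S))
        stepCost≤ i 1≤n = begin
          n * stepCost i
            ≡⟨ cong (λ z → n * z) (trans (cong (λ z → 5 + (2 + z) + (2 + ∑ n (λ v → suc (3 + heavy v * VT))) + 4) (∑-const n 4))
                 (trans (cong (λ z → 5 + (2 + n * 4) + (2 + z) + 4) (trans (∑-+ n (λ _ → 4) (λ v → heavy v * VT)) (cong₂ _+_ (∑-const n 4) (∑-*ʳ n heavy VT))))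
                   (solve 2 (λ n h → con 5 :+ (con 2 :+ n :* con 4) :+ (con 2 :+ (n :* con 4 :+ h)) :+ con 4 := con 13 :* con 1 :+ con 8 :* n :+ h) refl n (∑ n heavy * VT)))) ⟩
          n * (13 * 1 + 8 * n + ∑ n heavy * VT)
            ≡⟨ solve 3 (λ n h v → n :* (con 13 :* con 1 :+ con 8 :* n :+ h :* v) := con 13 :* (n :* con 1) :+ con 8 :* (n :* n) :+ n :* h :* v) refl n (∑ n heavy) VT ⟩
          13 * (n * 1) + 8 * (n * n) + n * ∑ n heavy * VT
            ≤⟨ +-mono-≤ (+-mono-≤ (*-monoʳ-≤ 13 (*-mono-≤ n≤S (≤-trans 1≤n n≤S))) (*-monoʳ-≤ 8 (*-mono-≤ n≤S n≤S))) (*-mono-≤ heavy-count (vertexTime≤ (2 ^ i) (m^n>0 2 i) 1≤n)) ⟩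
          13 * (S * S) + 8 * (S * S) + 6 * S * (68 * (2 ^ i * S))
            ≡⟨ solve 2 (λ S D → con 13 :* (S :* S) :+ con 8 :* (S :* S) :+ con 6 :* S :* (con 68 :* (D :* S)) := con 21 :* (S :* S) :+ con 408 :* (D :* (S :* S))) refl S (2 ^ i) ⟩
          21 * (S * S) + 408 * (2 ^ i * (S * S)) ≤⟨ +-monoˡ-≤ _ (*-monoʳ-≤ 21 (m≤n*m (S * S) (2 ^ i) {{m^n≢0 2 i}})) ⟩
          21 * (2 ^ i * (S * S)) + 408 * (2 ^ i * (S * S)) ≡⟨ *-distribʳ-+ (2 ^ i * (S * S)) 21 408 ⟨
          429 * (2 ^ i * (S * S)) ∎
          where
          VT = vertexTime (2 ^ i)
          n≤S = m≤n+m n m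

        -- The last threshold dominates, so that the search costs no more than a constant factor.
        powers-sum : ∀ j → ∑ (suc j) (2 ^_) ≤ 2 * 2 ^ j
        powers-sum zero = n≤1+n 1
        powers-sum (suc j) = ≤-trans (+-monoˡ-≤ (2 ^ suc j) (powers-sum j)) (≤-reflexive (cong (2 * 2 ^ j +_) (sym (+-identityʳ (2 * 2 ^ j)))))

        total≤ : ∀ j → 1 ≤ n → n * ∑ (suc j) stepCost ≤ 858 * (2 ^ j * (S * S))
        total≤ j 1≤n = begin
          n * ∑ (suc j) stepCost ≡⟨ ∑-*ˡ (suc j) n stepCost ⟨
          ∑ (suc j) (λ i → n * stepCost i) ≤⟨ ∑-mono (suc j) (λ {i} _ → stepCost≤ i 1≤n) ⟩
          ∑ (suc j) (λ i → 429 * (2 ^ i * (S * S))) ≡⟨ trans (∑-*ˡ (suc j) 429 (λ i → 2 ^ i * (S * S))) (cong (429 *_) (∑-*ʳ (suc j) (2 ^_) (S * S))) ⟩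
          429 * (∑ (suc j) (2 ^_) * (S * S)) ≤⟨ *-monoʳ-≤ 429 (*-monoˡ-≤ (S * S) (powers-sum j)) ⟩
          429 * (2 * 2 ^ j * (S * S)) ≡⟨ solve 2 (λ d s → con 429 :* (con 2 :* d :* s) := con 858 :* (d :* s)) refl (2 ^ j) (S * S) ⟩
          858 * (2 ^ j * (S * S)) ∎

        -- c is the number of multiplications in computing the modulus.
        time≤ : ∀ {c tl tp tr ta} j → tl ≤ 2 + (n + 2) * 3 → tp ≡ suc c → tr ≤ 2 + m * 9 → ta ≤ 5 + 3 * (m + m + 2) + ∑ (suc j) stepCost →
          n * (1 + (tl + (tp + 1)) + (tr + (ta + 1))) ≤ (c + 1000) * (2 ^ j * (S * S))
        time≤ {c} {tl} {.(suc c)} {tr} {ta} j tl≤ refl tr≤ ta≤ = go (n ≟ 0)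
          where
          go : Dec (n ≡ 0) → n * (1 + (tl + (suc c + 1)) + (tr + (ta + 1))) ≤ (c + 1000) * (2 ^ j * (S * S))
          go (yes n≡0) = ≤-trans (≤-reflexive (cong (_* (1 + (tl + (suc c + 1)) + (tr + (ta + 1)))) n≡0)) z≤n
          go (no n≢0) = begin
            n * (1 + (tl + (suc c + 1)) + (tr + (ta + 1)))
              ≤⟨ *-monoʳ-≤ n (+-mono-≤ (+-monoʳ-≤ 1 (+-monoˡ-≤ (suc c + 1) tl≤)) (+-mono-≤ tr≤ (+-monoˡ-≤ 1 ta≤))) ⟩
            n * (1 + (2 + (n + 2) * 3 + (suc c + 1)) + (2 + m * 9 + (5 + 3 * (m + m + 2) + Ct + 1)))
              ≡⟨ solve 4 (λ n m c s → n :* (con 1 :+ (con 2 :+ (n :+ con 2) :* con 3 :+ (con 1 :+ c :+ con 1)) :+ (con 2 :+ m :* con 9 :+ (con 5 :+ con 3 :* (m :+ m :+ con 2) :+ s :+ con 1)))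
                   := n :* ((c :+ con 25) :* con 1 :+ con 3 :* n :+ con 15 :* m) :+ n :* s) refl n m c Ct ⟩
            n * ((c + 25) * 1 + 3 * n + 15 * m) + n * Ct
              ≤⟨ +-mono-≤ (*-mono-≤ n≤S (+-mono-≤ (+-mono-≤ (*-monoʳ-≤ (c + 25) (≤-trans 1≤n n≤S)) (*-monoʳ-≤ 3 n≤S)) (*-monoʳ-≤ 15 (m≤m+n m n)))) (total≤ j 1≤n) ⟩
            S * ((c + 25) * S + 3 * S + 15 * S) + 858 * (2 ^ j * (S * S))
              ≡⟨ cong (_+ 858 * (2 ^ j * (S * S))) (solve 2 (λ c s → s :* ((c :+ con 25) :* s :+ con 3 :* s :+ con 15 :* s) := (c :+ con 43) :* (s :* s)) refl c S) ⟩
            (c + 43) * (S * S) + 858 * (2 ^ j * (S * S)) ≤⟨ +-monoˡ-≤ _ (*-monoʳ-≤ (c + 43) (m≤n*m (S * S) (2 ^ j) {{m^n≢0 2 j}})) ⟩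
            (c + 43) * (2 ^ j * (S * S)) + 858 * (2 ^ j * (S * S)) ≡⟨ *-distribʳ-+ (2 ^ j * (S * S)) (c + 43) 858 ⟨
            (c + 43 + 858) * (2 ^ j * (S * S)) ≤⟨ *-monoˡ-≤ (2 ^ j * (S * S)) (≤-trans (≤-reflexive (+-assoc c 43 858)) (+-monoʳ-≤ c (≤ᵇ⇒≤ 901 1000 tt))) ⟩
            (c + 1000) * (2 ^ j * (S * S)) ∎
            where
            Ct = ∑ (suc j) stepCost
            1≤n = n≢0⇒n>0 n≢0
            n≤S = m≤n+m n m

      search-ok : ∀ l {μ c tl tp tr} → Stored b μ → Fresh 5 μ → tl ≤ 2 + (n + 2) * 3 → tp ≡ suc c → tr ≤ 2 + m * 9 →
        Run (attempts (code P) ⨟ (rn ≔ # 0 ≺ ` rans)) (gl ▹ l) μ (λ vs′ μ′ u →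
          ((∃ λ v → ∃ λ u → ∃ λ x → Triangle v u x) → vs′ rn ≡ 1) × (¬ (∃ λ v → ∃ λ u → ∃ λ x → Triangle v u x) → vs′ rn ≡ 0) ×
          ∃ λ j → (∀ i → i < j → Stuck P n m w′ (2 ^ i)) × n * (1 + (tl + (tp + 1)) + (tr + u)) ≤ (c + 1000) * (2 ^ j * ((m + n) * (m + n))))
      search-ok l {μ} {c} st fresh tl≤ tp≡ tr≤ =
        sequence (weaken (attempts-ok l {μ} st fresh)
        λ { {vs₂} {μ₂} {ta} (j , failed , answer , ta≤) →
          assign [ 0 < vs₂ rans ] refl (≤-<-trans ([<]≤1 0 (vs₂ rans)) (≤-trans (s≤s (s≤s z≤n)) 8≤β))
            ( (λ has → [<]-yes (n≢0⇒n>0 (answer-complete answer (proj₂ (proj₂ (proj₂ has))))))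
            , (λ hasn′t → none-found (vs₂ rans ≟ 0) (λ nz → hasn′t (answer-sound answer nz)))
            , j , (λ i i< → fail≤ (failed i i<) , fits (quotient≤ (m + m) (2 ^ i)) , proj₂ (failed i i<))
            , time≤ {c} j tl≤ tp≡ tr≤ ta≤) })
        where
        none-found : ∀ {z} → Dec (z ≡ 0) → ¬ (z ≢ 0) → [ 0 < z ] ≡ 0
        none-found (yes refl) _ = refl
        none-found (no nz) no-nz = contradiction nz no-nz

-- The complete program

program : ℕ → Cmd → Stm
program c code = choose c ⨟ readGraph ⨟ attempts code ⨟ (rn ≔ # 0 ≺ ` rans)

exponent-≤ : ∀ {x y} → 2 ^ x ≤ 2 ^ y → x ≤ y
exponent-≤ {x} {y} 2^x≤ = ≮⇒≥ λ y<x → <⇒≱ (^-monoʳ-< 2 (s≤s (s≤s z≤n)) y<x) 2^x≤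

module Correspondence {n} (G : Graph n) (es : List (Edge n)) (es↭ : es ↭ edges G) where

  open Counting G es es↭

  module _ (tables : Tables n) (a≡ : ∀ u x → Tables.a tables u x ≡ adjacency u x) where

    open Dominating tables

    to-triangle : HasDominatingTriangle G → ∃ λ v → ∃ λ u → ∃ λ x → Triangle v u x
    to-triangle (u , v , w , (uv , vw , uw) , dom) = toℕ u , toℕ v , toℕ w , triangle (toℕ<n u) (toℕ<n v) (toℕ<n w) (yes-adj uv) (yes-adj uw) (yes-adj vw)
      λ {x} x<n → subst (λ x → x ≡ toℕ u ⊎ Tables.a tables (toℕ u) x ≡ 1 ⊎ Tables.a tables (toℕ v) x ≡ 1 ⊎ Tables.a tables (toℕ w) x ≡ 1)
        (toℕ-fromℕ< x<n) (cover-at (dom (fromℕ< x<n)))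
      where
      yes-adj : ∀ {p q} → Adj G p q → Tables.a tables (toℕ p) (toℕ q) ≡ 1
      yes-adj e = trans (a≡ _ _) (adjacent-yes e)
      cover-at : ∀ {x} → (x ≡ u ⊎ x ≡ v ⊎ x ≡ w) ⊎ (Adj G x u ⊎ Adj G x v ⊎ Adj G x w) →
        toℕ x ≡ toℕ u ⊎ Tables.a tables (toℕ u) (toℕ x) ≡ 1 ⊎ Tables.a tables (toℕ v) (toℕ x) ≡ 1 ⊎ Tables.a tables (toℕ w) (toℕ x) ≡ 1
      cover-at (inj₁ (inj₁ refl)) = inj₁ refl
      cover-at (inj₁ (inj₂ (inj₁ refl))) = inj₂ (inj₁ (yes-adj uv))
      cover-at (inj₁ (inj₂ (inj₂ refl))) = inj₂ (inj₁ (yes-adj uw))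
      cover-at (inj₂ (inj₁ e)) = inj₂ (inj₁ (yes-adj (Graph.sym G e)))
      cover-at (inj₂ (inj₂ (inj₁ e))) = inj₂ (inj₂ (inj₁ (yes-adj (Graph.sym G e))))
      cover-at (inj₂ (inj₂ (inj₂ e))) = inj₂ (inj₂ (inj₂ (yes-adj (Graph.sym G e))))

    from-triangle : ∀ {v u x} → Triangle v u x → HasDominatingTriangle G
    from-triangle {v} {u} {x} (triangle v< u< x< vu vx ux dom) =
      fromℕ< v< , fromℕ< u< , fromℕ< x< , (edge v< u< vu , edge u< x< ux , edge v< x< vx) , λ y → back y (dom (toℕ<n y))
      where
      edge : ∀ {p q} (p< : p < n) (q< : q < n) → Tables.a tables p q ≡ 1 → Adj G (fromℕ< p<) (fromℕ< q<)
      edge p< q< e = adjacent-no (trans (cong₂ adjacency (toℕ-fromℕ< p<) (toℕ-fromℕ< q<)) (trans (sym (a≡ _ _)) e))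
      edge-to : ∀ {p} (p< : p < n) y → Tables.a tables p (toℕ y) ≡ 1 → Adj G y (fromℕ< p<)
      edge-to p< y e = Graph.sym G (adjacent-no (trans (cong (λ z → adjacency z (toℕ y)) (toℕ-fromℕ< p<)) (trans (sym (a≡ _ _)) e)))
      back : ∀ y → toℕ y ≡ v ⊎ Tables.a tables v (toℕ y) ≡ 1 ⊎ Tables.a tables u (toℕ y) ≡ 1 ⊎ Tables.a tables x (toℕ y) ≡ 1 →
        (y ≡ fromℕ< v< ⊎ y ≡ fromℕ< u< ⊎ y ≡ fromℕ< x<) ⊎ (Adj G y (fromℕ< v<) ⊎ Adj G y (fromℕ< u<) ⊎ Adj G y (fromℕ< x<))
      back y (inj₁ e) = inj₁ (inj₁ (toℕ-injective (trans e (sym (toℕ-fromℕ< v<)))))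
      back y (inj₂ (inj₁ e)) = inj₂ (inj₁ (edge-to v< y e))
      back y (inj₂ (inj₂ (inj₁ e))) = inj₂ (inj₂ (inj₁ (edge-to u< y e)))
      back y (inj₂ (inj₂ (inj₂ e))) = inj₂ (inj₂ (inj₂ (edge-to x< y e)))

record Sized (mc : Machine) (n m c : ℕ) (P : Algorithm) (k : ℕ) : Set where
  open Machine mc
  gl : Consts
  gl = consts n m (2 ^ k) ((2 ^ k) ^ c) (m + n)
  field
    n<b : n < 2 ^ k
    b<β : 2 ^ k < β
    b³≤β : 2 ^ k * 2 ^ k * 2 ^ k ≤ β
    power<β : (2 ^ k) ^ c < β
    multiplier : Multiplier mc gl P
    bounds : Bounds mc gl multiplier

-- The exponent k is found by the program itself, so `sized` has to be available for every k in the
-- possible range.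
module Solver-run (mc : Machine) {n} (G : Graph n) (es : List (Edge n)) (es↭ : es ↭ edges G) (P : Algorithm) (c : ℕ)
  (n+2<β : n + 2 < Machine.β mc) (2x<β : 2 * (2 + n) < Machine.β mc) (m+n<β : length es + n < Machine.β mc)
  (2m≤n² : length es + length es ≤ n * n) (sized : ∀ k → 2 + n ≤ 2 ^ k → 2 ^ k ≤ 2 * (2 + n) → Sized mc n (length es) c P k) where

  open Machine mc
  open Logic mc
  open Correspondence G es es↭

  private
    m : ℕ
    m = length es

    n<β : n < β
    n<β = ≤-<-trans (m≤m+n n 2) n+2<β

    m<β : m < β
    m<β = ≤-<-trans (m≤m+n m n) m+n<β

    β≤2ʷ : β ≤ 2 ^ w
    β≤2ʷ = ≤-trans (≤-trans (≤-reflexive (sym (*-identityʳ β))) (^-monoʳ-≤ β (≤ᵇ⇒≤ 1 16 tt))) β¹⁶≤2ʷ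

    μ₀ : Mem
    μ₀ = mem (graphInput w n es)

    input : ∀ a → μ₀ a ≡ nth (listed es) a
    input a = word-small w (<-≤-trans (≤-<-trans (nth-listed< es a) n<β) β≤2ʷ)

  init : Vars
  init = (λ _ → 0) [ rn ≔ n ] [ rm ≔ m ]

  Correct : Post
  Correct vs _ t = (HasDominatingTriangle G → vs rn ≡ 1) × (¬ HasDominatingTriangle G → vs rn ≡ 0) ×
    ∃ λ w′ → ∃ λ j → (∀ i → i < j → Stuck P n m w′ (2 ^ i)) × n * t ≤ (c + 1000) * (2 ^ j * ((m + n) * (m + n)))

  module _ (k : ℕ) (sizes : Sized mc n m c P k) where

    open Sized sizes
    open Multiplier multiplier using (w′; M)
    open Bounds bounds using (J; J<; idb)

    private
      b = 2 ^ k

    -- Reading the graph changes no cell beyond table 3, and the input ends before that, so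
    -- everything later is still zero.
    fresh : ∀ {μ} → Above (4 * b * b) μ₀ μ → ∀ a → (6 * b * b ≤ a × a < M) ⊎ 6 * M ≤ a → μ a ≡ 0
    fresh hi a far = trans (Above.at hi a≥) (trans (input a) (nth-beyond (listed es)
        (≤-trans (≤-reflexive (length-listed es)) (≤-trans 2m≤n² (≤-trans (*-mono-≤ (<⇒≤ n<b) (<⇒≤ n<b)) (≤-trans (≤-trans (m≤n*m (b * b) 4) (≤-reflexive (sym (*-assoc 4 b b)))) a≥))))))
      where
      table : ∀ {j i} → j ≤ i → j * b * b ≤ i * b * b
      table j≤ = *-monoˡ-≤ b (*-monoˡ-≤ b j≤)
      4≤J : 4 ≤ J
      4≤J = ≤-trans (≤-trans (≤ᵇ⇒≤ 4 7 tt) (m≤m+n 7 ((m + m + 2) * n))) (≤-trans (m≤m+n _ n) J<)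
      a≥ : 4 * b * b ≤ a
      a≥ = [ (λ (x≥ , _) → ≤-trans (table (≤ᵇ⇒≤ 4 6 tt)) x≥)
           , (λ x≥ → ≤-trans (≤-trans (table 4≤J) idb) (≤-trans (m≤n*m M 6) x≥)) ]′ far

    rest-ok : ∀ l {tl tp} → tl ≤ 2 + (n + 2) * 3 → tp ≡ suc c →
      Run (readGraph ⨟ attempts (code P) ⨟ (rn ≔ # 0 ≺ ` rans)) (gl ▹ l) μ₀ (λ vs′ μ′ u → Correct vs′ μ′ (1 + (tl + (tp + 1)) + u))
    rest-ok l {tl} {tp} tl≤ tp≡ =
      sequence (weaken (Reading.readGraph-ok mc gl n<b b<β G es es↭ refl m<β l {μ₀} input)
      λ { {μ′ = μ₁} {tr} (tr≤ , part , hi , e , p , q , refl) →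
      let l₁ = (gl ▹ l) [ re ≔ e ] [ rp ≔ p ] [ rq ≔ q ]
          module Read = Reading mc gl n<b b<β G es es↭ refl m<β
          tables = Read.tables-of part
      in restart (gl ▹ l₁) ✓ (weaken
        (Phases.Processing.Attempting.search-ok mc gl tables n<b b³≤β multiplier bounds (Read.tables-degrees part)
          l₁ {μ₁} {c} {tl} {tp} {tr} (Read.tables-stored part) (fresh hi) tl≤ tp≡ tr≤)
        λ (has , hasn′t , j , stuck , t≤) →
          (λ h → has (to-triangle tables (λ _ _ → refl) h))
          , (λ no-h → hasn′t λ (v , u , x , t) → no-h (from-triangle tables (λ _ _ → refl) t))
          , w′ , j , stuck , t≤) })

  -- As long as the power is too small it doubles in each round and so stays ahead of the counter;
  -- after n + 2 rounds it is large enough.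
  choose-loop : Run (for re (` rn ⊕ # 2) doubling) (init [ rb ≔ 1 ]) μ₀ (λ vs′ μ′ t → t ≤ 2 + (n + 2) * 3 × μ′ ≡ μ₀ ×
    ∃ λ k → 2 + n ≤ 2 ^ k × 2 ^ k ≤ 2 * (2 + n) × ∃ λ e → vs′ ≡ init [ re ≔ e ] [ rb ≔ 2 ^ k ])
  choose-loop =
    iterate
      (λ i vs′ μ′ → μ′ ≡ μ₀ × ∃ λ k → (i < 2 ^ k ⊎ 2 + n ≤ 2 ^ k) × 2 ^ k ≤ 2 * (2 + n) × vs′ ≡ init [ re ≔ i ] [ rb ≔ 2 ^ k ])
      (n + 2) (λ _ → 2) n+2<β
      (λ { (refl , k , _ , _ , refl) → refl , refl })
      (λ { {i} i< (refl , k , far , b≤ , refl) → branch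
        (λ small → assign (2 ^ suc k) (cong (2 ^ k +_) (sym (+-identityʳ (2 ^ k)))) (bound {k} ([<]-≢0 small))
          (≤-refl , refl , _ , (refl , suc k , grow {k} far , *-monoʳ-≤ 2 (<⇒≤ (subst (2 ^ k <_) (+-comm n 2) ([<]-≢0 small))) , refl) , ✓))
        (λ large → nothing (≤-refl , refl , _ , (refl , k , inj₂ (subst (_≤ 2 ^ k) (+-comm n 2) ([<]-≡0 large)) , b≤ , refl) , ✓)) })
      (_ , (refl , 0 , inj₁ (s≤s z≤n) , s≤s z≤n , refl) , ✓)
      (λ { (refl , k , far , b≤ , refl) t≤ → ≤-trans t≤ (+-monoʳ-≤ 2 (≤-reflexive (∑-const (n + 2) 3))) , refl , k
         , [ (λ l → ≤-trans (≤-reflexive (+-comm 2 n)) (<⇒≤ l)) , (λ g → g) ]′ far , b≤ , n + 2 , refl })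
    where
    bound : ∀ {k} → 2 ^ k < n + 2 → 2 ^ suc k < β
    bound {k} l = ≤-<-trans (*-monoʳ-≤ 2 (<⇒≤ l)) (subst (λ x → 2 * x < β) (+-comm 2 n) 2x<β)
    grow : ∀ {k i} → i < 2 ^ k ⊎ 2 + n ≤ 2 ^ k → suc i < 2 ^ suc k ⊎ 2 + n ≤ 2 ^ suc k
    grow {k} (inj₁ i<) = inj₁ (≤-trans (+-mono-≤ (≤-trans (s≤s z≤n) i<) i<) (≤-reflexive (cong (2 ^ k +_) (sym (+-identityʳ (2 ^ k))))))
    grow {k} (inj₂ x≤) = inj₂ (≤-trans x≤ (m≤n*m (2 ^ k) 2))

  program-ok : Run (program c (code P)) init μ₀ Correct
  program-ok = sequence
    (sequence (assign 1 refl (≤-trans (s≤s (s≤s z≤n)) 8≤β)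
    (sequence (weaken choose-loop
      λ { {t = tl} (tl≤ , refl , k , x≤b , b≤2x , e , refl) →
      let vs₁ = init [ re ≔ e ] [ rb ≔ 2 ^ k ]
      in sequence (weaken (Choosing.powers-ok mc c vs₁ (2 ^ k) refl (m^n>0 2 k) (Sized.power<β (sized k x≤b b≤2x)))
      λ { {t = tp} (tp≡ , same-vs , refl) →
        restart (vs₁ [ rM ≔ (2 ^ k) ^ c ]) same-vs
          (assign (m + n) refl m+n<β (restart (Sized.gl (sized k x≤b b≤2x) ▹ vs₁) ✓ (rest-ok k (sized k x≤b b≤2x) vs₁ tl≤ tp≡))) }) }))))

  run-result : ∃₂ λ s t → (w ⊢ compile (program c (code P)) , graphInput w n es ⇓ s , t) ×
    (HasDominatingTriangle G → reg s 0 ≡ 1) × (¬ HasDominatingTriangle G → reg s 0 ≡ 0) ×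
    ∃ λ w′ → ∃ λ j → (∀ i → i < j → Stuck P n m w′ (2 ^ i)) × n * t ≤ κ * (c + 1000) * (2 ^ j * ((m + n) * (m + n)))
  run-result = finish (from program-ok (graphInput w n es) (bnd start< (λ a → subst (_< β) (sym (input a)) (≤-<-trans (nth-listed< es a) n<β))) agree refl)
    where
    open ≤-Reasoning
    small : ∀ {x} → x < β → word w x ≡ x
    small x< = word-small w (<-≤-trans x< β≤2ʷ)
    agree : Agrees (graphInput w n es) init
    agree {zero} _ = small n<β
    agree {suc zero} _ = small m<β
    agree {suc (suc r)} _ = small (≤-trans (s≤s z≤n) 8≤β)
    start< : ∀ {r} → r < temp → reg (graphInput w n es) r < β
    start< {zero} r< = subst (_< β) (sym (agree {0} r<)) n<β
    start< {suc zero} r< = subst (_< β) (sym (agree {1} r<)) m<β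
    start< {suc (suc r)} r< = subst (_< β) (sym (agree {suc (suc r)} r<)) (≤-trans (s≤s z≤n) 8≤β)
    finish : Ends (program c (code P)) (graphInput w n es) Correct → ∃₂ λ s t → (w ⊢ compile (program c (code P)) , graphInput w n es ⇓ s , t) ×
      (HasDominatingTriangle G → reg s 0 ≡ 1) × (¬ HasDominatingTriangle G → reg s 0 ≡ 0) ×
      ∃ λ w′ → ∃ λ j → (∀ i → i < j → Stuck P n m w′ (2 ^ i)) × n * t ≤ κ * (c + 1000) * (2 ^ j * ((m + n) * (m + n)))
    finish (ends {s} {t} {T₁} {vs} exec cost _ ag (has , hasn′t , w′ , j , stuck , nt≤)) =
      s , t , exec , (λ h → trans (ag (s≤s z≤n)) (has h)) , (λ h → trans (ag (s≤s z≤n)) (hasn′t h)) , w′ , j , stuck , (begin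
        n * t         ≤⟨ *-monoʳ-≤ n cost ⟩
        n * (κ * T₁)  ≡⟨ solve 3 (λ n k t → n :* (k :* t) := k :* (n :* t)) refl n κ T₁ ⟩
        κ * (n * T₁)  ≤⟨ *-monoʳ-≤ κ nt≤ ⟩
        κ * ((c + 1000) * (2 ^ j * ((m + n) * (m + n)))) ≡⟨ *-assoc κ (c + 1000) _ ⟨
        κ * (c + 1000) * (2 ^ j * ((m + n) * (m + n))) ∎)

module Solving (P : Algorithm) (mult : MultipliesMatrices P) where

  c κ : ℕ
  c = 2 * wordFactor P + 8
  κ = 200 + (registers (code P) + factor (code P) + 10)

  solver : Algorithm
  -- The words have to hold numbers up to β¹⁶, and β is (2 + n) ^ (2 c + 8).
  solver = record { code = compile (program c (code P)) ; wordFactor = (2 * c + 8) * 16 }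

  -- All that the analysis learns about a run: every threshold before the last left a certificate,
  -- and the last one governs the time.
  Timed : ℕ → ℕ → ℕ → Set
  Timed n m t = ∃ λ w′ → ∃ λ j → (∀ i → i < j → Stuck P n m w′ (2 ^ i)) × n * t ≤ κ * (c + 1000) * (2 ^ j * ((m + n) * (m + n)))

  module _ {n} (G : Graph n) (es : List (Edge n)) (es↭ : es ↭ edges G) (w : ℕ) (fits-w : FitsWords solver n w) where

    private
      m = length es

    open Counting G es es↭ using (2m≤n²)

    abstract
      β : ℕ
      β = (2 + n) ^ (2 * c + 8)

      β≡ : β ≡ (2 + n) ^ (2 * c + 8)
      β≡ = refl

      κ′ : ℕ
      κ′ = κ

      κ′≡ : κ′ ≡ κ
      κ′≡ = refl

    mc : Machine
    mc = machine w β κ′ (subst (8 ≤_) (sym β≡) Size₀.8≤β)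
      (≤-trans (≤-reflexive (trans (cong (_^ 16) β≡) (^-*-assoc (2 + n) (2 * c + 8) 16))) fits-w)
      (subst (200 ≤_) (sym κ′≡) (m≤m+n 200 (registers (code P) + factor (code P) + 10)))
      where
      module Size₀ = Sizes n m c (wordFactor P) (2 + n) ≤-refl (m≤n*m (2 + n) 2) 2m≤n² refl

    sized : ∀ k → 2 + n ≤ 2 ^ k → 2 ^ k ≤ 2 * (2 + n) → Sized mc n m c P k
    sized k x≤b b≤2x = record
      { n<b = Size.n<b
      ; b<β = toβ< Size.b<β
      ; b³≤β = toβ Size.b³≤β
      ; power<β = toβ< Size.M<β
      ; multiplier = record
        { mult = mult ; w′ = k * c
        ; w′≤w = exponent-≤ (≤-trans M≤β (≤-trans (≤-trans (≤-reflexive (sym (*-identityʳ β))) (^-monoʳ-≤ β {{>-nonZero (≤-trans (s≤s z≤n) (Machine.8≤β mc))}} (≤ᵇ⇒≤ 1 16 tt))) (Machine.β¹⁶≤2ʷ mc)))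
        ; M≡ = M≡ ; M≤β = M≤β
        ; κ≥ = subst (registers (code P) + factor (code P) + 10 ≤_) (sym κ′≡) (m≤n+m _ 200)
        ; n<M = subst (n <_) M≡ Size.n<M }
      ; bounds = record
        { S≡ = refl
        ; fits = λ {N} N≤ → subst ((2 + N) ^ wordFactor P ≤_) M≡ (Size.fits N≤)
        ; 2m<M = subst (m + m <_) M≡ Size.2m<M
        ; N²≤M = subst ((m + m) * (m + m) + (m + m) * (m + m) ≤_) M≡ Size.N²≤M
        ; J = Size.ids
        ; J< = Size.ids≥
        ; idb = subst (Size.ids * 2 ^ k * 2 ^ k ≤_) M≡ Size.idb
        ; idM = toβ< (subst (λ M → Size.ids * M < (2 + n) ^ (2 * c + 8)) M≡ Size.idM)
        ; 3n< = toβ< Size.3n<β ; n+2< = toβ< Size.n+2<β ; ans< = toβ< Size.ans<β ; F< = toβ< Size.F<β ; 4m< = toβ< Size.4m<β } }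
      where
      module Size = Sizes n m c (wordFactor P) (2 ^ k) x≤b b≤2x 2m≤n² refl
      toβ : ∀ {y} → y ≤ (2 + n) ^ (2 * c + 8) → y ≤ β
      toβ = subst (_ ≤_) (sym β≡)
      toβ< : ∀ {y} → y < (2 + n) ^ (2 * c + 8) → y < β
      toβ< = subst (_ <_) (sym β≡)
      M≡ : (2 ^ k) ^ c ≡ 2 ^ (k * c)
      M≡ = ^-*-assoc 2 k c
      M≤β : 2 ^ (k * c) ≤ β
      M≤β = subst (_≤ β) M≡ (<⇒≤ (toβ< Size.M<β))

    solved-run : ∃₂ λ s t → (w ⊢ code solver , graphInput w n es ⇓ s , t) ×
      (HasDominatingTriangle G → reg s 0 ≡ 1) × (¬ HasDominatingTriangle G → reg s 0 ≡ 0) × Timed n m t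
    solved-run = finish (Solver-run.run-result mc G es es↭ P c
        (subst (n + 2 <_) (sym β≡) Size₀.n+2<β)
        (subst (2 * (2 + n) <_) (sym β≡) (≤-<-trans (*-monoˡ-≤ (2 + n) (m≤m+n 2 n)) (<-≤-trans (m<m*n ((2 + n) * (2 + n)) (2 + n) {{_}} (s≤s (s≤s z≤n))) Size₀.b³≤β)))
        (subst (m + n <_) (sym β≡) Size₀.m+n<β) 2m≤n² sized)
      where
      module Size₀ = Sizes n m c (wordFactor P) (2 + n) ≤-refl (m≤n*m (2 + n) 2) 2m≤n² refl
      finish : (∃₂ λ s t → (w ⊢ compile (program c (code P)) , graphInput w n es ⇓ s , t) ×
          (HasDominatingTriangle G → reg s 0 ≡ 1) × (¬ HasDominatingTriangle G → reg s 0 ≡ 0) ×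
          ∃ λ w′ → ∃ λ j → (∀ i → i < j → Stuck P n m w′ (2 ^ i)) × n * t ≤ κ′ * (c + 1000) * (2 ^ j * ((m + n) * (m + n)))) →
        ∃₂ λ s t → (w ⊢ code solver , graphInput w n es ⇓ s , t) ×
          (HasDominatingTriangle G → reg s 0 ≡ 1) × (¬ HasDominatingTriangle G → reg s 0 ≡ 0) × Timed n m t
      finish (s , t , exec , has , hasn′t , w′ , j , stuck , nt≤) = s , t , exec , has , hasn′t , w′ , j , stuck ,
        subst (λ κ → n * t ≤ κ * (c + 1000) * (2 ^ j * ((m + n) * (m + n)))) κ′≡ nt≤

  solver-correct : SolvesDominatingTriangle solver
  solver-correct G es es↭ w fits =
    let s , t , exec , has , hasn′t , _ = solved-run G es es↭ w fits in s , t , exec , has , hasn′t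

  solver-timed : ∀ {n} (G : Graph n) es → es ↭ edges G → ∀ w → FitsWords solver n w →
    ∀ {s t} → w ⊢ code solver , graphInput w n es ⇓ s , t → Timed n (#edges G) t
  solver-timed {n} G es es↭ w fits {t = t} run =
    let _ , _ , exec , _ , _ , timed = solved-run G es es↭ w fits
    in subst₂ (Timed n) (↭-length es↭) (sym (proj₂ (deterministic run exec))) timed

-- Inequalities between powers

root-≤ : ∀ r {x y} → 1 ≤ r → x ^ r ≤ y ^ r → x ≤ y
root-≤ r {x} {y} 1≤r x^r≤ = ≮⇒≥ λ y<x → <⇒≱ (^-monoˡ-< r {{>-nonZero 1≤r}} y<x) x^r≤

^-distribʳ : ∀ x y r → (x * y) ^ r ≡ x ^ r * y ^ r
^-distribʳ x y zero = refl
^-distribʳ x y (suc r) = trans (cong (x * y *_) (^-distribʳ x y r))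
  (solve 4 (λ x y a b → x :* y :* (a :* b) := x :* a :* (y :* b)) refl x y (x ^ r) (y ^ r))

-- Bernoulli's inequality (1 + 1/x) ^ j ≥ 1 + j/x, cleared of denominators.
bernoulli : ∀ x j → x ^ j * (x + j) ≤ x * suc x ^ j
bernoulli x zero = ≤-reflexive (solve 1 (λ x → con 1 :* (x :+ con 0) := x :* con 1) refl x)
bernoulli x (suc j) = begin
  x * x ^ j * (x + suc j) ≤⟨ m≤m+n _ (x ^ j * j) ⟩
  x * x ^ j * (x + suc j) + x ^ j * j ≡⟨ solve 3 (λ x y j → x :* y :* (x :+ (con 1 :+ j)) :+ y :* j := (con 1 :+ x) :* (y :* (x :+ j))) refl x (x ^ j) j ⟩
  suc x * (x ^ j * (x + j)) ≤⟨ *-monoʳ-≤ (suc x) (bernoulli x j) ⟩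
  suc x * (x * suc x ^ j) ≡⟨ solve 2 (λ x z → (con 1 :+ x) :* (x :* z) := x :* ((con 1 :+ x) :* z)) refl x (suc x ^ j) ⟩
  x * suc x ^ suc j ∎
  where open ≤-Reasoning

-- If n^(1 − 1/(k+1)) ≤ x for all k then n ≤ x.
limit-≤ : ∀ n x → (∀ k → n ^ k ≤ x ^ suc k) → n ≤ x
limit-≤ n zero h = contradiction (h 0) λ ()
-- For x < n the hypothesis with k = x² gives (1 + 1/x) ^ k ≤ x, while Bernoulli's inequality gives
-- at least 1 + x.
limit-≤ n x@(suc _) h = ≮⇒≥ λ x<n → <⇒≱ (m<n+m (x * x) (s≤s z≤n)) (*-cancelˡ-≤ (x ^ (x * x)) {{m^n≢0 x (x * x)}} (begin
    x ^ (x * x) * (x + x * x) ≤⟨ bernoulli x (x * x) ⟩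
    x * suc x ^ (x * x) ≤⟨ *-monoʳ-≤ x (≤-trans (^-monoˡ-≤ (x * x) x<n) (h (x * x))) ⟩
    x * x ^ suc (x * x) ≡⟨ solve 2 (λ x y → x :* (x :* y) := y :* (x :* x)) refl x (x ^ (x * x)) ⟩
    x ^ (x * x) * (x * x) ∎))
  where open ≤-Reasoning

-- A lower bound for matrix multiplication

-- Each step writes at most one cell.

differs : ℕ → ℕ → ℕ
differs x y = 1 ∸ δ x y

differs-refl : ∀ x → differs x x ≡ 0
differs-refl x = cong (1 ∸_) (δ-same {x} refl)

differs≤1 : ∀ x y → differs x y ≤ 1
differs≤1 x y = m∸n≤m 1 (δ x y)

differs-≢ : ∀ {x y} → x ≢ y → differs x y ≡ 1
differs-≢ x≢y = cong (1 ∸_) (δ-other x≢y)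

differs-trans : ∀ x y z → differs x z ≤ differs x y + differs y z
differs-trans x y z with x ≟ y
... | yes refl = m≤n+m (differs x z) (differs x x)
... | no x≢y = ≤-trans (differs≤1 x z) (≤-trans (≤-reflexive (sym (differs-≢ x≢y))) (m≤m+n _ _))

changed : ℕ → Mem → Mem → ℕ
changed k f g = ∑ k (λ i → differs (f i) (g i))

changed-refl : ∀ k f → changed k f f ≡ 0
changed-refl k f = ∑-zero k λ {i} _ → differs-refl (f i)

changed-update : ∀ k f a v → changed k f (f [ a ↦ v ]) ≤ 1
changed-update k f a v = ≤-trans (∑-mono k λ {i} _ → each i) (one k)
  where
  each : ∀ i → differs (f i) ((f [ a ↦ v ]) i) ≤ δ i a
  each i with i ≡ᵇ a
  ... | true = differs≤1 (f i) v
  ... | false = ≤-reflexive (differs-refl (f i))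
  one : ∀ k → ∑ k (λ i → δ i a) ≤ 1
  one k with a <? k
  ... | yes a<k = ≤-reflexive (trans (∑-cong k λ {i} _ → sym (*-identityʳ (δ i a))) (∑-δ k (λ _ → 1) a<k))
  ... | no a≮k = ≤-trans (≤-reflexive (∑-zero k λ {i} i<k → δ-other λ i≡a → a≮k (subst (_< k) i≡a i<k))) z≤n

changed-trans : ∀ k f g h → changed k f h ≤ changed k f g + changed k g h
changed-trans k f g h = ≤-trans (∑-mono k λ {i} _ → differs-trans (f i) (g i) (h i)) (≤-reflexive (∑-+ k _ _))

writes≤time : ∀ k {w c s s′ t} → w ⊢ c , s ⇓ s′ , t → changed k (mem s) (mem s′) ≤ t
writes≤time k (skip {s}) = ≤-trans (≤-reflexive (changed-refl k (mem s))) z≤n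
writes≤time k (const {s = s}) = ≤-trans (≤-reflexive (changed-refl k (mem s))) z≤n
writes≤time k (op {s = s}) = ≤-trans (≤-reflexive (changed-refl k (mem s))) z≤n
writes≤time k (load {s = s}) = ≤-trans (≤-reflexive (changed-refl k (mem s))) z≤n
writes≤time k (store {x} {y} {s}) = changed-update k (mem s) (reg s x) (reg s y)
writes≤time k (seq {s = s} {s′} {s″} d e) = ≤-trans (changed-trans k (mem s) (mem s′) (mem s″)) (+-mono-≤ (writes≤time k d) (writes≤time k e))
writes≤time k (then′ _ d) = m≤n⇒m≤1+n (writes≤time k d)
writes≤time k (else′ _ d) = m≤n⇒m≤1+n (writes≤time k d)
writes≤time k (done {s = s} _) = ≤-trans (≤-reflexive (changed-refl k (mem s))) z≤n
writes≤time k (loop {s = s} {s′} {s″} _ d e) = m≤n⇒m≤1+n (≤-trans (changed-trans k (mem s) (mem s′) (mem s″)) (+-mono-≤ (writes≤time k d) (writes≤time k e)))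

-- The square of the all-ones matrix has no entry 1, so every cell of the result is written.
multiplication-time≥ : ∀ n w → 2 ≤ n → n < 2 ^ w → ∀ {c s t} →
  (let A = matrix-of n (λ _ _ → 1)) → w ⊢ c , matMulInput w A A ⇓ s , t →
  (∀ i j → mem s (toℕ i * n + toℕ j) ≡ wordℤ w ((A ⊗ A) i j)) → n * n ≤ t
multiplication-time≥ n w 2≤n n< {s = s} run prod = ≤-trans (≤-reflexive (sym (trans (∑-cong (n * n) (λ {a} a< → differs-≢ (changes a<)))
    (trans (∑-const (n * n) 1) (*-identityʳ (n * n)))))) (writes≤time (n * n) run)
  where
  A = matrix-of n (λ _ _ → 1)
  instance n≢0 = >-nonZero {n} (≤-trans (s≤s z≤n) 2≤n)
  entries : ∀ i j → mem (matMulInput w A A) (toℕ i * n + toℕ j) ≡ 1 × mem s (toℕ i * n + toℕ j) ≡ n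
  entries i j = trans (cong (word w) (trans (nth-++ˡ (rowMajor w A) (rowMajor w A) (subst (toℕ i * n + toℕ j <_) (sym (length-rows n n (λ i j → wordℤ w (A i j)))) inside))
      (trans (nth-rows n n (λ i j → wordℤ w (A i j)) i j) (wordℤ-+ w 1<)))) (word-small w 1<)
    , trans (prod i j) (trans (cong (wordℤ w) (trans (matrix-product n (λ _ _ → 1) (λ _ _ → 1) i j) (cong ℤ.+_ (trans (∑-const n 1) (*-identityʳ n))))) (wordℤ-+ w n<))
    where
    1< : 1 < 2 ^ w
    1< = <-trans 2≤n n<
    inside : toℕ i * n + toℕ j < n * n
    inside = <-≤-trans (+-monoʳ-< (toℕ i * n) (toℕ<n j)) (≤-trans (≤-reflexive (+-comm (toℕ i * n) n)) (*-monoˡ-≤ n (toℕ<n i)))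
  changes : ∀ {a} → a < n * n → mem (matMulInput w A A) a ≢ mem s a
  changes {a} a< e = <⇒≢ 2≤n (trans (sym (proj₁ at)) (trans (cong (mem (matMulInput w A A)) (sym a≡)) (trans e (trans (cong (mem s) a≡) (proj₂ at)))))
    where
    r< : a ÷ n < n
    r< = m<n*o⇒m/o<n a<
    s< : a % n < n
    s< = m%n<n a n
    at = entries (fromℕ< r<) (fromℕ< s<)
    a≡ : a ≡ toℕ (fromℕ< r<) * n + toℕ (fromℕ< s<)
    a≡ = trans (m≡m%n+[m/n]*n a n) (trans (+-comm (a % n) (a ÷ n * n)) (cong₂ (λ x y → x * n + y) (sym (toℕ-fromℕ< r<)) (sym (toℕ-fromℕ< s<))))

-- Balancing the two parts of the algorithm

-- Let ρ = P / D.  The threshold 2^j is compared with the largest threshold Δ at which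
-- multiplying matrices of dimension 2m / Δ in time (2m / Δ)^ρ would exceed the time Δ S.

module Balance (n m j P D N₀ a K₀ t : ℕ) (2D≤P : 2 * D ≤ P)
  (n≤am : n ≤ a * m) (1≤m : 1 ≤ m) (a≤m : suc a ≤ m)
  (stuck : ∀ i → i < j → 2 ^ i ≤ m + m × (quotient (m + m) (2 ^ i) < N₀ ⊎ (2 ^ i * (m + n)) ^ D ≤ quotient (m + m) (2 ^ i) ^ P))
  (nt≤ : n * t ≤ K₀ * (2 ^ j * ((m + n) * (m + n)))) where

  private
    S = m + n
    instance m≢0 = >-nonZero 1≤m
    N₁ = suc N₀
    open ≤-Reasoning

    -- This is (Δ S) ^ D ≤ (2m / Δ) ^ P without the fraction: the limit on the steps does not exceed
    -- (2m / Δ) ^ ρ.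
    Good : ℕ → Set
    Good Δ = Δ ^ (P + D) * S ^ D ≤ (m + m) ^ P

    S≤ : S ≤ suc a * m
    S≤ = +-monoʳ-≤ m n≤am

    -- Here ρ ≥ 2 enters: S is at most (2m)², by S ≤ (a + 1) m and a + 1 ≤ m.
    good-1 : Good 1
    good-1 = begin
      1 ^ (P + D) * S ^ D ≡⟨ trans (cong (_* S ^ D) (^-zeroˡ (P + D))) (+-identityʳ _) ⟩
      S ^ D ≤⟨ ^-monoˡ-≤ D (≤-trans S≤ (≤-trans (*-monoˡ-≤ m a≤m) (*-mono-≤ (m≤m+n m m) (≤-trans (m≤m+n m m) (≤-reflexive (sym (*-identityʳ (m + m)))))))) ⟩
      ((m + m) ^ 2) ^ D ≡⟨ ^-*-assoc (m + m) 2 D ⟩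
      (m + m) ^ (2 * D) ≤⟨ ^-monoʳ-≤ (m + m) {{>-nonZero (≤-trans 1≤m (m≤m+n m m))}} 2D≤P ⟩
      (m + m) ^ P ∎

    quotient-* : ∀ x Δ → 1 ≤ Δ → quotient x Δ * Δ ≤ x
    quotient-* x (suc Δ) _ = m/n*n≤m x (suc Δ)

    quotient-< : ∀ x Δ → 1 ≤ Δ → x < suc (quotient x Δ) * Δ
    quotient-< x (suc Δ) _ = begin-strict
      x ≡⟨ m≡m%n+[m/n]*n x (suc Δ) ⟩
      x % suc Δ + x ÷ suc Δ * suc Δ <⟨ +-monoˡ-< (x ÷ suc Δ * suc Δ) (m%n<n x (suc Δ)) ⟩
      suc Δ + x ÷ suc Δ * suc Δ ∎

    good-stuck : ∀ Δ → 1 ≤ Δ → (Δ * S) ^ D ≤ quotient (m + m) Δ ^ P → Good Δ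
    good-stuck Δ 1≤Δ h = begin
      Δ ^ (P + D) * S ^ D ≡⟨ cong (_* S ^ D) (^-distribˡ-+-* Δ P D) ⟩
      Δ ^ P * Δ ^ D * S ^ D ≡⟨ trans (*-assoc (Δ ^ P) (Δ ^ D) (S ^ D)) (trans (*-comm (Δ ^ P) _) (cong (_* Δ ^ P) (sym (^-distribʳ Δ S D)))) ⟩
      (Δ * S) ^ D * Δ ^ P ≤⟨ *-monoˡ-≤ (Δ ^ P) h ⟩
      quotient (m + m) Δ ^ P * Δ ^ P ≡⟨ ^-distribʳ (quotient (m + m) Δ) Δ P ⟨
      (quotient (m + m) Δ * Δ) ^ P ≤⟨ ^-monoˡ-≤ P (quotient-* (m + m) Δ 1≤Δ) ⟩
      (m + m) ^ P ∎

    -- A failure by time makes 2 ^ i itself good and thus bounds 2 ^ (i + 1). A failure in a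
    -- dimension below N₀ says nothing about time, but then the last good Δ is already at least m /
    -- N₁, and no threshold exceeds 4m.
    Threshold : ℕ → Set
    Threshold i = ∃ λ Δ → Good Δ × (2 ^ i ≤ 2 * Δ ⊎ (m ≤ N₁ * Δ × 2 ^ i ≤ 4 * m))

    double : ∀ {i} → 2 ^ i ≤ m + m → 2 ^ suc i ≤ 4 * m
    double h = ≤-trans (*-monoʳ-≤ 2 h) (≤-reflexive (solve 1 (λ m → con 2 :* (m :+ m) := con 4 :* m) refl m))

    threshold : ∀ i → i ≤ j → Threshold i
    threshold zero _ = 1 , good-1 , inj₁ (s≤s z≤n)
    threshold (suc i) i<j with stuck i i<j | threshold i (<⇒≤ i<j)
    ... | _ , inj₂ h | _ = 2 ^ i , good-stuck (2 ^ i) (m^n>0 2 i) h , inj₁ ≤-refl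
    ... | 2^i≤ , inj₁ _ | Δ , good , inj₂ (m≤ , _) = Δ , good , inj₂ (m≤ , double {i} 2^i≤)
    ... | 2^i≤ , inj₁ N< | Δ , good , inj₁ 2^i≤2Δ = Δ , good , inj₂ (*-cancelˡ-≤ 2 (begin
          2 * m ≡⟨ cong (m +_) (+-identityʳ m) ⟩
          m + m ≤⟨ <⇒≤ (quotient-< (m + m) (2 ^ i) (m^n>0 2 i)) ⟩
          suc (quotient (m + m) (2 ^ i)) * 2 ^ i ≤⟨ *-mono-≤ (m≤n⇒m≤1+n N<) 2^i≤2Δ ⟩
          N₁ * (2 * Δ) ≡⟨ solve 2 (λ n d → n :* (con 2 :* d) := con 2 :* (n :* d)) refl N₁ Δ ⟩
          2 * (N₁ * Δ) ∎) , double {i} 2^i≤)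

    below-threshold : ∀ {Δ} → 2 ^ j ≤ 2 * Δ ⊎ (m ≤ N₁ * Δ × 2 ^ j ≤ 4 * m) → 2 ^ j ≤ 4 * N₁ * Δ
    below-threshold {Δ} (inj₁ h) = ≤-trans h (*-monoˡ-≤ Δ (≤-trans (≤ᵇ⇒≤ 2 4 tt) (m≤m*n 4 N₁)))
    below-threshold {Δ} (inj₂ (m≤ , h)) = ≤-trans h (≤-trans (*-monoʳ-≤ 4 m≤) (≤-reflexive (sym (*-assoc 4 N₁ Δ))))

  K : ℕ
  K = 2 * (K₀ * (4 * suc N₀) * (suc a * suc a))

  -- The bound n t = O(m² Δ) is combined with Δ ^ (P + D) S ^ D ≤ (2m) ^ P. The resulting exponent
  -- (3 P + D) / (P + D) of m is 1 + 2 ρ / (ρ + 1).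
  bound : (n * t) ^ (P + D) ≤ K ^ (P + D) * m ^ (3 * P + D)
  bound with threshold j ≤-refl
  ... | Δ , good , 2^j≤ = *-cancelʳ-≤ _ _ (m ^ D) {{m^n≢0 m D}} (begin
      Z ^ R * m ^ D ≤⟨ *-mono-≤ (^-monoˡ-≤ R Z≤) (^-monoˡ-≤ D (m≤m+n m n)) ⟩
      (K₃ * (m * m) * Δ) ^ R * S ^ D ≡⟨ trans (cong (_* S ^ D) (^-distribʳ (K₃ * (m * m)) Δ R)) (*-assoc ((K₃ * (m * m)) ^ R) (Δ ^ R) (S ^ D)) ⟩
      (K₃ * (m * m)) ^ R * (Δ ^ R * S ^ D) ≤⟨ *-monoʳ-≤ ((K₃ * (m * m)) ^ R) good ⟩
      (K₃ * (m * m)) ^ R * (m + m) ^ P ≡⟨ cong₂ _*_ (trans (^-distribʳ K₃ (m * m) R) (cong (K₃ ^ R *_) (^-distribʳ m m R))) (trans (cong (λ x → (m + x) ^ P) (sym (+-identityʳ m))) (^-distribʳ 2 m P)) ⟩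
      K₃ ^ R * (m ^ R * m ^ R) * (2 ^ P * m ^ P) ≤⟨ *-monoʳ-≤ (K₃ ^ R * (m ^ R * m ^ R)) (*-monoˡ-≤ (m ^ P) (^-monoʳ-≤ 2 (m≤m+n P D))) ⟩
      K₃ ^ R * (m ^ R * m ^ R) * (2 ^ R * m ^ P) ≡⟨ solve 4 (λ k r t p → k :* (r :* r) :* (t :* p) := t :* k :* (r :* r :* p)) refl (K₃ ^ R) (m ^ R) (2 ^ R) (m ^ P) ⟩
      2 ^ R * K₃ ^ R * (m ^ R * m ^ R * m ^ P) ≡⟨ cong₂ _*_ (sym (^-distribʳ 2 K₃ R)) (trans (cong (_* m ^ P) (sym (^-distribˡ-+-* m R R))) (trans (sym (^-distribˡ-+-* m (R + R) P)) (trans (cong (m ^_) (solve 2 (λ p d → p :+ d :+ (p :+ d) :+ p := con 3 :* p :+ d :+ d) refl P D)) (^-distribˡ-+-* m (3 * P + D) D)))) ⟩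
      K ^ R * (m ^ (3 * P + D) * m ^ D) ≡⟨ *-assoc (K ^ R) (m ^ (3 * P + D)) (m ^ D) ⟨
      K ^ R * m ^ (3 * P + D) * m ^ D ∎)
    where
    Z = n * t
    R = P + D
    K₃ = K₀ * (4 * N₁) * (suc a * suc a)
    Z≤ : Z ≤ K₃ * (m * m) * Δ
    Z≤ = begin
      n * t ≤⟨ nt≤ ⟩
      K₀ * (2 ^ j * (S * S)) ≤⟨ *-monoʳ-≤ K₀ (*-mono-≤ (below-threshold 2^j≤) (*-mono-≤ S≤ S≤)) ⟩
      K₀ * (4 * N₁ * Δ * (suc a * m * (suc a * m))) ≡⟨ solve 5 (λ k q d a m → k :* (q :* d :* (a :* m :* (a :* m))) := k :* q :* (a :* a) :* (m :* m) :* d) refl K₀ (4 * N₁) Δ (suc a) m ⟩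
      K₃ * (m * m) * Δ ∎

-- Removing the slack in the exponent

-- From the exponent ρ = τ + 1/k, with τ = p / q, to the exponent τ and the slack ε = e₁ / e₂.

module Exponents (n m t p q e₁ e₂ a K : ℕ) (1≤q : 1 ≤ q) (1≤e₁ : 1 ≤ e₁) (1≤e₂ : 1 ≤ e₂) (q≤p : q ≤ p)
  (n≤am : n ≤ a * m) (1≤m : 1 ≤ m) (large : K ^ (4 * (e₂ * e₂)) * a ^ (4 * (e₁ * e₂)) ≤ m)
  (bound : (n * t) ^ (p * (4 * e₂) + q + q * (4 * e₂)) ≤
    K ^ (p * (4 * e₂) + q + q * (4 * e₂)) * m ^ (3 * (p * (4 * e₂) + q) + q * (4 * e₂))) where

  private
    -- The slack 1/k is a quarter of 1 / e₂, hence at most ε / 4.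
    k = 4 * e₂
    P = p * k + q
    D = q * k
    instance m≢0 = >-nonZero 1≤m
    open ≤-Reasoning
    Z = n * t
    s = p + q
    G = s * k
    R = P + D
    B = (3 * p + q) * k + 2 * s
    1≤s = ≤-trans 1≤q (m≤n+m q p)
    1≤k = ≤-trans 1≤e₂ (m≤n*m e₂ 4)

    -- (3 ρ + 1) / (ρ + 1) exceeds its value at τ by at most 2 / k, since its derivative is at most
    -- 2. B / G is the value at τ plus 2 / k.
    exponents : (3 * P + D) * G ≤ B * R
    exponents = ≤-trans (m≤m+n _ (k * (2 * (p * p) + 4 * (p * q)) + 2 * (s * q)))
      (≤-reflexive (solve 3 (λ p q k → (con 3 :* (p :* k :+ q) :+ q :* k) :* ((p :+ q) :* k) :+ (k :* (con 2 :* (p :* p) :+ con 4 :* (p :* q)) :+ con 2 :* ((p :+ q) :* q))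
        := ((con 3 :* p :+ q) :* k :+ con 2 :* (p :+ q)) :* (p :* k :+ q :+ q :* k)) refl p q k))

    step₁ : Z ^ G ≤ K ^ G * m ^ B
    step₁ = root-≤ R (≤-trans 1≤q (≤-trans (m≤n+m q (p * k)) (m≤m+n P D))) (begin
      (Z ^ G) ^ R ≡⟨ trans (^-*-assoc Z G R) (trans (cong (Z ^_) (*-comm G R)) (sym (^-*-assoc Z R G))) ⟩
      (Z ^ R) ^ G ≤⟨ ^-monoˡ-≤ G bound ⟩
      (K ^ R * m ^ (3 * P + D)) ^ G ≡⟨ trans (^-distribʳ (K ^ R) (m ^ (3 * P + D)) G) (cong₂ _*_ (trans (^-*-assoc K R G) (trans (cong (K ^_) (*-comm R G)) (sym (^-*-assoc K G R)))) (^-*-assoc m (3 * P + D) G)) ⟩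
      (K ^ G) ^ R * m ^ ((3 * P + D) * G) ≤⟨ *-monoʳ-≤ ((K ^ G) ^ R) (^-monoʳ-≤ m exponents) ⟩
      (K ^ G) ^ R * m ^ (B * R) ≡⟨ cong ((K ^ G) ^ R *_) (sym (^-*-assoc m B R)) ⟩
      (K ^ G) ^ R * (m ^ B) ^ R ≡⟨ ^-distribʳ (K ^ G) (m ^ B) R ⟨
      (K ^ G * m ^ B) ^ R ∎)

    -- The constants K and a are paid with a power of m, by raising `large` to the power p + q.
    large′ : K ^ (G * e₂) * a ^ (e₁ * G) ≤ m ^ (s * (2 * (e₁ * e₂)))
    large′ = begin
      K ^ (G * e₂) * a ^ (e₁ * G) ≡⟨ cong₂ _*_ (trans (cong (K ^_) (solve 2 (λ s e → s :* (con 4 :* e) :* e := con 4 :* (e :* e) :* s) refl s e₂)) (sym (^-*-assoc K (4 * (e₂ * e₂)) s)))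
                                                (trans (cong (a ^_) (solve 3 (λ s e f → f :* (s :* (con 4 :* e)) := con 4 :* (f :* e) :* s) refl s e₂ e₁)) (sym (^-*-assoc a (4 * (e₁ * e₂)) s))) ⟩
      (K ^ (4 * (e₂ * e₂))) ^ s * (a ^ (4 * (e₁ * e₂))) ^ s ≡⟨ ^-distribʳ _ _ s ⟨
      (K ^ (4 * (e₂ * e₂)) * a ^ (4 * (e₁ * e₂))) ^ s ≤⟨ ^-monoˡ-≤ s large ⟩
      m ^ s ≤⟨ ^-monoʳ-≤ m (m≤m*n s (2 * (e₁ * e₂)) {{>-nonZero (*-mono-≤ {1} {2} (s≤s z≤n) (*-mono-≤ 1≤e₁ 1≤e₂))}}) ⟩
      m ^ (s * (2 * (e₁ * e₂))) ∎

    -- The power 1 + ε multiplies the bound by another (m ^ ((3 p + q) / (p + q)) / n) ^ ε. As q ≤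
    -- p, the exponent of m in the fraction is at least 2, and n ≤ a m, so m ^ ε is gained up to a
    -- constant; this covers the slack in the exponent and the constants.
    sizes : s * (2 * (e₁ * e₂)) + (B * e₂ + e₁ * G) ≤ (3 * p + q) * (e₁ + e₂) * k
    sizes = begin
      s * (2 * (e₁ * e₂)) + (B * e₂ + e₁ * G)
        ≡⟨ solve 4 (λ s x e f → s :* (con 2 :* (f :* e)) :+ ((x :* (con 4 :* e) :+ con 2 :* s) :* e :+ f :* (s :* (con 4 :* e)))
             := x :* e :* (con 4 :* e) :+ (con 6 :* (s :* (f :* e)) :+ con 2 :* (s :* (con 1 :* e)))) refl s (3 * p + q) e₂ e₁ ⟩
      (3 * p + q) * e₂ * k + (6 * (s * (e₁ * e₂)) + 2 * (s * (1 * e₂)))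
        ≤⟨ +-monoʳ-≤ ((3 * p + q) * e₂ * k) (+-monoʳ-≤ (6 * (s * (e₁ * e₂))) (*-monoʳ-≤ 2 (*-monoʳ-≤ s (*-monoˡ-≤ e₂ 1≤e₁)))) ⟩
      (3 * p + q) * e₂ * k + (6 * (s * (e₁ * e₂)) + 2 * (s * (e₁ * e₂)))
        ≡⟨ cong ((3 * p + q) * e₂ * k +_) (solve 3 (λ s e f → con 6 :* (s :* (f :* e)) :+ con 2 :* (s :* (f :* e)) := con 2 :* s :* (f :* (con 4 :* e))) refl s e₂ e₁) ⟩
      (3 * p + q) * e₂ * k + 2 * s * (e₁ * k)
        ≤⟨ +-monoʳ-≤ ((3 * p + q) * e₂ * k) (*-monoˡ-≤ (e₁ * k) (≤-trans (≤-reflexive (solve 2 (λ p q → con 2 :* (p :+ q) := con 2 :* p :+ q :+ q) refl p q)) (≤-trans (+-monoʳ-≤ (2 * p + q) q≤p) (≤-reflexive (solve 2 (λ p q → con 2 :* p :+ q :+ p := con 3 :* p :+ q) refl p q))))) ⟩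
      (3 * p + q) * e₂ * k + (3 * p + q) * (e₁ * k)
        ≡⟨ solve 4 (λ x e f k → x :* e :* k :+ x :* (f :* k) := x :* (f :+ e) :* k) refl (3 * p + q) e₂ e₁ k ⟩
      (3 * p + q) * (e₁ + e₂) * k ∎

    step₂ : (Z ^ e₂ * n ^ e₁) ^ s ≤ m ^ ((3 * p + q) * (e₁ + e₂))
    step₂ = root-≤ k 1≤k (begin
      ((Z ^ e₂ * n ^ e₁) ^ s) ^ k ≡⟨ trans (^-*-assoc _ s k) (trans (^-distribʳ (Z ^ e₂) (n ^ e₁) G) (cong₂ _*_ (trans (^-*-assoc Z e₂ G) (trans (cong (Z ^_) (*-comm e₂ G)) (sym (^-*-assoc Z G e₂)))) (^-*-assoc n e₁ G))) ⟩
      (Z ^ G) ^ e₂ * n ^ (e₁ * G) ≤⟨ *-mono-≤ (^-monoˡ-≤ e₂ step₁) (^-monoˡ-≤ (e₁ * G) n≤am) ⟩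
      (K ^ G * m ^ B) ^ e₂ * (a * m) ^ (e₁ * G)
        ≡⟨ cong₂ _*_ (trans (^-distribʳ (K ^ G) (m ^ B) e₂) (cong₂ _*_ (^-*-assoc K G e₂) (^-*-assoc m B e₂))) (^-distribʳ a m (e₁ * G)) ⟩
      K ^ (G * e₂) * m ^ (B * e₂) * (a ^ (e₁ * G) * m ^ (e₁ * G))
        ≡⟨ solve 4 (λ k b a g → k :* b :* (a :* g) := k :* a :* (b :* g)) refl (K ^ (G * e₂)) (m ^ (B * e₂)) (a ^ (e₁ * G)) (m ^ (e₁ * G)) ⟩
      K ^ (G * e₂) * a ^ (e₁ * G) * (m ^ (B * e₂) * m ^ (e₁ * G)) ≤⟨ *-monoˡ-≤ _ large′ ⟩
      m ^ (s * (2 * (e₁ * e₂))) * (m ^ (B * e₂) * m ^ (e₁ * G))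
        ≡⟨ trans (cong (m ^ (s * (2 * (e₁ * e₂))) *_) (sym (^-distribˡ-+-* m (B * e₂) (e₁ * G)))) (sym (^-distribˡ-+-* m (s * (2 * (e₁ * e₂))) (B * e₂ + e₁ * G))) ⟩
      m ^ (s * (2 * (e₁ * e₂)) + (B * e₂ + e₁ * G)) ≤⟨ ^-monoʳ-≤ m sizes ⟩
      m ^ ((3 * p + q) * (e₁ + e₂) * k) ≡⟨ ^-*-assoc m ((3 * p + q) * (e₁ + e₂)) k ⟨
      (m ^ ((3 * p + q) * (e₁ + e₂))) ^ k ∎)

  final : t ^ ((p + q) * e₂) * n ^ ((p + q) * (e₁ + e₂)) ≤ m ^ ((3 * p + q) * (e₁ + e₂))
  final = ≤-trans (≤-reflexive (sym (begin-equality
      (Z ^ e₂ * n ^ e₁) ^ s ≡⟨ cong (_^ s) (trans (cong (_* n ^ e₁) (^-distribʳ n t e₂)) (solve 3 (λ x y z → x :* y :* z := y :* (z :* x)) refl (n ^ e₂) (t ^ e₂) (n ^ e₁))) ⟩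
      (t ^ e₂ * (n ^ e₁ * n ^ e₂)) ^ s ≡⟨ trans (^-distribʳ (t ^ e₂) _ s) (cong₂ _*_ (trans (^-*-assoc t e₂ s) (cong (t ^_) (*-comm e₂ s))) (trans (cong (_^ s) (sym (^-distribˡ-+-* n e₁ e₂))) (trans (^-*-assoc n (e₁ + e₂) s) (cong (n ^_) (*-comm (e₁ + e₂) s))))) ⟩
      t ^ (s * e₂) * n ^ (s * (e₁ + e₂)) ∎))) step₂

-- Comparison with rational powers

posPart-+ : ∀ k → posPart (ℤ.+ k) ≡ k
posPart-+ zero = refl
posPart-+ (suc k) = refl

negPart-+ : ∀ k → negPart (ℤ.+ k) ≡ 0
negPart-+ zero = refl
negPart-+ (suc k) = refl

posPart-neg : ∀ k → posPart (ℤ.- (ℤ.+ k)) ≡ 0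
posPart-neg zero = refl
posPart-neg (suc k) = refl

negPart-neg : ∀ k → negPart (ℤ.- (ℤ.+ k)) ≡ k
negPart-neg k = trans (cong posPart (ℤ.neg-involutive (ℤ.+ k))) (posPart-+ k)

-- The comparison is t ≤ x^(a / (d + 1)) y^(− b / (e + 1)).
module _ (t x y a d b e : ℕ) where

  private
    α β : ℤ
    α = ℤ.+ a ℤ.* ℤ.+ suc e
    β = ℤ.- (ℤ.+ b) ℤ.* ℤ.+ suc d

    α≡ : α ≡ ℤ.+ (a * suc e)
    α≡ = sym (ℤ.pos-* a (suc e))

    β≡ : β ≡ ℤ.- (ℤ.+ (b * suc d))
    β≡ = trans (sym (ℤ.neg-distribˡ-* (ℤ.+ b) (ℤ.+ suc d))) (cong ℤ.-_ (sym (ℤ.pos-* b (suc d))))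

    left≡ : t ^ (suc d * suc e) * (x ^ negPart α * y ^ negPart β) ≡ t ^ (suc d * suc e) * y ^ (b * suc d)
    left≡ = cong (t ^ (suc d * suc e) *_) (trans (cong₂ (λ p q → x ^ p * y ^ q) (trans (cong negPart α≡) (negPart-+ (a * suc e))) (trans (cong negPart β≡) (negPart-neg (b * suc d)))) (+-identityʳ _))

    right≡ : x ^ posPart α * y ^ posPart β ≡ x ^ (a * suc e)
    right≡ = trans (cong₂ (λ p q → x ^ p * y ^ q) (trans (cong posPart α≡) (posPart-+ (a * suc e))) (trans (cong posPart β≡) (posPart-neg (b * suc d)))) (*-identityʳ _)

  ≤ᵖ-intro : t ^ (suc d * suc e) * y ^ (b * suc d) ≤ x ^ (a * suc e) → t ≤ᵖ x ↑ mkℚᵘ (ℤ.+ a) d · y ↑ mkℚᵘ (ℤ.- (ℤ.+ b)) e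
  ≤ᵖ-intro h = ≤-trans (≤-reflexive left≡) (≤-trans h (≤-reflexive (sym right≡)))

  ≤ᵖ-elim : t ≤ᵖ x ↑ mkℚᵘ (ℤ.+ a) d · y ↑ mkℚᵘ (ℤ.- (ℤ.+ b)) e → t ^ (suc d * suc e) * y ^ (b * suc d) ≤ x ^ (a * suc e)
  ≤ᵖ-elim h = ≤-trans (≤-reflexive (sym left≡)) (≤-trans h (≤-reflexive right≡))

≤ᵖ-power : ∀ t x a d → t ≤ᵖ x ↑ mkℚᵘ (ℤ.+ a) d → t ^ suc d ≤ x ^ a
≤ᵖ-power t x a d h = ≤-trans (≤-reflexive (trans (cong (t ^_) (sym (*-identityʳ (suc d)))) (sym (*-identityʳ _))))
  (≤-trans (≤ᵖ-elim t x 1 a d 0 0 h) (≤-reflexive (cong (x ^_) (*-identityʳ a))))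

-- The exponents may be proved as fractions V₁ / U and V₂ / U with any common denominator: after
-- passing to suitable powers and a U-th root only their values count.
≤ᵖ-cross : ∀ {t x y a d b e U V₁ V₂} → 1 ≤ U → a * U ≡ V₁ * suc d → b * U ≡ V₂ * suc e →
           t ^ U * y ^ V₂ ≤ x ^ V₁ → t ≤ᵖ x ↑ mkℚᵘ (ℤ.+ a) d · y ↑ mkℚᵘ (ℤ.- (ℤ.+ b)) e
≤ᵖ-cross {t} {x} {y} {a} {d} {b} {e} {U} {V₁} {V₂} 1≤U a≡ b≡ h = ≤ᵖ-intro t x y a d b e (root-≤ U 1≤U (begin
    (t ^ (suc d * suc e) * y ^ (b * suc d)) ^ U
      ≡⟨ trans (^-distribʳ _ _ U) (cong₂ _*_ (trans (^-*-assoc t (suc d * suc e) U) (trans (cong (t ^_) (*-comm (suc d * suc e) U)) (sym (^-*-assoc t U (suc d * suc e)))))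
           (trans (^-*-assoc y (b * suc d) U) (trans (cong (y ^_) (trans (solve 3 (λ b d u → b :* d :* u := b :* u :* d) refl b (suc d) U) (trans (cong (_* suc d) b≡) (solve 3 (λ v e d → v :* e :* d := v :* (d :* e)) refl V₂ (suc e) (suc d))))) (sym (^-*-assoc y V₂ (suc d * suc e)))))) ⟩
    (t ^ U) ^ (suc d * suc e) * (y ^ V₂) ^ (suc d * suc e) ≡⟨ ^-distribʳ (t ^ U) (y ^ V₂) (suc d * suc e) ⟨
    (t ^ U * y ^ V₂) ^ (suc d * suc e) ≤⟨ ^-monoˡ-≤ (suc d * suc e) h ⟩
    (x ^ V₁) ^ (suc d * suc e)
      ≡⟨ trans (^-*-assoc x V₁ (suc d * suc e)) (trans (cong (x ^_) (trans (sym (*-assoc V₁ (suc d) (suc e))) (trans (cong (_* suc e) (sym a≡)) (solve 3 (λ a u e → a :* u :* e := a :* e :* u) refl a U (suc e))))) (sym (^-*-assoc x (a * suc e) U))) ⟩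
    (x ^ (a * suc e)) ^ U ∎))
  where open ≤-Reasoning

-- Here τ = suc p / suc q and ε = suc f / suc g.
bound-from : ∀ {t m n} p q f g → t ^ ((suc p + suc q) * suc g) * n ^ ((suc p + suc q) * (suc f + suc g)) ≤ m ^ ((3 * suc p + suc q) * (suc f + suc g)) →
  t ≤ᵖ m ↑ (exponent (mkℚᵘ ℤ.+[1+ p ] q) ℚᵘ.* (1ℚᵘ ℚᵘ.+ mkℚᵘ ℤ.+[1+ f ] g)) · n ↑ (ℚᵘ.- (1ℚᵘ ℚᵘ.+ mkℚᵘ ℤ.+[1+ f ] g))
bound-from {t} {m} {n} p q f g h = ≤ᵖ-cross {t} {m} {n} {ℤ.∣ ℚᵘ.↥ X ∣} {ℚᵘ.denominator-1 X} {ℤ.∣ ℚᵘ.↥ Y ∣} {ℚᵘ.denominator-1 Y}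
    {(suc p + suc q) * suc g} {(3 * suc p + suc q) * (suc f + suc g)} {(suc p + suc q) * (suc f + suc g)} (s≤s z≤n)
    -- The fraction that the rational arithmetic leaves unreduced equals (3 τ + 1) / (τ + 1) · (1 +
    -- ε).
    (solve 4 (λ p q f g →
      let P = con 1 :+ p ; Q = con 1 :+ q ; F = con 1 :+ f ; G = con 1 :+ g
          numZ = con 2 :* P :* (Q :* con 1) ; denZ = con 1 :* Q :* (P :* con 1 :+ con 1 :* Q)
      in (con 1 :* denZ :+ numZ :* con 1) :* (con 1 :* G :+ F :* con 1) :* ((P :+ Q) :* G)
        := (con 3 :* P :+ Q) :* (F :+ G) :* (con 1 :* denZ :* (con 1 :* G))) refl p q f g)
    (solve 4 (λ p q f g →
      let P = con 1 :+ p ; Q = con 1 :+ q ; F = con 1 :+ f ; G = con 1 :+ g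
      in (con 1 :* G :+ F :* con 1) :* ((P :+ Q) :* G) := (P :+ Q) :* (F :+ G) :* (con 1 :* G)) refl p q f g)
    h
  where
  Y = 1ℚᵘ ℚᵘ.+ mkℚᵘ ℤ.+[1+ f ] g
  X = exponent (mkℚᵘ ℤ.+[1+ p ] q) ℚᵘ.* Y

not-positive : ∀ {k d} → (∀ {i} → k ≢ ℤ.+[1+ i ]) → ¬ Positive (mkℚᵘ k d)
not-positive {ℤ.+ zero} _ record { pos = () }
not-positive {ℤ.+[1+ i ]} k≢ _ = k≢ refl
not-positive { ℤ.-[1+ i ]} _ record { pos = () }

-- Each k / (k + 1) is a rational below α, so its power of n is at most a m, and `limit-≤` passes to
-- the limit.
linear-≤ : ∀ {n m a} α → fromℚᵘ (mkℚᵘ (ℤ.+ 1) 0) ≤ʳ α → n ↑ʳ α ≤ᵖ a * m → n ≤ a * m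
linear-≤ {n} {m} {a} α 1≤α n≤ = limit-≤ n (a * m) λ k →
  ≤-trans (≤-reflexive (sym (trans (cong (_* n ^ (k * 1)) (^-zeroˡ (1 * suc k))) (trans (+-identityʳ _) (cong (n ^_) (*-identityʳ k))))))
    (≤-trans (≤ᵖ-elim 1 (a * m) n 1 0 k k (n≤ (mkℚᵘ (ℤ.+ k) k) (1≤α _ (ratio<1 k)))) (≤-reflexive (cong ((a * m) ^_) (+-identityʳ (suc k)))))
  where
  ratio<1 : ∀ k → mkℚᵘ (ℤ.+ k) k ℚᵘ.< mkℚᵘ (ℤ.+ 1) 0
  ratio<1 k = ℚᵘ.*<* (subst₂ ℤ._<_ (ℤ.pos-* k 1) (ℤ.pos-* 1 (suc k))
    (ℤ.+<+ (≤-trans (≤-reflexive (cong suc (*-identityʳ k))) (≤-reflexive (sym (+-identityʳ (suc k)))))))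

-- What the exponent says about the multiplication algorithm

-- The slack over τ = suc p / suc q is 1 / suc k.
module Multiplication (ω : ℝ) (P : Algorithm) (mult : MultipliesMatrices P) (fast : MatMulTime P ω)
  (k : ℕ) (p q : ℕ) (τ>ω : Upper ω (mkℚᵘ ℤ.+[1+ p ] q)) where

  slack : ℚᵘ
  slack = mkℚᵘ ℤ.+[1+ 0 ] k

  N₀ X D : ℕ
  N₀ = proj₁ (fast slack _)
  X = suc p * suc k + suc q
  D = suc q * suc k

  time-≤ : ∀ {N} → N₀ ≤ N → ∀ {w} → FitsWords P N w → {A B : Matrix N} → EntriesBounded A → EntriesBounded B →
    ∀ {s t} → w ⊢ code P , matMulInput w A B ⇓ s , t → t ^ D ≤ N ^ X
  time-≤ {N} N₀≤ {w} fits {A} {B} A≤ B≤ {t = t} run =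
    ≤-trans (≤ᵖ-power t N (suc p * suc k + 1 * suc q) (k + q * suc k) (proj₂ (fast slack _) N₀≤ w fits A B A≤ B≤ run _ τ>ω))
      (≤-reflexive (cong (λ y → N ^ (suc p * suc k + y)) (+-identityʳ (suc q))))

  -- ρ ≥ 2, since the product of all-ones matrices of dimension N forces N² cells to be written. A
  -- single N ≥ 2 is enough, because it compares the integers 2 D and X through powers of N.
  2D≤X : 2 * D ≤ X
  2D≤X = ≮⇒≥ λ X<2D → <⇒≱ (^-monoʳ-< N (s≤s (s≤s z≤n)) X<2D) (begin
    N ^ (2 * D)   ≡⟨ ^-*-assoc N 2 D ⟨
    (N ^ 2) ^ D   ≡⟨ cong (λ y → (N * y) ^ D) (*-identityʳ N) ⟩
    (N * N) ^ D   ≤⟨ ^-monoˡ-≤ D N²≤t ⟩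
    t ^ D         ≤⟨ time-≤ (m≤n+m N₀ 2) {w} fits {A} {A} ones ones run ⟩
    N ^ X         ∎)
    where
    open ≤-Reasoning
    N = 2 + N₀
    w = (2 + N) ^ wordFactor P + N
    A = matrix-of N (λ _ _ → 1)
    ones : EntriesBounded A
    ones _ _ = s≤s z≤n
    fits : FitsWords P N w
    fits = ≤-trans (m≤m+n _ N) (<⇒≤ (n<2^n w))
    N< : N < 2 ^ w
    N< = ≤-<-trans (m≤n+m N _) (n<2^n w)
    product-run = mult w fits A A ones ones
    t = proj₁ (proj₂ product-run)
    run = proj₁ (proj₂ (proj₂ product-run))
    N²≤t : N * N ≤ t
    N²≤t = multiplication-time≥ N w (s≤s (s≤s z≤n)) N< run (proj₂ (proj₂ (proj₂ product-run)))

  -- From τ + 1 / (k + 1) ≥ 2 follows τ ≥ 1.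
  q≤p : suc q ≤ suc p
  q≤p = *-cancelʳ-≤ (suc q) (suc p) (suc k) (+-cancelʳ-≤ (suc q) _ _ (begin
    D + suc q     ≤⟨ +-monoʳ-≤ D (m≤m*n (suc q) (suc k)) ⟩
    D + D         ≡⟨ cong (D +_) (+-identityʳ D) ⟨
    2 * D         ≤⟨ 2D≤X ⟩
    X             ∎))
    where open ≤-Reasoning

  -- A limit below N² is covered by ρ ≥ 2, a timeout by the time bound, unless N is too small for
  -- the latter to apply.
  slow-bound : ∀ {w N F} → FitsWords P N w → Slow P w N F → N < N₀ ⊎ F ^ D ≤ N ^ X
  slow-bound {N = N} {F} _ (too-large F<) = inj₂ (begin
    F ^ D         ≤⟨ ^-monoˡ-≤ D (<⇒≤ F<) ⟩
    (N * N) ^ D   ≡⟨ cong (λ y → (N * y) ^ D) (*-identityʳ N) ⟨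
    (N ^ 2) ^ D   ≡⟨ ^-*-assoc N 2 D ⟩
    N ^ (2 * D)   ≤⟨ ^-monoʳ-≤ N {{N≢0 F<}} 2D≤X ⟩
    N ^ X         ∎)
    where
    open ≤-Reasoning
    N≢0 : ∀ {N} → F < N * N → NonZero N
    N≢0 {suc _} _ = _
  slow-bound {w} {N} {F} fits (timeout {A} {B} A≤ B≤ run F≤t) with N₀ ≤? N
  ... | yes N₀≤ = inj₂ (≤-trans (^-monoˡ-≤ D F≤t) (time-≤ N₀≤ {w} fits {A} {B} A≤ B≤ run))
  ... | no N₀≰ = inj₁ (≰⇒> N₀≰)

-- The running time

module Running-time (ω : ℝ) (P : Algorithm) (mult : MultipliesMatrices P) (fast : MatMulTime P ω) where

  open Solving P mult

  K₀ : ℕ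
  K₀ = κ * (c + 1000)

  module _ (a f g : ℕ) where

    private
      -- This makes `suc k` equal to `4 * suc g`, the k of `Exponents`.
      k = g + 3 * suc g
      -- It depends on ε but not on τ, because the bound from which n counts as large has to be
      -- chosen before τ is given.
      N₀ = proj₁ (fast (mkℚᵘ ℤ.+[1+ 0 ] k) _)

    -- `constant` is the K of `Balance`. From `least-n` on, n ≤ a m forces m to reach `least-m`,
    -- large enough to absorb the constants and to exceed a.
    constant least-m least-n : ℕ
    constant = 2 * (K₀ * (4 * suc N₀) * (suc a * suc a))
    least-m = constant ^ (4 * (suc g * suc g)) * a ^ (4 * (suc f * suc g)) + suc a
    least-n = suc (a * least-m)

    large : ∀ {n m} → least-n ≤ n → n ≤ a * m → least-m ≤ m
    large {n} {m} N≤n n≤ = ≮⇒≥ λ m< → <⇒≱ N≤n (≤-trans n≤ (*-monoʳ-≤ a (<⇒≤ m<)))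

    timed-bound : ∀ {n m t} p q → Upper ω (mkℚᵘ ℤ.+[1+ p ] q) → least-n ≤ n → n ≤ a * m → Timed n m t →
      t ^ ((suc p + suc q) * suc g) * n ^ ((suc p + suc q) * (suc f + suc g)) ≤ m ^ ((3 * suc p + suc q) * (suc f + suc g))
    timed-bound {n} {m} {t} p q τ>ω N≤n n≤ (w′ , j , stuck , nt≤) =
      Exponents.final n m t (suc p) (suc q) (suc f) (suc g) a constant (s≤s z≤n) (s≤s z≤n) (s≤s z≤n) q≤p n≤ 1≤m (≤-trans (m≤m+n _ (suc a)) m≥)
        (Balance.bound n m j X D N₀ a K₀ t 2D≤X n≤ 1≤m (≤-trans (m≤n+m (suc a) _) m≥)
          (λ i i< → let Δ≤ , fits , slow = stuck i i< in Δ≤ , slow-bound {w′} fits slow) nt≤)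
      where
      open Multiplication ω P mult fast k p q τ>ω using (X; D; 2D≤X; q≤p; slow-bound)
      m≥ = large N≤n n≤
      1≤m : 1 ≤ m
      1≤m = ≤-trans (≤-trans (s≤s z≤n) (m≤n+m (suc a) _)) m≥

  time : (α : ℝ) → fromℚᵘ (mkℚᵘ (ℤ.+ 1) 0) ≤ʳ α → DominatingTriangleTime solver ω α
  time α 1≤α a b (mkℚᵘ (ℤ.+ 0) g) ε>0 = contradiction ε>0 (not-positive {ℤ.+ 0} {g} λ ())
  time α 1≤α a b (mkℚᵘ ℤ.-[1+ i ] g) ε>0 = contradiction ε>0 (not-positive { ℤ.-[1+ i ]} {g} λ ())
  time α 1≤α a b (mkℚᵘ ℤ.+[1+ f ] g) _ = least-n a f g , λ N≤n G n≤ _ es es↭ w fits run →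
    at-rational N≤n (linear-≤ {a = a} α 1≤α n≤) (solver-timed G es es↭ w fits run)
    where
    at-rational : ∀ {n m t} → least-n a f g ≤ n → n ≤ a * m → Timed n m t → TriangleBound ω (1ℚᵘ ℚᵘ.+ mkℚᵘ ℤ.+[1+ f ] g) t m n
    at-rational N≤n n≤ _ (mkℚᵘ (ℤ.+ 0) q) {{τ>0}} _ = ⊥-elim-irr (not-positive {ℤ.+ 0} {q} (λ ()) τ>0)
    at-rational N≤n n≤ _ (mkℚᵘ ℤ.-[1+ i ] q) {{τ>0}} _ = ⊥-elim-irr (not-positive { ℤ.-[1+ i ]} {q} (λ ()) τ>0)
    at-rational {n} {m} {t} N≤n n≤ timed (mkℚᵘ ℤ.+[1+ p ] q) τ>ω = bound-from {t} {m} {n} p q f g (timed-bound a f g p q τ>ω N≤n n≤ timed)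

open import Data.Integer.Base using (+_)
open import Data.Rational.Unnormalised.Base using (_/_)

theorem3 : (ω : ℝ) → IsMatMulExponent ω →
    Σ[ D ∈ Algorithm ] SolvesDominatingTriangle D ×
    ((α : ℝ) → fromℚᵘ (+ 1 / 1) ≤ʳ α → α ≤ʳ fromℚᵘ (+ 2 / 1) →
    DominatingTriangleTime D ω α)
theorem3 ω exponent-ω = solver , solver-correct , λ α 1≤α _ → Running-time.time ω P mult fast α 1≤α
  where
  P = proj₁ (IsMatMulExponent.attained exponent-ω)
  mult = proj₁ (proj₂ (IsMatMulExponent.attained exponent-ω))
  fast = proj₂ (proj₂ (IsMatMulExponent.attained exponent-ω))
  open Solving P mult
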